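{- Let $\epsilon>0$ and let $G$ be a weighted complete graph on $n$ vertices whose edge weights (bounded polynomially in $n$) satisfy the triangle inequality, given as a stream of weighted edges. There exists a streaming interactive proof for verifying the optimal travelling salesperson tour cost within a $(\frac{3}{2}+\epsilon)$-approximation, with $O(\log n)$ rounds of communication and cost $(\log^2 n, n\log^2 n/\epsilon)$.
   Context: A streaming interactive proof (SIP): a randomized verifier $V$ reads the input stream once in a streaming fashion (as does the prover $P$); after the stream has passed, $V$ and $P$ exchange messages, after which $V$ outputs a value or $\perp$ (rejection). There must be a prover strategy causing $V$ to output a correct answer with probability at least $2/3$, and for every prover strategy $V$ must output a correct answer or $\perp$ with probability at least $2/3$; here a correct answer is a value within a factor $\frac32+\epsilon$ of (and at least) the minimum TSP tour cost. Cost $(A,B)$ means verifier space $O(A)$ bits and total communication $O(B)$ bits. -}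

module Defs where

open import Data.Bool.Base using (Bool; true; false)
open import Data.Empty using (⊥)
open import Data.Fin.Base using (Fin)
import Data.Fin.Properties as Fin
import Data.Integer.Base as ℤ
open import Data.List.Base using (List; []; _∷_; map; filter; cartesianProduct; allFin)
open import Data.List.Relation.Binary.Permutation.Propositional using (_↭_)
open import Data.Maybe.Base using (Maybe; just; nothing)
open import Data.Nat.Base as ℕ using (ℕ; zero; suc)
open import Data.Product.Base using (_×_; _,_; ∃-syntax)
open import Data.Rational.Base using (ℚ; 0ℚ; 1ℚ; ½; _+_; _*_; _≤_; _/_)
import Data.Rational.Properties as ℚ
open import Data.Unit.Base using (⊤)
open import Data.Vec.Base using (Vec)
open import Relation.Binary.PropositionalEquality.Core using (_≡_; _≢_)
open import Relation.Nullary.Decidable.Core using (yes; no; _×-dec_)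
open import Relation.Unary using (Decidable)

fromℕ : ℕ → ℚ
fromℕ k = ℤ.+ k / 1

data Rand (A : Set) : Set where
  return : A → Rand A
  toss   : (Bool → Rand A) → Rand A

_>>=_ : {A B : Set} → Rand A → (A → Rand B) → Rand B
return a >>= f = f a
toss g   >>= f = toss λ coin → g coin >>= f

Pr : {A : Set} {E : A → Set} → Decidable E → Rand A → ℚ
Pr E? (return a) with E? a
... | yes _ = 1ℚ
... | no  _ = 0ℚ
Pr E? (toss g) = ½ * (Pr E? (g true) + Pr E? (g false))

data Surely {A : Set} (E : A → Set) : Rand A → Set where
  return : {a : A} → E a → Surely E (return a)
  toss   : {g : Bool → Rand A} → (∀ coin → Surely E (g coin)) → Surely E (toss g)

data Party : Set where
  verifier prover : Party

-- The communicated bits with their senders, most recent first.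
Transcript : Set
Transcript = List (Party × Bool)

-- The number of messages, a message being a maximal run of bits with the
-- same sender.
rounds : Transcript → ℕ
rounds []       = 0
rounds (x ∷ []) = 1
rounds ((verifier , _) ∷ τ@((verifier , _) ∷ _)) = rounds τ
rounds ((prover   , _) ∷ τ@((prover   , _) ∷ _)) = rounds τ
rounds ((verifier , _) ∷ τ@((prover   , _) ∷ _)) = suc (rounds τ)
rounds ((prover   , _) ∷ τ@((verifier , _) ∷ _)) = suc (rounds τ)

Memory : ℕ → Set
Memory s = Vec Bool s

-- In `halt`, `nothing` is the rejection symbol ⊥.
data Action (s : ℕ) : Set where
  send    : Bool → Rand (Memory s) → Action s
  receive : (Bool → Rand (Memory s)) → Action s
  halt    : Maybe ℚ → Action s

-- The s bits of memory are all that survives from one stream item, or one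
-- communicated bit, to the next.  In particular coins are private and must
-- be stored to be reused, and long messages have to be processed bit by bit.
record Verifier (A : Set) (s : ℕ) : Set where
  field
    start : Rand (Memory s)
    read  : A → Memory s → Rand (Memory s)
    act   : Memory s → Action s

-- The prover's next bit, given everything communicated so far.  It does not
-- see the verifier's memory or coins.
Strategy : Set
Strategy = Transcript → Bool

data Outcome : Set where
  output     : Maybe ℚ → Outcome
  unfinished : Outcome

module _ {A : Set} {s : ℕ} (V : Verifier A s) where
  open Verifier V

  readAll : List A → Memory s → Rand (Memory s)
  readAll []      m = return m
  readAll (a ∷ σ) m = read a m >>= readAll σ

  -- The first argument bounds the number of bits still to be communicated.
  interact : ℕ → Strategy → Transcript → Memory s → Rand (Transcript × Outcome)
  interact b P τ m with act m
  interact b       P τ m | halt v         = return (τ , output v)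
  interact zero    P τ m | send _ _       = return (τ , unfinished)
  interact zero    P τ m | receive _      = return (τ , unfinished)
  interact (suc b) P τ m | send bit next  =
    next >>= interact b P ((verifier , bit) ∷ τ)
  interact (suc b) P τ m | receive next   =
    next (P τ) >>= interact b P ((prover , P τ) ∷ τ)

  run : ℕ → Strategy → List A → Rand (Transcript × Outcome)
  run b P σ = start >>= λ m → readAll σ m >>= interact b P []

record Problem (A : Set) : Set₁ where
  field
    Instance : Set
    Presents : Instance → List A → Set
    Correct  : Instance → ℚ → Set
    correct? : ∀ x → Decidable (Correct x)

module _ {A : Set} (Π : Problem A) where
  open Problem Π

  Answered : Instance → Transcript × Outcome → Set
  Answered x (_ , output (just v)) = Correct x v
  Answered x (_ , output nothing)  = ⊥
  Answered x (_ , unfinished)      = ⊥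

  answered? : ∀ x → Decidable (Answered x)
  answered? x (_ , output (just v)) = correct? x v
  answered? x (_ , output nothing)  = no λ ()
  answered? x (_ , unfinished)      = no λ ()

  AnsweredOrRejected : Instance → Transcript × Outcome → Set
  AnsweredOrRejected x (_ , output (just v)) = Correct x v
  AnsweredOrRejected x (_ , output nothing)  = ⊤
  AnsweredOrRejected x (_ , unfinished)      = ⊥

  answeredOrRejected? : ∀ x → Decidable (AnsweredOrRejected x)
  answeredOrRejected? x (_ , output (just v)) = correct? x v
  answeredOrRejected? x (_ , output nothing)  = yes _
  answeredOrRejected? x (_ , unfinished)      = no λ ()

  -- V is the verifier of a streaming interactive proof that uses at most
  -- `bits` bits and r messages, whatever the prover and the coins do.
  -- `run` stops after `bits` communicated bits, so being finished bounds the
  -- communication.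
  record IsSIP {s : ℕ} (V : Verifier A s) (bits r : ℕ) : Set where
    field
      bounded  : ∀ x σ → Presents x σ → (P : Strategy) →
                 Surely (λ (τ , o) → o ≢ unfinished × rounds τ ℕ.≤ r) (run V bits P σ)
      honest   : List A → Strategy
      complete : ∀ x σ → Presents x σ →
                 ℤ.+ 2 / 3 ≤ Pr (answered? x) (run V bits (honest σ) σ)
      sound    : ∀ x σ → Presents x σ → (P : Strategy) →
                 ℤ.+ 2 / 3 ≤ Pr (answeredOrRejected? x) (run V bits P σ)

-- The diagonal of `weight` is irrelevant: the graph has no loops.
record MetricGraph (n : ℕ) : Set where
  field
    weight    : Fin n → Fin n → ℕ
    symmetric : ∀ i j → weight i j ≡ weight j i
    triangle  : ∀ i j k → i ≢ j → j ≢ k → i ≢ k →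
                weight i k ℕ.≤ weight i j ℕ.+ weight j k

WeightedEdge : ℕ → Set
WeightedEdge n = Fin n × Fin n × ℕ

module _ {n : ℕ} (G : MetricGraph n) where
  open MetricGraph G

  WeightsAtMost : ℕ → Set
  WeightsAtMost u = ∀ i j → i ≢ j → weight i j ℕ.≤ u

  edges : List (WeightedEdge n)
  edges = map (λ (i , j) → i , j , weight i j)
              (filter (λ (i , j) → i Fin.<? j) (cartesianProduct (allFin n) (allFin n)))

  IsTour : List (Fin n) → Set
  IsTour vs = vs ↭ allFin n

  pathCost : Fin n → List (Fin n) → Fin n → ℕ
  pathCost i []       k = weight i k
  pathCost i (j ∷ js) k = weight i j ℕ.+ pathCost j js k

  tourCost : List (Fin n) → ℕ
  tourCost []       = 0
  tourCost (i ∷ is) = pathCost i is i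

  IsMinTourCost : ℕ → Set
  IsMinTourCost m = (∃[ vs ] (IsTour vs × tourCost vs ≡ m))
                  × (∀ vs → IsTour vs → m ℕ.≤ tourCost vs)

-- The minimum tour cost is carried along only so that correctness of an
-- answer is visibly decidable; it is determined by the graph.
record TSPInstance (n u : ℕ) : Set where
  field
    graph         : MetricGraph n
    weightsAtMost : WeightsAtMost graph u
    opt           : ℕ
    isMinTourCost : IsMinTourCost graph opt

-- Approximating, from above and within the factor α, the minimum tour cost of
-- a metric graph with weights at most u, whose edges arrive in any order.
TSP : (n u : ℕ) → ℚ → Problem (WeightedEdge n)
TSP n u α = record
  { Instance = TSPInstance n u
  ; Presents = λ x σ → σ ↭ edges (graph x)
  ; Correct  = λ x v → fromℕ (opt x) ≤ v × v ≤ α * fromℕ (opt x)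
  ; correct? = λ x v → (fromℕ (opt x) ℚ.≤? v) ×-dec (v ℚ.≤? α * fromℕ (opt x))
  }
  where open TSPInstance

-- The prover sends a closed walk of length T through K points such that every
-- vertex is within distance ρ of one of them; detours to all vertices show
-- opt ≤ T + 2nρ.  For the lower bound it sends two trees with these points as
-- leaves whose tree metrics are dominated by the distances: a tour is at least
-- as long as such a tree when the root is a branching.  Christofides' walk has
-- length at most m₁ + m₂ / 2, where m₁ is the weight of a minimum spanning tree
-- and m₂ is twice the weight of a minimum T-join on its odd vertices, and there
-- are trees of lengths m₁ (Prim) and m₂ (packing of T-cuts).  The points are all
-- vertices (ρ = 0) if ε ≤ 1, and otherwise K ≈ 2n / ε points at pairwise distance
-- at least ρ, so that 2nρ ≤ ε (K − 1) ρ ≤ ε m₁.  If ε ≥ n, no proof is needed: n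
-- times the largest weight is a good enough answer.
--
-- That the message is a valid proof is a conjunction of local conditions: for
-- all v, j, i₂, i₃ some i satisfies a predicate of the i-th, i₂-th and i₃-th
-- token and of the distance of v to the vertex of token i.  It is checked by the
-- sum-check protocol over a prime field.  The evaluation points are secret coins
-- drawn before the stream, so that the verifier can accumulate the multilinear
-- extensions of the distances and of the message as they pass.

module Submission where

-- Since both trees bound the optimum from below, `m₁ + m₂ / 2` is at most 3/2 times the larger of
-- `m₁` and `m₂`, hence of the optimum. The tree metrics are compared with doubled distances: a tour
-- uses every edge of such a tree at least twice, and doubled weights are even, which makes the
-- packing of T-cuts integral. Leaves are listed in planar order with the heights of the branchings
-- between them, so that domination becomes an inequality for three tokens. The quantifier over i is
-- arithmetised by counting: the number of witnesses is between 0 and N, and a polynomial `Z N` with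
-- roots 1, ..., N tells 0 from the rest. Its degree makes each sum-check message about as long as
-- the proof, but there are only logarithmically many. The resulting sum is N! times the number of
-- violated conditions; a prime larger than N and than the number of conditions detects it. A
-- minimum T-join, and so a valid message, is shown to exist only up to double negation. Validity is
-- decidable and messages are finite, so the honest prover can search for one, and the double
-- negation suffices.

-- Bit strings, encodings and counting over the Boolean cube

module BitStrings where

  open import Data.Bool.Base using (Bool; true; false)
  open import Data.Nat.Base
  open import Data.Nat.Properties
  open import Data.Nat.Tactic.RingSolver using (solve-∀)
  open import Data.Nat.DivMod using (_/_; _%_; m≡m%n+[m/n]*n; m%n<n; m<n*o⇒m/o<n)
  open import Data.Product.Base using (∃; _×_; _,_; proj₁; proj₂)
  open import Data.Vec.Base using (Vec; []; _∷_; _++_)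
  open import Relation.Binary.PropositionalEquality
  open import Relation.Nullary.Decidable.Core using (Dec; yes; no)
  import Data.Empty


  private variable
    A : Set

  -- Little-endian.
  val : ∀ {k} → Vec Bool k → ℕ
  val []          = 0
  val (true ∷ v)  = 1 + val v * 2
  val (false ∷ v) = val v * 2

  odd : ℕ → Bool
  odd x with x % 2
  ... | zero  = false
  ... | suc _ = true

  bits : ∀ k → ℕ → Vec Bool k
  bits zero    x = []
  bits (suc k) x = odd x ∷ bits k (x / 2)

  val<2^ : ∀ {k} (v : Vec Bool k) → val v < 2 ^ k
  val<2^ []          = s≤s z≤n
  val<2^ {suc k} (true ∷ v) = begin
    2 + val v * 2    ≡⟨⟩
    suc (val v) * 2  ≤⟨ *-monoˡ-≤ 2 (val<2^ v) ⟩
    2 ^ k * 2        ≡⟨ *-comm (2 ^ k) 2 ⟩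
    2 ^ suc k        ∎
    where open ≤-Reasoning
  val<2^ {suc k} (false ∷ v) = begin
    suc (val v * 2)  ≤⟨ n≤1+n _ ⟩
    suc (val v) * 2  ≤⟨ *-monoˡ-≤ 2 (val<2^ v) ⟩
    2 ^ k * 2        ≡⟨ *-comm (2 ^ k) 2 ⟩
    2 ^ suc k        ∎
    where open ≤-Reasoning

  private
    val-odd : ∀ x {k} (v : Vec Bool k) → val (odd x ∷ v) ≡ x % 2 + val v * 2
    val-odd x v with x % 2 | m%n<n x 2
    ... | 0           | _ = refl
    ... | 1           | _ = refl
    ... | suc (suc _) | s≤s (s≤s ())

  val-bits : ∀ k x → x < 2 ^ k → val (bits k x) ≡ x
  val-bits zero    zero    _ = refl
  val-bits zero    (suc x) (s≤s ())
  val-bits (suc k) x x<2^k = begin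
    val (odd x ∷ bits k (x / 2))   ≡⟨ val-odd x (bits k (x / 2)) ⟩
    x % 2 + val (bits k (x / 2)) * 2
      ≡⟨ cong (λ y → x % 2 + y * 2) (val-bits k (x / 2) (m<n*o⇒m/o<n (subst (x <_) (*-comm 2 (2 ^ k)) x<2^k))) ⟩
    x % 2 + x / 2 * 2              ≡⟨ m≡m%n+[m/n]*n x 2 ⟨
    x                              ∎
    where open ≡-Reasoning

  val-injective : ∀ {k} (u v : Vec Bool k) → val u ≡ val v → u ≡ v
  val-injective []          []          _ = refl
  val-injective (true ∷ u)  (true ∷ v)  e = cong (true ∷_) (val-injective u v (*-cancelʳ-≡ _ _ 2 (suc-injective e)))
  val-injective (false ∷ u) (false ∷ v) e = cong (false ∷_) (val-injective u v (*-cancelʳ-≡ _ _ 2 e))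
  val-injective (true ∷ u)  (false ∷ v) e with () ← even≢odd (val v) (val u) (trans (*-comm 2 (val v)) (trans (sym e) (cong suc (*-comm (val u) 2))))
  val-injective (false ∷ u) (true ∷ v)  e with () ← even≢odd (val u) (val v) (trans (*-comm 2 (val u)) (trans e (cong suc (*-comm (val v) 2))))

  pre : ∀ a {c} → Vec A (a + c) → Vec A a
  pre zero    _        = []
  pre (suc a) (x ∷ xs) = x ∷ pre a xs

  suf : ∀ a {c} → Vec A (a + c) → Vec A c
  suf zero    xs       = xs
  suf (suc a) (_ ∷ xs) = suf a xs

  pre-++ : ∀ {a c} (u : Vec A a) (v : Vec A c) → pre a (u ++ v) ≡ u
  pre-++ []      v = refl
  pre-++ (x ∷ u) v = cong (x ∷_) (pre-++ u v)

  suf-++ : ∀ {a c} (u : Vec A a) (v : Vec A c) → suf a (u ++ v) ≡ v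
  suf-++ []      v = refl
  suf-++ (x ∷ u) v = suf-++ u v

  -- Lets the verifier be written with structured states, while its space is read off as the sum of
  -- the widths of the components.
  record Enc (A : Set) (s : ℕ) : Set where
    field
      enc     : A → Vec Bool s
      dec     : Vec Bool s → A
      dec-enc : ∀ a → dec (enc a) ≡ a
  open Enc public

  encBits : ∀ {s} → Enc (Vec Bool s) s
  encBits = record { enc = λ v → v ; dec = λ v → v ; dec-enc = λ _ → refl }

  encBool : Enc Bool 1
  encBool = record { enc = _∷ [] ; dec = λ { (β ∷ []) → β } ; dec-enc = λ _ → refl }

  encPair : ∀ {B : Set} {s t} → Enc A s → Enc B t → Enc (A × B) (s + t)
  encPair {s = s} E F = record
    { enc     = λ (a , b) → enc E a ++ enc F b
    ; dec     = λ v → dec E (pre s v) , dec F (suf s v)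
    ; dec-enc = λ (a , b) → cong₂ _,_
        (trans (cong (dec E) (pre-++ (enc E a) _)) (dec-enc E a))
        (trans (cong (dec F) (suf-++ (enc E a) _)) (dec-enc F b))
    }

  encVec : ∀ {s} → Enc A s → ∀ m → Enc (Vec A m) (m * s)
  encVec E zero    = record { enc = λ _ → [] ; dec = λ _ → [] ; dec-enc = λ { [] → refl } }
  encVec {A = A} {s} E (suc m) = record
    { enc     = λ { (a ∷ as) → enc P (a , as) }
    ; dec     = λ v → let p = dec P v in proj₁ p ∷ proj₂ p
    ; dec-enc = λ { (a ∷ as) → cong (λ p → proj₁ p ∷ proj₂ p) (dec-enc P (a , as)) }
    }
    where
    P : Enc (A × Vec A m) (s + m * s)
    P = encPair E (encVec E m)

  ΣN : ∀ k → (Vec Bool k → ℕ) → ℕ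
  ΣN zero    f = f []
  ΣN (suc k) f = ΣN k (λ x → f (false ∷ x)) + ΣN k (λ x → f (true ∷ x))

  ΣN-mono : ∀ k {f g} → (∀ x → f x ≤ g x) → ΣN k f ≤ ΣN k g
  ΣN-mono zero    h = h []
  ΣN-mono (suc k) h = +-mono-≤ (ΣN-mono k λ x → h (false ∷ x)) (ΣN-mono k λ x → h (true ∷ x))

  ΣN-cong : ∀ k {f g} → (∀ x → f x ≡ g x) → ΣN k f ≡ ΣN k g
  ΣN-cong zero    h = h []
  ΣN-cong (suc k) h = cong₂ _+_ (ΣN-cong k λ x → h (false ∷ x)) (ΣN-cong k λ x → h (true ∷ x))

  private
    interchange : ∀ a b c d → (a + b) + (c + d) ≡ (a + c) + (b + d)
    interchange = solve-∀

  ΣN-+ : ∀ k f g → ΣN k (λ x → f x + g x) ≡ ΣN k f + ΣN k g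
  ΣN-+ zero    f g = refl
  ΣN-+ (suc k) f g = trans (cong₂ _+_ (ΣN-+ k _ _) (ΣN-+ k _ _)) (interchange (ΣN k _) _ _ _)

  ΣN-const : ∀ k c → ΣN k (λ _ → c) ≡ 2 ^ k * c
  ΣN-const zero    c = sym (+-identityʳ c)
  ΣN-const (suc k) c = trans (cong₂ _+_ (ΣN-const k c) (ΣN-const k c))
    (trans (sym (*-distribʳ-+ c (2 ^ k) (2 ^ k))) (cong (λ y → (2 ^ k + y) * c) (sym (+-identityʳ (2 ^ k)))))

  ΣN-zero : ∀ k → ΣN k (λ _ → 0) ≡ 0
  ΣN-zero k = trans (ΣN-const k 0) (*-zeroʳ (2 ^ k))

  ΣN-*ˡ : ∀ k c f → ΣN k (λ x → c * f x) ≡ c * ΣN k f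
  ΣN-*ˡ zero    c f = refl
  ΣN-*ˡ (suc k) c f = trans (cong₂ _+_ (ΣN-*ˡ k c _) (ΣN-*ˡ k c _)) (sym (*-distribˡ-+ c _ _))

  ΣN-split : ∀ a c (f : Vec Bool (a + c) → ℕ) → ΣN (a + c) f ≡ ΣN a (λ u → ΣN c (λ v → f (u ++ v)))
  ΣN-split zero    c f = refl
  ΣN-split (suc a) c f = cong₂ _+_ (ΣN-split a c _) (ΣN-split a c _)

  -- Events are counted in natural numbers, so that probabilities stay out of the combinatorial
  -- estimates.
  ind : ∀ {P : Set} → Dec P → ℕ
  ind (yes _) = 1
  ind (no _)  = 0

  ind≤1 : ∀ {P : Set} (d : Dec P) → ind d ≤ 1
  ind≤1 (yes _) = ≤-refl
  ind≤1 (no _)  = z≤n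

  ind-no : ∀ {P : Set} (d : Dec P) → (P → Data.Empty.⊥) → ind d ≡ 0
  ind-no (yes p) ¬p with () ← ¬p p
  ind-no (no _)  _ = refl

  ind-yes : ∀ {P : Set} (d : Dec P) → P → ind d ≡ 1
  ind-yes (yes _) _ = refl
  ind-yes (no ¬p) p with () ← ¬p p

  ind-mono : ∀ {P Q : Set} (d : Dec P) (e : Dec Q) → (P → Q) → ind d ≤ ind e
  ind-mono (no _)  e       f = z≤n
  ind-mono (yes p) (yes q) f = ≤-refl
  ind-mono (yes p) (no ¬q) f with () ← ¬q (f p)

  -- Exhaustive search is what makes satisfiability of the conditions, and later the existence of a
  -- valid message, decidable.
  searchB : ∀ k {P : Vec Bool k → Set} → (∀ v → Dec (P v)) → Dec (∃ P)
  searchB zero    d with d []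
  ... | yes p = yes ([] , p)
  ... | no ¬p = no λ { ([] , p) → ¬p p }
  searchB (suc k) {P} d with searchB k {λ v → P (false ∷ v)} (λ v → d (false ∷ v)) | searchB k {λ v → P (true ∷ v)} (λ v → d (true ∷ v))
  ... | yes (v , p) | _           = yes (false ∷ v , p)
  ... | no _        | yes (v , p) = yes (true ∷ v , p)
  ... | no ¬p       | no ¬q       = no λ { (false ∷ v , p) → ¬p (v , p) ; (true ∷ v , p) → ¬q (v , p) }

  ΣN-ind-unique : ∀ k {P : Vec Bool k → Set} (d : ∀ v → Dec (P v)) → (∀ u v → P u → P v → u ≡ v) → ΣN k (λ v → ind (d v)) ≤ 1
  ΣN-ind-unique zero    d _ = ind≤1 (d [])
  ΣN-ind-unique (suc k) {P} d uniq with searchB k {λ v → P (true ∷ v)} (λ v → d (true ∷ v))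
  ... | yes (u , p) = +-mono-≤ {_} {0} {_} {1}
        (≤-reflexive (trans (ΣN-cong k λ v → ind-no (d (false ∷ v)) (λ q → [λ] (uniq (false ∷ v) (true ∷ u) q p))) (ΣN-zero k)))
        (ΣN-ind-unique k (λ v → d (true ∷ v)) (λ x y px py → ∷-inj (uniq _ _ px py)))
    where
    [λ] : ∀ {v u : Vec Bool k} → _≡_ {A = Vec Bool (suc k)} (false ∷ v) (true ∷ u) → Data.Empty.⊥
    [λ] ()
    ∷-inj : ∀ {v u : Vec Bool k} → _≡_ {A = Vec Bool (suc k)} (true ∷ v) (true ∷ u) → v ≡ u
    ∷-inj refl = refl
  ... | no ¬p = subst (_≤ 1) (sym (trans (cong (ΣN k (λ x → ind (d (false ∷ x))) +_) (trans (ΣN-cong k λ v → ind-no (d (true ∷ v)) (λ q → ¬p (v , q))) (ΣN-zero k))) (+-identityʳ _)))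
        (ΣN-ind-unique k (λ v → d (false ∷ v)) (λ x y px py → ∷-inj (uniq _ _ px py)))
    where
    ∷-inj : ∀ {v u : Vec Bool k} → _≡_ {A = Vec Bool (suc k)} (false ∷ v) (false ∷ u) → v ≡ u
    ∷-inj refl = refl

-- The sum-check protocol for iterated sums modulo a prime

module SumCheck where

  open BitStrings
  open import Data.Bool.Base using (Bool; true; false)
  open import Data.Fin.Base using (Fin; zero; suc)
  open import Data.Integer.Base hiding (suc; _⊔_)
  open import Data.Integer.Properties
  open import Data.Integer.Divisibility.Signed
  open import Data.Integer.Tactic.RingSolver using (solve-∀)
  open import Data.List.Base using (List; []; _∷_; length; map)
  open import Data.Nat.Base as ℕ using (ℕ; zero; suc; z≤n; s≤s; _⊔_)
  import Data.Nat.Divisibility as ℕ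
  import Data.Nat.Properties as ℕ
  open import Data.Nat.Primality using (Prime; euclidsLemma)
  open import Data.Product.Base using (_×_; _,_)
  open import Data.Sum.Base using (_⊎_; inj₁; inj₂)
  open import Data.Unit.Base using (⊤)
  import Data.Vec.Base as Vec
  import Data.Nat.Tactic.RingSolver as ℕSolver
  open import Data.Vec.Base using (Vec; []; _∷_)
  open import Data.Vec.Properties using (≡-dec)
  open import Data.Bool.Properties using () renaming (_≟_ to _≟ᵇ_)
  open import Relation.Binary.PropositionalEquality
  open import Relation.Nullary.Decidable.Core using (Dec; yes; no; map′; _×-dec_)
  open import Relation.Nullary.Negation.Core using (¬_; contradiction)

  ΣB : ∀ m → (Vec Bool m → ℤ) → ℤ
  ΣB zero    f = f []
  ΣB (suc m) f = ΣB m (λ x → f (false ∷ x)) + ΣB m (λ x → f (true ∷ x))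

  ΣB-cong : ∀ m {f g} → (∀ x → f x ≡ g x) → ΣB m f ≡ ΣB m g
  ΣB-cong zero    h = h []
  ΣB-cong (suc m) h = cong₂ _+_ (ΣB-cong m λ x → h (false ∷ x)) (ΣB-cong m λ x → h (true ∷ x))

  private
    interchange : ∀ a b c d → (a + b) + (c + d) ≡ (a + c) + (b + d)
    interchange = solve-∀

  ΣB-+ : ∀ m f g → ΣB m (λ x → f x + g x) ≡ ΣB m f + ΣB m g
  ΣB-+ zero    f g = refl
  ΣB-+ (suc m) f g = trans (cong₂ _+_ (ΣB-+ m _ _) (ΣB-+ m _ _)) (interchange (ΣB m _) _ _ _)

  ΣB-*ˡ : ∀ m c f → ΣB m (λ x → c * f x) ≡ c * ΣB m f
  ΣB-*ˡ zero    c f = refl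
  ΣB-*ˡ (suc m) c f = trans (cong₂ _+_ (ΣB-*ˡ m c _) (ΣB-*ˡ m c _)) (sym (*-distribˡ-+ c _ _))

  ΣB-zero : ∀ m → ΣB m (λ _ → 0ℤ) ≡ 0ℤ
  ΣB-zero zero    = refl
  ΣB-zero (suc m) = cong₂ _+_ (ΣB-zero m) (ΣB-zero m)

  ΣB-split : ∀ a {c} (g : Vec Bool a → Vec Bool c → ℤ) →
    ΣB (a ℕ.+ c) (λ z → g (pre a z) (suf a z)) ≡ ΣB a (λ u → ΣB c (g u))
  ΣB-split zero    g = refl
  ΣB-split (suc a) g = cong₂ _+_ (ΣB-split a λ u → g (false ∷ u)) (ΣB-split a λ u → g (true ∷ u))

  ΣB-ΣN : ∀ m f → ΣB m (λ x → + f x) ≡ + ΣN m f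
  ΣB-ΣN zero    f = refl
  ΣB-ΣN (suc m) f = cong₂ _+_ (ΣB-ΣN m _) (ΣB-ΣN m _)

  -- The graph of a map `g` is the 0-1 function `δ (g u) v`. With `ΣB-δ`, a value `f (g u)` becomes
  -- a sum of products of functions of independent bits, each with its own multilinear extension.
  δ : ∀ {m} → Vec Bool m → Vec Bool m → ℤ
  δ []          []          = 1ℤ
  δ (false ∷ u) (false ∷ v) = δ u v
  δ (true ∷ u)  (true ∷ v)  = δ u v
  δ (false ∷ u) (true ∷ v)  = 0ℤ
  δ (true ∷ u)  (false ∷ v) = 0ℤ

  ΣB-δ : ∀ {m} (u : Vec Bool m) (f : Vec Bool m → ℤ) → ΣB m (λ v → δ u v * f v) ≡ f u
  ΣB-δ []          f = *-identityˡ (f [])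
  ΣB-δ {suc m} (false ∷ u) f = trans (cong₂ _+_ (ΣB-δ u _) (ΣB-zero m)) (+-identityʳ _)
  ΣB-δ {suc m} (true ∷ u)  f = trans (cong₂ _+_ (ΣB-zero m) (ΣB-δ u _)) (+-identityˡ _)

  δ-refl : ∀ {m} (u : Vec Bool m) → δ u u ≡ 1ℤ
  δ-refl []          = refl
  δ-refl (false ∷ u) = δ-refl u
  δ-refl (true ∷ u)  = δ-refl u

  δ-≢ : ∀ {m} (u v : Vec Bool m) → ¬ u ≡ v → δ u v ≡ 0ℤ
  δ-≢ []          []          u≢v = contradiction refl u≢v
  δ-≢ (false ∷ u) (false ∷ v) u≢v = δ-≢ u v λ { refl → u≢v refl }
  δ-≢ (true ∷ u)  (true ∷ v)  u≢v = δ-≢ u v λ { refl → u≢v refl }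
  δ-≢ (false ∷ u) (true ∷ v)  u≢v = refl
  δ-≢ (true ∷ u)  (false ∷ v) u≢v = refl

  -- Univariate polynomials, as coefficient lists starting with the constant term.
  ev : List ℤ → ℤ → ℤ
  ev []       t = 0ℤ
  ev (c ∷ cs) t = c + t * ev cs t

  -- The degree bound is carried by a coefficient list, because such lists are what the prover
  -- sends.
  record IsPoly (d : ℕ) (f : ℤ → ℤ) : Set where
    constructor isPoly
    field
      coeffs  : List ℤ
      short   : length coeffs ℕ.≤ suc d
      correct : ∀ t → ev coeffs t ≡ f t
  open IsPoly public

  private
    addP : List ℤ → List ℤ → List ℤ
    addP []       q        = q
    addP (a ∷ p)  []       = a ∷ p
    addP (a ∷ p)  (b ∷ q)  = (a + b) ∷ addP p q

    ev-addP : ∀ p q t → ev (addP p q) t ≡ ev p t + ev q t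
    ev-addP []      q       t = sym (+-identityˡ _)
    ev-addP (a ∷ p) []      t = sym (+-identityʳ _)
    ev-addP (a ∷ p) (b ∷ q) t = trans (cong (λ x → a + b + t * x) (ev-addP p q t)) (ring a b t (ev p t) (ev q t))
      where
      ring : ∀ a b t x y → a + b + t * (x + y) ≡ (a + t * x) + (b + t * y)
      ring = solve-∀

    length-addP : ∀ p q {d} → length p ℕ.≤ d → length q ℕ.≤ d → length (addP p q) ℕ.≤ d
    length-addP []      q       h        k        = k
    length-addP (a ∷ p) []      h        k        = h
    length-addP (a ∷ p) (b ∷ q) (s≤s h)  (s≤s k)  = s≤s (length-addP p q h k)

    ev-scale : ∀ c p t → ev (map (c *_) p) t ≡ c * ev p t
    ev-scale c []      t = sym (*-zeroʳ c)
    ev-scale c (a ∷ p) t = trans (cong (λ x → c * a + t * x) (ev-scale c p t)) (ring c a t (ev p t))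
      where
      ring : ∀ c a t x → c * a + t * (c * x) ≡ c * (a + t * x)
      ring = solve-∀

    mulP : List ℤ → List ℤ → List ℤ
    mulP []      q = []
    mulP (a ∷ p) q = addP (map (a *_) q) (0ℤ ∷ mulP p q)

    ev-mulP : ∀ p q t → ev (mulP p q) t ≡ ev p t * ev q t
    ev-mulP []      q t = sym (*-zeroˡ (ev q t))
    ev-mulP (a ∷ p) q t = trans (ev-addP (map (a *_) q) _ t)
      (trans (cong₂ (λ x y → x + (0ℤ + t * y)) (ev-scale a q t) (ev-mulP p q t)) (ring a t (ev p t) (ev q t)))
      where
      ring : ∀ a t x y → a * y + (0ℤ + t * (x * y)) ≡ (a + t * x) * y
      ring = solve-∀

    length-map : ∀ (f : ℤ → ℤ) p → length (map f p) ≡ length p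
    length-map f []      = refl
    length-map f (_ ∷ p) = cong suc (length-map f p)

    length-mulP : ∀ p q {d e} → length p ℕ.≤ suc d → length q ℕ.≤ suc e → length (mulP p q) ℕ.≤ suc (d ℕ.+ e)
    length-mulP []      q h k = z≤n
    length-mulP (a ∷ p) q {d} {e} (s≤s h) k = length-addP (map (a *_) q) (0ℤ ∷ mulP p q)
      (subst (ℕ._≤ suc (d ℕ.+ e)) (sym (length-map (a *_) q)) (ℕ.≤-trans k (s≤s (ℕ.m≤n+m e d)))) (s≤s (rest p h))
      where
      rest : ∀ p {d} → length p ℕ.≤ d → length (mulP p q) ℕ.≤ d ℕ.+ e
      rest []      _ = z≤n
      rest (b ∷ p) {suc d} h′ = length-mulP (b ∷ p) q h′ k

  poly-const : ∀ c → IsPoly 0 (λ _ → c)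
  poly-const c = isPoly (c ∷ []) (s≤s z≤n) λ t → trans (cong (_+_ c) (*-zeroʳ t)) (+-identityʳ c)

  poly-line : ∀ a b → IsPoly 1 (λ t → a + t * (b - a))
  poly-line a b = isPoly (a ∷ (b - a) ∷ []) (s≤s (s≤s z≤n)) λ t → cong (λ x → a + t * x) (trans (cong (_+_ (b - a)) (*-zeroʳ t)) (+-identityʳ (b - a)))

  poly-+ : ∀ {d f g} → IsPoly d f → IsPoly d g → IsPoly d (λ t → f t + g t)
  poly-+ (isPoly p h e) (isPoly q k e′) = isPoly (addP p q) (length-addP p q h k) λ t → trans (ev-addP p q t) (cong₂ _+_ (e t) (e′ t))

  poly-* : ∀ {d d′ f g} → IsPoly d f → IsPoly d′ g → IsPoly (d ℕ.+ d′) (λ t → f t * g t)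
  poly-* (isPoly p h e) (isPoly q k e′) = isPoly (mulP p q) (length-mulP p q h k) λ t → trans (ev-mulP p q t) (cong₂ _*_ (e t) (e′ t))

  poly-neg : ∀ {d f} → IsPoly d f → IsPoly d (λ t → - f t)
  poly-neg {f = f} (isPoly p h e) = isPoly (map (-1ℤ *_) p) (subst (ℕ._≤ _) (sym (length-map _ p)) h)
    λ t → trans (ev-scale -1ℤ p t) (trans (-1*i≡-i (ev p t)) (cong -_ (e t)))

  poly-≤ : ∀ {d d′ f} → d ℕ.≤ d′ → IsPoly d f → IsPoly d′ f
  poly-≤ d≤d′ (isPoly p h e) = isPoly p (ℕ.≤-trans h (s≤s d≤d′)) e

  -- Vanishes exactly at 1, …, N.
  Z : ℕ → ℤ → ℤ
  Z zero    t = 1ℤ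
  Z (suc N) t = (+ suc N - t) * Z N t

  poly-Z : ∀ N {d f} → IsPoly d f → IsPoly (N ℕ.* d) (λ t → Z N (f t))
  poly-Z zero    pf = poly-const 1ℤ
  poly-Z (suc N) pf = poly-* (poly-+ (poly-≤ z≤n (poly-const (+ suc N))) (poly-neg pf)) (poly-Z N pf)

  prodF : ∀ J → (Fin J → ℤ) → ℤ
  prodF zero    g = 1ℤ
  prodF (suc J) g = g zero * prodF J (λ j → g (suc j))

  prodF-cong : ∀ J {g h : Fin J → ℤ} → (∀ j → g j ≡ h j) → prodF J g ≡ prodF J h
  prodF-cong zero    e = refl
  prodF-cong (suc J) e = cong₂ _*_ (e zero) (prodF-cong J λ j → e (suc j))

  poly-prodF : ∀ J {g : Fin J → ℤ → ℤ} → (∀ j → IsPoly 1 (g j)) → IsPoly J (λ t → prodF J (λ j → g j t))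
  poly-prodF zero    h = poly-const 1ℤ
  poly-prodF (suc J) h = poly-* (h zero) (poly-prodF J λ j → h (suc j))

  -- The multilinear extension with its first variable set to t: affine in t, with the two halves of
  -- f at 0 and 1. The result is again a function on a cube, so the remaining rounds are an instance
  -- of the same problem.
  bind : ∀ {m} → (Vec Bool (suc m) → ℤ) → ℤ → Vec Bool m → ℤ
  bind f t x = f (false ∷ x) + t * (f (true ∷ x) - f (false ∷ x))

  mle : ∀ {m} → (Vec Bool m → ℤ) → Vec ℤ m → ℤ
  mle f []       = f []
  mle f (t ∷ ts) = mle (bind f t) ts

  mle-cong : ∀ {m} {f g : Vec Bool m → ℤ} → (∀ x → f x ≡ g x) → ∀ ts → mle f ts ≡ mle g ts
  mle-cong e []       = e []
  mle-cong e (t ∷ ts) = mle-cong (λ x → cong₂ (λ a b → a + t * (b - a)) (e (false ∷ x)) (e (true ∷ x))) ts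

  mle-+ : ∀ {m} (f g : Vec Bool m → ℤ) ts → mle (λ x → f x + g x) ts ≡ mle f ts + mle g ts
  mle-+ f g []       = refl
  mle-+ f g (t ∷ ts) = trans (mle-cong (λ x → ring (f (false ∷ x)) (g (false ∷ x)) (f (true ∷ x)) (g (true ∷ x)) t) ts) (mle-+ (bind f t) (bind g t) ts)
    where
    ring : ∀ a b c d t → (a + b) + t * ((c + d) - (a + b)) ≡ (a + t * (c - a)) + (b + t * (d - b))
    ring = solve-∀

  -- Linearity is what makes streaming possible: the extension of a sum, at a secret point, is
  -- accumulated summand by summand.
  mle-ΣB : ∀ {m} k (f : Vec Bool k → Vec Bool m → ℤ) ts → mle (λ x → ΣB k (λ i → f i x)) ts ≡ ΣB k (λ i → mle (f i) ts)
  mle-ΣB zero    f ts = refl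
  mle-ΣB (suc k) f ts = trans (mle-+ _ _ ts) (cong₂ _+_ (mle-ΣB k (λ i → f (false ∷ i)) ts) (mle-ΣB k (λ i → f (true ∷ i)) ts))

  data Φ : Set where
    plain vanish : Φ

  module Total (N J : ℕ) where

    app : Φ → ℤ → ℤ
    app plain  t = t
    app vanish t = Z N t

    -- Iterated sum over the cube, with Z N applied to the partial sums at the
    -- coordinates marked `vanish`.
    total : ∀ {m} → Vec Φ m → (Vec Bool m → ℤ) → ℤ
    total []       f = f []
    total (φ ∷ sp) f = app φ (total sp (λ x → f (false ∷ x)) + total sp (λ x → f (true ∷ x)))

    total-cong : ∀ {m} (sp : Vec Φ m) {f g} → (∀ x → f x ≡ g x) → total sp f ≡ total sp g
    total-cong []       e = e []
    total-cong (φ ∷ sp) e = cong (app φ) (cong₂ _+_ (total-cong sp λ x → e (false ∷ x)) (total-cong sp λ x → e (true ∷ x)))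

    -- Degree in a variable bound before these coordinates: a product of J multilinear factors has
    -- degree at most J, sums preserve the bound, and each `Z N` multiplies it by N.
    degree : ∀ {m} → Vec Φ m → ℕ
    degree []            = J
    degree (plain ∷ sp)  = degree sp
    degree (vanish ∷ sp) = N ℕ.* degree sp

    tot : ∀ {m} → Vec Φ m → (Fin J → Vec Bool m → ℤ) → ℤ
    tot sp fs = total sp (λ x → prodF J (λ j → fs j x))

    poly-app : ∀ φ {m} (sp : Vec Φ m) {f} → IsPoly (degree sp) f → IsPoly (degree (φ ∷ sp)) (λ t → app φ (f t))
    poly-app plain  sp pf = pf
    poly-app vanish sp pf = poly-Z N pf

    poly-tot : ∀ {m} (sp : Vec Φ m) (g : Fin J → ℤ → Vec Bool m → ℤ) → (∀ j x → IsPoly 1 (λ t → g j t x)) → IsPoly (degree sp) (λ t → tot sp (λ j → g j t))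
    poly-tot []       g h = poly-prodF J λ j → h j []
    poly-tot (φ ∷ sp) g h = poly-app φ sp (poly-+ (poly-tot sp (λ j t x → g j t (false ∷ x)) λ j x → h j (false ∷ x)) (poly-tot sp (λ j t x → g j t (true ∷ x)) λ j x → h j (true ∷ x)))

    roundPoly : ∀ {m} (sp : Vec Φ m) (fs : Fin J → Vec Bool (suc m) → ℤ) → IsPoly (degree sp) (λ t → tot sp (λ j → bind (fs j) t))
    roundPoly sp fs = poly-tot sp (λ j t x → bind (fs j) t x) λ j x → poly-line (fs j (false ∷ x)) (fs j (true ∷ x))

    -- Binding to 0 and to 1 restores the two halves of the cube. This identity is what the verifier
    -- checks in each round.
    tot-step : ∀ {m} φ (sp : Vec Φ m) fs → tot (φ ∷ sp) fs ≡ app φ (tot sp (λ j → bind (fs j) 0ℤ) + tot sp (λ j → bind (fs j) 1ℤ))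
    tot-step φ sp fs = cong (app φ) (cong₂ _+_
      (total-cong sp λ x → prodF-cong J λ j → sym (trans (cong (_+_ (fs j (false ∷ x))) (*-zeroˡ (fs j (true ∷ x) - fs j (false ∷ x)))) (+-identityʳ _)))
      (total-cong sp λ x → prodF-cong J λ j → ring (fs j (false ∷ x)) (fs j (true ∷ x))))
      where
      ring : ∀ a b → b ≡ a + 1ℤ * (b - a)
      ring = solve-∀

  ΣV : ∀ a m → (Vec (Vec Bool a) m → ℕ) → ℕ
  ΣV a zero    f = f []
  ΣV a (suc m) f = ΣN a (λ w → ΣV a m (λ ws → f (w ∷ ws)))

  ΣV-mono : ∀ a m {f g} → (∀ x → f x ℕ.≤ g x) → ΣV a m f ℕ.≤ ΣV a m g
  ΣV-mono a zero    h = h []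
  ΣV-mono a (suc m) h = ΣN-mono a λ w → ΣV-mono a m λ ws → h (w ∷ ws)

  ΣV-cong : ∀ a m {f g} → (∀ x → f x ≡ g x) → ΣV a m f ≡ ΣV a m g
  ΣV-cong a zero    h = h []
  ΣV-cong a (suc m) h = ΣN-cong a λ w → ΣV-cong a m λ ws → h (w ∷ ws)

  ΣV-zero : ∀ a m → ΣV a m (λ _ → 0) ≡ 0
  ΣV-zero a zero    = refl
  ΣV-zero a (suc m) = trans (ΣN-cong a λ _ → ΣV-zero a m) (ΣN-zero a)

  ΣV-one : ∀ a m → ΣV a m (λ _ → 1) ≡ 2 ℕ.^ (m ℕ.* a)
  ΣV-one a zero    = refl
  ΣV-one a (suc m) = trans (ΣN-cong a λ _ → ΣV-one a m) (trans (ΣN-const a _) (sym (ℕ.^-distribˡ-+-* 2 a (m ℕ.* a))))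

  valℤ : ∀ {a} → Vec Bool a → ℤ
  valℤ w = + val w

  -- The prover of the sum-check protocol: the polynomials it sends, as they
  -- depend on the points revealed so far.
  data Reply (a : ℕ) : ℕ → Set where
    done  : Reply a 0
    round : ∀ {m} → List ℤ → (Vec Bool a → Reply a m) → Reply a (suc m)

  data Bounded {a} (D : ℕ) : ∀ {m} → Reply a m → Set where
    done  : Bounded D done
    round : ∀ {m g} {k : Vec Bool a → Reply a m} → length g ℕ.≤ suc D → (∀ w → Bounded D (k w)) → Bounded D (round g k)

  module Modular (p : ℕ) where

    infix 4 _≈_ _≉_ _≈?_
    -- Arithmetic stays in ℤ, where the ring solver applies, and passes to the field of p elements
    -- only through this congruence. The record wrapper lets x and y be inferred.
    record _≈_ (x y : ℤ) : Set where
      constructor congruent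
      field divisible : + p ∣ x - y
    open _≈_

    _≉_ : ℤ → ℤ → Set
    x ≉ y = ¬ x ≈ y

    _≈?_ : ∀ x y → Dec (x ≈ y)
    x ≈? y = map′ congruent divisible (+ p ∣? (x - y))

    ≈-refl : ∀ {x} → x ≈ x
    ≈-refl {x} = congruent (divides 0ℤ (i≡j⇒i-j≡0 {x} refl))

    ≈-reflexive : ∀ {x y} → x ≡ y → x ≈ y
    ≈-reflexive refl = ≈-refl

    ≈-sym : ∀ {x y} → x ≈ y → y ≈ x
    ≈-sym {x} {y} h = congruent (subst (+ p ∣_) (ring x y) ((∣m⇒∣-m (divisible h))))
      where
      ring : ∀ x y → - (x - y) ≡ y - x
      ring = solve-∀

    ≈-trans : ∀ {x y z} → x ≈ y → y ≈ z → x ≈ z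
    ≈-trans {x} {y} {z} h k = congruent (subst (+ p ∣_) (ring x y z) ((∣m∣n⇒∣m+n (divisible h) (divisible k))))
      where
      ring : ∀ x y z → (x - y) + (y - z) ≡ x - z
      ring = solve-∀

    ≈-+ : ∀ {x y u v} → x ≈ y → u ≈ v → x + u ≈ y + v
    ≈-+ {x} {y} {u} {v} h k = congruent (subst (+ p ∣_) (ring x y u v) ((∣m∣n⇒∣m+n (divisible h) (divisible k))))
      where
      ring : ∀ x y u v → (x - y) + (u - v) ≡ (x + u) - (y + v)
      ring = solve-∀

    ≈-* : ∀ {x y u v} → x ≈ y → u ≈ v → x * u ≈ y * v
    ≈-* {x} {y} {u} {v} h k = congruent (subst (+ p ∣_) (ring x y u v) ((∣m∣n⇒∣m+n (∣n⇒∣m*n u (divisible h)) (∣n⇒∣m*n y (divisible k)))))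
      where
      ring : ∀ x y u v → u * (x - y) + y * (u - v) ≡ x * u - y * v
      ring = solve-∀

    ≈-neg : ∀ {x y} → x ≈ y → - x ≈ - y
    ≈-neg {x} {y} h = congruent (subst (+ p ∣_) (ring x y) ((∣m⇒∣-m (divisible h))))
      where
      ring : ∀ x y → - (x - y) ≡ - x - - y
      ring = solve-∀

    ≈-ev : ∀ cs {s t} → s ≈ t → ev cs s ≈ ev cs t
    ≈-ev []       h = ≈-refl
    ≈-ev (c ∷ cs) h = ≈-+ (≈-refl {c}) (≈-* h (≈-ev cs h))

    ≈-Z : ∀ N {s t} → s ≈ t → Z N s ≈ Z N t
    ≈-Z zero    h = ≈-refl
    ≈-Z (suc N) h = ≈-* (≈-+ (≈-refl {+ suc N}) (≈-neg h)) (≈-Z N h)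

    ≈-prodF : ∀ J {g h : Fin J → ℤ} → (∀ j → g j ≈ h j) → prodF J g ≈ prodF J h
    ≈-prodF zero    e = ≈-refl
    ≈-prodF (suc J) e = ≈-* (e zero) (≈-prodF J λ j → e (suc j))

    private
      multiple-small : ∀ z → z ℕ.< p → p ℕ.∣ z → z ≡ 0
      multiple-small zero    _   _ = refl
      multiple-small (suc z) z<p d = contradiction (ℕ.∣⇒≤ d) (ℕ.<⇒≱ z<p)

      small-≈-ordered : ∀ {x y} → y ℕ.≤ x → x ℕ.< p → + x ≈ + y → y ≡ x
      small-≈-ordered {x} {y} y≤x x<p h = ℕ.≤-antisym y≤x (ℕ.m∸n≡0⇒m≤n
        (multiple-small (x ℕ.∸ y) (ℕ.≤-<-trans (ℕ.m∸n≤m x y) x<p)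
          (∣⇒∣ᵤ (subst (+ p ∣_) (trans (m-n≡m⊖n x y) (⊖-≥ y≤x)) (divisible h)))))

    small-≈ : ∀ {x y} → x ℕ.< p → y ℕ.< p → + x ≈ + y → x ≡ y
    small-≈ {x} {y} x<p y<p h with ℕ.≤-total x y
    ... | inj₁ x≤y = small-≈-ordered x≤y y<p (≈-sym h)
    ... | inj₂ y≤x = sym (small-≈-ordered y≤x x<p h)

    module Field (isPrime : Prime p) where

      no-zero-divisors : ∀ x y → x * y ≈ 0ℤ → x ≈ 0ℤ ⊎ y ≈ 0ℤ
      no-zero-divisors x y h with euclidsLemma ∣ x ∣ ∣ y ∣ isPrime (subst (p ℕ.∣_) (abs-* x y) (∣⇒∣ᵤ (subst (+ p ∣_) (+-identityʳ (x * y)) (divisible h))))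
      ... | inj₁ d = inj₁ (congruent (subst (+ p ∣_) (sym (+-identityʳ x)) (∣ᵤ⇒∣ d)))
      ... | inj₂ d = inj₂ (congruent (subst (+ p ∣_) (sym (+-identityʳ y)) (∣ᵤ⇒∣ d)))

      private
        -- Synthetic division by t - s: the coefficients of the quotient are the intermediate values
        -- of Horner's scheme at s.
        quot : ℤ → List ℤ → List ℤ
        quot s []       = []
        quot s (c ∷ cs) = ev (c ∷ cs) s ∷ quot s cs

        length-quot : ∀ s cs → length (quot s cs) ≡ length cs
        length-quot s []       = refl
        length-quot s (_ ∷ cs) = cong suc (length-quot s cs)

        factor : ∀ c cs s t → ev (c ∷ cs) t ≡ (t - s) * ev (quot s cs) t + ev (c ∷ cs) s
        factor c []       s t = ring c s t
          where
          ring : ∀ c s t → c + t * 0ℤ ≡ (t - s) * 0ℤ + (c + s * 0ℤ)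
          ring = solve-∀
        factor c (d ∷ cs) s t = trans (cong (λ x → c + t * x) (factor d cs s t)) (ring c s t (ev (quot s cs) t) (ev (d ∷ cs) s))
          where
          ring : ∀ c s t q e → c + t * ((t - s) * q + e) ≡ (t - s) * (e + t * q) + (c + s * e)
          ring = solve-∀

      -- Splitting off a root leaves a quotient of lower degree, and modulo a prime every other root
      -- is a root of the quotient; 2 ^ a ≤ p keeps distinct samples incongruent. That the
      -- polynomial is nonzero is witnessed by a point t, and the same t serves for the quotient.
      roots : ∀ {a} → 2 ℕ.^ a ℕ.≤ p → ∀ D cs → length cs ℕ.≤ suc D → ∀ t → ev cs t ≉ 0ℤ →
              ΣN a (λ w → ind (ev cs (valℤ w) ≈? 0ℤ)) ℕ.≤ D
      roots 2^a≤p D [] _ t h = contradiction ≈-refl h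
      roots {a} 2^a≤p D (c ∷ cs) (s≤s short) t h
        with searchB a (λ w → ev (c ∷ cs) (valℤ w) ≈? 0ℤ)
      ... | no none = ℕ.≤-trans (ℕ.≤-reflexive (trans (ΣN-cong a λ w → ind-no (ev (c ∷ cs) (valℤ w) ≈? 0ℤ) (λ q → none (w , q))) (ΣN-zero a))) z≤n
      ... | yes (w₀ , root) = further D short
        where
        s : ℤ
        s = valℤ w₀
        q : List ℤ
        q = quot s cs
        factored : ∀ t → ev (c ∷ cs) t ≈ (t - s) * ev q t
        factored t = ≈-trans (≈-reflexive (factor c cs s t)) (≈-trans (≈-+ (≈-refl {(t - s) * ev q t}) root) (≈-reflexive (+-identityʳ _)))
        q≉0 : ev q t ≉ 0ℤ
        q≉0 k = h (≈-trans (factored t) (≈-trans (≈-* (≈-refl {t - s}) k) (≈-reflexive (*-zeroʳ (t - s)))))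
        further : ∀ D → length cs ℕ.≤ D → ΣN a (λ w → ind (ev (c ∷ cs) (valℤ w) ≈? 0ℤ)) ℕ.≤ D
        further zero z≤n′ = contradiction (≈-reflexive (cong (λ l → ev l t) (empty q (subst (ℕ._≤ 0) (sym (length-quot s cs)) z≤n′)))) q≉0
          where
          empty : ∀ (l : List ℤ) → length l ℕ.≤ 0 → l ≡ []
          empty [] _ = refl
        further (suc D) short′ = ℕ.≤-trans (ΣN-mono a pointwise)
          (ℕ.≤-trans (ℕ.≤-reflexive (ΣN-+ a _ _))
            (ℕ.+-mono-≤ (ΣN-ind-unique a same? λ u v u≡ v≡ → trans u≡ (sym v≡))
                        (roots {a} 2^a≤p D q (subst (ℕ._≤ suc D) (sym (length-quot s cs)) short′) t q≉0)))
          where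
          same? : ∀ w → Dec (w ≡ w₀)
          same? w = ≡-dec _≟ᵇ_ w w₀
          pointwise : ∀ w → ind (ev (c ∷ cs) (valℤ w) ≈? 0ℤ) ℕ.≤ ind (same? w) ℕ.+ ind (ev q (valℤ w) ≈? 0ℤ)
          pointwise w with same? w
          ... | yes _ = ℕ.≤-trans (ind≤1 _) (s≤s z≤n)
          ... | no w≢w₀ = ind-mono _ _ λ e → other (no-zero-divisors _ _ (≈-trans (≈-sym (factored (valℤ w))) e))
            where
            other : valℤ w - s ≈ 0ℤ ⊎ ev q (valℤ w) ≈ 0ℤ → ev q (valℤ w) ≈ 0ℤ
            other (inj₂ e) = e
            other (inj₁ e) = contradiction (val-injective w w₀ (small-≈ (ℕ.<-≤-trans (val<2^ w) 2^a≤p) (ℕ.<-≤-trans (val<2^ w₀) 2^a≤p)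
              (congruent (subst (+ p ∣_) (+-identityʳ _) (divisible e))))) w≢w₀

      module Sumcheck (N J : ℕ) where
        open Total N J

        ≈-app : ∀ φ {s t} → s ≈ t → app φ s ≈ app φ t
        ≈-app plain  h = h
        ≈-app vanish h = ≈-Z N h

        Accepts : ∀ {a m} → Vec Φ m → ℤ → Reply a m → Vec (Vec Bool a) m → ℤ → Set
        Accepts []       claim done        []       F = claim ≈ F
        Accepts (φ ∷ sp) claim (round g k) (w ∷ ws) F =
          app φ (ev g 0ℤ + ev g 1ℤ) ≈ claim × Accepts sp (ev g (valℤ w)) (k w) ws F

        accepts? : ∀ {a m} (sp : Vec Φ m) claim (ρ : Reply a m) ws F → Dec (Accepts sp claim ρ ws F)
        accepts? []       claim done        []       F = claim ≈? F
        accepts? (φ ∷ sp) claim (round g k) (w ∷ ws) F =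
          (app φ (ev g 0ℤ + ev g 1ℤ) ≈? claim) ×-dec accepts? sp (ev g (valℤ w)) (k w) ws F

        final : ∀ {a m} → (Fin J → Vec Bool m → ℤ) → Vec (Vec Bool a) m → ℤ
        final fs ws = prodF J (λ j → mle (fs j) (Vec.map valℤ ws))

        DegreesAtMost : ∀ {m} → ℕ → Vec Φ m → Set
        DegreesAtMost D []       = ⊤
        DegreesAtMost D (φ ∷ sp) = degree sp ℕ.≤ D × DegreesAtMost D sp

        -- An accepted false claim is preserved until, at some revealed point,
        -- two different polynomials of degree at most D agree.
        sumcheck-sound : ∀ {a} → 2 ℕ.^ a ℕ.≤ p → ∀ D {m} (sp : Vec Φ m) → DegreesAtMost D sp → ∀ fs claim {ρ : Reply a m} → Bounded D ρ → claim ≉ tot sp fs →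
          2 ℕ.^ a ℕ.* ΣV a m (λ ws → ind (accepts? sp claim ρ ws (final fs ws))) ℕ.≤ m ℕ.* D ℕ.* 2 ℕ.^ (m ℕ.* a)
        sumcheck-sound {a} 2^a≤p D [] _ fs claim {done} done wrong with claim ≈? final {a} fs []
        ... | yes h = contradiction h wrong
        ... | no _  = ℕ.≤-reflexive (ℕ.*-zeroʳ (2 ℕ.^ a))
        sumcheck-sound {a} 2^a≤p D {suc m} (φ ∷ sp) (deg , degs) fs claim {round g k} (round short bnd) wrong
          with app φ (ev g 0ℤ + ev g 1ℤ) ≈? claim
        ... | no reject = ℕ.≤-trans (ℕ.≤-reflexive (trans (cong (2 ℕ.^ a ℕ.*_) (trans (ΣN-cong a λ w → trans (ΣV-cong a m λ ws → ind-no (no reject ×-dec accepts? sp (ev g (valℤ w)) (k w) ws (final fs (w ∷ ws))) λ (h , _) → reject h) (ΣV-zero a m)) (ΣN-zero a))) (ℕ.*-zeroʳ (2 ℕ.^ a)))) z≤n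
        ... | yes passed = begin
          2 ℕ.^ a ℕ.* ΣN a (λ w → cnt w)
            ≡⟨ ΣN-*ˡ a (2 ℕ.^ a) cnt ⟨
          ΣN a (λ w → 2 ℕ.^ a ℕ.* cnt w)
            ≤⟨ ΣN-mono a pointwise ⟩
          ΣN a (λ w → C ℕ.* ind (ev diff (valℤ w) ≈? 0ℤ) ℕ.+ m ℕ.* D ℕ.* 2 ℕ.^ (m ℕ.* a))
            ≡⟨ ΣN-+ a _ _ ⟩
          ΣN a (λ w → C ℕ.* ind (ev diff (valℤ w) ≈? 0ℤ)) ℕ.+ ΣN a (λ _ → m ℕ.* D ℕ.* 2 ℕ.^ (m ℕ.* a))
            ≡⟨ cong₂ ℕ._+_ (ΣN-*ˡ a C _) (ΣN-const a _) ⟩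
          C ℕ.* ΣN a (λ w → ind (ev diff (valℤ w) ≈? 0ℤ)) ℕ.+ 2 ℕ.^ a ℕ.* (m ℕ.* D ℕ.* 2 ℕ.^ (m ℕ.* a))
            ≤⟨ ℕ.+-monoˡ-≤ _ (ℕ.*-monoʳ-≤ C few) ⟩
          C ℕ.* D ℕ.+ 2 ℕ.^ a ℕ.* (m ℕ.* D ℕ.* 2 ℕ.^ (m ℕ.* a))
            ≡⟨ ring (2 ℕ.^ a) (2 ℕ.^ (m ℕ.* a)) m D ⟩
          suc m ℕ.* D ℕ.* (2 ℕ.^ a ℕ.* 2 ℕ.^ (m ℕ.* a))
            ≡⟨ cong (suc m ℕ.* D ℕ.*_) (ℕ.^-distribˡ-+-* 2 a (m ℕ.* a)) ⟨
          suc m ℕ.* D ℕ.* 2 ℕ.^ (a ℕ.+ m ℕ.* a) ∎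
          where
          open ℕ.≤-Reasoning
          C : ℕ
          C = 2 ℕ.^ a ℕ.* 2 ℕ.^ (m ℕ.* a)
          ring : ∀ A M m D → A ℕ.* M ℕ.* D ℕ.+ A ℕ.* (m ℕ.* D ℕ.* M) ≡ suc m ℕ.* D ℕ.* (A ℕ.* M)
          ring = ℕSolver.solve-∀
          G : IsPoly D (λ t → tot sp (λ j → bind (fs j) t))
          G = poly-≤ deg (roundPoly sp fs)
          difference : IsPoly D (λ t → ev g t + - tot sp (λ j → bind (fs j) t))
          difference = poly-+ (isPoly g short λ _ → refl) (poly-neg G)
          diff : List ℤ
          diff = coeffs difference
          agree : ∀ t → ev diff t ≈ 0ℤ → ev g t ≈ tot sp (λ j → bind (fs j) t)
          agree t h = ≈-trans (≈-reflexive (split (ev g t) (tot sp (λ j → bind (fs j) t))))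
            (≈-trans (≈-+ (≈-trans (≈-reflexive (sym (correct difference t))) h) (≈-refl {tot sp (λ j → bind (fs j) t)})) (≈-reflexive (+-identityˡ _)))
            where
            split : ∀ x y → x ≡ (x + - y) + y
            split = solve-∀
          -- If the received and the true polynomial agreed at both 0 and 1, the passed round check
          -- would make the claim true. So their difference is nonzero at 0 or at 1.
          few : ΣN a (λ w → ind (ev diff (valℤ w) ≈? 0ℤ)) ℕ.≤ D
          few with ev diff 0ℤ ≈? 0ℤ | ev diff 1ℤ ≈? 0ℤ
          ... | no h  | _    = roots {a} 2^a≤p D diff (IsPoly.short difference) 0ℤ h
          ... | yes _ | no h = roots {a} 2^a≤p D diff (IsPoly.short difference) 1ℤ h
          ... | yes h₀ | yes h₁ = contradiction (≈-trans (≈-sym passed) (≈-trans (≈-app φ (≈-+ (agree 0ℤ h₀) (agree 1ℤ h₁))) (≈-reflexive (sym (tot-step φ sp fs))))) wrong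
          cnt : Vec Bool a → ℕ
          cnt w = ΣV a m (λ ws → ind (yes passed ×-dec accepts? sp (ev g (valℤ w)) (k w) ws (final fs (w ∷ ws))))
          drop-yes : ∀ {P Q : Set} (x : P) (d : Dec Q) → ind (yes x ×-dec d) ℕ.≤ ind d
          drop-yes x (yes _) = ℕ.≤-refl
          drop-yes x (no _)  = z≤n
          -- At the at most D points where the polynomials agree, everything is given up; elsewhere
          -- the next claim is false again and induction applies.
          pointwise : ∀ w → 2 ℕ.^ a ℕ.* cnt w ℕ.≤ C ℕ.* ind (ev diff (valℤ w) ≈? 0ℤ) ℕ.+ m ℕ.* D ℕ.* 2 ℕ.^ (m ℕ.* a)
          pointwise w with ev diff (valℤ w) ≈? 0ℤ
          ... | yes _ = ℕ.≤-trans (ℕ.*-monoʳ-≤ (2 ℕ.^ a) (ℕ.≤-trans (ΣV-mono a m λ ws → ind≤1 (yes passed ×-dec accepts? sp (ev g (valℤ w)) (k w) ws (final fs (w ∷ ws)))) (ℕ.≤-reflexive (ΣV-one a m))))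
                          (ℕ.≤-trans (ℕ.≤-reflexive (sym (ℕ.*-identityʳ C))) (ℕ.m≤m+n _ _))
          ... | no h = ℕ.≤-trans (ℕ.*-monoʳ-≤ (2 ℕ.^ a) (ΣV-mono a m λ ws → drop-yes passed (accepts? sp (ev g (valℤ w)) (k w) ws (final fs (w ∷ ws)))))
                (ℕ.≤-trans (sumcheck-sound 2^a≤p D sp degs (λ j → bind (fs j) (valℤ w)) (ev g (valℤ w)) (bnd w) still) (ℕ.m≤n+m _ _))
            where
            still : ev g (valℤ w) ≉ tot sp (λ j → bind (fs j) (valℤ w))
            still e = h (≈-trans (≈-reflexive (correct difference (valℤ w))) (≈-trans (≈-+ e (≈-refl { - tot sp (λ j → bind (fs j) (valℤ w))})) (≈-reflexive (+-inverseʳ (tot sp (λ j → bind (fs j) (valℤ w)))))))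

        Honest : ∀ {a m} → Vec Φ m → (Fin J → Vec Bool m → ℤ) → Reply a m → Set
        Honest []       fs done        = ⊤
        Honest (φ ∷ sp) fs (round g k) = (∀ t → ev g t ≈ tot sp (λ j → bind (fs j) t)) × (∀ w → Honest sp (λ j → bind (fs j) (valℤ w)) (k w))

        sumcheck-complete : ∀ {a m} (sp : Vec Φ m) fs claim (ρ : Reply a m) → Honest sp fs ρ → claim ≈ tot sp fs → ∀ ws → Accepts sp claim ρ ws (final fs ws)
        sumcheck-complete []       fs claim done        _         h []       = h
        sumcheck-complete (φ ∷ sp) fs claim (round g k) (hg , hk) h (w ∷ ws) =
          ≈-trans (≈-app φ (≈-+ (hg 0ℤ) (hg 1ℤ))) (≈-trans (≈-reflexive (sym (tot-step φ sp fs))) (≈-sym h)) ,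
          sumcheck-complete sp (λ j → bind (fs j) (valℤ w)) (ev g (valℤ w)) (k w) (hk w) (hg (valℤ w)) ws

-- Straight-line verifiers with bounded memory, and their probabilities

module Programs where

  open BitStrings
  open import Defs
  open import Data.Bool.Base using (Bool; true; false)
  import Data.Integer.Base as ℤ
  open import Data.List.Base as List using (List; []; _∷_; _++_; length; drop; foldl)
  open import Data.Maybe.Base using (Maybe)
  open import Data.Nat.Base as ℕ
  open import Data.Nat.Properties
  open import Data.Nat.Tactic.RingSolver using (solve-∀)
  open import Data.Product.Base using (_×_; _,_; proj₁; proj₂)
  open import Data.Rational.Base as ℚ using (ℚ; 0ℚ; 1ℚ; ½)
  import Data.Rational.Properties as ℚ
  import Data.Rational.Unnormalised.Base as ℚᵘ
  import Data.Rational.Unnormalised.Properties as ℚᵘ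
  import Data.Integer.Properties as ℤ
  open import Data.Vec.Base as Vec using (Vec; []; _∷_)
  open import Relation.Binary.PropositionalEquality
  open import Relation.Nullary.Decidable.Core using (yes; no)
  open import Relation.Unary using (Decidable)

  private variable
    A S : Set

  randMap : ∀ k → (Vec Bool k → A) → Rand A
  randMap zero    f = return (f [])
  randMap (suc k) f = toss λ coin → randMap k (λ v → f (coin ∷ v))

  Surely-randMap : ∀ {B : Set} {E : B → Set} k (f : Vec Bool k → A) (g : A → Rand B) (out : Vec Bool k → B) →
    (∀ v → g (f v) ≡ return (out v)) → (∀ v → E (out v)) → Surely E (randMap k f >>= g)
  Surely-randMap zero    f g out e h rewrite e [] = return (h [])
  Surely-randMap (suc k) f g out e h = toss λ coin →
    Surely-randMap k (λ v → f (coin ∷ v)) g (λ v → out (coin ∷ v)) (λ v → e (coin ∷ v)) (λ v → h (coin ∷ v))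

  fromℕ-+ : ∀ a b → fromℕ (a ℕ.+ b) ≡ fromℕ a ℚ.+ fromℕ b
  fromℕ-+ a b = ℚ.toℚᵘ-injective (ℚᵘ.≃-trans (ℚ.toℚᵘ-cong {fromℕ (a ℕ.+ b)} refl) (ℚᵘ.≃-trans h (ℚᵘ.≃-sym (ℚ.toℚᵘ-homo-+ (fromℕ a) (fromℕ b)))))
    where
    h : ℚ.toℚᵘ (fromℕ (a ℕ.+ b)) ℚᵘ.≃ ℚ.toℚᵘ (fromℕ a) ℚᵘ.+ ℚ.toℚᵘ (fromℕ b)
    h = ℚᵘ.≃-trans (ℚ.toℚᵘ-fromℚᵘ (ℚᵘ.mkℚᵘ (ℤ.+ (a ℕ.+ b)) 0)) (ℚᵘ.≃-trans (ℚᵘ.*≡* (cong (ℤ._* ℤ.+ 1) eq)) (ℚᵘ.≃-sym (ℚᵘ.+-cong (ℚ.toℚᵘ-fromℚᵘ (ℚᵘ.mkℚᵘ (ℤ.+ a) 0)) (ℚ.toℚᵘ-fromℚᵘ (ℚᵘ.mkℚᵘ (ℤ.+ b) 0)))))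
      where
      eq : ℤ.+ (a ℕ.+ b) ≡ ℤ.+ a ℤ.* ℤ.+ 1 ℤ.+ ℤ.+ b ℤ.* ℤ.+ 1
      eq = sym (cong₂ ℤ._+_ (ℤ.*-identityʳ (ℤ.+ a)) (ℤ.*-identityʳ (ℤ.+ b)))

  fromℕ-* : ∀ a b → fromℕ (a ℕ.* b) ≡ fromℕ a ℚ.* fromℕ b
  fromℕ-* zero    b = sym (ℚ.*-zeroˡ (fromℕ b))
  fromℕ-* (suc a) b = trans (fromℕ-+ b (a ℕ.* b)) (trans (cong₂ ℚ._+_ (sym (ℚ.*-identityˡ (fromℕ b))) (fromℕ-* a b))
    (trans (sym (ℚ.*-distribʳ-+ (fromℕ b) 1ℚ (fromℕ a))) (cong (ℚ._* fromℕ b) (sym (fromℕ-+ 1 a)))))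

  fromℕ-mono-≤ : ∀ {a b} → a ≤ b → fromℕ a ℚ.≤ fromℕ b
  fromℕ-mono-≤ {a} {b} a≤b = ℚ.toℚᵘ-cancel-≤ (ℚᵘ.≤-respˡ-≃ (ℚᵘ.≃-sym (ℚ.toℚᵘ-fromℚᵘ (ℚᵘ.mkℚᵘ (ℤ.+ a) 0))) (ℚᵘ.≤-respʳ-≃ (ℚᵘ.≃-sym (ℚ.toℚᵘ-fromℚᵘ (ℚᵘ.mkℚᵘ (ℤ.+ b) 0)))
    (ℚᵘ.*≤* (ℤ.*-monoʳ-≤-nonNeg (ℤ.+ 1) (ℤ.+≤+ a≤b)))))

  fromℕ-nonNeg : ∀ a → 0ℚ ℚ.≤ fromℕ a
  fromℕ-nonNeg a = fromℕ-mono-≤ {0} {a} z≤n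

  -- The denominators of a tree of fair coins are powers of two; clearing them turns a probability
  -- into a number of coin strings.
  Pr-randMap : ∀ {B : Set} {E : B → Set} (E? : Decidable E) k (f : Vec Bool k → A) (g : A → Rand B) (out : Vec Bool k → B) →
    (∀ v → g (f v) ≡ return (out v)) → fromℕ (2 ^ k) ℚ.* Pr E? (randMap k f >>= g) ≡ fromℕ (ΣN k (λ v → ind (E? (out v))))
  Pr-randMap E? zero    f g out e rewrite e [] with E? (out [])
  ... | yes _ = refl
  ... | no _  = refl
  Pr-randMap E? (suc k) f g out e = begin
    fromℕ (2 ^ suc k) ℚ.* (½ ℚ.* (t ℚ.+ u))                   ≡⟨ cong (ℚ._* (½ ℚ.* (t ℚ.+ u))) (fromℕ-* 2 (2 ^ k)) ⟩
    fromℕ 2 ℚ.* c ℚ.* (½ ℚ.* (t ℚ.+ u))                       ≡⟨ ℚ.*-assoc (fromℕ 2 ℚ.* c) ½ (t ℚ.+ u) ⟨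
    fromℕ 2 ℚ.* c ℚ.* ½ ℚ.* (t ℚ.+ u)                         ≡⟨ cong (ℚ._* (t ℚ.+ u)) (trans (cong (ℚ._* ½) (ℚ.*-comm (fromℕ 2) c)) (trans (ℚ.*-assoc c (fromℕ 2) ½) (ℚ.*-identityʳ c))) ⟩
    c ℚ.* (t ℚ.+ u)                                           ≡⟨ ℚ.*-distribˡ-+ c t u ⟩
    c ℚ.* t ℚ.+ c ℚ.* u                                       ≡⟨ cong₂ ℚ._+_ (rec true) (rec false) ⟩
    fromℕ (cnt true) ℚ.+ fromℕ (cnt false)                    ≡⟨ fromℕ-+ (cnt true) (cnt false) ⟨
    fromℕ (cnt true ℕ.+ cnt false)                            ≡⟨ cong fromℕ (+-comm (cnt true) (cnt false)) ⟩
    fromℕ (cnt false ℕ.+ cnt true)                            ∎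
    where
    open ≡-Reasoning
    c t u : ℚ
    c = fromℕ (2 ^ k)
    t = Pr E? (randMap k (λ v → f (true ∷ v)) >>= g)
    u = Pr E? (randMap k (λ v → f (false ∷ v)) >>= g)
    cnt : Bool → ℕ
    cnt coin = ΣN k (λ v → ind (E? (out (coin ∷ v))))
    rec : ∀ coin → c ℚ.* Pr E? (randMap k (λ v → f (coin ∷ v)) >>= g) ≡ fromℕ (cnt coin)
    rec coin = Pr-randMap E? k (λ v → f (coin ∷ v)) g (λ v → out (coin ∷ v)) (λ v → e (coin ∷ v))

  two-thirds : ∀ {B : Set} {E : B → Set} (E? : Decidable E) k (f : Vec Bool k → A) (g : A → Rand B) (out : Vec Bool k → B) →
    (∀ v → g (f v) ≡ return (out v)) → 2 ℕ.* 2 ^ k ≤ 3 ℕ.* ΣN k (λ v → ind (E? (out v))) → (ℤ.+ 2) ℚ./ 3 ℚ.≤ Pr E? (randMap k f >>= g)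
  two-thirds E? k f g out e h = ℚ.*-cancelˡ-≤-pos (fromℕ 3 ℚ.* c) (begin
    fromℕ 3 ℚ.* c ℚ.* q       ≡⟨ trans (cong (ℚ._* q) (ℚ.*-comm (fromℕ 3) c)) (trans (ℚ.*-assoc c (fromℕ 3) q) (ℚ.*-comm c (fromℕ 2))) ⟩
    fromℕ 2 ℚ.* c             ≡⟨ fromℕ-* 2 (2 ^ k) ⟨
    fromℕ (2 ℕ.* 2 ^ k)       ≤⟨ fromℕ-mono-≤ h ⟩
    fromℕ (3 ℕ.* cnt)         ≡⟨ fromℕ-* 3 cnt ⟩
    fromℕ 3 ℚ.* fromℕ cnt     ≡⟨ cong (fromℕ 3 ℚ.*_) (Pr-randMap E? k f g out e) ⟨
    fromℕ 3 ℚ.* (c ℚ.* x)     ≡⟨ ℚ.*-assoc (fromℕ 3) c x ⟨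
    fromℕ 3 ℚ.* c ℚ.* x       ∎)
    where
    open ℚ.≤-Reasoning
    c q x : ℚ
    c = fromℕ (2 ^ k)
    q = (ℤ.+ 2) ℚ./ 3
    x = Pr E? (randMap k f >>= g)
    cnt : ℕ
    cnt = ΣN k (λ v → ind (E? (out v)))
    instance
      c>0 : ℚ.Positive c
      c>0 = ℚ.positive (ℚ.<-≤-trans {0ℚ} {1ℚ} (ℚ.*<* (ℤ.+<+ (s≤s z≤n))) (fromℕ-mono-≤ {1} (m^n>0 2 k)))
      3c>0 : ℚ.Positive (fromℕ 3 ℚ.* c)
      3c>0 = ℚ.pos*pos⇒pos (fromℕ 3) c

  count-all : ∀ K (good : Vec Bool K → ℕ) → (∀ v → good v ≡ 1) → 2 ℕ.* 2 ^ K ≤ 3 ℕ.* ΣN K good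
  count-all K good h = *-mono-≤ {2} {3} (s≤s (s≤s z≤n)) (≤-reflexive (trans (sym (*-identityʳ (2 ^ K))) (trans (sym (ΣN-const K 1)) (ΣN-cong K λ v → sym (h v)))))

  -- Union bound: every coin string is good or bad, and at most a third are bad.
  count-most : ∀ K (good bad : Vec Bool K → ℕ) → (∀ v → 1 ≤ good v ℕ.+ bad v) → 3 ℕ.* ΣN K bad ≤ 2 ^ K → 2 ℕ.* 2 ^ K ≤ 3 ℕ.* ΣN K good
  count-most K good bad h few = +-cancelʳ-≤ (2 ^ K) (2 ℕ.* 2 ^ K) (3 ℕ.* ΣN K good) (begin
    2 ℕ.* 2 ^ K ℕ.+ 2 ^ K                      ≡⟨ ring (2 ^ K) ⟩
    3 ℕ.* (2 ^ K ℕ.* 1)                        ≡⟨ cong (3 ℕ.*_) (ΣN-const K 1) ⟨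
    3 ℕ.* ΣN K (λ _ → 1)                       ≤⟨ *-monoʳ-≤ 3 (ΣN-mono K h) ⟩
    3 ℕ.* ΣN K (λ v → good v ℕ.+ bad v)        ≡⟨ cong (3 ℕ.*_) (ΣN-+ K good bad) ⟩
    3 ℕ.* (ΣN K good ℕ.+ ΣN K bad)             ≡⟨ *-distribˡ-+ 3 (ΣN K good) (ΣN K bad) ⟩
    3 ℕ.* ΣN K good ℕ.+ 3 ℕ.* ΣN K bad         ≤⟨ +-monoʳ-≤ (3 ℕ.* ΣN K good) few ⟩
    3 ℕ.* ΣN K good ℕ.+ 2 ^ K                  ∎)
    where
    open ≤-Reasoning
    ring : ∀ y → 2 ℕ.* y ℕ.+ y ≡ 3 ℕ.* (y ℕ.* 1)
    ring = solve-∀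

  -- Straight-line verifiers, one instruction per communicated bit.
  data Instr (S : Set) : Set where
    recv : (Bool → S → S) → Instr S
    send : (S → Bool) → (S → S) → Instr S

  exec : List (Instr S) → Strategy → Transcript → S → Transcript × S
  exec []              P τ s = τ , s
  exec (recv u ∷ is)   P τ s = exec is P ((prover , P τ) ∷ τ) (u (P τ) s)
  exec (send o u ∷ is) P τ s = exec is P ((verifier , o s) ∷ τ) (u s)

  exec-++ : ∀ (is js : List (Instr S)) P τ s → exec (is ++ js) P τ s ≡ exec js P (proj₁ (exec is P τ s)) (proj₂ (exec is P τ s))
  exec-++ []              js P τ s = refl
  exec-++ (recv u ∷ is)   js P τ s = exec-++ is js P _ _
  exec-++ (send o u ∷ is) js P τ s = exec-++ is js P _ _

  -- The memory is a program counter of pb bits next to the encoded state. Control is straight-line,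
  -- so the counter alone tells which token or coefficient is arriving, and it costs the logarithm
  -- of the program's length. While the stream passes it stays 0.
  module Compile {A S : Set} {s : ℕ} (E : Enc S s) (pb : ℕ) (prog : List (Instr S)) (fits : length prog < 2 ^ pb)
                 (coins : ℕ) (init : Vec Bool coins → S) (step : A → S → S) (answer : S → Maybe ℚ) where

    store : ℕ → S → Memory (pb ℕ.+ s)
    store pc x = bits pb pc Vec.++ enc E x

    actOn : List (Instr S) → ℕ → S → Action (pb ℕ.+ s)
    actOn []             pc x = halt (answer x)
    actOn (recv u ∷ _)   pc x = receive λ β → return (store (suc pc) (u β x))
    actOn (send o u ∷ _) pc x = send (o x) (return (store (suc pc) (u x)))

    counter : Memory (pb ℕ.+ s) → ℕ
    counter m = val (pre pb m)

    contents : Memory (pb ℕ.+ s) → S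
    contents m = dec E (suf pb m)

    V : Verifier A (pb ℕ.+ s)
    V = record
      { start = randMap coins (λ v → store 0 (init v))
      ; read  = λ a m → return (store 0 (step a (contents m)))
      ; act   = λ m → actOn (drop (counter m) prog) (counter m) (contents m)
      }

    contents-store : ∀ pc x → contents (store pc x) ≡ x
    contents-store pc x = trans (cong (dec E) (suf-++ (bits pb pc) (enc E x))) (dec-enc E x)

    counter-store : ∀ pc x → pc ≤ length prog → counter (store pc x) ≡ pc
    counter-store pc x h = trans (cong val (pre-++ (bits pb pc) (enc E x))) (val-bits pb pc (≤-<-trans h fits))

    consumed : List A → S → S
    consumed σ x = foldl (λ y a → step a y) x σ

    readAll-store : ∀ {B : Set} (g : Memory (pb ℕ.+ s) → Rand B) σ x → (readAll V σ (store 0 x) >>= g) ≡ g (store 0 (consumed σ x))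
    readAll-store g []      x = refl
    readAll-store g (a ∷ σ) x rewrite contents-store 0 x = readAll-store g σ (step a x)

    finished : Transcript × S → Transcript × Outcome
    finished (τ , x) = τ , output (answer x)

    drop-suc : ∀ pc {i} {is : List (Instr S)} → drop pc prog ≡ i ∷ is → drop (suc pc) prog ≡ is
    drop-suc pc = go pc prog
      where
      go : ∀ pc (l : List (Instr S)) {i is} → drop pc l ≡ i ∷ is → drop (suc pc) l ≡ is
      go zero     (_ ∷ l) refl = refl
      go (suc pc) (_ ∷ l) e    = go pc l e

    drop-bound : ∀ pc {i} {is : List (Instr S)} → drop pc prog ≡ i ∷ is → suc pc ≤ length prog
    drop-bound pc = go pc prog
      where
      go : ∀ pc (l : List (Instr S)) {i is} → drop pc l ≡ i ∷ is → suc pc ≤ length l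
      go zero     (_ ∷ l) e = s≤s z≤n
      go (suc pc) (_ ∷ l) e = s≤s (go pc l e)

    -- The communication bound is exactly the number of remaining instructions, so a run is never
    -- cut off.
    interact-exec : ∀ is pc → pc ≤ length prog → drop pc prog ≡ is → ∀ P τ x →
      interact V (length is) P τ (store pc x) ≡ return (finished (exec is P τ x))
    interact-exec [] pc pc≤ e P τ x
      rewrite counter-store pc x pc≤ | contents-store pc x | e = refl
    interact-exec (recv u ∷ is) pc pc≤ e P τ x
      rewrite counter-store pc x pc≤ | contents-store pc x | e =
      interact-exec is (suc pc) (drop-bound pc e) (drop-suc pc e) P _ _
    interact-exec (send o u ∷ is) pc pc≤ e P τ x
      rewrite counter-store pc x pc≤ | contents-store pc x | e =
      interact-exec is (suc pc) (drop-bound pc e) (drop-suc pc e) P _ _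

    run-exec : ∀ P σ v → (readAll V σ (store 0 (init v)) >>= interact V (length prog) P []) ≡ return (finished (exec prog P [] (consumed σ (init v))))
    run-exec P σ v = trans (readAll-store _ σ (init v)) (interact-exec prog 0 z≤n refl P [] _)

    module _ (Π : Problem A) where
      open Problem Π

      -- `outcome` describes the result of a run apart from the execution itself, so that the
      -- counting arguments never unfold the program.
      isSIP : ∀ {r} (outcome : ∀ x σ → Presents x σ → Strategy → Vec Bool coins → Transcript × S) →
        (∀ x σ pr P v → exec prog P [] (foldl (λ y a → step a y) (init v) σ) ≡ outcome x σ pr P v) →
        (∀ x σ pr P v → rounds (proj₁ (outcome x σ pr P v)) ≤ r) →
        (honest : List A → Strategy) →
        (∀ x σ pr → 2 ℕ.* 2 ^ coins ≤ 3 ℕ.* ΣN coins (λ v → ind (answered? Π x (finished (outcome x σ pr (honest σ) v))))) →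
        (∀ x σ pr P → 2 ℕ.* 2 ^ coins ≤ 3 ℕ.* ΣN coins (λ v → ind (answeredOrRejected? Π x (finished (outcome x σ pr P v))))) →
        IsSIP Π V (length prog) r
      isSIP outcome e rds honest compl snd = record
        { bounded  = λ x σ pr P → Surely-randMap coins _ _ (λ v → finished (outcome x σ pr P v)) (runs x σ pr P) λ v → (λ ()) , rds x σ pr P v
        ; honest   = honest
        ; complete = λ x σ pr → two-thirds (answered? Π x) coins _ _ (λ v → finished (outcome x σ pr (honest σ) v)) (runs x σ pr (honest σ)) (compl x σ pr)
        ; sound    = λ x σ pr P → two-thirds (answeredOrRejected? Π x) coins _ _ (λ v → finished (outcome x σ pr P v)) (runs x σ pr P) (snd x σ pr P)
        }
        where
        runs : ∀ x σ pr P v → (readAll V σ (store 0 (init v)) >>= interact V (length prog) P []) ≡ return (finished (outcome x σ pr P v))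
        runs x σ pr P v = trans (run-exec P σ v) (cong (λ o → return (finished o)) (e x σ pr P v))

-- Words sent bit by bit, prover plans, and the number of messages

module Messages where

  open BitStrings
  open import Defs
  open Programs
  open import Data.Bool.Base using (Bool; true; false)
  open import Data.List.Base as List using (List; []; _∷_; _++_; length; _ʳ++_; reverse)
  open import Data.List.Properties using (++-identityʳ; ++-assoc; reverse-involutive)
  open import Data.Nat.Base
  open import Data.Nat.Properties
  open import Data.Product.Base using (_×_; _,_)
  open import Data.Vec.Base as Vec using (Vec; []; _∷_; _∷ʳ_; toList; head; tail)
  open import Data.Vec.Properties using (length-toList)
  open import Relation.Binary.PropositionalEquality

  answers : ∀ k → Strategy → Transcript → Vec Bool k
  answers zero    P τ = []
  answers (suc k) P τ = P τ ∷ answers k P ((prover , P τ) ∷ τ)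

  after : ℕ → Strategy → Transcript → Transcript
  after zero    P τ = τ
  after (suc k) P τ = after k P ((prover , P τ) ∷ τ)

  sent : ∀ {k} → Vec Bool k → Transcript → Transcript
  sent []      τ = τ
  sent (β ∷ w) τ = sent w ((verifier , β) ∷ τ)

  private
    -- A shift register: after as many bits as it is long, it holds exactly the received word,
    -- whatever it held before. So the buffer is never cleared.
    shift : ∀ {k} → Vec Bool (suc k) → Bool → Vec Bool (suc k)
    shift v β = tail (v ∷ʳ β)

    shifts : ∀ {k j} → Vec Bool (suc k) → Vec Bool j → Vec Bool (suc k)
    shifts v []      = v
    shifts v (β ∷ w) = shifts (shift v β) w

    toList-∷ʳ : ∀ {k} (v : Vec Bool k) β → toList (v ∷ʳ β) ≡ toList v ++ β ∷ []
    toList-∷ʳ []      β = refl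
    toList-∷ʳ (x ∷ v) β = cong (x ∷_) (toList-∷ʳ v β)

    toList-shift : ∀ {k} (v : Vec Bool (suc k)) β → toList (shift v β) ≡ List.drop 1 (toList v) ++ β ∷ []
    toList-shift (x ∷ v) β = toList-∷ʳ v β

    toList-shifts : ∀ {k j} (v : Vec Bool (suc k)) (w : Vec Bool j) → toList (shifts v w) ≡ List.drop j (toList v ++ toList w)
    toList-shifts (x ∷ v) []      = sym (++-identityʳ (x ∷ toList v))
    toList-shifts {j = suc j} (x ∷ v) (β ∷ w) = trans (toList-shifts (shift (x ∷ v) β) w)
      (cong (List.drop j) (trans (cong (_++ toList w) (toList-shift (x ∷ v) β)) (++-assoc (toList v) (β ∷ []) (toList w))))

    drop-length : ∀ (l m : List Bool) → List.drop (length l) (l ++ m) ≡ m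
    drop-length []      m = refl
    drop-length (_ ∷ l) m = drop-length l m

    shifts-all : ∀ {k} (v w : Vec Bool (suc k)) → shifts v w ≡ w
    shifts-all {k} v w = toList-inj (shifts v w) w (trans (toList-shifts v w)
      (trans (cong (λ j → List.drop j (toList v ++ toList w)) (sym (length-toList v))) (drop-length (toList v) (toList w))))
      where
      toList-inj : ∀ {k} (u v : Vec Bool k) → toList u ≡ toList v → u ≡ v
      toList-inj []      []      _ = refl
      toList-inj (x ∷ u) (y ∷ v) e with e | toList-inj u v
      ... | e′ | f = cong₂ _∷_ (cong hd e′) (f (cong (List.drop 1) e′))
        where
        hd : List Bool → Bool
        hd []      = x
        hd (z ∷ _) = z

  module _ {R : Set} where

    private
      recvFrom : ∀ {b} → ℕ → (Vec Bool (suc b) → R → R) → List (Instr (Vec Bool (suc b) × R))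
      recvFrom zero    f = recv (λ β (v , r) → shift v β , f (shift v β) r) ∷ []
      recvFrom (suc k) f = recv (λ β (v , r) → shift v β , r) ∷ recvFrom k f

      exec-recvFrom : ∀ {b} k (f : Vec Bool (suc b) → R → R) P τ v r → exec (recvFrom k f) P τ (v , r) ≡
        (after (suc k) P τ , shifts v (answers (suc k) P τ) , f (shifts v (answers (suc k) P τ)) r)
      exec-recvFrom zero    f P τ v r = refl
      exec-recvFrom (suc k) f P τ v r = exec-recvFrom k f P _ _ r

      length-recvFrom : ∀ {b} k (f : Vec Bool (suc b) → R → R) → length (recvFrom k f) ≡ suc k
      length-recvFrom zero    f = refl
      length-recvFrom (suc k) f = cong suc (length-recvFrom k f)

    -- The first component of the state collects the bits of the current word.
    recvW : ∀ {b} → (Vec Bool (suc b) → R → R) → List (Instr (Vec Bool (suc b) × R))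
    recvW {b} f = recvFrom b f

    length-recvW : ∀ {b} (f : Vec Bool (suc b) → R → R) → length (recvW f) ≡ suc b
    length-recvW {b} f = length-recvFrom b f

    exec-recvW : ∀ {b} (f : Vec Bool (suc b) → R → R) P τ v r →
      exec (recvW f) P τ (v , r) ≡ (after (suc b) P τ , answers (suc b) P τ , f (answers (suc b) P τ) r)
    exec-recvW {b} f P τ v r = trans (exec-recvFrom b f P τ v r)
      (cong (λ w → after (suc b) P τ , w , f w r) (shifts-all v (answers (suc b) P τ)))

  sendW : ∀ {S : Set} {k} → (S → Vec Bool (suc k)) → (S → S) → List (Instr S)
  sendW {k = zero}  o u = send (λ s → head (o s)) u ∷ []
  sendW {k = suc k} o u = send (λ s → head (o s)) (λ s → s) ∷ sendW (λ s → tail (o s)) u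

  exec-sendW : ∀ {S : Set} {k} (o : S → Vec Bool (suc k)) u P τ s → exec (sendW o u) P τ s ≡ (sent (o s) τ , u s)
  exec-sendW {k = zero}  o u P τ s with o s
  ... | β ∷ [] = refl
  exec-sendW {k = suc k} o u P τ s = trans (exec-sendW (λ s → tail (o s)) u P _ s) (cong (_, u s) (cons (o s)))
    where
    cons : ∀ (w : Vec Bool (suc (suc k))) → sent (tail w) ((verifier , head w) ∷ τ) ≡ sent w τ
    cons (β ∷ w) = refl

  length-sendW : ∀ {S : Set} {k} (o : S → Vec Bool (suc k)) u → length (sendW o u) ≡ suc k
  length-sendW {k = zero}  o u = refl
  length-sendW {k = suc k} o u = cong suc (length-sendW (λ s → tail (o s)) u)

  -- A strategy is a function of the whole transcript. A plan describes one as a tree of words,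
  -- which can follow the structure of the protocol.
  data Plan : Set where
    end  : Plan
    say  : ∀ {k} → Vec Bool k → Plan → Plan
    hear : ∀ k → (Vec Bool k → Plan) → Plan

  -- The argument lists the bits communicated so far, the oldest first.
  play : Plan → List (Party × Bool) → Bool
  play end              ext             = false
  play (say [] p)       ext             = play p ext
  play (say (β ∷ w) p)  []              = β
  play (say (β ∷ w) p)  (_ ∷ ext)       = play (say w p) ext
  play (hear zero f)    ext             = play (f []) ext
  play (hear (suc k) f) []              = false
  play (hear (suc k) f) ((_ , β) ∷ ext) = play (hear k (λ w → f (β ∷ w))) ext

  -- Transcripts list recent bits first, hence the reversed append. Quantifying over all
  -- continuations makes the relation survive every further bit, whoever sends it.
  Follows : Strategy → Transcript → Plan → Set
  Follows P τ p = ∀ ext → P (ext ʳ++ τ) ≡ play p ext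

  follows-say : ∀ {P τ k} (w : Vec Bool k) {p} → Follows P τ (say w p) → answers k P τ ≡ w × Follows P (after k P τ) p
  follows-say []      h = refl , h
  follows-say {P} {τ} (β ∷ w) h with follows-say {P} {(prover , P τ) ∷ τ} w (λ ext → h ((prover , P τ) ∷ ext))
  ... | e , h′ = cong₂ _∷_ (h []) e , h′

  follows-hear : ∀ {P τ k} (w : Vec Bool k) {f} → Follows P τ (hear k f) → Follows P (sent w τ) (f w)
  follows-hear []      h = h
  follows-hear {P} {τ} (β ∷ w) h = follows-hear {P} {(verifier , β) ∷ τ} w (λ ext → h ((verifier , β) ∷ ext))

  follow : Plan → Strategy
  follow p τ = play p (reverse τ)

  follow-follows : ∀ p → Follows (follow p) [] p
  follow-follows p ext = cong (play p) (reverse-involutive ext)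

  -- The number of messages if the prover speaks next.
  roundsₚ : Transcript → ℕ
  roundsₚ τ = rounds ((prover , true) ∷ τ)

  rounds≤roundsₚ : ∀ τ → rounds τ ≤ roundsₚ τ
  rounds≤roundsₚ []                 = z≤n
  rounds≤roundsₚ ((verifier , _) ∷ τ) = n≤1+n _
  rounds≤roundsₚ ((prover , _) ∷ τ)   = ≤-refl

  private
    rounds-prover : ∀ β τ → rounds ((prover , β) ∷ τ) ≡ roundsₚ τ
    rounds-prover β []                   = refl
    rounds-prover β ((verifier , _) ∷ τ) = refl
    rounds-prover β ((prover , _) ∷ τ)   = refl

    rounds-verifier : ∀ β τ → rounds ((verifier , β) ∷ τ) ≤ suc (roundsₚ τ)
    rounds-verifier β []                   = s≤s z≤n
    rounds-verifier β ((verifier , γ) ∷ τ) = ≤-trans (n≤1+n _) (n≤1+n _)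
    rounds-verifier β ((prover , γ) ∷ τ)   = ≤-refl

    rounds-sent : ∀ {k} (w : Vec Bool k) β τ → roundsₚ (sent w ((verifier , β) ∷ τ)) ≤ suc (suc (roundsₚ τ))
    rounds-sent []      β τ = s≤s (rounds-verifier β τ)
    rounds-sent (γ ∷ w) β τ = go w γ β τ
      where
      same : ∀ {k} (w : Vec Bool k) γ β τ → roundsₚ (sent w ((verifier , γ) ∷ (verifier , β) ∷ τ)) ≡ roundsₚ (sent w ((verifier , β) ∷ τ))
      same []      γ β τ = refl
      same (δ ∷ w) γ β τ = trans (same w δ γ ((verifier , β) ∷ τ)) (trans (same w γ β τ) (sym (same w δ β τ)))
      go : ∀ {k} (w : Vec Bool k) γ β τ → roundsₚ (sent w ((verifier , γ) ∷ (verifier , β) ∷ τ)) ≤ suc (suc (roundsₚ τ))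
      go w γ β τ = ≤-trans (≤-reflexive (same w γ β τ)) (rounds-sent w β τ)

  roundsₚ-after : ∀ k P τ → roundsₚ (after k P τ) ≡ roundsₚ τ
  roundsₚ-after zero    P τ = refl
  roundsₚ-after (suc k) P τ = trans (roundsₚ-after k P _) (rounds-prover (P τ) τ)

  -- The word opens at most one message of the verifier, and the prover's next bit another one.
  roundsₚ-sent : ∀ {k} (w : Vec Bool k) τ → roundsₚ (sent w τ) ≤ 2 + roundsₚ τ
  roundsₚ-sent []      τ = m≤n+m _ 2
  roundsₚ-sent (β ∷ w) τ = rounds-sent w β τ

-- Local conditions as a polynomial sum

module ConstraintCounting where

  open BitStrings
  open SumCheck
  open import Data.Bool.Base using (Bool; true; false)
  open import Data.Fin.Base using (Fin; zero; suc)
  open import Data.Integer.Base hiding (suc; _⊔_)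
  open import Data.Integer.Properties
  open import Data.Integer.Tactic.RingSolver using (solve-∀)
  open import Data.Nat.Base as ℕ using (ℕ; zero; suc; z≤n; s≤s)
  import Data.Nat.Properties as ℕ
  open import Data.Nat.Primality using (Prime; prime)
  open import Data.Product.Base using (∃; _,_)
  open import Data.Sum.Base using (_⊎_; inj₁; inj₂)
  open import Data.Vec.Base using (Vec; []; _∷_; _++_; replicate)
  open import Relation.Binary.PropositionalEquality
  open import Relation.Nullary.Decidable.Core using (Dec; yes; no; map′)
  import Data.Empty
  open import Relation.Nullary.Negation.Core using (¬_; contradiction)

  ΣN-member : ∀ {k} (u : Vec Bool k) f → f u ℕ.≤ ΣN k f
  ΣN-member []          f = ℕ.≤-refl
  ΣN-member (false ∷ u) f = ℕ.≤-trans (ΣN-member u (λ x → f (false ∷ x))) (ℕ.m≤m+n _ _)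
  ΣN-member (true ∷ u)  f = ℕ.≤-trans (ΣN-member u (λ x → f (true ∷ x))) (ℕ.m≤n+m _ _)

  ΣN-≤ : ∀ k {f} c → (∀ x → f x ℕ.≤ c) → ΣN k f ℕ.≤ 2 ℕ.^ k ℕ.* c
  ΣN-≤ k c h = ℕ.≤-trans (ΣN-mono k h) (ℕ.≤-reflexive (ΣN-const k c))

  module Spec (N J : ℕ) where
    open Total N J

    total-plain : ∀ a {c} (sp : Vec Φ c) (g : Vec Bool a → Vec Bool c → ℤ) →
      total (replicate a plain ++ sp) (λ z → g (pre a z) (suf a z)) ≡ ΣB a (λ u → total sp (g u))
    total-plain zero    sp g = refl
    total-plain (suc a) sp g = cong₂ _+_ (total-plain a sp λ u → g (false ∷ u)) (total-plain a sp λ u → g (true ∷ u))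

    total-ΣB : ∀ k (f : Vec Bool k → ℤ) → total (replicate k plain) f ≡ ΣB k f
    total-ΣB zero    f = refl
    total-ΣB (suc k) f = cong₂ _+_ (total-ΣB k _) (total-ΣB k _)

    degree-plain : ∀ a {c} (sp : Vec Φ c) → degree (replicate a plain ++ sp) ≡ degree sp
    degree-plain zero    sp = refl
    degree-plain (suc a) sp = degree-plain a sp

    degree-ΣB : ∀ k → degree (replicate k plain) ≡ J
    degree-ΣB zero    = refl
    degree-ΣB (suc k) = degree-ΣB k

    Z-root : ∀ N c → 1 ℕ.≤ c → c ℕ.≤ N → Z N (+ c) ≡ 0ℤ
    Z-root zero    (suc c) _   ()
    Z-root (suc N) c 1≤c c≤N with c ℕ.≟ suc N
    ... | yes refl = trans (cong (_* Z N (+ suc N)) (i≡j⇒i-j≡0 {+ suc N} refl)) (*-zeroˡ (Z N (+ suc N)))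
    ... | no c≢N   = trans (cong ((+ suc N - + c) *_) (Z-root N c 1≤c (ℕ.≤-pred (ℕ.≤∧≢⇒< c≤N c≢N)))) (*-zeroʳ (+ suc N - + c))

    -- On counts up to N, `Z N` is N! times the indicator of 0: the negation of an existential
    -- quantifier as a polynomial.
    Z-count : ∀ N c → c ℕ.≤ N → Z N (+ c) ≡ Z N 0ℤ * + ind (c ℕ.≟ 0)
    Z-count N zero    _   = sym (*-identityʳ (Z N 0ℤ))
    Z-count N (suc c) c≤N = trans (Z-root N (suc c) (s≤s z≤n) c≤N) (sym (*-zeroʳ (Z N 0ℤ)))

  module Z-nonzero (p : ℕ) (isPrime : Prime p) where
    open Modular p
    open Field isPrime

    private
      prime>1 : ∀ {p} → Prime p → 1 ℕ.< p
      prime>1 (prime _) = ℕ.nonTrivial⇒n>1 _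

    -- `Z N 0ℤ` is N!, a product of positive factors below p.
    Z0≉0 : ∀ N → N ℕ.< p → Z N 0ℤ ≉ 0ℤ
    Z0≉0 zero 0<p h with () ← small-≈ {1} {0} (prime>1 isPrime) 0<p h
    Z0≉0 (suc N) N<p h with no-zero-divisors (+ suc N - 0ℤ) (Z N 0ℤ) h
    ... | inj₂ h′ = Z0≉0 N (ℕ.<-trans (ℕ.n<1+n N) N<p) h′
    ... | inj₁ h′ with () ← small-≈ {suc N} {0} N<p (ℕ.≤-<-trans z≤n N<p) (≈-trans (≈-reflexive (sym (+-identityʳ (+ suc N)))) h′)

  module Constraints (ℓ bi′ b q : ℕ)
    (Cond : Vec Bool ℓ → Vec Bool (suc bi′) → Vec Bool (suc bi′) → Vec Bool (suc bi′) → Vec Bool (suc bi′) → Vec Bool b → Vec Bool b → Vec Bool b → Vec Bool q → Set)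
    (cond? : ∀ v j i₂ i₃ i s₁ s₂ s₃ w → Dec (Cond v j i₂ i₃ i s₁ s₂ s₃ w)) where

    bi : ℕ
    bi = suc bi′

    Index Word : Set
    Index = Vec Bool bi
    Word  = Vec Bool b

    m₂ m : ℕ
    m₂ = bi ℕ.+ (b ℕ.+ (b ℕ.+ (b ℕ.+ q)))
    m  = ℓ ℕ.+ (bi ℕ.+ (bi ℕ.+ (bi ℕ.+ m₂)))

    N : ℕ
    N = 2 ℕ.^ bi

    Function : Set
    Function = Vec Bool ℓ → Index → Index → Index → Index → Word → Word → Word → Vec Bool q → ℤ

    onY : (Index → Word → Word → Word → Vec Bool q → ℤ) → Vec Bool m₂ → ℤ
    onY F y = let y₁ = suf bi y ; y₂ = suf b y₁ ; y₃ = suf b y₂ in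
              F (pre bi y) (pre b y₁) (pre b y₂) (pre b y₃) (suf b y₃)

    onCube : Function → Vec Bool m → ℤ
    onCube F z = let z₁ = suf ℓ z ; z₂ = suf bi z₁ ; z₃ = suf bi z₂ in
                 onY (F (pre ℓ z) (pre bi z₁) (pre bi z₂) (pre bi z₃)) (suf bi z₃)

    open Total N 5 public
    open Spec N 5

    -- `total` applies `Z N` to the sum of both halves at a marked coordinate. Marking the first bit
    -- of i therefore applies it to the whole sum over i and the words, that is, to the number of
    -- witnesses for fixed v, j, i₂, i₃. This is why an index has at least one bit.
    spec : Vec Φ m
    spec = replicate ℓ plain ++ (replicate bi plain ++ (replicate bi plain ++ (replicate bi plain ++ (vanish ∷ replicate _ plain))))

    module Filled (tok : Index → Word) (dist : Vec Bool ℓ → Word → Vec Bool q) where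

      -- Message, distances and condition are separated by making the words s₁, s₂, s₃, w free
      -- variables, tied to their values by indicators. The first three factors depend only on the
      -- message, the fourth only on the graph, the fifth on neither, so each extension can be
      -- evaluated as its data pass.
      factor : Fin 5 → Function
      factor zero                         v j i₂ i₃ i s₁ s₂ s₃ w = δ (tok i) s₁
      factor (suc zero)                   v j i₂ i₃ i s₁ s₂ s₃ w = δ (tok i₂) s₂
      factor (suc (suc zero))             v j i₂ i₃ i s₁ s₂ s₃ w = δ (tok i₃) s₃
      factor (suc (suc (suc zero)))       v j i₂ i₃ i s₁ s₂ s₃ w = δ (dist v s₁) w
      factor (suc (suc (suc (suc zero)))) v j i₂ i₃ i s₁ s₂ s₃ w = + ind (cond? v j i₂ i₃ i s₁ s₂ s₃ w)

      factors : Fin 5 → Vec Bool m → ℤ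
      factors j = onCube (factor j)

      Holds : Vec Bool ℓ → Index → Index → Index → Index → Set
      Holds v j i₂ i₃ i = Cond v j i₂ i₃ i (tok i) (tok i₂) (tok i₃) (dist v (tok i))

      holds? : ∀ v j i₂ i₃ i → Dec (Holds v j i₂ i₃ i)
      holds? v j i₂ i₃ i = cond? v j i₂ i₃ i (tok i) (tok i₂) (tok i₃) (dist v (tok i))

      Satisfied : Set
      Satisfied = ∀ v j i₂ i₃ → ∃ (Holds v j i₂ i₃)

      witnesses : Vec Bool ℓ → Index → Index → Index → ℕ
      witnesses v j i₂ i₃ = ΣN bi (λ i → ind (holds? v j i₂ i₃ i))

      unsatisfied : ℕ
      unsatisfied = ΣN ℓ λ v → ΣN bi λ j → ΣN bi λ i₂ → ΣN bi λ i₃ → ind (witnesses v j i₂ i₃ ℕ.≟ 0)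

      private
        product : Function
        product v j i₂ i₃ i s₁ s₂ s₃ w = prodF 5 (λ k → factor k v j i₂ i₃ i s₁ s₂ s₃ w)

        holds : Function
        holds v j i₂ i₃ i s₁ s₂ s₃ w = + ind (cond? v j i₂ i₃ i s₁ s₂ s₃ w)

        inner : ∀ v j i₂ i₃ → ΣB m₂ (onY (product v j i₂ i₃)) ≡ + witnesses v j i₂ i₃
        inner v j i₂ i₃ = trans
          (ΣB-split bi (λ i y₁ → product v j i₂ i₃ i (pre b y₁) (pre b (suf b y₁)) (pre b (suf b (suf b y₁))) (suf b (suf b (suf b y₁)))))
          (trans (ΣB-cong bi eachIndex) (ΣB-ΣN bi (λ i → ind (holds? v j i₂ i₃ i))))
          where
          eachIndex : ∀ i → ΣB (b ℕ.+ (b ℕ.+ (b ℕ.+ q))) (λ y₁ → product v j i₂ i₃ i (pre b y₁) (pre b (suf b y₁)) (pre b (suf b (suf b y₁))) (suf b (suf b (suf b y₁))))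
                            ≡ + ind (holds? v j i₂ i₃ i)
          -- The words are summed out from the inside, in the order w, s₃, s₂, s₁, each by the δ
          -- that pins it.
          eachIndex i =
            trans (ΣB-split b (λ s₁ y₂ → product v j i₂ i₃ i s₁ (pre b y₂) (pre b (suf b y₂)) (suf b (suf b y₂))))
            (trans (ΣB-cong b λ s₁ →
              trans (ΣB-split b (λ s₂ y₃ → product v j i₂ i₃ i s₁ s₂ (pre b y₃) (suf b y₃)))
              (trans (ΣB-cong b λ s₂ →
                trans (ΣB-split b (product v j i₂ i₃ i s₁ s₂))
                (trans (ΣB-cong b λ s₃ →
                  trans (ΣB-cong q λ w → rearrange (δ (tok i) s₁) (δ (tok i₂) s₂) (δ (tok i₃) s₃) (δ (dist v s₁) w) (holds v j i₂ i₃ i s₁ s₂ s₃ w))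
                  (ΣB-δ (dist v s₁) (λ w → δ (tok i₃) s₃ * (δ (tok i) s₁ * (δ (tok i₂) s₂ * holds v j i₂ i₃ i s₁ s₂ s₃ w)))))
                (ΣB-δ (tok i₃) (λ s₃ → δ (tok i) s₁ * (δ (tok i₂) s₂ * holds v j i₂ i₃ i s₁ s₂ s₃ (dist v s₁))))))
              (trans (ΣB-cong b λ s₂ → swap (δ (tok i) s₁) (δ (tok i₂) s₂) (holds v j i₂ i₃ i s₁ s₂ (tok i₃) (dist v s₁)))
                (ΣB-δ (tok i₂) (λ s₂ → δ (tok i) s₁ * holds v j i₂ i₃ i s₁ s₂ (tok i₃) (dist v s₁))))))
            (ΣB-δ (tok i) (λ s₁ → holds v j i₂ i₃ i s₁ (tok i₂) (tok i₃) (dist v s₁))))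
            where
            rearrange : ∀ x y z u c → x * (y * (z * (u * (c * 1ℤ)))) ≡ u * (z * (x * (y * c)))
            rearrange = solve-∀
            swap : ∀ x y c → x * (y * c) ≡ y * (x * c)
            swap = solve-∀

        witnesses≤N : ∀ v j i₂ i₃ → witnesses v j i₂ i₃ ℕ.≤ N
        witnesses≤N v j i₂ i₃ = ℕ.≤-trans (ΣN-≤ bi 1 λ i → ind≤1 (holds? v j i₂ i₃ i)) (ℕ.≤-reflexive (ℕ.*-identityʳ N))

      tot-unsatisfied : tot spec factors ≡ Z N 0ℤ * + unsatisfied
      tot-unsatisfied =
        trans (total-plain ℓ sp₁ (λ v z₁ → onY (product v (pre bi z₁) (pre bi (suf bi z₁)) (pre bi (suf bi (suf bi z₁)))) (suf bi (suf bi (suf bi z₁)))))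
        (trans (ΣB-cong ℓ λ v →
          trans (total-plain bi sp₂ (λ j z₂ → onY (product v j (pre bi z₂) (pre bi (suf bi z₂))) (suf bi (suf bi z₂))))
          (trans (ΣB-cong bi λ j →
            trans (total-plain bi sp₃ (λ i₂ z₃ → onY (product v j i₂ (pre bi z₃)) (suf bi z₃)))
            (trans (ΣB-cong bi λ i₂ →
              trans (total-plain bi sp₄ (λ i₃ → onY (product v j i₂ i₃)))
              (trans (ΣB-cong bi λ i₃ → trans
                  (cong (Z N) (trans (cong₂ _+_ (total-ΣB m₂′ (λ y → onY (product v j i₂ i₃) (false ∷ y))) (total-ΣB m₂′ (λ y → onY (product v j i₂ i₃) (true ∷ y)))) (inner v j i₂ i₃)))
                  (Z-count N (witnesses v j i₂ i₃) (witnesses≤N v j i₂ i₃)))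
                (collect bi (λ i₃ → ind (witnesses v j i₂ i₃ ℕ.≟ 0)))))
              (collect bi (λ i₂ → ΣN bi λ i₃ → ind (witnesses v j i₂ i₃ ℕ.≟ 0)))))
            (collect bi (λ j → ΣN bi λ i₂ → ΣN bi λ i₃ → ind (witnesses v j i₂ i₃ ℕ.≟ 0)))))
          (collect ℓ (λ v → ΣN bi λ j → ΣN bi λ i₂ → ΣN bi λ i₃ → ind (witnesses v j i₂ i₃ ℕ.≟ 0))))
        where
        m₂′ : ℕ
        m₂′ = bi′ ℕ.+ (b ℕ.+ (b ℕ.+ (b ℕ.+ q)))
        sp₄ : Vec Φ m₂
        sp₄ = vanish ∷ replicate m₂′ plain
        sp₃ : Vec Φ (bi ℕ.+ m₂)
        sp₃ = replicate bi plain ++ sp₄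
        sp₂ : Vec Φ (bi ℕ.+ (bi ℕ.+ m₂))
        sp₂ = replicate bi plain ++ sp₃
        sp₁ : Vec Φ (bi ℕ.+ (bi ℕ.+ (bi ℕ.+ m₂)))
        sp₁ = replicate bi plain ++ sp₂
        collect : ∀ k (f : Vec Bool k → ℕ) → ΣB k (λ x → Z N 0ℤ * + f x) ≡ Z N 0ℤ * + ΣN k f
        collect k f = trans (ΣB-*ˡ k (Z N 0ℤ) _) (cong (Z N 0ℤ *_) (ΣB-ΣN k f))

      satisfied⇒zero : Satisfied → unsatisfied ≡ 0
      satisfied⇒zero sat = trans (ΣN-cong ℓ λ v → trans (ΣN-cong bi λ j → trans (ΣN-cong bi λ i₂ → trans (ΣN-cong bi λ i₃ →
        ind-no (witnesses v j i₂ i₃ ℕ.≟ 0) (someWitness v j i₂ i₃)) (ΣN-zero bi)) (ΣN-zero bi)) (ΣN-zero bi)) (ΣN-zero ℓ)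
        where
        someWitness : ∀ v j i₂ i₃ → ¬ witnesses v j i₂ i₃ ≡ 0
        someWitness v j i₂ i₃ e with sat v j i₂ i₃
        ... | i , h with () ← ℕ.≤-trans (ℕ.≤-reflexive (sym (ind-yes (holds? v j i₂ i₃ i) h))) (ℕ.≤-trans (ΣN-member i (λ i → ind (holds? v j i₂ i₃ i))) (ℕ.≤-reflexive e))

      satisfied⇒tot≡0 : Satisfied → tot spec factors ≡ 0ℤ
      satisfied⇒tot≡0 sat = trans tot-unsatisfied (trans (cong (λ c → Z N 0ℤ * + c) (satisfied⇒zero sat)) (*-zeroʳ (Z N 0ℤ)))

      zero⇒satisfied : unsatisfied ≡ 0 → Satisfied
      zero⇒satisfied e v j i₂ i₃ with searchB bi (holds? v j i₂ i₃)
      ... | yes h = h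
      ... | no ¬h = contradiction (ℕ.≤-trans (ℕ.≤-reflexive (sym (ind-yes (witnesses v j i₂ i₃ ℕ.≟ 0) none))) (ℕ.≤-trans member (ℕ.≤-reflexive e))) λ ()
        where
        none : witnesses v j i₂ i₃ ≡ 0
        none = trans (ΣN-cong bi λ i → ind-no (holds? v j i₂ i₃ i) (λ h → ¬h (i , h))) (ΣN-zero bi)
        member : ind (witnesses v j i₂ i₃ ℕ.≟ 0) ℕ.≤ unsatisfied
        member = ℕ.≤-trans (ΣN-member i₃ (λ i₃ → ind (witnesses v j i₂ i₃ ℕ.≟ 0)))
          (ℕ.≤-trans (ΣN-member i₂ (λ i₂ → ΣN bi λ i₃ → ind (witnesses v j i₂ i₃ ℕ.≟ 0)))
          (ℕ.≤-trans (ΣN-member j (λ j → ΣN bi λ i₂ → ΣN bi λ i₃ → ind (witnesses v j i₂ i₃ ℕ.≟ 0)))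
                     (ΣN-member v (λ v → ΣN bi λ j → ΣN bi λ i₂ → ΣN bi λ i₃ → ind (witnesses v j i₂ i₃ ℕ.≟ 0)))))

      satisfied? : Dec Satisfied
      satisfied? = map′ zero⇒satisfied satisfied⇒zero (unsatisfied ℕ.≟ 0)

      -- The total is N! times the number of violated conditions. That number is positive and at
      -- most 2 ^ (ℓ + 3 bi), so neither factor is 0 modulo p.
      unsatisfied⇒tot≉0 : ∀ {p} (isPrime : Prime p) → N ℕ.< p → 2 ℕ.^ (ℓ ℕ.+ (bi ℕ.+ (bi ℕ.+ bi))) ℕ.< p → ¬ Satisfied → ¬ Modular._≈_ p 0ℤ (tot spec factors)
      unsatisfied⇒tot≉0 {p} isPrime N<p M<p ¬sat h = excluded (no-zero-divisors (Z N 0ℤ) (+ unsatisfied) (≈-trans (≈-reflexive (sym tot-unsatisfied)) (≈-sym h)))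
        where
        open Modular p
        open Field isPrime
        atMost : unsatisfied ℕ.≤ 2 ℕ.^ (ℓ ℕ.+ (bi ℕ.+ (bi ℕ.+ bi)))
        atMost = ℕ.≤-trans (ΣN-≤ ℓ _ λ v → ΣN-≤ bi _ λ j → ΣN-≤ bi _ λ i₂ → ΣN-≤ bi 1 λ i₃ → ind≤1 (witnesses v j i₂ i₃ ℕ.≟ 0)) (ℕ.≤-reflexive
          (trans (cong (λ x → 2 ℕ.^ ℓ ℕ.* (N ℕ.* (N ℕ.* x))) (ℕ.*-identityʳ N))
          (sym (trans (ℕ.^-distribˡ-+-* 2 ℓ _) (cong (2 ℕ.^ ℓ ℕ.*_) (trans (ℕ.^-distribˡ-+-* 2 bi _) (cong (N ℕ.*_) (ℕ.^-distribˡ-+-* 2 bi bi))))))))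
        excluded : Z N 0ℤ ≈ 0ℤ ⊎ + unsatisfied ≈ 0ℤ → Data.Empty.⊥
        excluded (inj₁ h′) = Z-nonzero.Z0≉0 p isPrime N N<p h′
        excluded (inj₂ h′) = ¬sat (zero⇒satisfied (small-≈ (ℕ.≤-<-trans atMost M<p) (ℕ.≤-<-trans z≤n N<p) h′))

-- Distances as sums over the edge stream

module EdgeStreams where

  open BitStrings
  open SumCheck
  open import Defs
  open import Data.Bool.Base using (Bool)
  open import Data.Fin.Base using (Fin; zero; suc)
  import Data.Fin.Base as Fin
  import Data.Fin.Properties as Fin
  open import Data.Integer.Base hiding (suc; _⊔_)
  open import Data.Integer.Properties
  open import Data.Integer.Tactic.RingSolver using (solve-∀)
  open import Data.List.Base as List using (List; []; _∷_; map; filter; cartesianProduct; allFin; tabulate; _++_)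
  open import Data.List.Relation.Binary.Permutation.Propositional using (_↭_; refl; prep; swap; trans; ↭-sym)
  open import Data.List.Relation.Binary.Permutation.Propositional.Properties using (∈-resp-↭)
  open import Data.List.Membership.Propositional using (_∈_)
  open import Data.List.Membership.Propositional.Properties using (∈-map⁺; ∈-map⁻; ∈-filter⁺; ∈-filter⁻; ∈-cartesianProduct⁺; ∈-allFin)
  open import Data.List.Relation.Unary.Any using (here; there)
  open import Data.Nat.Base as ℕ using (ℕ; zero; suc)
  import Data.Nat.Properties as ℕ
  open import Data.Product.Base using (_×_; _,_; proj₁; proj₂)
  open import Data.Vec.Base using (Vec; []; _∷_)
  open import Relation.Binary.Definitions using (Tri; tri<; tri≈; tri>)
  open import Relation.Binary.PropositionalEquality as ≡ using (_≡_; _≢_; refl; cong; cong₂; sym)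
  open import Relation.Nullary.Decidable.Core using (Dec; yes; no; _×-dec_; _⊎-dec_)
  open import Data.Sum.Base using (_⊎_; inj₁; inj₂)
  open import Relation.Nullary.Negation.Core using (contradiction)

  sumL : ∀ {A : Set} → (A → ℤ) → List A → ℤ
  sumL f []       = 0ℤ
  sumL f (x ∷ xs) = f x + sumL f xs

  sumL-++ : ∀ {A : Set} (f : A → ℤ) xs ys → sumL f (xs ++ ys) ≡ sumL f xs + sumL f ys
  sumL-++ f []       ys = sym (+-identityˡ _)
  sumL-++ f (x ∷ xs) ys = ≡.trans (cong (_+_ (f x)) (sumL-++ f xs ys)) (sym (+-assoc (f x) _ _))

  sumL-cong : ∀ {A : Set} {f g : A → ℤ} → (∀ x → f x ≡ g x) → ∀ xs → sumL f xs ≡ sumL g xs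
  sumL-cong h []       = refl
  sumL-cong h (x ∷ xs) = cong₂ _+_ (h x) (sumL-cong h xs)

  sumL-map : ∀ {A B : Set} (f : B → ℤ) (g : A → B) xs → sumL f (map g xs) ≡ sumL (λ x → f (g x)) xs
  sumL-map f g []       = refl
  sumL-map f g (x ∷ xs) = cong (_+_ (f (g x))) (sumL-map f g xs)

  sumL-↭ : ∀ {A : Set} (f : A → ℤ) {xs ys} → xs ↭ ys → sumL f xs ≡ sumL f ys
  sumL-↭ f refl         = refl
  sumL-↭ f (prep x p)   = cong (_+_ (f x)) (sumL-↭ f p)
  sumL-↭ f (swap {xs} {ys} x y p) = ≡.trans (cong (λ s → f x + (f y + s)) (sumL-↭ f p)) (ring (f x) (f y) (sumL f ys))
    where
    ring : ∀ a b c → a + (b + c) ≡ b + (a + c)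
    ring = solve-∀
  sumL-↭ f (trans p q)  = ≡.trans (sumL-↭ f p) (sumL-↭ f q)

  sumL-filter : ∀ {A : Set} {P : A → Set} (P? : ∀ x → Dec (P x)) (f : A → ℤ) xs → sumL f (filter P? xs) ≡ sumL (λ x → + ind (P? x) * f x) xs
  sumL-filter P? f []       = refl
  sumL-filter P? f (x ∷ xs) with P? x
  ... | yes _ = cong₂ _+_ (sym (*-identityˡ (f x))) (sumL-filter P? f xs)
  ... | no _  = ≡.trans (sumL-filter P? f xs) (sym (+-identityˡ _))

  sumL-product : ∀ {A B : Set} (f : A × B → ℤ) xs ys → sumL f (cartesianProduct xs ys) ≡ sumL (λ x → sumL (λ y → f (x , y)) ys) xs
  sumL-product f []       ys = refl
  sumL-product f (x ∷ xs) ys = ≡.trans (sumL-++ f (map (x ,_) ys) _) (cong₂ _+_ (sumL-map f (x ,_) ys) (sumL-product f xs ys))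

  sumL-0 : ∀ {A : Set} (xs : List A) → sumL (λ _ → 0ℤ) xs ≡ 0ℤ
  sumL-0 []       = refl
  sumL-0 (x ∷ xs) = ≡.trans (+-identityˡ _) (sumL-0 xs)

  δF : ∀ {n} → Fin n → Fin n → ℤ
  δF u v = + ind (u Fin.≟ v)

  δF-refl : ∀ {n} (u : Fin n) → δF u u ≡ 1ℤ
  δF-refl u = cong +_ (ind-yes (u Fin.≟ u) refl)

  δF-≢ : ∀ {n} {u v : Fin n} → u ≢ v → δF u v ≡ 0ℤ
  δF-≢ {u = u} {v} h = cong +_ (ind-no (u Fin.≟ v) h)

  sumL-δF : ∀ {n} (u : Fin n) (f : Fin n → ℤ) → sumL (λ i → δF u i * f i) (allFin n) ≡ f u
  sumL-δF {n} u f = ≡.trans (tabulated (λ i → i)) (go u f)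
    where
    sumT : ∀ n → (Fin n → ℤ) → ℤ
    sumT zero    g = 0ℤ
    sumT (suc n) g = g zero + sumT n (λ i → g (suc i))
    tabulated : ∀ {k} (g : Fin k → Fin n) → sumL (λ i → δF u i * f i) (tabulate g) ≡ sumT k (λ i → δF u (g i) * f (g i))
    tabulated {zero}  g = refl
    tabulated {suc k} g = cong (_+_ (δF u (g zero) * f (g zero))) (tabulated (λ i → g (suc i)))
    sumT-cong : ∀ n {g h : Fin n → ℤ} → (∀ i → g i ≡ h i) → sumT n g ≡ sumT n h
    sumT-cong zero    e = refl
    sumT-cong (suc n) e = cong₂ _+_ (e zero) (sumT-cong n λ i → e (suc i))
    sumT-0 : ∀ n → sumT n (λ _ → 0ℤ) ≡ 0ℤ
    sumT-0 zero    = refl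
    sumT-0 (suc n) = ≡.trans (+-identityˡ _) (sumT-0 n)
    δF-suc : ∀ {n} (u i : Fin n) → δF (suc u) (suc i) ≡ δF u i
    δF-suc u i with u Fin.≟ i
    ... | yes _ = refl
    ... | no _  = refl
    go : ∀ {n} (u : Fin n) (f : Fin n → ℤ) → sumT n (λ i → δF u i * f i) ≡ f u
    go {suc n} zero    f = ≡.trans (cong₂ _+_ (*-identityˡ (f zero)) (≡.trans (sumT-cong n λ i → *-zeroˡ (f (suc i))) (sumT-0 n))) (+-identityʳ _)
    go {suc n} (suc u) f = ≡.trans (cong₂ _+_ (*-zeroˡ (f zero)) (≡.trans (sumT-cong n λ i → cong (_* f (suc i)) (δF-suc u i)) (go u λ i → f (suc i)))) (+-identityˡ _)

  mle-sumL : ∀ {A : Set} {m} (f : A → Vec Bool m → ℤ) xs ts → mle (λ z → sumL (λ x → f x z) xs) ts ≡ sumL (λ x → mle (f x) ts) xs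
  mle-sumL f []       ts = mle-0 ts
    where
    mle-0 : ∀ {m} (ts : Vec ℤ m) → mle (λ _ → 0ℤ) ts ≡ 0ℤ
    mle-0 []       = refl
    mle-0 (t ∷ ts) = ≡.trans (mle-cong (λ _ → ≡.trans (+-identityˡ _) (*-zeroʳ t)) ts) (mle-0 ts)
  mle-sumL f (x ∷ xs) ts = ≡.trans (mle-+ (f x) _ ts) (cong (_+_ (mle (f x) ts)) (mle-sumL f xs ts))

  Joins : ∀ {n} → WeightedEdge n → Fin n → Fin n → Set
  Joins (i , j , _) u v = (i ≡ u × j ≡ v) ⊎ (i ≡ v × j ≡ u)

  joins? : ∀ {n} (e : WeightedEdge n) u v → Dec (Joins e u v)
  joins? (i , j , _) u v = ((i Fin.≟ u) ×-dec (j Fin.≟ v)) ⊎-dec ((i Fin.≟ v) ×-dec (j Fin.≟ u))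

  -- The honest prover is given the list of edges instead of the graph, so it has to read the
  -- distances off the list.
  distIn : ∀ {n} → List (WeightedEdge n) → Fin n → Fin n → ℕ
  distIn []      u v = 0
  distIn (e ∷ σ) u v with joins? e u v
  ... | yes _ = proj₂ (proj₂ e)
  ... | no _  = distIn σ u v

  -- How an edge of the stream contributes to the indicator of
  -- "the distance of x and y is ω".
  edgeTerm : ∀ {n q} → WeightedEdge n → Fin n → Fin n → Vec Bool q → ℤ
  edgeTerm {q = q} (i , j , ω) x y w = (δF x i * δF y j + δF x j * δF y i) * δ (bits q ω) w

  module _ {n : ℕ} (G : MetricGraph n) where
    open MetricGraph G

    -- The diagonal of `weight` is arbitrary; with 0 there, the triangle inequality holds for all
    -- triples and not only for distinct vertices.
    dist : Fin n → Fin n → ℕ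
    dist u v with u Fin.≟ v
    ... | yes _ = 0
    ... | no _  = weight u v

    dist-≢ : ∀ {u v} → u ≢ v → dist u v ≡ weight u v
    dist-≢ {u} {v} u≢v with u Fin.≟ v
    ... | yes e = contradiction e u≢v
    ... | no _  = refl

    dist-refl : ∀ u → dist u u ≡ 0
    dist-refl u with u Fin.≟ u
    ... | yes _ = refl
    ... | no h  = contradiction refl h

    dist-sym : ∀ u v → dist u v ≡ dist v u
    dist-sym u v with u Fin.≟ v | v Fin.≟ u
    ... | yes _ | yes _ = refl
    ... | no _  | no _  = symmetric u v
    ... | yes e | no h  = contradiction (sym e) h
    ... | no h  | yes e = contradiction (sym e) h

    dist-triangle : ∀ u v w → dist u w ℕ.≤ dist u v ℕ.+ dist v w
    dist-triangle u v w with u Fin.≟ w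
    ... | yes _ = ℕ.z≤n
    ... | no u≢w with u Fin.≟ v | v Fin.≟ w
    ... | yes refl | yes refl = contradiction refl u≢w
    ... | yes refl | no _     = ℕ.≤-refl
    ... | no _     | yes refl = ℕ.≤-reflexive (sym (ℕ.+-identityʳ _))
    ... | no u≢v   | no v≢w   = triangle u v w u≢v v≢w u≢w

    dist-≤ : ∀ {B} → WeightsAtMost G B → ∀ u v → dist u v ℕ.≤ B
    dist-≤ h u v with u Fin.≟ v
    ... | yes _  = ℕ.z≤n
    ... | no u≢v = h u v u≢v

    edge-∈ : ∀ {u v} → u Fin.< v → (u , v , weight u v) ∈ edges G
    edge-∈ {u} {v} u<v = ∈-map⁺ (λ (i , j) → i , j , weight i j)
      (∈-filter⁺ (λ (i , j) → i Fin.<? j) (∈-cartesianProduct⁺ (∈-allFin u) (∈-allFin v)) u<v)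

    edge-weight : ∀ {i j ω} → (i , j , ω) ∈ edges G → ω ≡ weight i j × i ≢ j
    edge-weight e with ∈-map⁻ (λ (i , j) → i , j , weight i j) e
    ... | (i , j) , e′ , refl = refl , λ { refl → ℕ.<-irrefl refl (proj₂ (∈-filter⁻ (λ (i , j) → i Fin.<? j) {xs = cartesianProduct (allFin n) (allFin n)} e′)) }

    -- The stream holds each pair once, with i < j, so `edgeTerm` serves both orders; the case x = y
    -- is absent from it and enters as a separate term. A sum does not see the order of arrival.
    stream-indicator : ∀ {q} σ → σ ↭ edges G → ∀ x y (w : Vec Bool q) →
      δF x y * δ (bits q 0) w + sumL (λ e → edgeTerm e x y w) σ ≡ δ (bits q (dist x y)) w
    stream-indicator {q} σ perm x y w = ≡.trans (cong (_+_ (δF x y * δ (bits q 0) w))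
      (≡.trans (sumL-↭ (λ e → edgeTerm e x y w) perm)
      (≡.trans (sumL-map (λ e → edgeTerm e x y w) _ (filter _ (cartesianProduct (allFin n) (allFin n))))
      (≡.trans (sumL-filter (λ (i , j) → i Fin.<? j) (λ (i , j) → term i j) (cartesianProduct (allFin n) (allFin n)))
      (≡.trans (sumL-product _ (allFin n) (allFin n))
      (≡.trans (sumL-cong (λ i → ≡.trans (sumL-cong (λ j → split (lt i j) (δF x i) (δF y j) (δF x j) (δF y i) (g i j)) (allFin n))
          (sumL-plus (λ j → δF y j * (δF x i * (lt i j * g i j))) (λ j → δF x j * (δF y i * (lt i j * g i j))) (allFin n))) (allFin n))
      (≡.trans (sumL-cong (λ i → cong₂ _+_ (sumL-δF y (λ j → δF x i * (lt i j * g i j))) (sumL-δF x (λ j → δF y i * (lt i j * g i j)))) (allFin n))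
      (≡.trans (sumL-plus (λ i → δF x i * (lt i y * g i y)) (λ i → δF y i * (lt i x * g i x)) (allFin n))
         (cong₂ _+_ (sumL-δF x (λ i → lt i y * g i y)) (sumL-δF y (λ i → lt i x * g i x)))))))))))
      (cases (Fin.<-cmp x y))
      where
      g : Fin n → Fin n → ℤ
      g i j = δ (bits q (weight i j)) w
      term : Fin n → Fin n → ℤ
      term i j = edgeTerm (i , j , weight i j) x y w
      lt : Fin n → Fin n → ℤ
      lt i j = + ind (i Fin.<? j)
      split : ∀ l a b c d e → l * ((a * b + c * d) * e) ≡ b * (a * (l * e)) + c * (d * (l * e))
      split = solve-∀
      interchange : ∀ a b c d → (a + b) + (c + d) ≡ (a + c) + (b + d)
      interchange = solve-∀
      sumL-plus : ∀ {A : Set} (f h : A → ℤ) xs → sumL (λ z → f z + h z) xs ≡ sumL f xs + sumL h xs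
      sumL-plus f h []       = refl
      sumL-plus f h (z ∷ zs) = ≡.trans (cong (_+_ (f z + h z)) (sumL-plus f h zs)) (interchange (f z) (h z) _ _)
      combine : ∀ {a b c a′ b′ c′ r} → a ≡ a′ → b ≡ b′ → c ≡ c′ → a′ * δ (bits q 0) w + (b′ * g x y + c′ * g y x) ≡ r →
                a * δ (bits q 0) w + (b * g x y + c * g y x) ≡ r
      combine refl refl refl e = e
      cases : Tri (x Fin.< y) (x ≡ y) (y Fin.< x) →
              δF x y * δ (bits q 0) w + (lt x y * g x y + lt y x * g y x) ≡ δ (bits q (dist x y)) w
      cases (tri< x<y x≢y y≮x) = combine (δF-≢ x≢y) (cong +_ (ind-yes (x Fin.<? y) x<y)) (cong +_ (ind-no (y Fin.<? x) y≮x))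
        (≡.trans (ring (δ (bits q 0) w) (g x y) (g y x)) (cong (λ k → δ (bits q k) w) (sym (dist-≢ x≢y))))
        where
        ring : ∀ a b c → 0ℤ * a + (1ℤ * b + 0ℤ * c) ≡ b
        ring = solve-∀
      cases (tri≈ x≮y refl y≮x) = combine (δF-refl x) (cong +_ (ind-no (x Fin.<? x) x≮y)) (cong +_ (ind-no (x Fin.<? x) x≮y))
        (≡.trans (ring (δ (bits q 0) w) (g x x) (g x x)) (cong (λ k → δ (bits q k) w) (sym (dist-refl x))))
        where
        ring : ∀ a b c → 1ℤ * a + (0ℤ * b + 0ℤ * c) ≡ a
        ring = solve-∀
      cases (tri> x≮y x≢y y<x) = combine (δF-≢ x≢y) (cong +_ (ind-no (x Fin.<? y) x≮y)) (cong +_ (ind-yes (y Fin.<? x) y<x))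
        (≡.trans (ring (δ (bits q 0) w) (g x y) (g y x)) (cong (λ k → δ (bits q k) w) (≡.trans (symmetric y x) (sym (dist-≢ x≢y)))))
        where
        ring : ∀ a b c → 0ℤ * a + (0ℤ * b + 1ℤ * c) ≡ c
        ring = solve-∀

    distIn-dist : ∀ {σ} → σ ↭ edges G → ∀ u v → distIn σ u v ≡ dist u v
    distIn-dist {σ} perm u v = go (Fin.<-cmp u v)
      where
      Valid : List (WeightedEdge n) → Set
      Valid σ = ∀ {i j ω} → (i , j , ω) ∈ σ → ω ≡ weight i j × i ≢ j
      valid : Valid σ
      valid e = edge-weight (∈-resp-↭ perm e)
      absent : u ≡ v → ∀ σ → Valid σ → distIn σ u v ≡ 0
      absent u≡v []      ok = refl
      absent u≡v (e ∷ σ) ok with joins? e u v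
      ... | yes (inj₁ (refl , refl)) = contradiction u≡v (proj₂ (ok (here refl)))
      ... | yes (inj₂ (refl , refl)) = contradiction (sym u≡v) (proj₂ (ok (here refl)))
      ... | no _ = absent u≡v σ (λ e → ok (there e))
      found : ∀ σ → Valid σ → ∀ {e} → e ∈ σ → Joins e u v → distIn σ u v ≡ weight u v
      found (e ∷ σ) ok e′∈ join with joins? e u v
      ... | yes (inj₁ (refl , refl)) = proj₁ (ok (here refl))
      ... | yes (inj₂ (refl , refl)) = ≡.trans (proj₁ (ok (here refl))) (symmetric v u)
      found (e ∷ σ) ok (here refl) join | no ¬join = contradiction join ¬join
      found (e ∷ σ) ok (there e′∈) join | no _     = found σ (λ e → ok (there e)) e′∈ join
      go : Tri (u Fin.< v) (u ≡ v) (v Fin.< u) → distIn σ u v ≡ dist u v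
      go (tri< u<v u≢v _) = ≡.trans (found σ valid (∈-resp-↭ (↭-sym perm) (edge-∈ u<v)) (inj₁ (refl , refl))) (sym (dist-≢ u≢v))
      go (tri≈ _ refl _)  = ≡.trans (absent refl σ valid) (sym (dist-refl u))
      go (tri> _ u≢v v<u) = ≡.trans (found σ valid (∈-resp-↭ (↭-sym perm) (edge-∈ v<u)) (inj₂ (refl , refl))) (sym (dist-≢ u≢v))

-- The verifier, its soundness and its completeness

module Verification where

  open BitStrings
  open SumCheck
  open ConstraintCounting
  open import Defs hiding (run)
  open Programs
  open Messages
  open EdgeStreams
  open import Data.Bool.Base using (Bool; true; false; _∧_; T; if_then_else_)
  import Data.Bool.Properties as Bool
  import Data.Empty
  open import Data.Fin.Base using (Fin; zero; suc)
  open import Data.Integer.Base hiding (suc; _⊔_; _≤_; _<_)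
  open import Data.Integer.DivMod using (_%ℕ_; _/ℕ_; n%ℕd<d; a≡a%ℕn+[a/ℕn]*n)
  open import Data.Integer.Divisibility.Signed using (divides)
  open import Data.Integer.Properties using (+-identityˡ; +-identityʳ; *-zeroʳ; +-assoc; *-assoc)
  open import Data.Integer.Tactic.RingSolver using (solve-∀)
  open import Data.List.Base as List using (List; []; _∷_; _++_; length; foldl)
  open import Data.List.Properties using (length-++)
  open import Data.List.Relation.Binary.Permutation.Propositional using (_↭_)
  open import Data.Maybe.Base using (Maybe; just; nothing)
  open import Data.Nat.Base as ℕ using (ℕ; zero; suc; _≤_; _<_; z≤n; s≤s)
  import Data.Nat.Properties as ℕ
  open import Data.Nat.Primality using (Prime; prime⇒nonZero)
  open import Data.Product.Base using (∃; ∃-syntax; _×_; _,_; proj₁; proj₂)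
  open import Data.Rational.Base using (ℚ)
  open import Data.Sum.Base using (_⊎_; inj₁; inj₂)
  open import Data.Unit.Base using (tt)
  open import Data.Vec.Base as Vec using (Vec; []; _∷_; head; tail; replicate)
  open import Data.Vec.Properties using (≡-dec)
  open import Relation.Binary.PropositionalEquality
  open import Relation.Nullary.Decidable.Core using (Dec; yes; no; ⌊_⌋; toWitness; fromWitness; _×-dec_)
  import Data.Nat.Tactic.RingSolver as ℕSolver
  open import Relation.Nullary.Negation.Core using (¬_; contradiction)

  -- 2 ^ a ≤ p keeps the sample points distinct modulo p, and p ≤ 2 ^ b lets a word hold a residue.
  module Protocol (n ℓ bi′ b′ q a′ p : ℕ) (isPrime : Prime p)
    (2^a≤p : 2 ℕ.^ suc a′ ≤ p) (p≤2^b : p ≤ 2 ℕ.^ suc b′)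
    (vdec : Vec Bool ℓ → Fin n) (vert : Vec Bool (suc b′) → Fin n)
    (Cond : Vec Bool ℓ → Vec Bool (suc bi′) → Vec Bool (suc bi′) → Vec Bool (suc bi′) → Vec Bool (suc bi′) → Vec Bool (suc b′) → Vec Bool (suc b′) → Vec Bool (suc b′) → Vec Bool q → Set)
    (cond? : ∀ v j i₂ i₃ i s₁ s₂ s₃ w → Dec (Cond v j i₂ i₃ i s₁ s₂ s₃ w))
    (out : Vec Bool (suc b′) → Maybe ℚ) where

    a b : ℕ
    a = suc a′
    b = suc b′

    open Constraints ℓ bi′ b q Cond cond? public
    open Modular p public
    open Field isPrime public
    open Sumcheck N 5 public

    D : ℕ
    D = N ℕ.* 5

    private instance
      p≢0 : ℕ.NonZero p
      p≢0 = prime⇒nonZero isPrime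

    un : Word → ℤ
    un = valℤ

    opaque
      red : ℤ → Word
      red x = bits b (x %ℕ p)

      un-red : ∀ x → un (red x) ≈ x
      un-red x = congruent (divides (- (x /ℕ p)) (trans (cong₂ _-_ (cong +_ (val-bits b (x %ℕ p) (ℕ.<-≤-trans (n%ℕd<d x p) p≤2^b))) (a≡a%ℕn+[a/ℕn]*n x p)) (ring (+ (x %ℕ p)) (x /ℕ p) (+ p))))
        where
        ring : ∀ r k p → r - (r + k * p) ≡ - k * p
        ring = solve-∀

    Points : Set
    Points = Vec (Vec Bool a) m

    -- `Fixed` holds the secret points and the values there of the factors for distances and
    -- condition; `Accum` the values of the three token factors, and the header; `Claim` the current
    -- claim and whether all checks have passed; `Work` the partial value of the arriving polynomial
    -- at the sample point, the next power of that point, and the partial sum of the values at 0 and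
    -- 1. A state begins with the receive buffer.
    Fixed Accum Claim Work Reg State : Set
    Fixed = Points × (Word × Word)
    Accum = Word × (Word × (Word × Word))
    Claim = Word × Bool
    Work  = Word × (Word × Word)
    Reg   = Fixed × (Accum × (Claim × Work))
    State = Word × Reg

    stateBits : ℕ
    stateBits = b ℕ.+ ((m ℕ.* a ℕ.+ (b ℕ.+ b)) ℕ.+ ((b ℕ.+ (b ℕ.+ (b ℕ.+ b))) ℕ.+ ((b ℕ.+ 1) ℕ.+ (b ℕ.+ (b ℕ.+ b)))))

    encState : Enc State stateBits
    encState = encPair encBits (encPair (encPair (encVec encBits m) (encPair encBits encBits))
      (encPair (encPair encBits (encPair encBits (encPair encBits encBits))) (encPair (encPair encBits encBool) (encPair encBits (encPair encBits encBits)))))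

    points : Points → Vec ℤ m
    points = Vec.map valℤ

    tokenTerm₀ tokenTerm₁ tokenTerm₂ : Index → Word → Function
    tokenTerm₀ i′ t v j i₂ i₃ i s₁ s₂ s₃ w = δ i i′ * δ t s₁
    tokenTerm₁ i′ t v j i₂ i₃ i s₁ s₂ s₃ w = δ i₂ i′ * δ t s₂
    tokenTerm₂ i′ t v j i₂ i₃ i s₁ s₂ s₃ w = δ i₃ i′ * δ t s₃

    diagonalTerm condTerm : Function
    diagonalTerm v j i₂ i₃ i s₁ s₂ s₃ w = δF (vdec v) (vert s₁) * δ (bits q 0) w
    condTerm v j i₂ i₃ i s₁ s₂ s₃ w = + ind (cond? v j i₂ i₃ i s₁ s₂ s₃ w)

    streamTerm : WeightedEdge n → Function
    streamTerm e v j i₂ i₃ i s₁ s₂ s₃ w = edgeTerm e (vdec v) (vert s₁) w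

    header : Index
    header = replicate bi false

    header? : ∀ i → Dec (i ≡ header)
    header? i = ≡-dec Bool._≟_ i header

    zeroWord : Word
    zeroWord = red 0ℤ

    fresh : Work
    fresh = red 0ℤ , red 1ℤ , red 0ℤ

    init : Points → State
    init r = zeroWord , (r , red (mle (onCube diagonalTerm) (points r)) , red (mle (onCube condTerm) (points r))) ,
             (zeroWord , zeroWord , zeroWord , zeroWord) , (zeroWord , true) , fresh

    readEdge : WeightedEdge n → State → State
    readEdge e (buf , (r , a₃ , a₄) , rest) = buf , (r , red (un a₃ + mle (onCube (streamTerm e)) (points r)) , a₄) , rest

    pickHeader : Index → Word → Word → Word
    pickHeader i t h with header? i
    ... | yes _ = t
    ... | no _  = h

    addToken : Vec ℤ m → Index → Word → Accum → Accum
    addToken ts i t (a₀ , a₁ , a₂ , h) =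
      red (un a₀ + mle (onCube (tokenTerm₀ i t)) ts) , red (un a₁ + mle (onCube (tokenTerm₁ i t)) ts) , red (un a₂ + mle (onCube (tokenTerm₂ i t)) ts) , pickHeader i t h

    tokUpd : Index → Word → Reg → Reg
    tokUpd i t (fx@(r , _) , acc , c) = fx , addToken (points r) i t acc , c

    -- The constant coefficient occurs in the values at 0 and at 1, hence twice in their sum; later
    -- coefficients occur only in the value at 1.
    firstUpd : ℤ → Word → Work → Work
    firstUpd t w (e , pw , s) = red (un e + un pw * un w) , red (un pw * t) , red (un s + (un w + un w))

    nextUpd : ℤ → Word → Work → Work
    nextUpd t w (e , pw , s) = red (un e + un pw * un w) , red (un pw * t) , red (un s + un w)

    -- Attached to the sending of the sample point, which is revealed only after the whole
    -- polynomial has arrived.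
    endRound : Φ → State → State
    endRound φ (buf , fx , acc , (claim , ok) , (e , pw , s)) = buf , fx , acc , (e , ok ∧ ⌊ app φ (un s) ≈? un claim ⌋) , fresh

    product₅ : ℤ → ℤ → ℤ → ℤ → ℤ → ℤ
    product₅ a₀ a₁ a₂ a₃ a₄ = a₀ * (a₁ * (a₂ * (a₃ * (a₄ * 1ℤ))))

    checked : Fixed → Accum → ℤ
    checked (r , a₃ , a₄) (a₀ , a₁ , a₂ , h) = product₅ (un a₀) (un a₁) (un a₂) (un a₃) (un a₄)

    answer : State → Maybe ℚ
    answer (buf , fx , acc@(_ , _ , _ , h) , (claim , ok) , wk) = if ok ∧ ⌊ un claim ≈? checked fx acc ⌋ then out h else nothing

    -- Unrolled over all indices: the position in the program stands for the index of the token,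
    -- which takes no memory of its own.
    tokProg : ∀ k → (Vec Bool k → Index) → List (Instr State)
    tokProg zero    e = recvW (tokUpd (e []))
    tokProg (suc k) e = tokProg k (λ x → e (false ∷ x)) ++ tokProg k (λ x → e (true ∷ x))

    module _ (point : Points → Vec Bool a) where
      onWork : (ℤ → Word → Work → Work) → Word → Reg → Reg
      onWork f w (fx@(r , _) , acc , cl , wk) = fx , acc , cl , f (valℤ (point r)) w wk

      coefProg : ℕ → List (Instr State)
      coefProg zero    = []
      coefProg (suc k) = recvW (onWork nextUpd) ++ coefProg k

      roundProg : Φ → List (Instr State)
      roundProg φ = (recvW (onWork firstUpd) ++ coefProg D) ++ sendW (λ (_ , (r , _) , _) → point r) (endRound φ)

    roundsProg : ∀ {k} → Vec Φ k → (Points → Vec (Vec Bool a) k) → List (Instr State)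
    roundsProg []       g = []
    roundsProg (φ ∷ sp) g = roundProg (λ r → head (g r)) φ ++ roundsProg sp (λ r → tail (g r))

    prog : List (Instr State)
    prog = tokProg bi (λ i → i) ++ roundsProg spec (λ r → r)

    length-tokProg : ∀ k e → length (tokProg k e) ≡ 2 ℕ.^ k ℕ.* b
    length-tokProg zero    e = trans (length-recvW (tokUpd (e []))) (sym (ℕ.+-identityʳ b))
    length-tokProg (suc k) e = trans (length-++ (tokProg k _)) (trans (cong₂ ℕ._+_ (length-tokProg k _) (length-tokProg k _))
      (trans (sym (ℕ.*-distribʳ-+ b (2 ℕ.^ k) (2 ℕ.^ k))) (cong (λ y → (2 ℕ.^ k ℕ.+ y) ℕ.* b) (sym (ℕ.+-identityʳ (2 ℕ.^ k))))))

    length-roundsProg : ∀ {k} (sp : Vec Φ k) g → length (roundsProg sp g) ≡ k ℕ.* ((suc D ℕ.* b) ℕ.+ a)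
    length-roundsProg []       g = refl
    length-roundsProg (φ ∷ sp) g = trans (length-++ (roundProg _ φ)) (cong₂ ℕ._+_
      (trans (length-++ (recvW (onWork (λ r → head (g r)) firstUpd) ++ coefProg (λ r → head (g r)) D))
        (cong₂ ℕ._+_ (trans (length-++ (recvW (onWork (λ r → head (g r)) firstUpd))) (cong₂ ℕ._+_ (length-recvW (onWork (λ r → head (g r)) firstUpd)) (length-coefProg D)))
                     (length-sendW (λ ((_ , (r , _) , _) : State) → head (g r)) (endRound φ))))
      (length-roundsProg sp _))
      where
      length-coefProg : ∀ k → length (coefProg (λ r → head (g r)) k) ≡ k ℕ.* b
      length-coefProg zero    = refl
      length-coefProg (suc k) = trans (length-++ (recvW (onWork (λ r → head (g r)) nextUpd))) (cong₂ ℕ._+_ (length-recvW (onWork (λ r → head (g r)) nextUpd)) (length-coefProg k))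

    length-prog : length prog ≡ N ℕ.* b ℕ.+ m ℕ.* (suc D ℕ.* b ℕ.+ a)
    length-prog = trans (length-++ (tokProg bi (λ i → i))) (cong₂ ℕ._+_ (length-tokProg bi (λ i → i)) (length-roundsProg spec (λ r → r)))

    tokens : ∀ k → Strategy → Transcript → Vec Bool k → Word
    afterTokens : ℕ → Strategy → Transcript → Transcript
    tokens zero    P τ []          = answers b P τ
    tokens (suc k) P τ (false ∷ x) = tokens k P τ x
    tokens (suc k) P τ (true ∷ x)  = tokens k P (afterTokens k P τ) x
    afterTokens zero    P τ = after b P τ
    afterTokens (suc k) P τ = afterTokens k P (afterTokens k P τ)

    accFold : ∀ k → (Vec Bool k → Index) → (Vec Bool k → Word) → Vec ℤ m → Accum → Accum
    accFold zero    e tok ts acc = addToken ts (e []) (tok []) acc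
    accFold (suc k) e tok ts acc = accFold k (λ x → e (true ∷ x)) (λ x → tok (true ∷ x)) ts
                                     (accFold k (λ x → e (false ∷ x)) (λ x → tok (false ∷ x)) ts acc)

    exec-tokProg : ∀ k e P τ buf r f acc c → ∃[ buf′ ]
      exec (tokProg k e) P τ (buf , (r , f) , acc , c) ≡ (afterTokens k P τ , buf′ , (r , f) , accFold k e (tokens k P τ) (points r) acc , c)
    exec-tokProg zero    e P τ buf r f acc c = _ , exec-recvW (tokUpd (e [])) P τ buf ((r , f) , acc , c)
    exec-tokProg (suc k) e P τ buf r f acc c with exec-tokProg k (λ x → e (false ∷ x)) P τ buf r f acc c
    ... | buf₁ , eq₁ with exec-tokProg k (λ x → e (true ∷ x)) P (afterTokens k P τ) buf₁ r f (accFold k (λ x → e (false ∷ x)) (tokens k P τ) (points r) acc) c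
    ... | buf₂ , eq₂ = buf₂ , trans (exec-++ (tokProg k _) (tokProg k _) P τ _) (trans (cong (λ (τ′ , s) → exec (tokProg k (λ x → e (true ∷ x))) P τ′ s) eq₁) eq₂)

    module _ (ts : Vec ℤ m) where
      private
        ac₀ ac₁ ac₂ hd : Accum → Word
        ac₀ (x , _) = x
        ac₁ (_ , x , _) = x
        ac₂ (_ , _ , x , _) = x
        hd  (_ , _ , _ , x) = x

        accumulate : (get : Accum → Word) (term : Index → Word → Function) →
          (∀ i t acc → un (get (addToken ts i t acc)) ≈ un (get acc) + mle (onCube (term i t)) ts) →
          ∀ k e tok acc → un (get (accFold k e tok ts acc)) ≈ un (get acc) + ΣB k (λ x → mle (onCube (term (e x) (tok x))) ts)
        accumulate get term h zero    e tok acc = h (e []) (tok []) acc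
        accumulate get term h (suc k) e tok acc = ≈-trans (accumulate get term h k (λ x → e (true ∷ x)) (λ x → tok (true ∷ x)) _)
          (≈-trans (≈-+ (accumulate get term h k (λ x → e (false ∷ x)) (λ x → tok (false ∷ x)) acc) (≈-refl {ΣB k (λ x → mle (onCube (term (e (true ∷ x)) (tok (true ∷ x)))) ts)}))
            (≈-reflexive (+-assoc (un (get acc)) (ΣB k (λ x → mle (onCube (term (e (false ∷ x)) (tok (false ∷ x)))) ts)) (ΣB k (λ x → mle (onCube (term (e (true ∷ x)) (tok (true ∷ x)))) ts)))))

      accFold₀ : ∀ tok acc → un (ac₀ (accFold bi (λ i → i) tok ts acc)) ≈ un (ac₀ acc) + ΣB bi (λ i → mle (onCube (tokenTerm₀ i (tok i))) ts)
      accFold₀ = accumulate ac₀ tokenTerm₀ (λ _ _ _ → un-red _) bi (λ i → i)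
      accFold₁ : ∀ tok acc → un (ac₁ (accFold bi (λ i → i) tok ts acc)) ≈ un (ac₁ acc) + ΣB bi (λ i → mle (onCube (tokenTerm₁ i (tok i))) ts)
      accFold₁ = accumulate ac₁ tokenTerm₁ (λ _ _ _ → un-red _) bi (λ i → i)
      accFold₂ : ∀ tok acc → un (ac₂ (accFold bi (λ i → i) tok ts acc)) ≈ un (ac₂ acc) + ΣB bi (λ i → mle (onCube (tokenTerm₂ i (tok i))) ts)
      accFold₂ = accumulate ac₂ tokenTerm₂ (λ _ _ _ → un-red _) bi (λ i → i)

      private
        pick-no : ∀ i t h → i ≢ header → pickHeader i t h ≡ h
        pick-no i t h i≢ with header? i
        ... | yes e = contradiction e i≢
        ... | no _  = refl
        pick-yes : ∀ i t h → i ≡ header → pickHeader i t h ≡ t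
        pick-yes i t h e with header? i
        ... | yes _ = refl
        ... | no i≢ = contradiction e i≢

        skip : ∀ k e tok acc → (∀ x → e x ≢ header) → hd (accFold k e tok ts acc) ≡ hd acc
        skip zero    e tok acc h = pick-no (e []) (tok []) _ (h [])
        skip (suc k) e tok acc h = trans (skip k _ _ _ λ x → h (true ∷ x)) (skip k _ _ acc λ x → h (false ∷ x))

        -- The header is the first token received, and no later index equals its index.
        pick : ∀ k e tok acc → e (replicate k false) ≡ header → (∀ x y → e x ≡ e y → x ≡ y) → hd (accFold k e tok ts acc) ≡ tok (replicate k false)
        pick zero    e tok acc h inj = pick-yes (e []) (tok []) _ h
        pick (suc k) e tok acc h inj = trans (skip k _ _ _ λ x eq → clash (inj (true ∷ x) (replicate (suc k) false) (trans eq (sym h))))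
          (pick k (λ x → e (false ∷ x)) (λ x → tok (false ∷ x)) acc h λ x y eq → cong tail (inj (false ∷ x) (false ∷ y) eq))
          where
          clash : ∀ {x y : Vec Bool k} → _≡_ {A = Vec Bool (suc k)} (true ∷ x) (false ∷ y) → Data.Empty.⊥
          clash ()

      accFold-header : ∀ tok acc → hd (accFold bi (λ i → i) tok ts acc) ≡ tok header
      accFold-header tok acc = pick bi (λ i → i) tok acc refl (λ x y eq → eq)

    coeffWords : ℕ → Strategy → Transcript → List ℤ
    coeffWords zero    P τ = []
    coeffWords (suc k) P τ = un (answers b P τ) ∷ coeffWords k P (after b P τ)

    afterCoeffs : ℕ → Strategy → Transcript → Transcript
    afterCoeffs zero    P τ = τ
    afterCoeffs (suc k) P τ = afterCoeffs k P (after b P τ)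

    length-coeffWords : ∀ k P τ → length (coeffWords k P τ) ≡ k
    length-coeffWords zero    P τ = refl
    length-coeffWords (suc k) P τ = cong suc (length-coeffWords k P (after b P τ))

    -- All tokens are sent before any coin is revealed, and each polynomial depends only on the
    -- points sent so far. So against private coins an arbitrary strategy amounts to a fixed message
    -- followed by a `Reply`.
    replyOf : ∀ k → Strategy → Transcript → Reply a k
    replyOf zero    P τ = done
    replyOf (suc k) P τ = round (coeffWords (suc D) P τ) λ w → replyOf k P (sent w (afterCoeffs (suc D) P τ))

    bounded-replyOf : ∀ k P τ → Bounded D (replyOf k P τ)
    bounded-replyOf zero    P τ = done
    bounded-replyOf (suc k) P τ = round (ℕ.≤-reflexive (length-coeffWords (suc D) P τ)) λ w → bounded-replyOf k P _

    -- In `WorkIs`, t is the point at which the received polynomial is evaluated.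
    record WorkIs (wk : Work) (e pw s : ℤ) : Set where
      constructor workIs
      field
        ev≈ : un (proj₁ wk) ≈ e
        pw≈ : un (proj₁ (proj₂ wk)) ≈ pw
        sm≈ : un (proj₂ (proj₂ wk)) ≈ s

    exec-coefProg : ∀ (g : Points → Vec Bool a) k P τ buf r f acc cl wk {e pw s} → WorkIs wk e pw s → ∃[ buf′ ] ∃[ wk′ ]
      exec (coefProg g k) P τ (buf , (r , f) , acc , cl , wk) ≡ (afterCoeffs k P τ , buf′ , (r , f) , acc , cl , wk′) ×
      (let t = valℤ (g r) ; cs = coeffWords k P τ in ∃[ pw′ ] WorkIs wk′ (e + pw * ev cs t) pw′ (s + ev cs 1ℤ))
    exec-coefProg g zero P τ buf r f acc cl wk {e} {pw} {s} (workIs e≈ p≈ s≈) =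
      buf , wk , refl , pw , workIs (≈-trans e≈ (≈-reflexive (ring e pw))) p≈ (≈-trans s≈ (≈-reflexive (sym (+-identityʳ s))))
      where
      ring : ∀ e pw → e ≡ e + pw * 0ℤ
      ring = solve-∀
    exec-coefProg g (suc k) P τ buf r f acc cl wk {e} {pw} {s} (workIs e≈ p≈ s≈) =
      let (buf′ , wk′ , eq , pw′ , workIs e′ p′ s′) = exec-coefProg g k P (after b P τ) (answers b P τ) r f acc cl (nextUpd (valℤ (g r)) (answers b P τ) wk)
             (workIs (≈-trans (un-red _) (≈-+ e≈ (≈-* p≈ (≈-refl {un (answers b P τ)})))) (≈-trans (un-red _) (≈-* p≈ (≈-refl {valℤ (g r)}))) (≈-trans (un-red _) (≈-+ s≈ (≈-refl {un (answers b P τ)}))))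
      in buf′ , wk′ ,
      trans (exec-++ (recvW (onWork g nextUpd)) (coefProg g k) P τ _) (trans (cong (λ (τ′ , x) → exec (coefProg g k) P τ′ x) (exec-recvW (onWork g nextUpd) P τ buf _)) eq) ,
      pw′ , workIs (≈-trans e′ (≈-reflexive (ring₁ e pw c t x))) p′ (≈-trans s′ (≈-reflexive (ring₂ s c y)))
      where
      c t x y : ℤ
      c = un (answers b P τ)
      t = valℤ (g r)
      x = ev (coeffWords k P (after b P τ)) t
      y = ev (coeffWords k P (after b P τ)) 1ℤ
      ring₁ : ∀ e pw c t x → (e + pw * c) + (pw * t) * x ≡ e + pw * (c + t * x)
      ring₁ = solve-∀
      ring₂ : ∀ s c y → (s + c) + y ≡ s + (c + 1ℤ * y)
      ring₂ = solve-∀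

    exec-roundProg : ∀ (g : Points → Vec Bool a) φ P τ buf r f acc claim ok → let cs = coeffWords (suc D) P τ in
      ∃[ buf′ ] ∃[ claim′ ] ∃[ s ]
      exec (roundProg g φ) P τ (buf , (r , f) , acc , (claim , ok) , fresh) ≡
        (sent (g r) (afterCoeffs (suc D) P τ) , buf′ , (r , f) , acc , (claim′ , ok ∧ ⌊ app φ (un s) ≈? un claim ⌋) , fresh) ×
      un claim′ ≈ ev cs (valℤ (g r)) × un s ≈ ev cs 0ℤ + ev cs 1ℤ
    exec-roundProg g φ P τ buf r f acc claim ok =
      let (buf′ , (e , pw , s) , eq , pw′ , workIs e≈ _ s≈) = exec-coefProg g D P (after b P τ) (answers b P τ) r f acc (claim , ok) (firstUpd (valℤ (g r)) (answers b P τ) fresh)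
             (workIs (≈-trans (un-red _) (≈-+ (un-red 0ℤ) (≈-* (un-red 1ℤ) (≈-refl {un (answers b P τ)})))) (≈-trans (un-red _) (≈-* (un-red 1ℤ) (≈-refl {valℤ (g r)}))) (≈-trans (un-red _) (≈-+ (un-red 0ℤ) (≈-refl {un (answers b P τ) + un (answers b P τ)}))))
      in buf′ , e , s ,
      trans (exec-++ (recvW (onWork g firstUpd) ++ coefProg g D) _ P τ _)
        (trans (cong (λ (τ′ , x) → exec (sendW (λ ((_ , (r , _) , _) : State) → g r) (endRound φ)) P τ′ x)
          (trans (exec-++ (recvW (onWork g firstUpd)) (coefProg g D) P τ _) (trans (cong (λ (τ′ , x) → exec (coefProg g D) P τ′ x) (exec-recvW (onWork g firstUpd) P τ buf _)) eq)))
          (exec-sendW (λ ((_ , (r , _) , _) : State) → g r) (endRound φ) P _ _)) ,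
      ≈-trans e≈ (≈-reflexive (ring₁ c t x)) , ≈-trans s≈ (≈-reflexive (ring₂ c (ev (coeffWords D P (after b P τ)) 0ℤ) y))
      where
      c t x y : ℤ
      c = un (answers b P τ)
      t = valℤ (g r)
      x = ev (coeffWords D P (after b P τ)) t
      y = ev (coeffWords D P (after b P τ)) 1ℤ
      ring₁ : ∀ c t x → (0ℤ + 1ℤ * c) + (1ℤ * t) * x ≡ c + t * x
      ring₁ = solve-∀
      ring₂ : ∀ c z y → (0ℤ + (c + c)) + y ≡ (c + 0ℤ * z) + (c + 1ℤ * y)
      ring₂ = solve-∀

    roundsₚ-afterCoeffs : ∀ k P τ → roundsₚ (afterCoeffs k P τ) ≡ roundsₚ τ
    roundsₚ-afterCoeffs zero    P τ = refl
    roundsₚ-afterCoeffs (suc k) P τ = trans (roundsₚ-afterCoeffs k P _) (roundsₚ-after b P τ)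

    roundsₚ-afterTokens : ∀ k P τ → roundsₚ (afterTokens k P τ) ≡ roundsₚ τ
    roundsₚ-afterTokens zero    P τ = roundsₚ-after b P τ
    roundsₚ-afterTokens (suc k) P τ = trans (roundsₚ-afterTokens k P _) (roundsₚ-afterTokens k P τ)

    private
      ∧-left : ∀ x y → T (x ∧ y) → T x
      ∧-left true  y h = tt
      ∧-right : ∀ x y → T (x ∧ y) → T y
      ∧-right true y h = h
      ∧-both : ∀ x y → T x → T y → T (x ∧ y)
      ∧-both true y _ h = h

    accepts-≈ : ∀ {k} (sp : Vec Φ k) {c c′} (ρ : Reply a k) ws {F} → c ≈ c′ → Accepts sp c ρ ws F → Accepts sp c′ ρ ws F
    accepts-≈ []       done        []       h acc        = ≈-trans (≈-sym h) acc
    accepts-≈ (φ ∷ sp) (round g k) (w ∷ ws) h (chk , acc) = ≈-trans chk h , acc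

    -- F stands for the value with which the last claim is compared. By `only` and `also`, the flag
    -- together with this comparison amounts to acceptance in the abstract sum-check.
    record RoundsRun {k} (sp : Vec Φ k) (g : Points → Vec (Vec Bool a) k) (P : Strategy) (τ : Transcript)
                     (buf : Word) (r : Points) (f : Word × Word) (acc : Accum) (claim : Word) (ok : Bool) (F : ℤ) : Set where
      field
        τ′     : Transcript
        buf′   : Word
        claim′ : Word
        ok′    : Bool
        result : exec (roundsProg sp g) P τ (buf , (r , f) , acc , (claim , ok) , fresh) ≡ (τ′ , buf′ , (r , f) , acc , (claim′ , ok′) , fresh)
        only   : T ok′ → un claim′ ≈ F → T ok × Accepts sp (un claim) (replyOf k P τ) (g r) F
        also   : T ok → Accepts sp (un claim) (replyOf k P τ) (g r) F → T ok′ × un claim′ ≈ F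
        few    : roundsₚ τ′ ≤ k ℕ.* 2 ℕ.+ roundsₚ τ

    exec-roundsProg : ∀ {k} (sp : Vec Φ k) g P τ buf r f acc claim ok F → RoundsRun sp g P τ buf r f acc claim ok F
    exec-roundsProg [] g P τ buf r f acc claim ok F with g r in gr
    ... | [] = record { result = refl
                      ; only = λ h e → h , subst (λ ws → Accepts [] (un claim) done ws F) (sym gr) e
                      ; also = λ h e → h , subst (λ ws → Accepts [] (un claim) done ws F) gr e ; few = ℕ.≤-refl }
    exec-roundsProg {suc k} (φ ∷ sp) g P τ buf r f acc claim ok F = record
      { τ′ = τ′ ; buf′ = buf′ ; claim′ = claim′ ; ok′ = ok′
      ; result = trans (exec-++ (roundProg (λ r → head (g r)) φ) _ P τ _) (trans (cong (λ (τ′ , x) → exec (roundsProg sp (λ r → tail (g r))) P τ′ x) eq) result)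
      ; only = λ h e → let (oks , rest) = only h e in
          ∧-left ok _ oks , subst (λ ws → Accepts (φ ∷ sp) (un claim) (replyOf (suc k) P τ) ws F) (η (g r))
            (≈-trans (≈-app φ (≈-sym s≈)) (toWitness (∧-right ok _ oks)) , accepts-≈ sp (replyOf k P _) (tail (g r)) claim≈ rest)
      ; also = λ h e → let (chk , rest) = subst (λ ws → Accepts (φ ∷ sp) (un claim) (replyOf (suc k) P τ) ws F) (sym (η (g r))) e in
          also (∧-both ok _ h (fromWitness (≈-trans (≈-app φ s≈) chk))) (accepts-≈ sp (replyOf k P _) (tail (g r)) (≈-sym claim≈) rest)
      ; few = ℕ.≤-trans few (ℕ.≤-trans (ℕ.+-monoʳ-≤ (k ℕ.* 2) (ℕ.≤-trans (roundsₚ-sent (head (g r)) (afterCoeffs (suc D) P τ)) (ℕ.≤-reflexive (cong (2 ℕ.+_) (roundsₚ-afterCoeffs (suc D) P τ)))))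
          (ℕ.≤-reflexive (trans (sym (ℕ.+-assoc (k ℕ.* 2) 2 _)) (cong (ℕ._+ roundsₚ τ) (ℕ.+-comm (k ℕ.* 2) 2)))))
      }
      where
      η : ∀ {k} (ws : Vec (Vec Bool a) (suc k)) → head ws ∷ tail ws ≡ ws
      η (_ ∷ _) = refl
      first = exec-roundProg (λ r → head (g r)) φ P τ buf r f acc claim ok
      claim₁ s : Word
      claim₁ = proj₁ (proj₂ first)
      s      = proj₁ (proj₂ (proj₂ first))
      eq     = proj₁ (proj₂ (proj₂ (proj₂ first)))
      claim≈ = proj₁ (proj₂ (proj₂ (proj₂ (proj₂ first))))
      s≈     = proj₂ (proj₂ (proj₂ (proj₂ (proj₂ first))))
      open RoundsRun (exec-roundsProg sp (λ r → tail (g r)) P (sent (head (g r)) (afterCoeffs (suc D) P τ)) (proj₁ first) r f acc claim₁ (ok ∧ ⌊ app φ (un s) ≈? un claim ⌋) F)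

    private
      consume : ∀ σ buf r a₃ a₄ rest → ∃[ a₃′ ]
        foldl (λ y e → readEdge e y) (buf , (r , a₃ , a₄) , rest) σ ≡ (buf , (r , a₃′ , a₄) , rest) ×
        un a₃′ ≈ un a₃ + sumL (λ e → mle (onCube (streamTerm e)) (points r)) σ
      consume []      buf r a₃ a₄ rest = a₃ , refl , ≈-reflexive (sym (+-identityʳ (un a₃)))
      consume (e ∷ σ) buf r a₃ a₄ rest =
        let (a₃′ , eq , h) = consume σ buf r (red (un a₃ + x)) a₄ rest
        in a₃′ , eq , ≈-trans h (≈-trans (≈-+ (un-red (un a₃ + x)) (≈-refl {s})) (≈-reflexive (+-assoc (un a₃) x s)))
        where
        x s : ℤ
        x = mle (onCube (streamTerm e)) (points r)
        s = sumL (λ e → mle (onCube (streamTerm e)) (points r)) σ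

    onCube-cong : ∀ (F F′ : Function) → (∀ v j i₂ i₃ i s₁ s₂ s₃ w → F v j i₂ i₃ i s₁ s₂ s₃ w ≡ F′ v j i₂ i₃ i s₁ s₂ s₃ w) → ∀ z → onCube F z ≡ onCube F′ z
    onCube-cong F F′ h z = h _ _ _ _ _ _ _ _ _

    distances : MetricGraph n → Vec Bool ℓ → Word → Vec Bool q
    distances G v s = bits q (dist G (vdec v) (vert s))

    module _ (G : MetricGraph n) (σ : List (WeightedEdge n)) (perm : σ ↭ edges G) where
      private
        indicator₃ : ∀ tok ts → mle (onCube diagonalTerm) ts + sumL (λ e → mle (onCube (streamTerm e)) ts) σ ≡ mle (Filled.factors tok (distances G) (suc (suc (suc zero)))) ts
        indicator₃ tok ts = trans (cong (_+_ (mle (onCube diagonalTerm) ts)) (sym (mle-sumL (λ e → onCube (streamTerm e)) σ ts)))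
          (trans (sym (mle-+ (onCube diagonalTerm) (λ z → sumL (λ e → onCube (streamTerm e) z) σ) ts))
            (mle-cong (onCube-cong (λ v j i₂ i₃ i s₁ s₂ s₃ w → diagonalTerm v j i₂ i₃ i s₁ s₂ s₃ w + sumL (λ e → streamTerm e v j i₂ i₃ i s₁ s₂ s₃ w) σ) (Filled.factor tok (distances G) (suc (suc (suc zero)))) λ v j i₂ i₃ i s₁ s₂ s₃ w → stream-indicator G σ perm (vdec v) (vert s₁) w) ts))

        indicator₀ : ∀ tok ts → ΣB bi (λ i → mle (onCube (tokenTerm₀ i (tok i))) ts) ≡ mle (Filled.factors tok (distances G) zero) ts
        indicator₀ tok ts = trans (sym (mle-ΣB bi (λ i → onCube (tokenTerm₀ i (tok i))) ts)) (mle-cong (onCube-cong (λ v j i₂ i₃ i s₁ s₂ s₃ w → ΣB bi (λ i′ → tokenTerm₀ i′ (tok i′) v j i₂ i₃ i s₁ s₂ s₃ w)) (Filled.factor tok (distances G) zero) λ v j i₂ i₃ i s₁ s₂ s₃ w → ΣB-δ i (λ i′ → δ (tok i′) s₁)) ts)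
        indicator₁ : ∀ tok ts → ΣB bi (λ i → mle (onCube (tokenTerm₁ i (tok i))) ts) ≡ mle (Filled.factors tok (distances G) (suc zero)) ts
        indicator₁ tok ts = trans (sym (mle-ΣB bi (λ i → onCube (tokenTerm₁ i (tok i))) ts)) (mle-cong (onCube-cong (λ v j i₂ i₃ i s₁ s₂ s₃ w → ΣB bi (λ i′ → tokenTerm₁ i′ (tok i′) v j i₂ i₃ i s₁ s₂ s₃ w)) (Filled.factor tok (distances G) (suc zero)) λ v j i₂ i₃ i s₁ s₂ s₃ w → ΣB-δ i₂ (λ i′ → δ (tok i′) s₂)) ts)
        indicator₂ : ∀ tok ts → ΣB bi (λ i → mle (onCube (tokenTerm₂ i (tok i))) ts) ≡ mle (Filled.factors tok (distances G) (suc (suc zero))) ts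
        indicator₂ tok ts = trans (sym (mle-ΣB bi (λ i → onCube (tokenTerm₂ i (tok i))) ts)) (mle-cong (onCube-cong (λ v j i₂ i₃ i s₁ s₂ s₃ w → ΣB bi (λ i′ → tokenTerm₂ i′ (tok i′) v j i₂ i₃ i s₁ s₂ s₃ w)) (Filled.factor tok (distances G) (suc (suc zero))) λ v j i₂ i₃ i s₁ s₂ s₃ w → ΣB-δ i₃ (λ i′ → δ (tok i′) s₃)) ts)

      record Run (P : Strategy) (r : Points) : Set where
        tok : Index → Word
        tok = tokens bi P []
        ρ : Reply a m
        ρ = replyOf m P (afterTokens bi P [])
        F : ℤ
        F = final (Filled.factors tok (distances G)) r
        field
          τ′  : Transcript
          s′  : State
          result : exec prog P [] (foldl (λ y e → readEdge e y) (init r) σ) ≡ (τ′ , s′)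
          rejectedOrAccepted : answer s′ ≡ nothing ⊎ answer s′ ≡ out (tok header) × Accepts spec (un zeroWord) ρ r F
          accepted : Accepts spec (un zeroWord) ρ r F → answer s′ ≡ out (tok header)
          few : rounds τ′ ≤ m ℕ.* 2 ℕ.+ 1

      private
       run : ∀ P r → Run P r
       run P r = record
         { τ′ = τ′ ; s′ = s′
         ; result = trans (cong (exec prog P []) eq₀) (trans (exec-++ (tokProg bi (λ i → i)) _ P [] _) (trans (cong (λ (τ , x) → exec (roundsProg spec (λ r → r)) P τ x) eq₁) result))
         ; rejectedOrAccepted = outcome₁ ok′ refl (un claim′ ≈? checked fx acc) refl
         ; accepted = λ h → let (okT , e) = also tt (accepts-F (≈-sym F≈) h) in
             trans (cong (λ c → if c then out hdr else nothing) (T⇒true _ (∧-both ok′ _ okT (fromWitness {a? = un claim′ ≈? checked fx acc} e)))) (cong out hdr≡)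
         ; few = ℕ.≤-trans (rounds≤roundsₚ τ′) (ℕ.≤-trans few (ℕ.≤-reflexive (cong (m ℕ.* 2 ℕ.+_) (roundsₚ-afterTokens bi P []))))
         }
         where
         ts : Vec ℤ m
         ts = points r
         tok : Index → Word
         tok = tokens bi P []
         acc₀ : Accum
         acc₀ = zeroWord , zeroWord , zeroWord , zeroWord
         acc : Accum
         acc = accFold bi (λ i → i) tok ts acc₀
         hdr : Word
         hdr = proj₂ (proj₂ (proj₂ acc))
         a₄ : Word
         a₄ = red (mle (onCube condTerm) ts)
         read = consume σ zeroWord r (red (mle (onCube diagonalTerm) ts)) a₄ (acc₀ , (zeroWord , true) , fresh)
         a₃ : Word
         a₃ = proj₁ read
         eq₀ = proj₁ (proj₂ read)
         fx : Fixed
         fx = r , a₃ , a₄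
         toks = exec-tokProg bi (λ i → i) P [] zeroWord r (a₃ , a₄) acc₀ ((zeroWord , true) , fresh)
         eq₁ = proj₂ toks
         open RoundsRun (exec-roundsProg spec (λ r → r) P (afterTokens bi P []) (proj₁ toks) r (a₃ , a₄) acc zeroWord true (checked fx acc))
         s′ : State
         s′ = buf′ , fx , acc , (claim′ , ok′) , fresh
         hdr≡ : hdr ≡ tok header
         hdr≡ = accFold-header ts tok acc₀
         from0 : ∀ {x y} → x ≈ un zeroWord + y → x ≈ y
         from0 {x} {y} h = ≈-trans h (≈-trans (≈-+ (un-red 0ℤ) (≈-refl {y})) (≈-reflexive (+-identityˡ y)))
         F≈ : checked fx acc ≈ final (Filled.factors tok (distances G)) r
         F≈ = ≈-* (≈-trans (from0 (accFold₀ ts tok acc₀)) (≈-reflexive (indicator₀ tok ts)))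
           (≈-* (≈-trans (from0 (accFold₁ ts tok acc₀)) (≈-reflexive (indicator₁ tok ts)))
           (≈-* (≈-trans (from0 (accFold₂ ts tok acc₀)) (≈-reflexive (indicator₂ tok ts)))
           (≈-* (≈-trans (proj₂ (proj₂ read)) (≈-trans (≈-+ (un-red _) (≈-refl {sumL (λ e → mle (onCube (streamTerm e)) ts) σ})) (≈-reflexive (indicator₃ tok ts))))
           (≈-* (un-red _) (≈-refl {1ℤ})))))
         accepts-F : ∀ {k} {sp : Vec Φ k} {c} {ρ : Reply a k} {ws} {F F′} → F ≈ F′ → Accepts sp c ρ ws F → Accepts sp c ρ ws F′
         accepts-F {sp = []}     {ρ = done}      {[]}     h e         = ≈-trans e h
         accepts-F {sp = φ ∷ sp} {ρ = round g k} {w ∷ ws} h (chk , e) = chk , accepts-F {sp = sp} {ρ = k w} h e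
         T⇒true : ∀ x → T x → x ≡ true
         T⇒true true _ = refl
         outcome₁ : ∀ o → o ≡ ok′ → (d : Dec (un claim′ ≈ checked fx acc)) → d ≡ (un claim′ ≈? checked fx acc) →
           answer s′ ≡ nothing ⊎ answer s′ ≡ out (tok header) × Accepts spec (un zeroWord) (replyOf m P (afterTokens bi P [])) r (final (Filled.factors tok (distances G)) r)
         outcome₁ false o≡ d d≡ = inj₁ (cong (λ o → if o ∧ ⌊ un claim′ ≈? checked fx acc ⌋ then out hdr else nothing) (sym o≡))
         outcome₁ true  o≡ (no _) d≡ = inj₁ (cong₂ (λ o d → if o ∧ ⌊ d ⌋ then out hdr else nothing) (sym o≡) (sym d≡))
         outcome₁ true  o≡ (yes h) d≡ = inj₂ (trans (cong₂ (λ o d → if o ∧ ⌊ d ⌋ then out hdr else nothing) (sym o≡) (sym d≡)) (cong out hdr≡) ,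
           accepts-F F≈ (proj₂ (only (subst T o≡ tt) h)))

      opaque
        -- Opaque, so that the counting below never normalises a run of the verifier.
        execute : ∀ P r → Run P r
        execute = run

    -- Short polynomials are padded with zeros, because the program expects the same number of
    -- coefficients in every round.
    sayCoeffs : ℕ → List ℤ → Plan → Plan
    sayCoeffs zero    cs       p = p
    sayCoeffs (suc k) []       p = say (red 0ℤ) (sayCoeffs k [] p)
    sayCoeffs (suc k) (c ∷ cs) p = say (red c) (sayCoeffs k cs p)

    follows-coeffs : ∀ k cs {p P τ} → length cs ≤ k → Follows P τ (sayCoeffs k cs p) →
      (∀ t → ev (coeffWords k P τ) t ≈ ev cs t) × Follows P (afterCoeffs k P τ) p
    follows-coeffs zero    []       _       h = (λ _ → ≈-refl) , h
    follows-coeffs (suc k) [] {p} {P} {τ} z≤n h =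
      let (e , h₁) = follows-say {P} {τ} (red 0ℤ) h ; (e′ , h₂) = follows-coeffs k [] {p} {P} {after b P τ} z≤n h₁
      in (λ t → ≈-trans (≈-+ (≈-trans (≈-reflexive (cong un e)) (un-red 0ℤ)) (≈-* (≈-refl {t}) (e′ t))) (≈-reflexive (trans (+-identityˡ (t * 0ℤ)) (*-zeroʳ t)))) , h₂
    follows-coeffs (suc k) (c ∷ cs) {p} {P} {τ} (s≤s short) h =
      let (e , h₁) = follows-say {P} {τ} (red c) h ; (e′ , h₂) = follows-coeffs k cs {p} {P} {after b P τ} short h₁
      in (λ t → ≈-+ (≈-trans (≈-reflexive (cong un e)) (un-red c)) (≈-* (≈-refl {t}) (e′ t))) , h₂

    roundsPlan : ∀ {k} → Vec Φ k → (Fin 5 → Vec Bool k → ℤ) → Plan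
    roundsPlan []       fs = end
    roundsPlan (φ ∷ sp) fs = sayCoeffs (suc D) (coeffs (roundPoly sp fs)) (hear a λ w → roundsPlan sp (λ j → bind (fs j) (valℤ w)))

    follows-rounds : ∀ {k} (sp : Vec Φ k) fs {P τ} → DegreesAtMost D sp → Follows P τ (roundsPlan sp fs) → Honest sp fs (replyOf k P τ)
    follows-rounds []       fs _            h = tt
    follows-rounds (φ ∷ sp) fs {P} {τ} (deg , degs) h =
      let (e , h₁) = follows-coeffs (suc D) (coeffs (roundPoly sp fs)) {P = P} {τ} (ℕ.≤-trans (IsPoly.short (roundPoly sp fs)) (s≤s deg)) h
      in (λ t → ≈-trans (e t) (≈-reflexive (correct (roundPoly sp fs) t))) ,
         λ w → follows-rounds sp (λ j → bind (fs j) (valℤ w)) degs (follows-hear {P} w h₁)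

    tokensPlan : ∀ k → (Vec Bool k → Word) → Plan → Plan
    tokensPlan zero    tok p = say (tok []) p
    tokensPlan (suc k) tok p = tokensPlan k (λ x → tok (false ∷ x)) (tokensPlan k (λ x → tok (true ∷ x)) p)

    follows-tokens : ∀ k tok {p P τ} → Follows P τ (tokensPlan k tok p) → (∀ x → tokens k P τ x ≡ tok x) × Follows P (afterTokens k P τ) p
    follows-tokens zero    tok {P = P} {τ} h = let (e , h₁) = follows-say {P} {τ} (tok []) h in (λ { [] → e }) , h₁
    follows-tokens (suc k) tok {p} {P} {τ} h =
      let (e , h₁)  = follows-tokens k (λ x → tok (false ∷ x)) {tokensPlan k (λ x → tok (true ∷ x)) p} {P} {τ} h
          (e′ , h₂) = follows-tokens k (λ x → tok (true ∷ x)) {p} {P} {afterTokens k P τ} h₁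
      in (λ { (false ∷ x) → e x ; (true ∷ x) → e′ x }) , h₂

    -- Functions on the cube are enumerated by halves. The search reaches each function only up to
    -- pointwise equality, which Q therefore has to respect.
    searchFun : ∀ k {Q : (Vec Bool k → Word) → Set} → (∀ {f g} → (∀ x → f x ≡ g x) → Q f → Q g) → (∀ f → Dec (Q f)) → Dec (∃ Q)
    searchFun zero {Q} resp Q? with searchB b {λ w → Q (λ _ → w)} (λ w → Q? (λ _ → w))
    ... | yes (w , h) = yes ((λ _ → w) , h)
    ... | no none     = no λ (f , h) → none (f [] , resp (λ { [] → refl }) h)
    searchFun (suc k) {Q} resp Q?
      with searchFun k {λ f → ∃ λ g → Q (combine f g)}
             (λ e (g , h) → g , resp (λ { (false ∷ x) → e x ; (true ∷ x) → refl }) h)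
             (λ f → searchFun k {λ g → Q (combine f g)} (λ e → resp (λ { (false ∷ x) → refl ; (true ∷ x) → e x })) (λ g → Q? (combine f g)))
      where
      combine : (Vec Bool k → Word) → (Vec Bool k → Word) → Vec Bool (suc k) → Word
      combine f g (false ∷ x) = f x
      combine f g (true ∷ x)  = g x
    ... | yes (f , g , h) = yes (_ , h)
    ... | no none         = no λ (f , h) → none ((λ x → f (false ∷ x)) , (λ x → f (true ∷ x)) , resp (λ { (false ∷ x) → refl ; (true ∷ x) → refl }) h)

    satisfied-resp : ∀ {tok tok′ : Index → Word} {d d′ : Vec Bool ℓ → Word → Vec Bool q} → (∀ i → tok i ≡ tok′ i) → (∀ v s → d v s ≡ d′ v s) →
      Filled.Satisfied tok d → Filled.Satisfied tok′ d′
    satisfied-resp {tok} {tok′} {d} {d′} e e′ sat v j i₂ i₃ =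
      let (i , h) = sat v j i₂ i₃ in
      i , subst (Cond v j i₂ i₃ i (tok′ i) (tok′ i₂) (tok′ i₃)) (trans (e′ v (tok i)) (cong (d′ v) (e i)))
            (subst (λ s → Cond v j i₂ i₃ i (tok′ i) (tok′ i₂) s (d v (tok i))) (e i₃)
              (subst (λ s → Cond v j i₂ i₃ i (tok′ i) s (tok i₃) (d v (tok i))) (e i₂)
                (subst (λ s → Cond v j i₂ i₃ i s (tok i₂) (tok i₃) (d v (tok i))) (e i) h)))

    private
      degrees-plain : ∀ k {c} (sp : Vec Φ c) → degree sp ≤ D → DegreesAtMost D sp → DegreesAtMost D (replicate k plain Vec.++ sp)
      degrees-plain zero    sp h hs = hs
      degrees-plain (suc k) sp h hs = subst (_≤ D) (sym (Spec.degree-plain N 5 k sp)) h , degrees-plain k sp h hs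

      degrees-sum : ∀ k → DegreesAtMost D (replicate k plain)
      degrees-sum zero    = tt
      degrees-sum (suc k) = subst (_≤ D) (sym (Spec.degree-ΣB N 5 k)) (ℕ.m≤n*m 5 N {{ℕ.m^n≢0 2 bi}}) , degrees-sum k

    -- In the rounds for v, j, i₂ and i₃ the round polynomial contains `Z N` of a sum of products of
    -- five multilinear factors, of degree 5 N; from the first bit of i on, the degree is 5.
    degrees : DegreesAtMost D spec
    degrees = degrees-plain ℓ sp₁ (dg bi sp₂ (dg bi sp₃ (dg bi sp₄ d₄))) (degrees-plain bi sp₂ (dg bi sp₃ (dg bi sp₄ d₄)) (degrees-plain bi sp₃ (dg bi sp₄ d₄) (degrees-plain bi sp₄ d₄
      (subst (_≤ D) (sym (Spec.degree-ΣB N 5 m₂′)) (ℕ.m≤n*m 5 N {{ℕ.m^n≢0 2 bi}}) , degrees-sum m₂′))))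
      where
      m₂′ : ℕ
      m₂′ = bi′ ℕ.+ (b ℕ.+ (b ℕ.+ (b ℕ.+ q)))
      sp₄ : Vec Φ m₂
      sp₄ = vanish ∷ replicate m₂′ plain
      sp₃ : Vec Φ (bi ℕ.+ m₂)
      sp₃ = replicate bi plain Vec.++ sp₄
      sp₂ : Vec Φ (bi ℕ.+ (bi ℕ.+ m₂))
      sp₂ = replicate bi plain Vec.++ sp₃
      sp₁ : Vec Φ (bi ℕ.+ (bi ℕ.+ (bi ℕ.+ m₂)))
      sp₁ = replicate bi plain Vec.++ sp₂
      d₄ : degree sp₄ ≤ D
      d₄ = ℕ.≤-reflexive (cong (N ℕ.*_) (Spec.degree-ΣB N 5 m₂′))
      dg : ∀ k {c} (sp : Vec Φ c) → degree sp ≤ D → degree (replicate k plain Vec.++ sp) ≤ D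
      dg k sp h = subst (_≤ D) (sym (Spec.degree-plain N 5 k sp)) h

    -- `error` keeps the failure probability m D / 2 ^ a of the sum-check at most 1/3. `exists` can
    -- be doubly negated because it only refutes the failure of a decidable search.
    module Verify (Π : Problem (WeightedEdge n)) (graphOf : Problem.Instance Π → MetricGraph n)
      (presents : ∀ x σ → Problem.Presents Π x σ → σ ↭ edges (graphOf x))
      (N<p : N < p) (M<p : 2 ℕ.^ (ℓ ℕ.+ (bi ℕ.+ (bi ℕ.+ bi))) < p) (error : 3 ℕ.* (m ℕ.* D) ≤ 2 ℕ.^ a)
      (pb : ℕ) (fits : N ℕ.* b ℕ.+ m ℕ.* (suc D ℕ.* b ℕ.+ a) < 2 ℕ.^ pb)
      (sound : ∀ x tok → Filled.Satisfied tok (distances (graphOf x)) → ∀ v → out (tok header) ≡ just v → Problem.Correct Π x v)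
      (exists : ∀ x → ¬ ¬ (∃[ tok ] (Filled.Satisfied tok (distances (graphOf x)) × ∃[ v ] out (tok header) ≡ just v))) where

      open Problem Π

      unpack : Vec Bool (m ℕ.* a) → Points
      unpack = dec (encVec encBits m)

      ΣN-ΣV : ∀ k (f : Vec (Vec Bool a) k → ℕ) → ΣN (k ℕ.* a) (λ v → f (dec (encVec encBits k) v)) ≡ ΣV a k f
      ΣN-ΣV zero    f = refl
      ΣN-ΣV (suc k) f = trans (ΣN-split a (k ℕ.* a) (λ v → f (dec (encVec encBits (suc k)) v))) (ΣN-cong a λ u → trans (ΣN-cong (k ℕ.* a) λ v →
        cong f (cong₂ _∷_ (pre-++ u v) (cong (dec (encVec encBits k)) (suf-++ u v)))) (ΣN-ΣV k (λ ws → f (u ∷ ws))))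

      outcome : ∀ x σ → Presents x σ → Strategy → Vec Bool (m ℕ.* a) → Transcript × State
      outcome x σ pr P v = Run.τ′ e , Run.s′ e
        where e = execute (graphOf x) σ (presents x σ pr) P (unpack v)

      finished : Transcript × State → Transcript × Outcome
      finished (τ , s) = τ , output (answer s)

      -- If the tokens satisfy all conditions, every output is correct. Otherwise the claim 0 is
      -- false, and only the rare coins for which the sum-check accepts can lead to an output.
      soundness : ∀ x σ pr P → 2 ℕ.* 2 ℕ.^ (m ℕ.* a) ≤ 3 ℕ.* ΣN (m ℕ.* a) (λ v → ind (answeredOrRejected? Π x (finished (outcome x σ pr P v))))
      soundness x σ pr P = conclude (Filled.satisfied? tok (distances G))
        where
        G : MetricGraph n
        G = graphOf x
        tok : Index → Word
        tok = tokens bi P []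
        ρ : Reply a m
        ρ = replyOf m P (afterTokens bi P [])
        fs : Fin 5 → Vec Bool m → ℤ
        fs = Filled.factors tok (distances G)
        good : Vec Bool (m ℕ.* a) → ℕ
        good v = ind (answeredOrRejected? Π x (finished (outcome x σ pr P v)))
        acceptance : Points → ℕ
        acceptance r = ind (accepts? spec (un zeroWord) ρ r (final fs r))
        module R v = Run (execute G σ (presents x σ pr) P (unpack v))
        fine : ∀ τ o → (∀ v → o ≡ just v → Correct x v) → AnsweredOrRejected Π x (τ , output o)
        fine τ nothing  h = tt
        fine τ (just v) h = h v refl
        isGood : ∀ v → (∀ y → answer (R.s′ v) ≡ just y → Correct x y) → good v ≡ 1
        isGood v h = ind-yes (answeredOrRejected? Π x (finished (outcome x σ pr P v))) (fine (R.τ′ v) (answer (R.s′ v)) h)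
        conclude : Dec (Filled.Satisfied tok (distances G)) → 2 ℕ.* 2 ℕ.^ (m ℕ.* a) ≤ 3 ℕ.* ΣN (m ℕ.* a) good
        conclude (yes sat) = count-all (m ℕ.* a) good λ v → isGood v λ y e → always v y e (R.rejectedOrAccepted v)
          where
          always : ∀ v y → answer (R.s′ v) ≡ just y → answer (R.s′ v) ≡ nothing ⊎ answer (R.s′ v) ≡ out (tok header) × Accepts spec (un zeroWord) ρ (unpack v) (final fs (unpack v)) → Correct x y
          always v y e (inj₁ e′)       = contradiction (trans (sym e) e′) λ ()
          always v y e (inj₂ (e′ , _)) = sound x tok sat y (trans (sym e′) e)
        conclude (no ¬sat) = count-most (m ℕ.* a) good (λ v → acceptance (unpack v)) (λ v → either v (R.rejectedOrAccepted v))
            (ℕ.≤-trans (ℕ.≤-reflexive (cong (3 ℕ.*_) (ΣN-ΣV m acceptance))) rare)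
          where
          open ℕ.≤-Reasoning
          ring : ∀ A B → A ℕ.* (3 ℕ.* B) ≡ 3 ℕ.* (A ℕ.* B)
          ring = ℕSolver.solve-∀
          either : ∀ v → answer (R.s′ v) ≡ nothing ⊎ answer (R.s′ v) ≡ out (tok header) × Accepts spec (un zeroWord) ρ (unpack v) (final fs (unpack v)) → 1 ≤ good v ℕ.+ acceptance (unpack v)
          either v (inj₁ e)       = ℕ.≤-trans (ℕ.≤-reflexive (sym (isGood v λ y e′ → contradiction (trans (sym e′) e) λ ()))) (ℕ.m≤m+n (good v) _)
          either v (inj₂ (_ , h)) = ℕ.≤-trans (ℕ.≤-reflexive (sym (ind-yes (accepts? spec (un zeroWord) ρ (unpack v) (final fs (unpack v))) h))) (ℕ.m≤n+m _ (good v))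
          wrong : un zeroWord ≉ tot spec fs
          wrong h = Filled.unsatisfied⇒tot≉0 tok (distances G) isPrime N<p M<p ¬sat (≈-trans (≈-sym (un-red 0ℤ)) h)
          rare : 3 ℕ.* ΣV a m acceptance ≤ 2 ℕ.^ (m ℕ.* a)
          rare = ℕ.*-cancelˡ-≤ (2 ℕ.^ a) {{ℕ.m^n≢0 2 a}} (begin
            2 ℕ.^ a ℕ.* (3 ℕ.* ΣV a m acceptance)      ≡⟨ ring (2 ℕ.^ a) (ΣV a m acceptance) ⟩
            3 ℕ.* (2 ℕ.^ a ℕ.* ΣV a m acceptance)      ≤⟨ ℕ.*-monoʳ-≤ 3 (sumcheck-sound 2^a≤p D spec degrees fs (un zeroWord) (bounded-replyOf m P (afterTokens bi P [])) wrong) ⟩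
            3 ℕ.* (m ℕ.* D ℕ.* 2 ℕ.^ (m ℕ.* a))        ≡⟨ ℕ.*-assoc 3 (m ℕ.* D) (2 ℕ.^ (m ℕ.* a)) ⟨
            3 ℕ.* (m ℕ.* D) ℕ.* 2 ℕ.^ (m ℕ.* a)        ≤⟨ ℕ.*-monoˡ-≤ (2 ℕ.^ (m ℕ.* a)) error ⟩
            2 ℕ.^ a ℕ.* 2 ℕ.^ (m ℕ.* a)                ∎)

      recovered : List (WeightedEdge n) → Vec Bool ℓ → Word → Vec Bool q
      recovered σ v s = bits q (distIn σ (vdec v) (vert s))

      Proves : List (WeightedEdge n) → (Index → Word) → Set
      Proves σ tok = Filled.Satisfied tok (recovered σ) × ∃[ v ] out (tok header) ≡ just v

      proves? : ∀ σ tok → Dec (Proves σ tok)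
      proves? σ tok = Filled.satisfied? tok (recovered σ) ×-dec answered (out (tok header)) refl
        where
        answered : ∀ o → o ≡ out (tok header) → Dec (∃[ v ] out (tok header) ≡ just v)
        answered nothing  e = no λ (v , e′) → contradiction (trans e e′) λ ()
        answered (just v) e = yes (v , sym e)

      planFor : List (WeightedEdge n) → (Index → Word) → Plan
      planFor σ tok = tokensPlan bi tok (roundsPlan spec (Filled.factors tok (recovered σ)))

      convinces : ∀ x σ pr tok → Proves σ tok → ∀ P → Follows P [] (planFor σ tok) → ∀ v → Answered Π x (finished (outcome x σ pr P v))
      convinces x σ pr tok (sat , y , eq) P follows v =
        subst (λ o → Answered Π x (Run.τ′ run , output o)) (sym answer≡) (sound x tok (satisfied-resp {tok} {tok} {recovered σ} {distances G} (λ _ → refl) same sat) y eq)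
        where
        G : MetricGraph n
        G = graphOf x
        same : ∀ v s → recovered σ v s ≡ distances G v s
        same v s = cong (bits q) (distIn-dist G (presents x σ pr) (vdec v) (vert s))
        run : Run G σ (presents x σ pr) P (unpack v)
        run = execute G σ (presents x σ pr) P (unpack v)
        fs : Fin 5 → Vec Bool m → ℤ
        fs = Filled.factors tok (recovered σ)
        followed : (∀ i → tokens bi P [] i ≡ tok i) × Follows P (afterTokens bi P []) (roundsPlan spec fs)
        followed = follows-tokens bi tok follows
        factor≡ : ∀ k v j i₂ i₃ i s₁ s₂ s₃ w → Filled.factor tok (recovered σ) k v j i₂ i₃ i s₁ s₂ s₃ w ≡ Filled.factor (tokens bi P []) (distances G) k v j i₂ i₃ i s₁ s₂ s₃ w
        factor≡ zero                         v j i₂ i₃ i s₁ s₂ s₃ w = cong (λ t → δ t s₁) (sym (proj₁ followed i))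
        factor≡ (suc zero)                   v j i₂ i₃ i s₁ s₂ s₃ w = cong (λ t → δ t s₂) (sym (proj₁ followed i₂))
        factor≡ (suc (suc zero))             v j i₂ i₃ i s₁ s₂ s₃ w = cong (λ t → δ t s₃) (sym (proj₁ followed i₃))
        factor≡ (suc (suc (suc zero)))       v j i₂ i₃ i s₁ s₂ s₃ w = cong (λ t → δ t w) (same v s₁)
        factor≡ (suc (suc (suc (suc zero)))) v j i₂ i₃ i s₁ s₂ s₃ w = refl
        final≡ : final fs (unpack v) ≡ final (Filled.factors (tokens bi P []) (distances G)) (unpack v)
        final≡ = prodF-cong 5 λ k → mle-cong (onCube-cong (Filled.factor tok (recovered σ) k) (Filled.factor (tokens bi P []) (distances G) k) (factor≡ k)) (points (unpack v))
        accepting : Accepts spec (un zeroWord) (replyOf m P (afterTokens bi P [])) (unpack v) (final fs (unpack v))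
        accepting = sumcheck-complete spec fs (un zeroWord) (replyOf m P (afterTokens bi P [])) (follows-rounds spec fs degrees (proj₂ followed))
          (≈-trans (un-red 0ℤ) (≈-reflexive (sym (Filled.satisfied⇒tot≡0 tok (recovered σ) sat)))) (unpack v)
        answer≡ : answer (Run.s′ run) ≡ just y
        answer≡ = trans (Run.accepted run (subst (Accepts spec (un zeroWord) (replyOf m P (afterTokens bi P [])) (unpack v)) final≡ accepting))
          (trans (cong out (proj₁ followed header)) eq)

      opaque
        -- Decidability turns the doubly negated existence of a proof into an honest prover that
        -- computes one from the stream.
        proof? : ∀ σ → Dec (∃ (Proves σ))
        proof? σ = searchFun bi (λ {f} {g} e (sat , v , eq) → satisfied-resp {f} {g} {recovered σ} {recovered σ} e (λ _ _ → refl) sat , v , trans (cong out (sym (e header))) eq) (proves? σ)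

      plan : ∀ σ → Dec (∃ (Proves σ)) → Plan
      plan σ (yes (tok , _)) = planFor σ tok
      plan σ (no _)          = end

      honestly : List (WeightedEdge n) → Strategy
      honestly σ = follow (plan σ (proof? σ))

      completeness : ∀ x σ pr → 2 ℕ.* 2 ℕ.^ (m ℕ.* a) ≤ 3 ℕ.* ΣN (m ℕ.* a) (λ v → ind (answered? Π x (finished (outcome x σ pr (honestly σ) v))))
      completeness x σ pr = count-all (m ℕ.* a) (λ v → ind (answered? Π x (finished (outcome x σ pr (honestly σ) v))))
          λ v → ind-yes (answered? Π x (finished (outcome x σ pr (honestly σ) v))) (always (proof? σ) v)
        where
        always : (d : Dec (∃ (Proves σ))) → ∀ v → Answered Π x (finished (outcome x σ pr (follow (plan σ d)) v))
        always (no none) v = contradiction (λ (tok , sat , h) → none (tok , satisfied-resp {tok} {tok} {distances (graphOf x)} {recovered σ} (λ _ → refl)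
          (λ v s → cong (bits q) (sym (distIn-dist (graphOf x) (presents x σ pr) (vdec v) (vert s)))) sat , h)) (exists x)
        always (yes (tok , pf)) v = convinces x σ pr tok pf (follow (planFor σ tok)) (follow-follows (planFor σ tok)) v

      verifier-SIP : ∃[ V ] IsSIP Π {pb ℕ.+ stateBits} V (N ℕ.* b ℕ.+ m ℕ.* (suc D ℕ.* b ℕ.+ a)) (m ℕ.* 2 ℕ.+ 1)
      verifier-SIP = V , subst (λ l → IsSIP Π V l (m ℕ.* 2 ℕ.+ 1)) length-prog
        (Compile.isSIP encState pb prog fits′ (m ℕ.* a) (λ v → init (unpack v)) readEdge answer Π outcome
          (λ x σ pr P v → Run.result (execute (graphOf x) σ (presents x σ pr) P (unpack v)))
          (λ x σ pr P v → Run.few (execute (graphOf x) σ (presents x σ pr) P (unpack v)))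
          honestly completeness soundness)
        where
        fits′ : length prog < 2 ℕ.^ pb
        fits′ = subst (_< 2 ℕ.^ pb) (sym length-prog) fits
        V : Verifier (WeightedEdge n) (pb ℕ.+ stateBits)
        V = Compile.V encState pb prog fits′ (m ℕ.* a) (λ v → init (unpack v)) readEdge answer

-- Primes between 2 ^ a and 2 ^ 2a

module PrimeBounds where

  open import Data.Nat.Base
  open import Data.Nat.Properties
  open import Data.Nat.Divisibility
  open import Data.Nat.Induction using (<-rec)
  open import Data.Nat.Primality using (Prime; prime?; prime⇒nonZero; prime⇒nonTrivial)
  open import Data.Nat.Primality.Factorisation using (factorise)
  open import Data.Nat.ListAction using (product)
  open import Data.List.Base using ([]; _∷_)
  open import Data.List.Relation.Unary.All using ([]; _∷_)
  open import Data.Nat.Tactic.RingSolver using (solve-∀)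
  open import Data.Product.Base using (∃-syntax; _×_; _,_; proj₁; proj₂)
  open import Relation.Binary.PropositionalEquality
  open import Relation.Nullary.Decidable.Core using (yes; no; _×-dec_)
  open import Relation.Nullary.Negation.Core using (¬_; contradiction)

  private
    bin : ℕ → ℕ → ℕ
    bin n       zero    = 1
    bin zero    (suc k) = 0
    bin (suc n) (suc k) = bin n k + bin n (suc k)

    absorb : ∀ n k → suc k * bin (suc n) (suc k) ≡ suc n * bin n k
    absorb zero    zero    = refl
    absorb zero    (suc k) = *-zeroʳ (suc (suc k))
    absorb (suc n) zero    = trans (ring (bin (suc n) 1)) (cong (λ y → 1 + y) (trans (sym (+-identityʳ _)) (absorb n 0)))
      where
      ring : ∀ y → 1 * (1 + y) ≡ 1 + y
      ring = solve-∀
    absorb (suc n) (suc k) = begin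
      (2 + k) * (u + v)                        ≡⟨ ring₁ k u v ⟩
      u + ((1 + k) * u + (2 + k) * v)          ≡⟨ cong₂ (λ x y → u + (x + y)) (absorb n k) (absorb n (suc k)) ⟩
      u + (suc n * x + suc n * y)              ≡⟨⟩
      (x + y) + (suc n * x + suc n * y)        ≡⟨ ring₂ n x y ⟩
      (2 + n) * (x + y)                        ∎
      where
      open ≡-Reasoning
      x y u v : ℕ
      x = bin n k
      y = bin n (suc k)
      u = bin (suc n) (suc k)
      v = bin (suc n) (suc (suc k))
      ring₁ : ∀ k u v → (2 + k) * (u + v) ≡ u + ((1 + k) * u + (2 + k) * v)
      ring₁ = solve-∀
      ring₂ : ∀ n x y → (x + y) + (suc n * x + suc n * y) ≡ (2 + n) * (x + y)
      ring₂ = solve-∀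

    bin>0 : ∀ {n k} → k ≤ n → 0 < bin n k
    bin>0 z≤n               = s≤s z≤n
    bin>0 {suc n} (s≤s k≤n) = ≤-trans (bin>0 k≤n) (m≤m+n _ _)

    -- The entries of Leibniz's harmonic triangle are integral combinations of
    -- 1, 1/2, …, 1/(n+1).
    leibniz : ∀ k n → k ≤ n → ∀ M → (∀ i → 1 ≤ i → i ≤ suc n → i ∣ M) → suc n * bin n k ∣ M
    leibniz zero    n       _         M h = subst (_∣ M) (sym (*-identityʳ (suc n))) (h (suc n) (s≤s z≤n) ≤-refl)
    leibniz (suc k) (suc n) (s≤s k≤n) M h
      with leibniz k n k≤n M (λ i 1≤i i≤n → h i 1≤i (m≤n⇒m≤1+n i≤n)) | leibniz k (suc n) (m≤n⇒m≤1+n k≤n) M h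
    ... | divides q₁ e₁ | divides q₂ e₂ = ∣m+n∣m⇒∣n (divides q₁ (trans (+-comm (q₂ * C) M) (sym key))) (n∣m*n q₂)
      where
      x y A B C : ℕ
      x = bin (suc n) k
      y = bin (suc n) (suc k)
      A = suc n * bin n k
      B = suc (suc n) * x
      C = suc (suc n) * y
      -- The rule 1 / A = 1 / B + 1 / C of the harmonic triangle without denominators; hence M / C =
      -- M / A - M / B.
      identity : A * B + C * A ≡ C * B
      identity = begin
        A * B + C * A                                       ≡⟨ cong₂ (λ a b → a * b + C * a) (sym (absorb n k)) (sym (absorb (suc n) k)) ⟩
        (suc k * y) * (suc k * (x + y)) + C * (suc k * y)   ≡⟨ ring (suc k) y (suc k * (x + y)) (suc (suc n)) ⟩
        (suc k * y) * (suc k * (x + y) + suc (suc n) * y)   ≡⟨ cong (λ b → (suc k * y) * (b + suc (suc n) * y)) (absorb (suc n) k) ⟩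
        (suc k * y) * (suc (suc n) * x + suc (suc n) * y)   ≡⟨ ring′ (suc k) y x (suc (suc n)) ⟩
        C * (suc k * (x + y))                               ≡⟨ cong (C *_) (absorb (suc n) k) ⟩
        C * B                                               ∎
        where
        open ≡-Reasoning
        ring : ∀ k y b n → (k * y) * b + (n * y) * (k * y) ≡ (k * y) * (b + n * y)
        ring = solve-∀
        ring′ : ∀ k y x n → (k * y) * (n * x + n * y) ≡ (n * y) * (k * (x + y))
        ring′ = solve-∀
      key : q₁ * C ≡ M + q₂ * C
      key = *-cancelʳ-≡ (q₁ * C) (M + q₂ * C) B {{>-nonZero (*-mono-< (s≤s (z≤n {suc n})) (bin>0 (m≤n⇒m≤1+n k≤n)))}} (begin
        q₁ * C * B                    ≡⟨ *-assoc q₁ C B ⟩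
        q₁ * (C * B)                  ≡⟨ cong (q₁ *_) identity ⟨
        q₁ * (A * B + C * A)          ≡⟨ ring q₁ A B C ⟩
        (q₁ * A) * B + C * (q₁ * A)   ≡⟨ cong₂ (λ a b → a * B + C * b) (sym e₁) (trans (sym e₁) e₂) ⟩
        M * B + C * (q₂ * B)          ≡⟨ ring′ q₂ M B C ⟩
        (M + q₂ * C) * B              ∎)
        where
        open ≡-Reasoning
        ring : ∀ q A B C → q * (A * B + C * A) ≡ (q * A) * B + C * (q * A)
        ring = solve-∀
        ring′ : ∀ q M B C → M * B + C * (q * B) ≡ (M + q * C) * B
        ring′ = solve-∀

    row : ℕ → ℕ → ℕ
    row n zero    = bin n 0
    row n (suc k) = row n k + bin n (suc k)

    row-suc : ∀ n k → row (suc n) (suc k) ≡ row n k + row n (suc k)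
    row-suc n zero    = refl
    row-suc n (suc k) = trans (cong (_+ bin (suc n) (suc (suc k))) (row-suc n k)) (ring (row n k) (row n (suc k)) (bin n (suc k)) (bin n (suc (suc k))))
      where
      ring : ∀ a b c d → (a + b) + (c + d) ≡ (a + c) + (b + d)
      ring = solve-∀

    row-all : ∀ n k → n ≤ k → row n k ≡ 2 ^ n
    row-all zero    zero    _ = refl
    row-all zero    (suc k) _ = trans (+-identityʳ _) (row-all zero k z≤n)
    row-all (suc n) (suc k) (s≤s n≤k) = trans (row-suc n k) (trans (cong₂ _+_ (row-all n k n≤k) (row-all n (suc k) (m≤n⇒m≤1+n n≤k))) (cong (2 ^ n +_) (sym (+-identityʳ (2 ^ n)))))

    -- M is a multiple of `suc n * bin n k` for every k ≤ n, hence at least as large as each of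
    -- these n + 1 numbers, and their sum is (n + 1) 2 ^ n.
    multiple-large : ∀ n M → 0 < M → (∀ i → 1 ≤ i → i ≤ suc n → i ∣ M) → 2 ^ n ≤ M
    multiple-large n M M>0 h = *-cancelˡ-≤ (suc n) (subst (λ y → suc n * y ≤ suc n * M) (row-all n n ≤-refl) (upTo n ≤-refl))
      where
      upTo : ∀ k → k ≤ n → suc n * row n k ≤ suc k * M
      upTo zero    k≤n = ≤-trans (∣⇒≤ {{>-nonZero M>0}} (leibniz 0 n k≤n M h)) (≤-reflexive (sym (+-identityʳ M)))
      upTo (suc k) k<n = begin
        suc n * (row n k + bin n (suc k))           ≡⟨ *-distribˡ-+ (suc n) (row n k) _ ⟩
        suc n * row n k + suc n * bin n (suc k)     ≤⟨ +-mono-≤ (upTo k (≤-trans (n≤1+n k) k<n)) (∣⇒≤ {{>-nonZero M>0}} (leibniz (suc k) n k<n M h)) ⟩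
        suc k * M + M                               ≡⟨ +-comm (suc k * M) M ⟩
        suc (suc k) * M                             ∎
        where open ≤-Reasoning

    n<p^n : ∀ {p} → 2 ≤ p → ∀ n → n < p ^ n
    n<p^n 2≤p zero    = s≤s z≤n
    n<p^n {p} 2≤p (suc n) = begin-strict
      suc n          <⟨ s≤s (n<p^n 2≤p n) ⟩
      1 + p ^ n      ≤⟨ +-monoˡ-≤ (p ^ n) (≤-trans (s≤s z≤n) (n<p^n 2≤p n)) ⟩
      p ^ n + p ^ n  ≡⟨ cong (p ^ n +_) (+-identityʳ (p ^ n)) ⟨
      2 * p ^ n      ≤⟨ *-monoˡ-≤ (p ^ n) 2≤p ⟩
      p * p ^ n      ∎
      where open ≤-Reasoning

    module _ (m : ℕ) (1≤m : 1 ≤ m) where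

      -- k bounds the search. It is used with k = m, beyond all exponents in question, since e < p ^
      -- e for p ≥ 2.
      top : ∀ p k → ∃[ E ] (p ^ E ≤ m × (∀ e → e ≤ k → p ^ e ≤ m → e ≤ E))
      top p zero = 0 , 1≤m , λ { zero z≤n _ → z≤n }
      top p (suc k) with p ^ suc k ≤? m
      ... | yes h = suc k , h , λ e e≤ _ → e≤
      ... | no ¬h = let (E , h , f) = top p k in E , h , λ e e≤ pe → f e (≤-pred (≤∧≢⇒< e≤ λ { refl → ¬h pe })) pe

      power : ℕ → ℕ
      power p with prime? p
      ... | yes _ = p ^ proj₁ (top p m)
      ... | no _  = 1

      Q : ℕ → ℕ
      Q zero    = 1
      Q (suc N) = power (suc N) * Q N

      power≤m : ∀ p → power p ≤ m
      power≤m p with prime? p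
      ... | yes _ = proj₁ (proj₂ (top p m))
      ... | no _  = 1≤m

      power>0 : ∀ p → 0 < power p
      power>0 p with prime? p
      ... | yes pr = m^n>0 p {{prime⇒nonZero pr}} (proj₁ (top p m))
      ... | no _   = s≤s z≤n

      Q>0 : ∀ N → 0 < Q N
      Q>0 zero    = s≤s z≤n
      Q>0 (suc N) = *-mono-< (power>0 (suc N)) (Q>0 N)

      Q≤ : ∀ N → Q N ≤ m ^ N
      Q≤ zero    = ≤-refl
      Q≤ (suc N) = *-mono-≤ (power≤m (suc N)) (Q≤ N)

      strip : ∀ p → 2 ≤ p → ∀ i → 1 ≤ i → ∃[ e ] ∃[ j ] (i ≡ p ^ e * j × ¬ p ∣ j)
      strip p 2≤p = <-rec _ step
        where
        step : ∀ i → (∀ {i′} → i′ < i → 1 ≤ i′ → ∃[ e ] ∃[ j ] (i′ ≡ p ^ e * j × ¬ p ∣ j)) → 1 ≤ i → ∃[ e ] ∃[ j ] (i ≡ p ^ e * j × ¬ p ∣ j)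
        step i rec 1≤i with p ∣? i
        ... | no p∤i = 0 , i , sym (+-identityʳ i) , p∤i
        ... | yes (divides zero refl) = contradiction 1≤i λ ()
        ... | yes (divides k@(suc _) refl) with rec (m<m*n k p 2≤p) (s≤s z≤n)
        ... | e , j , eq , p∤j = suc e , j , trans (*-comm k p) (trans (cong (p *_) eq) (sym (*-assoc p (p ^ e) j))) , p∤j

      SmoothDivides : ℕ → Set
      SmoothDivides N = ∀ i → 1 ≤ i → i ≤ m → (∀ r → Prime r → r ∣ i → r ≤ N) → i ∣ Q N

      -- The part of i at a prime `suc N` is a power not exceeding m, so it divides the power
      -- contained in `Q`; what remains of i is N-smooth.
      smooth : ∀ N → SmoothDivides N
      smooth zero i 1≤i _ h = subst (_∣ 1) (sym (noPrimes i 1≤i h)) ∣-refl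
        where
        noPrimes : ∀ i → 1 ≤ i → (∀ r → Prime r → r ∣ i → r ≤ 0) → i ≡ 1
        noPrimes i 1≤i h with factorise i {{>-nonZero 1≤i}}
        ... | record { factors = [] ; isFactorisation = e } = e
        ... | record { factors = r ∷ rs ; isFactorisation = e ; factorsPrime = pr ∷ _ } =
          contradiction (h r pr (divides (product rs) (trans e (*-comm r (product rs))))) (<⇒≱ (<-trans (s≤s z≤n) (nonTrivial⇒n>1 r {{prime⇒nonTrivial pr}})))
      smooth (suc N) i 1≤i i≤m h with prime? (suc N)
      ... | no ¬pr = subst (i ∣_) (sym (+-identityʳ (Q N))) (smooth N i 1≤i i≤m λ r pr r∣i → ≤-pred (≤∧≢⇒< (h r pr r∣i) λ { refl → ¬pr pr }))
      ... | yes pr with strip (suc N) (nonTrivial⇒n>1 (suc N) {{prime⇒nonTrivial pr}}) i 1≤i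
      ... | e , j , refl , p∤j = *-pres-∣ (le⇒∣ (proj₂ (proj₂ (top (suc N) m)) e e≤m pe≤m)) (smooth N j 1≤j (≤-trans (m≤n*m j (suc N ^ e) {{m^n≢0 (suc N) e}}) i≤m) primes)
        where
        1≤j : 1 ≤ j
        1≤j = n≢0⇒n>0 λ j≡0 → contradiction (subst (1 ≤_) (trans (cong (suc N ^ e *_) j≡0) (*-zeroʳ (suc N ^ e))) 1≤i) λ ()
        pe≤m : suc N ^ e ≤ m
        pe≤m = ≤-trans (m≤m*n (suc N ^ e) j {{>-nonZero 1≤j}}) i≤m
        e≤m : e ≤ m
        e≤m = ≤-trans (<⇒≤ (n<p^n (nonTrivial⇒n>1 (suc N) {{prime⇒nonTrivial pr}}) e)) pe≤m
        le⇒∣ : ∀ {e E} → e ≤ E → suc N ^ e ∣ suc N ^ E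
        le⇒∣ {e} {E} e≤E = divides (suc N ^ (E ∸ e)) (trans (cong (suc N ^_) (sym (m∸n+n≡m e≤E))) (^-distribˡ-+-* (suc N) (E ∸ e) e))
        primes : ∀ r → Prime r → r ∣ j → r ≤ N
        primes r rp r∣j = ≤-pred (≤∧≢⇒< (h r rp (∣-trans r∣j (n∣m*n (suc N ^ e)))) λ { refl → p∤j r∣j })

  -- If there were no prime in the interval, all numbers up to 2 ^ 2a would be
  -- 2 ^ a-smooth, so their least common multiple would be too small.
  prime-between : ∀ a → 3 ≤ a → ∃[ p ] (Prime p × 2 ^ a < p × p ≤ 2 ^ (a * 2))
  prime-between a 3≤a with anyUpTo? (λ p → prime? p ×-dec (2 ^ a <? p)) (suc (2 ^ (a * 2)))
  ... | yes (p , s≤s p≤ , pr , <p) = p , pr , <p , p≤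
  ... | no none = contradiction (multiple-large n M (Q>0 m 1≤m N) all) (<⇒≱ tooSmall)
    where
    N m n M : ℕ
    N = 2 ^ a
    m = 2 ^ (a * 2)
    n = pred m
    1≤m : 1 ≤ m
    1≤m = m^n>0 2 (a * 2)
    m≡ : suc n ≡ m
    m≡ = suc-pred m {{>-nonZero 1≤m}}
    M = Q m 1≤m N
    all : ∀ i → 1 ≤ i → i ≤ suc n → i ∣ M
    all i 1≤i i≤ = smooth m 1≤m N i 1≤i i≤m λ r pr r∣i → ≮⇒≥ λ N<r → none (r , s≤s (≤-trans (∣⇒≤ {{>-nonZero 1≤i}} r∣i) i≤m) , pr , N<r)
      where
      i≤m : i ≤ m
      i≤m = subst (i ≤_) m≡ i≤
    linear : ∀ d → suc ((3 + d) * 2) ≤ 2 ^ (3 + d)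
    linear zero    = s≤s (s≤s (s≤s (s≤s (s≤s (s≤s (s≤s z≤n))))))
    linear (suc d) = begin
      3 + (3 + d) * 2                                ≡⟨ +-comm 3 _ ⟩
      (3 + d) * 2 + 3                                ≤⟨ +-mono-≤ (≤-trans (n≤1+n _) (linear d)) (≤-trans (s≤s (s≤s (s≤s z≤n))) (linear d)) ⟩
      2 ^ (3 + d) + 2 ^ (3 + d)                      ≡⟨ cong (2 ^ (3 + d) +_) (+-identityʳ _) ⟨
      2 ^ (4 + d)                                    ∎
      where open ≤-Reasoning
    2a<2^a : suc (a * 2) ≤ 2 ^ a
    2a<2^a = subst (λ x → suc (x * 2) ≤ 2 ^ x) (m+[n∸m]≡n 3≤a) (linear (a ∸ 3))
    -- M is at most m ^ N = 2 ^ (2 a N), and 2 + 2 a N ≤ (2 a + 1) N ≤ N * N = m. The inequality 2 a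
    -- + 1 ≤ 2 ^ a holds from a = 3 on.
    tooSmall : M < 2 ^ n
    tooSmall = ≤-<-trans (Q≤ m 1≤m N) (≤-<-trans (≤-reflexive (^-*-assoc 2 (a * 2) N)) (^-monoʳ-< 2 (s≤s (s≤s z≤n)) (≤-pred (begin
      suc (suc (a * 2 * N))   ≤⟨ +-monoˡ-≤ (a * 2 * N) (≤-trans (s≤s (s≤s z≤n)) (^-monoʳ-≤ 2 {{_}} (≤-trans (s≤s z≤n) 3≤a))) ⟩
      N + a * 2 * N           ≡⟨⟩
      suc (a * 2) * N         ≤⟨ *-monoˡ-≤ N 2a<2^a ⟩
      N * N                   ≡⟨ ^-distribˡ-+-* 2 a a ⟨
      2 ^ (a + a)             ≡⟨ cong (2 ^_) (trans (cong (a +_) (sym (+-identityʳ a))) (*-comm 2 a)) ⟩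
      m                       ≡⟨ m≡ ⟨
      suc n                   ∎))))
      where open ≤-Reasoning

-- Closed walks in pseudometric spaces

module Walks where

  open import Data.List.Base using (List; []; _∷_; _++_; map)
  open import Data.List.Relation.Binary.Sublist.Propositional using (_⊆_; []; _∷_; _∷ʳ_)
  open import Data.List.Relation.Binary.Permutation.Propositional using (_↭_; ↭⇒↭ₛ)
  open import Data.List.Relation.Unary.AllPairs using (AllPairs)
  open import Data.List.Properties using (++-identityʳ)
  open import Data.Nat.Base
  open import Data.Nat.Properties
  open import Data.Nat.Tactic.RingSolver using (solve-∀)
  open import Relation.Binary.PropositionalEquality

  private variable
    A : Set

  path : (A → A → ℕ) → A → List A → A → ℕ
  path d x []       z = d x z
  path d x (y ∷ ys) z = d x y + path d y ys z

  cyc : (A → A → ℕ) → List A → ℕ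
  cyc d []       = 0
  cyc d (x ∷ xs) = path d x xs x

  path-++ : ∀ (d : A → A → ℕ) x xs y ys z → path d x (xs ++ y ∷ ys) z ≡ path d x xs y + path d y ys z
  path-++ d x []        y ys z = refl
  path-++ d x (x′ ∷ xs) y ys z = trans (cong (d x x′ +_) (path-++ d x′ xs y ys z)) (sym (+-assoc (d x x′) _ _))

  cyc-rotate : ∀ (d : A → A → ℕ) xs ys → cyc d (xs ++ ys) ≡ cyc d (ys ++ xs)
  cyc-rotate d []       []       = refl
  cyc-rotate d []       (y ∷ ys) = cong (λ l → path d y l y) (sym (++-identityʳ ys))
  cyc-rotate d (x ∷ xs) []       = cong (λ l → path d x l x) (++-identityʳ xs)
  cyc-rotate d (x ∷ xs) (y ∷ ys) = trans (path-++ d x xs y ys x) (trans (+-comm (path d x xs y) _) (sym (path-++ d y ys x xs y)))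

  path-map : ∀ {B : Set} (d : A → A → ℕ) (f : B → A) x xs z → path (λ i j → d (f i) (f j)) x xs z ≡ path d (f x) (map f xs) (f z)
  path-map d f x []       z = refl
  path-map d f x (y ∷ ys) z = cong (d (f x) (f y) +_) (path-map d f y ys z)

  cyc-map : ∀ {B : Set} (d : A → A → ℕ) (f : B → A) xs → cyc (λ i j → d (f i) (f j)) xs ≡ cyc d (map f xs)
  cyc-map d f []       = refl
  cyc-map d f (x ∷ xs) = path-map d f x xs x

  unique-↭ : ∀ {xs ys : List A} → xs ↭ ys → AllPairs _≢_ xs → AllPairs _≢_ ys
  unique-↭ {A} p = Unique-resp-↭ (↭⇒↭ₛ p)
    where open import Data.List.Relation.Binary.Permutation.Setoid.Properties (setoid A) using (Unique-resp-↭)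

  -- Distinct points may be at distance 0: edge weights may be 0, and points of a net may coincide.
  record Pseudometric (A : Set) : Set where
    field
      d        : A → A → ℕ
      d-refl   : ∀ x → d x x ≡ 0
      d-sym    : ∀ x y → d x y ≡ d y x
      triangle : ∀ x y z → d x z ≤ d x y + d y z

    path-head : ∀ x y zs w → path d x zs w ≤ d x y + path d y zs w
    path-head x y []       w = triangle x y w
    path-head x y (z ∷ zs) w = ≤-trans (+-monoˡ-≤ _ (triangle x y z)) (≤-reflexive (+-assoc (d x y) (d y z) _))

    path-last : ∀ x zs w w′ → path d x zs w ≤ path d x zs w′ + d w′ w
    path-last x []       w w′ = triangle x w′ w
    path-last x (z ∷ zs) w w′ = ≤-trans (+-monoʳ-≤ (d x z) (path-last z zs w w′)) (≤-reflexive (sym (+-assoc (d x z) _ _)))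

    path-⊆ : ∀ {xs ys} → xs ⊆ ys → ∀ x z → path d x xs z ≤ path d x ys z
    path-⊆ []                x z = ≤-refl
    path-⊆ {xs} (y ∷ʳ s)     x z = ≤-trans (path-head x y xs z) (+-monoʳ-≤ (d x y) (path-⊆ s y z))
    path-⊆ (_∷_ {x = y} refl s) x z = +-monoʳ-≤ (d x y) (path-⊆ s y z)

    cyc-∷ : ∀ x xs → cyc d xs ≤ cyc d (x ∷ xs)
    cyc-∷ x []       = z≤n
    cyc-∷ x (y ∷ ys) = ≤-trans (path-last y ys y x) (≤-reflexive (+-comm _ (d x y)))

    cyc-⊆ : ∀ {xs ys} → xs ⊆ ys → cyc d xs ≤ cyc d ys
    cyc-⊆ []         = z≤n
    cyc-⊆ {xs} (y ∷ʳ s) = ≤-trans (cyc-∷ y xs) (path-⊆ s y y)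
    cyc-⊆ (_∷_ {x = y} refl s) = path-⊆ s y y

    detour : ∀ x y ys z → path d x (y ∷ ys) z ≤ 2 * d x y + path d x ys z
    detour x y ys z = ≤-trans (+-monoʳ-≤ (d x y) (path-head y x ys z)) (≤-reflexive (trans (cong (λ e → d x y + (e + path d x ys z)) (d-sym y x)) (ring (d x y) _)))
      where
      ring : ∀ a b → a + (a + b) ≡ 2 * a + b
      ring = solve-∀

    -- ws visits points of vs in order, possibly repeatedly or not at all.
    data Stutter : List A → List A → Set where
      []   : Stutter [] []
      drop : ∀ {ws vs} v → Stutter ws vs → Stutter ws (v ∷ vs)
      keep : ∀ {ws vs} v → Stutter ws (v ∷ vs) → Stutter (v ∷ ws) (v ∷ vs)

    path-stutter : ∀ {ws vs} → Stutter ws vs → ∀ x z → path d x ws z ≤ path d x vs z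
    path-stutter []               x z = ≤-refl
    path-stutter {ws} (drop v s)  x z = ≤-trans (path-head x v ws z) (+-monoʳ-≤ (d x v) (path-stutter s v z))
    path-stutter {vs = v ∷ vs} (keep v s) x z = +-monoʳ-≤ (d x v) (≤-trans (path-stutter s v z) (≤-reflexive (cong (_+ path d v vs z) (d-refl v))))

    cyc-stutter : ∀ {ws v vs} → Stutter ws (v ∷ vs) → cyc d ws ≤ cyc d (v ∷ vs)
    cyc-stutter {ws} {v} {vs} s = ≤-trans (cyc-∷ v ws) (≤-trans (path-stutter s v v) (≤-reflexive (cong (_+ path d v vs v) (d-refl v))))

-- Every tour is at least as long as a dominated tree

module TreeLowerBound where

  open Walks
  open import Data.Empty using (⊥)
  open import Data.List.Base using (List; []; _∷_; _++_; map)
  open import Data.List.Membership.Propositional using (_∈_)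
  open import Data.List.Membership.Propositional.Properties using (∈-∃++)
  open import Data.List.Relation.Binary.Permutation.Propositional using (_↭_; refl; ↭-sym; ↭-trans)
  open import Data.List.Relation.Binary.Permutation.Propositional.Properties using (∈-resp-↭; drop-mid; ++-comm; ↭-singleton-inv) renaming (map⁺ to map-↭)
  open import Data.List.Relation.Binary.Permutation.Propositional.Properties using (↭-empty-inv)
  open import Data.List.Relation.Unary.All as All using (All; []; _∷_)
  import Data.List.Relation.Unary.All.Properties as All
  open import Data.List.Relation.Unary.AllPairs using (AllPairs; []; _∷_)
  open import Data.List.Relation.Unary.Any using (here; there)
  open import Data.Nat.Base
  open import Data.Nat.ListAction using (sum)
  open import Data.Nat.ListAction.Properties using (sum-↭)
  open import Data.Nat.Properties
  open import Data.Nat.Tactic.RingSolver using (solve-∀)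
  open import Data.Product.Base using (∃-syntax; _×_; _,_; proj₁; proj₂)
  open import Data.Sum.Base using (_⊎_; inj₁; inj₂)
  open import Relation.Binary.Definitions using (tri<; tri≈; tri>)
  open import Relation.Binary.PropositionalEquality hiding (refl)
  open import Relation.Binary.PropositionalEquality using () renaming (refl to ≡-refl)
  open import Relation.Nullary.Decidable.Core using (yes; no)
  open import Relation.Nullary.Negation.Core using (contradiction)

  iota : ℕ → ℕ → List ℕ
  iota p zero    = []
  iota p (suc c) = p ∷ iota (suc p) c

  iota-∈ : ∀ {x} p c → p ≤ x → x < p + c → x ∈ iota p c
  iota-∈ p zero    p≤x x<p = contradiction (<-≤-trans x<p (≤-trans (≤-reflexive (+-identityʳ p)) p≤x)) (<-irrefl ≡-refl)
  iota-∈ {x} p (suc c) p≤x x<p with p ≟ x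
  ... | yes ≡-refl = here ≡-refl
  ... | no p≢x     = there (iota-∈ (suc p) c (≤∧≢⇒< p≤x p≢x) (<-≤-trans x<p (≤-reflexive (+-suc p c))))

  iota-bounds : ∀ {x} p c → x ∈ iota p c → p ≤ x × x < p + c
  iota-bounds p (suc c) (here ≡-refl) = ≤-refl , m<m+n p (s≤s z≤n)
  iota-bounds p (suc c) (there x∈) = let (l , u) = iota-bounds (suc p) c x∈ in ≤-trans (n≤1+n p) l , <-≤-trans u (≤-reflexive (sym (+-suc p c)))

  sum-snoc : ∀ (f : ℕ → ℕ) p c → sum (map f (iota p (suc c))) ≡ sum (map f (iota p c)) + f (p + c)
  sum-snoc f p zero    = trans (+-identityʳ (f p)) (cong f (sym (+-identityʳ p)))
  sum-snoc f p (suc c) = trans (cong (f p +_) (trans (sum-snoc f (suc p) c) (cong (λ y → sum (map f (iota (suc p) c)) + f y) (sym (+-suc p c))))) (sym (+-assoc (f p) _ _))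

  -- Points 0, …, k ∸ 1 on a line, with heights h above the root of a tree;
  -- e g is the height of the least common ancestor of g ∸ 1 and g.
  module Dual (h e : ℕ → ℕ) where

    -- The height of the least common ancestor of i and i + 1 + c.
    low : ℕ → ℕ → ℕ
    low i zero    = e (suc i)
    low i (suc c) = e (suc i) ⊓ low (suc i) c

    low-attained : ∀ i c → ∃[ g ] (i < g × g ≤ suc (i + c) × low i c ≡ e g)
    low-attained i zero    = suc i , ≤-refl , s≤s (m≤m+n i 0) , ≡-refl
    low-attained i (suc c) with ⊓-sel (e (suc i)) (low (suc i) c) | low-attained (suc i) c
    ... | inj₁ eq | _ = suc i , ≤-refl , s≤s (m≤m+n i (suc c)) , eq
    ... | inj₂ eq | g , i<g , g≤ , eq′ = g , <-trans (n<1+n i) i<g , ≤-trans g≤ (≤-reflexive (cong suc (sym (+-suc i c)))) , trans eq eq′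

    low-gap : ∀ i c g → i < g → g ≤ suc (i + c) → low i c ≤ e g
    low-gap i zero    g i<g g≤ rewrite ≤-antisym i<g (≤-trans g≤ (≤-reflexive (cong suc (+-identityʳ i)))) = ≤-refl
    low-gap i (suc c) g i<g g≤ with suc i ≟ g
    ... | yes ≡-refl = m⊓n≤m _ _
    ... | no  i≢g    = ≤-trans (m⊓n≤n _ _) (low-gap (suc i) c g (≤∧≢⇒< i<g i≢g) (≤-trans g≤ (≤-reflexive (cong suc (+-suc i c)))))

    lca : ℕ → ℕ → ℕ
    lca i j with <-cmp i j
    ... | tri< _ _ _ = low i (j ∸ suc i)
    ... | tri≈ _ _ _ = 0
    ... | tri> _ _ _ = low j (i ∸ suc j)

    private
      lca-< : ∀ {i j} → i < j → lca i j ≡ low i (j ∸ suc i)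
      lca-< {i} {j} i<j with <-cmp i j
      ... | tri< _ _ _ = ≡-refl
      ... | tri≈ ¬p _ _ = contradiction i<j ¬p
      ... | tri> ¬p _ _ = contradiction i<j ¬p
      lca-> : ∀ {i j} → j < i → lca i j ≡ low j (i ∸ suc j)
      lca-> {i} {j} j<i with <-cmp i j
      ... | tri> _ _ _ = ≡-refl
      ... | tri≈ _ _ ¬p = contradiction j<i ¬p
      ... | tri< _ _ ¬p = contradiction j<i ¬p

      span : ∀ {i j} → i < j → suc (i + (j ∸ suc i)) ≡ j
      span {i} {j} i<j = m+[n∸m]≡n {suc i} i<j

    lca-sym : ∀ i j → lca i j ≡ lca j i
    lca-sym i j with <-cmp i j
    ... | tri< i<j _ _ = sym (lca-> i<j)
    ... | tri> _ _ j<i = sym (lca-< j<i)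
    ... | tri≈ _ ≡-refl _ with <-cmp i i
    ...   | tri< p _ _ = contradiction p (<-irrefl ≡-refl)
    ...   | tri≈ _ _ _ = ≡-refl
    ...   | tri> _ _ p = contradiction p (<-irrefl ≡-refl)

    lca-gap : ∀ {i j} g → i < g → g ≤ j → lca i j ≤ e g
    lca-gap {i} {j} g i<g g≤j = ≤-trans (≤-reflexive (lca-< i<j)) (low-gap i (j ∸ suc i) g i<g (≤-trans g≤j (≤-reflexive (sym (span i<j)))))
      where
      i<j : i < j
      i<j = <-≤-trans i<g g≤j

    -- Every gap between a and b also lies between p and b.
    lca-left : ∀ {p a b} → p < a → a < b → lca p b ≤ lca a b
    lca-left {p} {a} {b} p<a a<b with low-attained a (b ∸ suc a)
    ... | g , a<g , g≤ , eq = ≤-trans (lca-gap g (<-trans p<a a<g) (≤-trans g≤ (≤-reflexive (span a<b)))) (≤-reflexive (trans (sym eq) (sym (lca-< a<b))))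

    segment : List ℕ → ℕ
    segment []           = 0
    segment (x ∷ [])     = 0
    segment (x ∷ y ∷ ys) = lca x y + segment (y ∷ ys)

    private
      first-gap : ∀ {p a} → p < a → lca p a ≤ e (suc p)
      first-gap {p} p<a = lca-gap (suc p) ≤-refl p<a

      -- The nearer of a and b meets p no higher than the gap right after p, and the farther one
      -- meets p no higher than it meets the nearer one.
      through : ∀ p a b → p < a → p < b → a ≢ b → lca a p + lca p b ≤ e (suc p) + lca a b
      through p a b p<a p<b a≢b with <-cmp a b
      ... | tri≈ _ a≡b _ = contradiction a≡b a≢b
      ... | tri< a<b _ _ = +-mono-≤ (≤-trans (≤-reflexive (lca-sym a p)) (first-gap p<a)) (≤-trans (lca-left p<a a<b) (≤-reflexive (lca-< a<b)))
      ... | tri> _ _ b<a = ≤-trans (≤-reflexive (+-comm (lca a p) (lca p b))) (+-mono-≤ (first-gap p<b) (≤-trans (≤-reflexive (lca-sym a p)) (≤-trans (lca-left p<b b<a) (≤-reflexive (lca-< b<a)))))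

      delete : ∀ p xs ys → All (p <_) (xs ++ ys) → AllPairs _≢_ (xs ++ ys) → segment (xs ++ p ∷ ys) ≤ e (suc p) + segment (xs ++ ys)
      delete p []           []       _           _  = z≤n
      delete p []           (y ∷ ys) (p<y ∷ _)   _  = +-monoˡ-≤ _ (first-gap p<y)
      delete p (a ∷ [])     []       (p<a ∷ _)   _  = ≤-trans (≤-reflexive (trans (+-identityʳ _) (lca-sym a p))) (≤-trans (first-gap p<a) (≤-reflexive (sym (+-identityʳ _))))
      delete p (a ∷ [])     (b ∷ ys) (p<a ∷ p<b ∷ _) ((a≢b ∷ _) ∷ _) =
        ≤-trans (≤-reflexive (sym (+-assoc (lca a p) _ _))) (≤-trans (+-monoˡ-≤ _ (through p a b p<a p<b a≢b)) (≤-reflexive (+-assoc (e (suc p)) _ _)))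
      delete p (a ∷ a′ ∷ xs) ys (_ ∷ ps) (_ ∷ us) = ≤-trans (+-monoʳ-≤ (lca a a′) (delete p (a′ ∷ xs) ys ps us)) (≤-reflexive (ring (lca a a′) (e (suc p)) _))
        where
        ring : ∀ a b c → a + (b + c) ≡ b + (a + c)
        ring = solve-∀

    gaps : ℕ → ℕ → ℕ
    gaps p c = sum (map e (iota (suc p) c))

    iota-unique : ∀ p c → AllPairs _≢_ (iota p c)
    iota-unique p zero    = []
    iota-unique p (suc c) = All.tabulate (λ x∈ p≡x → <-irrefl p≡x (proj₁ (iota-bounds (suc p) c x∈))) ∷ iota-unique (suc p) c

    -- The smallest point contributes at most the gap after it: delete it from the sequence and
    -- induct. The order from left to right attains the bound.
    segment≤gaps : ∀ c p t → t ↭ iota p (suc c) → segment t ≤ gaps p c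
    segment≤gaps zero p t perm with ↭-singleton-inv perm
    ... | ≡-refl = z≤n
    segment≤gaps (suc c) p t perm with ∈-∃++ (∈-resp-↭ (↭-sym perm) (here ≡-refl))
    ... | xs , ys , ≡-refl = ≤-trans (delete p xs ys larger distinct) (+-monoʳ-≤ (e (suc p)) (segment≤gaps c (suc p) (xs ++ ys) rest))
      where
      rest : xs ++ ys ↭ iota (suc p) (suc c)
      rest = drop-mid xs [] perm
      larger : All (p <_) (xs ++ ys)
      larger = All.tabulate λ x∈ → proj₁ (iota-bounds (suc p) (suc c) (∈-resp-↭ rest x∈))
      distinct : AllPairs _≢_ (xs ++ ys)
      distinct = unique-↭ (↭-sym rest) (iota-unique (suc p) (suc c))

    module _ (k′ g₀ : ℕ) (0<g₀ : 0 < g₀) (g₀≤k′ : g₀ ≤ k′) (e₀ : e g₀ ≡ 0) where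

      private
        Opposite : ℕ → ℕ → Set
        Opposite x y = (x < g₀ × g₀ ≤ y) ⊎ (y < g₀ × g₀ ≤ x)

        SameSide : ℕ → ℕ → Set
        SameSide x y = (x < g₀ × y < g₀) ⊎ (g₀ ≤ x × g₀ ≤ y)

        crossing : ∀ {x y} → Opposite x y → lca x y ≡ 0
        crossing {x} {y} (inj₁ (x<g , g≤y)) = n≤0⇒n≡0 (≤-trans (lca-gap g₀ x<g g≤y) (≤-reflexive e₀))
        crossing {x} {y} (inj₂ (y<g , g≤x)) = n≤0⇒n≡0 (≤-trans (≤-reflexive (lca-sym x y)) (≤-trans (lca-gap g₀ y<g g≤x) (≤-reflexive e₀)))

        close : ∀ x us y → Opposite x y → All (SameSide x) us → path lca x us y ≡ segment (x ∷ us)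
        close x []       y opp _            = crossing opp
        close x (u ∷ us) y opp (same ∷ all) = cong (lca x u +_) (close u us y (moved same opp) (All.map (moved′ same) all))
          where
          moved : ∀ {x u y} → SameSide x u → Opposite x y → Opposite u y
          moved (inj₁ (_ , u<)) (inj₁ (_ , y≥)) = inj₁ (u< , y≥)
          moved (inj₁ (x< , _)) (inj₂ (_ , x≥)) = contradiction x< (≤⇒≯ x≥)
          moved (inj₂ (x≥ , _)) (inj₁ (x< , _)) = contradiction x< (≤⇒≯ x≥)
          moved (inj₂ (_ , u≥)) (inj₂ (y< , _)) = inj₂ (y< , u≥)
          moved′ : ∀ {x u y} → SameSide x u → SameSide x y → SameSide u y
          moved′ (inj₁ (_ , u<)) (inj₁ (_ , y<)) = inj₁ (u< , y<)
          moved′ (inj₂ (_ , u≥)) (inj₂ (_ , y≥)) = inj₂ (u≥ , y≥)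
          moved′ (inj₁ (x< , _)) (inj₂ (x≥ , _)) = contradiction x< (≤⇒≯ x≥)
          moved′ (inj₂ (x≥ , _)) (inj₁ (x< , _)) = contradiction x< (≤⇒≯ x≥)

        segment-++ : ∀ y ws x us → segment (y ∷ ws ++ x ∷ us) ≡ path lca y ws x + segment (x ∷ us)
        segment-++ y []       x us = ≡-refl
        segment-++ y (w ∷ ws) x us = trans (cong (lca y w +_) (segment-++ w ws x us)) (sym (+-assoc (lca y w) _ _))

        side : ∀ x y → SameSide x y ⊎ Opposite x y
        side x y with x <? g₀ | y <? g₀
        ... | yes x< | yes y< = inj₁ (inj₁ (x< , y<))
        ... | yes x< | no y≮  = inj₂ (inj₁ (x< , ≮⇒≥ y≮))
        ... | no x≮  | yes y< = inj₂ (inj₂ (y< , ≮⇒≥ x≮))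
        ... | no x≮  | no y≮  = inj₁ (inj₂ (≮⇒≥ x≮ , ≮⇒≥ y≮))

        firstOpposite : ∀ x xs → All (SameSide x) xs ⊎ (∃[ us ] ∃[ y ] ∃[ ws ] (xs ≡ us ++ y ∷ ws × All (SameSide x) us × Opposite x y))
        firstOpposite x []       = inj₁ []
        firstOpposite x (y ∷ xs) with side x y | firstOpposite x xs
        ... | inj₂ opp  | _ = inj₂ ([] , y , xs , ≡-refl , [] , opp)
        ... | inj₁ same | inj₁ all = inj₁ (same ∷ all)
        ... | inj₁ same | inj₂ (us , z , ws , ≡-refl , all , opp) = inj₂ (y ∷ us , z , ws , ≡-refl , same ∷ all , opp)

      -- A closed tour crosses the gap g₀; cut it open there.
      cyc-lca≤gaps : ∀ t → t ↭ iota 0 (suc k′) → cyc lca t ≤ gaps 0 k′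
      cyc-lca≤gaps [] perm = z≤n
      cyc-lca≤gaps (x ∷ xs) perm with firstOpposite x xs
      ... | inj₁ all = contradiction (∈-resp-↭ (↭-sym perm) (iota-∈ 0 (suc k′) z≤n (s≤s z≤n))) λ 0∈ →
          absurd (memberSide 0∈) (memberSide (∈-resp-↭ (↭-sym perm) (iota-∈ 0 (suc k′) z≤n (s≤s g₀≤k′))))
        where
        memberSide : ∀ {y} → y ∈ x ∷ xs → SameSide x y
        memberSide (here ≡-refl) with x <? g₀
        ... | yes x< = inj₁ (x< , x<)
        ... | no x≮  = inj₂ (≮⇒≥ x≮ , ≮⇒≥ x≮)
        memberSide (there y∈) = All.lookup all y∈
        absurd : SameSide x 0 → SameSide x g₀ → ⊥
        absurd _ (inj₁ (_ , g<)) = <-irrefl ≡-refl g<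
        absurd (inj₂ (_ , g≤0)) _ = <⇒≱ 0<g₀ g≤0
        absurd (inj₁ (x< , _)) (inj₂ (x≥ , _)) = <⇒≱ x< x≥
      ... | inj₂ (us , y , ws , ≡-refl , all , opp) = begin
        cyc lca (x ∷ us ++ y ∷ ws)              ≡⟨ path-++ lca x us y ws x ⟩
        path lca x us y + path lca y ws x       ≡⟨ cong (_+ path lca y ws x) (close x us y opp all) ⟩
        segment (x ∷ us) + path lca y ws x      ≡⟨ +-comm (segment (x ∷ us)) _ ⟩
        path lca y ws x + segment (x ∷ us)      ≡⟨ segment-++ y ws x us ⟨
        segment (y ∷ ws ++ x ∷ us)              ≤⟨ segment≤gaps k′ 0 _ (↭-trans (++-comm (y ∷ ws) (x ∷ us)) perm) ⟩
        gaps 0 k′                               ∎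
        where open ≤-Reasoning

      module _ (δ : ℕ → ℕ → ℕ) (below : ∀ i g j → i < g → g ≤ j → j ≤ k′ → h i + h j ≤ 2 * δ i j + 2 * e g) (δ-sym : ∀ i j → δ i j ≡ δ j i) where

        private
          edge : ∀ i j → i ≤ k′ → j ≤ k′ → i ≢ j → h i + h j ≤ 2 * δ i j + 2 * lca i j
          edge i j i≤ j≤ i≢j with <-cmp i j
          ... | tri≈ _ i≡j _ = contradiction i≡j i≢j
          ... | tri< i<j _ _ = let (g , i<g , g≤ , eq) = low-attained i (j ∸ suc i) in
            ≤-trans (below i g j i<g (≤-trans g≤ (≤-reflexive (span i<j))) j≤) (≤-reflexive (cong (λ y → 2 * δ i j + 2 * y) (sym eq)))
          ... | tri> _ _ j<i = let (g , j<g , g≤ , eq) = low-attained j (i ∸ suc j) in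
            ≤-trans (≤-reflexive (+-comm (h i) (h j))) (≤-trans (below j g i j<g (≤-trans g≤ (≤-reflexive (span j<i))) i≤) (≤-reflexive (cong₂ (λ x y → 2 * x + 2 * y) (δ-sym j i) (sym eq))))

          along : ∀ x xs z → AllPairs _≢_ (x ∷ xs) → All (_≤ k′) (x ∷ xs) → z ≤ k′ → All (_≢ z) xs → (xs ≡ [] → x ≢ z) →
            h x + 2 * sum (map h xs) + h z ≤ 2 * path δ x xs z + 2 * path lca x xs z
          along x []       z _ (x≤ ∷ _) z≤ _ ne = ≤-trans (≤-reflexive (cong (_+ h z) (+-identityʳ (h x)))) (edge x z x≤ z≤ (ne ≡-refl))
          along x (y ∷ ys) z ((x≢y ∷ _) ∷ us) (x≤ ∷ y≤ ∷ bs) z≤ (y≢z ∷ ys≢z) ne = begin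
            h x + 2 * (h y + sum (map h ys)) + h z                                             ≡⟨ ring₁ (h x) (h y) (sum (map h ys)) (h z) ⟩
            (h x + h y) + (h y + 2 * sum (map h ys) + h z)                                     ≤⟨ +-mono-≤ (edge x y x≤ y≤ x≢y) (along y ys z us (y≤ ∷ bs) z≤ ys≢z λ _ → y≢z) ⟩
            (2 * δ x y + 2 * lca x y) + (2 * path δ y ys z + 2 * path lca y ys z)              ≡⟨ ring₂ (δ x y) (lca x y) (path δ y ys z) (path lca y ys z) ⟩
            2 * (δ x y + path δ y ys z) + 2 * (lca x y + path lca y ys z)                      ∎
            where
            open ≤-Reasoning
            ring₁ : ∀ a b s c → a + 2 * (b + s) + c ≡ (a + b) + (b + 2 * s + c)
            ring₁ = solve-∀
            ring₂ : ∀ a b c d → (2 * a + 2 * b) + (2 * c + 2 * d) ≡ 2 * (a + c) + 2 * (b + d)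
            ring₂ = solve-∀

        -- Summing h x + h y ≤ 2 δ + 2 lca around the tour counts every height twice, and
        -- `cyc-lca≤gaps` bounds the lca terms. Heights minus gaps is the length of the tree.
        heights≤tour : ∀ t → t ↭ iota 0 (suc k′) → sum (map h (iota 0 (suc k′))) ≤ cyc δ t + gaps 0 k′
        heights≤tour [] perm with () ← ↭-empty-inv (↭-sym perm)
        heights≤tour (x ∷ xs) perm = *-cancelˡ-≤ 2 (begin
          2 * sum (map h (iota 0 (suc k′)))              ≡⟨ cong (2 *_) (sum-↭ (map-↭ h perm)) ⟨
          2 * (h x + sum (map h xs))                     ≡⟨ ring (h x) (sum (map h xs)) ⟩
          h x + 2 * sum (map h xs) + h x                 ≤⟨ along x xs x distinct bounds (All.lookup bounds (here ≡-refl)) (All.map (λ p q → p (sym q)) (head distinct)) nonempty ⟩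
          2 * cyc δ (x ∷ xs) + 2 * cyc lca (x ∷ xs)      ≤⟨ +-monoʳ-≤ (2 * cyc δ (x ∷ xs)) (*-monoʳ-≤ 2 (cyc-lca≤gaps (x ∷ xs) perm)) ⟩
          2 * cyc δ (x ∷ xs) + 2 * gaps 0 k′             ≡⟨ *-distribˡ-+ 2 (cyc δ (x ∷ xs)) (gaps 0 k′) ⟨
          2 * (cyc δ (x ∷ xs) + gaps 0 k′)               ∎)
          where
          open ≤-Reasoning
          open Data.List.Relation.Unary.AllPairs using (head)
          ring : ∀ a b → 2 * (a + b) ≡ a + 2 * b + a
          ring = solve-∀
          distinct : AllPairs _≢_ (x ∷ xs)
          distinct = unique-↭ (↭-sym perm) (iota-unique 0 (suc k′))
          bounds : All (_≤ k′) (x ∷ xs)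
          bounds = All.tabulate λ y∈ → ≤-pred (proj₂ (iota-bounds 0 (suc k′) (∈-resp-↭ perm y∈)))
          nonempty : xs ≡ [] → x ≢ x
          nonempty ≡-refl _ with ↭-singleton-inv (↭-sym perm)
          ... | eq = contradiction (≤-trans 0<g₀ g₀≤k′) (λ 0<k′ → singleton k′ 0<k′ eq)
            where
            singleton : ∀ k → 0 < k → iota 0 (suc k) ≡ x ∷ [] → ⊥
            singleton (suc k) _ ()

-- Tours from closed walks, and points visited along a tour

module Tours where

  open Walks
  open EdgeStreams
  open import Defs
  open import Data.Fin.Base using (Fin; suc)
  import Data.Fin.Properties as Fin
  open import Data.List.Base using (List; []; _∷_; _++_; map; allFin; length)
  open import Data.List.Properties using (length-tabulate)
  open import Data.List.Membership.Propositional using (_∈_)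
  open import Data.List.Membership.Propositional.Properties using (∈-∃++; ∈-++⁺ˡ; ∈-++⁺ʳ; ∈-++⁻; ∈-allFin)
  open import Data.List.Membership.DecPropositional using () renaming (_∈?_ to member?)
  open import Data.List.Membership.Propositional.Properties.WithK using (unique∧set⇒bag)
  open import Data.List.Relation.Binary.BagAndSetEquality using (∼bag⇒↭)
  open import Data.List.Relation.Binary.Permutation.Propositional using (_↭_; refl; prep; swap; ↭-sym; ↭-trans)
  open import Data.List.Relation.Binary.Permutation.Propositional.Properties using (∈-resp-↭; ↭-length)
  open import Data.List.Relation.Binary.Sublist.Propositional using (_⊆_; []; _∷_; _∷ʳ_; minimum)
  open import Data.List.Relation.Unary.All as All using (All; []; _∷_)
  open import Data.List.Relation.Unary.AllPairs using (AllPairs; []; _∷_)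
  open import Data.List.Relation.Unary.Any using (here; there)
  open import Data.List.Relation.Unary.Unique.Propositional.Properties using (allFin⁺)
  open import Data.Nat.Base
  open import Data.Nat.Properties
  open import Data.Product.Base using (∃-syntax; _×_; _,_)
  open import Data.Sum.Base using (_⊎_; inj₁; inj₂)
  open import Function.Bundles using (mk⇔)
  open import Relation.Binary.PropositionalEquality hiding (refl)
  open import Relation.Binary.PropositionalEquality using () renaming (refl to ≡-refl)
  open import Relation.Nullary.Decidable.Core using (Dec; yes; no)

  opaque
    nub : ∀ {A : Set} → (∀ x (xs : List A) → Dec (x ∈ xs)) → (ws : List A) → ∃[ vs ] (vs ⊆ ws × AllPairs _≢_ vs × (∀ {x} → x ∈ ws → x ∈ vs))
    nub ∈? []       = [] , [] , [] , λ ()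
    nub ∈? (w ∷ ws) with nub ∈? ws
    ... | vs , sub , uniq , all with ∈? w vs
    ... | yes w∈ = vs , w ∷ʳ sub , uniq , λ { (here ≡-refl) → w∈ ; (there x∈) → all x∈ }
    ... | no w∉  = w ∷ vs , ≡-refl ∷ sub , All.tabulate (λ x∈ w≡x → w∉ (subst (_∈ vs) (sym w≡x) x∈)) ∷ uniq , λ { (here ≡-refl) → here ≡-refl ; (there x∈) → there (all x∈) }

  module _ {n : ℕ} (G : MetricGraph n) where
    open MetricGraph G

    metric : Pseudometric (Fin n)
    metric = record { d = dist G ; d-refl = dist-refl G ; d-sym = dist-sym G ; triangle = dist-triangle G }

    open Pseudometric metric

    private
      pathCost-path : ∀ x xs z → AllPairs _≢_ (x ∷ xs) → All (_≢ z) xs → (xs ≡ [] → x ≢ z) → pathCost G x xs z ≡ path (dist G) x xs z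
      pathCost-path x []       z _                _            ne = sym (dist-≢ G (ne ≡-refl))
      pathCost-path x (y ∷ ys) z ((x≢y ∷ _) ∷ us) (y≢z ∷ ys≢z) ne = cong₂ _+_ (sym (dist-≢ G x≢y)) (pathCost-path y ys z us ys≢z λ _ → y≢z)

    tourCost-cyc : 2 ≤ n → ∀ vs → IsTour G vs → tourCost G vs ≡ cyc (dist G) vs
    tourCost-cyc 2≤n []       tour = ≡-refl
    tourCost-cyc 2≤n (v ∷ vs) tour with unique-↭ (↭-sym tour) (allFin⁺ n)
    ... | v≢ ∷ us = pathCost-path v vs v (v≢ ∷ us) (All.map (λ p q → p (sym q)) v≢) nonempty
      where
      nonempty : vs ≡ [] → v ≢ v
      nonempty ≡-refl with s≤s () ← ≤-trans 2≤n (≤-reflexive (trans (sym (length-tabulate (λ (i : Fin n) → i))) (sym (↭-length tour))))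

    shortcut : 2 ≤ n → ∀ ws → (∀ v → v ∈ ws) → ∃[ vs ] (IsTour G vs × tourCost G vs ≤ cyc (dist G) ws)
    shortcut 2≤n ws all with nub (member? Fin._≟_) ws
    ... | vs , sub , uniq , keeps = vs , tour , ≤-trans (≤-reflexive (tourCost-cyc 2≤n vs tour)) (cyc-⊆ sub)
      where
      tour : IsTour G vs
      tour = ∼bag⇒↭ (unique∧set⇒bag uniq (allFin⁺ n) (λ {x} → mk⇔ (λ _ → ∈-allFin x) (λ _ → keeps (all x))))

    private
      insert : ∀ ρ ws v → (∃[ c ] (c ∈ ws × dist G c v ≤ ρ)) → ∃[ ws′ ] (cyc (dist G) ws′ ≤ 2 * ρ + cyc (dist G) ws × v ∈ ws′ × (∀ {x} → x ∈ ws → x ∈ ws′))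
      insert ρ ws v (c , c∈ , cv≤ρ) with ∈-∃++ c∈
      ... | xs , ys , ≡-refl = c ∷ v ∷ (ys ++ xs) ,
        ≤-trans (detour c v (ys ++ xs) c) (+-mono-≤ (*-monoʳ-≤ 2 cv≤ρ) (≤-reflexive (cyc-rotate (dist G) (c ∷ ys) xs))) ,
        there (here ≡-refl) , λ x∈ → moved (∈-++⁻ xs x∈)
        where
        moved : ∀ {x} → x ∈ xs ⊎ x ∈ c ∷ ys → x ∈ c ∷ v ∷ (ys ++ xs)
        moved (inj₁ x∈)             = there (there (∈-++⁺ʳ ys x∈))
        moved (inj₂ (here ≡-refl))  = here ≡-refl
        moved (inj₂ (there x∈))     = there (there (∈-++⁺ˡ x∈))

      insertAll : ∀ ρ ws us → (∀ v → ∃[ c ] (c ∈ ws × dist G c v ≤ ρ)) → ∃[ ws′ ] (cyc (dist G) ws′ ≤ length us * (2 * ρ) + cyc (dist G) ws × (∀ {v} → v ∈ us → v ∈ ws′) × (∀ {x} → x ∈ ws → x ∈ ws′))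
      insertAll ρ ws []       near = ws , ≤-refl , (λ ()) , λ x∈ → x∈
      insertAll ρ ws (u ∷ us) near with insertAll ρ ws us near
      ... | ws₁ , cost₁ , has₁ , keep₁ with insert ρ ws₁ u (let (c , c∈ , h) = near u in c , keep₁ c∈ , h)
      ... | ws₂ , cost₂ , has₂ , keep₂ = ws₂ , ≤-trans cost₂ (≤-trans (+-monoʳ-≤ (2 * ρ) cost₁) (≤-reflexive (sym (+-assoc (2 * ρ) _ _)))) ,
        (λ { (here ≡-refl) → has₂ ; (there v∈) → keep₂ (has₁ v∈) }) , λ x∈ → keep₂ (keep₁ x∈)

    -- Visit every vertex by a detour from a nearby vertex of ws.
    covering-tour : 2 ≤ n → ∀ ρ ws → (∀ v → ∃[ c ] (c ∈ ws × dist G c v ≤ ρ)) → ∃[ vs ] (IsTour G vs × tourCost G vs ≤ n * (2 * ρ) + cyc (dist G) ws)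
    covering-tour 2≤n ρ ws near with insertAll ρ ws (allFin n) near
    ... | ws′ , cost , has , _ with shortcut 2≤n ws′ (λ v → has (∈-allFin v))
    ... | vs , tour , le = vs , tour , ≤-trans le (≤-trans cost (≤-reflexive (cong (λ k → k * (2 * ρ) + cyc (dist G) ws) (length-tabulate (λ (i : Fin n) → i)))))

    private
      emit : ∀ (at : ℕ → Fin n) t {ws vs} i → ws ≡ map at t → Stutter ws vs → at i ∈ vs → ∃[ t′ ] (t′ ↭ i ∷ t × Stutter (map at t′) vs)
      emit at t i eq s (here ≡-refl) = i ∷ t , refl , keep (at i) (subst (λ w → Stutter w _) eq s)
      emit at t i eq (drop v s) (there i∈) = let (t′ , p , s′) = emit at t i eq s i∈ in t′ , p , drop v s′
      emit at (j ∷ t) i ≡-refl (keep _ s) (there i∈) = let (t′ , p , s′) = emit at t i ≡-refl s (there i∈) in j ∷ t′ , ↭-trans (prep j p) (swap j i refl) , keep _ s′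

      emitAll : ∀ (at : ℕ → Fin n) vs (is : List ℕ) → (∀ v → v ∈ vs) → ∃[ t ] (t ↭ is × Stutter (map at t) vs)
      emitAll at vs []       all = [] , refl , none vs
        where
        none : ∀ vs → Stutter [] vs
        none []       = []
        none (v ∷ vs) = drop v (none vs)
      emitAll at vs (i ∷ is) all = let (t , p , s) = emitAll at vs is all ; (t′ , p′ , s′) = emit at t i ≡-refl s (all (at i)) in t′ , ↭-trans p′ (prep i p) , s′

    -- The points named in a message may repeat, so the lower bound is applied to indices, in the
    -- order in which the tour passes their vertices.
    tour-points : 2 ≤ n → ∀ vs → IsTour G vs → ∀ (at : ℕ → Fin n) is → ∃[ t ] (t ↭ is × cyc (λ i j → dist G (at i) (at j)) t ≤ tourCost G vs)
    tour-points 2≤n [] tour at is with () ← ≤-trans 2≤n (≤-reflexive (trans (sym (length-tabulate (λ (i : Fin n) → i))) (sym (↭-length tour))))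
    tour-points 2≤n (v ∷ vs) tour at is =
      let (t , p , s) = emitAll at (v ∷ vs) is (λ u → ∈-resp-↭ (↭-sym tour) (∈-allFin u))
      in t , p , ≤-trans (≤-reflexive (cyc-map (dist G) at t)) (≤-trans (cyc-stutter s) (≤-reflexive (sym (tourCost-cyc 2≤n (v ∷ vs) tour))))

    weight-tour : 2 ≤ n → ∀ vs → IsTour G vs → ∀ i j → 2 * dist G i j ≤ tourCost G vs
    weight-tour 2≤n vs tour i j = subst (2 * dist G i j ≤_) (sym (tourCost-cyc 2≤n vs tour)) (pair (∈-∃++ (mem i)))
      where
      mem : ∀ v → v ∈ vs
      mem v = ∈-resp-↭ (↭-sym tour) (∈-allFin v)
      both : 2 * dist G i j ≡ cyc (dist G) (i ∷ j ∷ [])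
      both = cong (dist G i j +_) (trans (+-identityʳ _) (dist-sym G i j))
      single : ∀ {x xs} → x ∈ xs → x ∷ [] ⊆ xs
      single (here ≡-refl) = ≡-refl ∷ minimum _
      single (there {y} x∈) = y ∷ʳ single x∈
      pair : ∃[ xs ] ∃[ ys ] (vs ≡ xs ++ i ∷ ys) → 2 * dist G i j ≤ cyc (dist G) vs
      pair (xs , ys , eq) = subst (λ l → 2 * dist G i j ≤ cyc (dist G) l) (sym eq) (≤-trans (≤-reflexive both)
        (≤-trans (two (split (mem′ j))) (≤-reflexive (cyc-rotate (dist G) (i ∷ ys) xs))))
        where
        mem′ : ∀ v → v ∈ xs ++ i ∷ ys
        mem′ v = subst (v ∈_) eq (mem v)
        split : ∀ {v} → v ∈ xs ++ i ∷ ys → v ≡ i ⊎ v ∈ ys ++ xs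
        split v∈ with ∈-++⁻ xs v∈
        ... | inj₁ v∈xs          = inj₂ (∈-++⁺ʳ ys v∈xs)
        ... | inj₂ (here v≡i)    = inj₁ v≡i
        ... | inj₂ (there v∈ys)  = inj₂ (∈-++⁺ˡ v∈ys)
        two : j ≡ i ⊎ j ∈ ys ++ xs → cyc (dist G) (i ∷ j ∷ []) ≤ cyc (dist G) (i ∷ ys ++ xs)
        two (inj₁ ≡-refl) = ≤-trans (≤-reflexive (cong₂ _+_ (dist-refl G i) (dist-refl G i))) z≤n
        two (inj₂ j∈)     = cyc-⊆ (≡-refl ∷ single j∈)

    tour-upper : 2 ≤ n → ∀ vs → IsTour G vs → ∀ M → (∀ i j → dist G i j ≤ M) → tourCost G vs ≤ n * M
    tour-upper 2≤n vs tour M h = ≤-trans (≤-reflexive (tourCost-cyc 2≤n vs tour)) (≤-trans (cycle vs) (≤-reflexive (cong (_* M) (trans (↭-length tour) (length-tabulate (λ (i : Fin n) → i))))))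
      where
      along : ∀ x xs z → path (dist G) x xs z ≤ suc (length xs) * M
      along x []       z = ≤-trans (h x z) (≤-reflexive (sym (+-identityʳ M)))
      along x (y ∷ ys) z = +-mono-≤ (h x y) (along y ys z)
      cycle : ∀ vs → cyc (dist G) vs ≤ length vs * M
      cycle []       = z≤n
      cycle (v ∷ vs) = along v vs v

-- Parities of edge lists, and exchange along a path

module TJoins where

  open import Data.Bool.Base using (Bool; true; false; _xor_; not)
  open import Data.Bool.Properties using (xor-assoc; xor-comm; xor-same)
  open import Data.Fin.Base using (Fin; zero; suc)
  import Data.Fin.Properties as Fin
  open import Data.List.Base using (List; []; _∷_; _++_; length)
  open import Data.List.Membership.Propositional using (_∈_)
  open import Data.List.Relation.Binary.Permutation.Propositional using (_↭_; refl; prep; swap; trans; ↭-trans)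
  open import Data.List.Relation.Binary.Permutation.Propositional.Properties using (All-resp-↭; ↭-length)
  open import Data.List.Relation.Unary.All as All using (All; []; _∷_)
  open import Data.Nat.Base
  open import Data.Nat.Induction using (<-rec)
  open import Data.Nat.Properties
  open import Data.Nat.Tactic.RingSolver using (solve-∀)
  open import Data.Product.Base using (∃; ∃-syntax; _×_; _,_; proj₁; proj₂)
  open import Data.Sum.Base using (_⊎_; inj₁; inj₂)
  open import Relation.Binary.PropositionalEquality as ≡ using (_≡_; _≢_; cong; cong₂; sym)
  open import Relation.Nullary.Decidable.Core using (yes; no; does)
  open import Relation.Nullary.Negation.Core using (¬_; contradiction)

  -- An arbitrary predicate has a least element only up to double negation. All non-constructive
  -- existence in the choice of minimum joins comes from here.
  least : ∀ {P : ℕ → Set} → ∃ P → ¬ ¬ (∃[ m ] (P m × (∀ k → P k → m ≤ k)))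
  least {P} (k , pk) none = <-rec (λ m → ¬ P m) (λ m rec pm → none (m , pm , λ k pk → ≮⇒≥ λ k<m → rec k<m pk)) k pk

  infixl 6 _⊕_
  _⊕_ : Bool → Bool → Bool
  _⊕_ = _xor_

  private
    ⊕-cancel : ∀ a b → a ⊕ (a ⊕ b) ≡ b
    ⊕-cancel a b = ≡.trans (sym (xor-assoc a a b)) (cong (_⊕ b) (xor-same a))

    rearrange : ∀ a z x → (a ⊕ z) ⊕ (a ⊕ x) ≡ z ⊕ x
    rearrange a z x = ≡.trans (cong (_⊕ (a ⊕ x)) (xor-comm a z)) (≡.trans (xor-assoc z a (a ⊕ x)) (cong (z ⊕_) (⊕-cancel a x)))

    swap₁ : ∀ a b c → a ⊕ (b ⊕ c) ≡ b ⊕ (a ⊕ c)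
    swap₁ a b c = ≡.trans (sym (xor-assoc a b c)) (≡.trans (cong (_⊕ c) (xor-comm a b)) (xor-assoc b a c))

  isOdd : ℕ → Bool
  isOdd zero    = false
  isOdd (suc x) = not (isOdd x)

  isOdd-+ : ∀ x y → isOdd (x + y) ≡ isOdd x ⊕ isOdd y
  isOdd-+ zero    y = ≡.refl
  isOdd-+ (suc x) y = ≡.trans (cong not (isOdd-+ x y)) (not-⊕ (isOdd x) (isOdd y))
    where
    not-⊕ : ∀ a b → not (a ⊕ b) ≡ not a ⊕ b
    not-⊕ false b = ≡.refl
    not-⊕ true  false = ≡.refl
    not-⊕ true  true  = ≡.refl

  isOdd-double : ∀ x → isOdd (2 * x) ≡ false
  isOdd-double x = ≡.trans (cong (λ y → isOdd (x + y)) (+-identityʳ x)) (≡.trans (isOdd-+ x x) (xor-same (isOdd x)))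

  ⟦_⟧ : Bool → ℕ
  ⟦ true ⟧  = 1
  ⟦ false ⟧ = 0

  module _ {k : ℕ} where

    Edge : Set
    Edge = Fin k × Fin k

    δᵇ : Fin k → Fin k → Bool
    δᵇ u v = does (u Fin.≟ v)

    δᵇ-refl : ∀ u → δᵇ u u ≡ true
    δᵇ-refl u with u Fin.≟ u
    ... | yes _ = ≡.refl
    ... | no h  = contradiction ≡.refl h

    δᵇ-≢ : ∀ {u v} → u ≢ v → δᵇ u v ≡ false
    δᵇ-≢ {u} {v} h with u Fin.≟ v
    ... | yes e = contradiction e h
    ... | no _  = ≡.refl

    -- A loop is not incident to its vertex.
    inc : Edge → Fin k → Bool
    inc (u , v) w = δᵇ u w ⊕ δᵇ v w

    par : List Edge → Fin k → Bool
    par []      w = false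
    par (e ∷ J) w = inc e w ⊕ par J w

    deg : List Edge → Fin k → ℕ
    deg []      w = 0
    deg (e ∷ J) w = ⟦ inc e w ⟧ + deg J w

    Weight : Set
    Weight = Fin k → Fin k → ℕ

    cost : Weight → List Edge → ℕ
    cost d []            = 0
    cost d ((u , v) ∷ J) = d u v + cost d J

    Within : List (Fin k) → List Edge → Set
    Within V = All (λ (u , v) → u ∈ V × v ∈ V)

    par-++ : ∀ J K w → par (J ++ K) w ≡ par J w ⊕ par K w
    par-++ []      K w = ≡.refl
    par-++ (e ∷ J) K w = ≡.trans (cong (inc e w ⊕_) (par-++ J K w)) (sym (xor-assoc (inc e w) _ _))

    par-↭ : ∀ {J K} → J ↭ K → ∀ w → par J w ≡ par K w
    par-↭ refl           w = ≡.refl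
    par-↭ (prep e p)     w = cong (inc e w ⊕_) (par-↭ p w)
    par-↭ (swap e f p)   w = ≡.trans (sym (xor-assoc (inc e w) _ _)) (≡.trans (cong₂ _⊕_ (xor-comm (inc e w) (inc f w)) (par-↭ p w)) (xor-assoc (inc f w) _ _))
    par-↭ (trans p q)    w = ≡.trans (par-↭ p w) (par-↭ q w)

    private
      additive : ∀ (f : Edge → ℕ) (F : List Edge → ℕ) → F [] ≡ 0 → (∀ e J → F (e ∷ J) ≡ f e + F J) → ∀ {J K} → J ↭ K → F J ≡ F K
      additive f F z s refl = ≡.refl
      additive f F z s (prep {J} {K} e p) = ≡.trans (s e J) (≡.trans (cong (f e +_) (additive f F z s p)) (sym (s e K)))
      additive f F z s (swap {J} {K} e g p) = ≡.trans (s e (g ∷ J)) (≡.trans (cong (f e +_) (s g J)) (≡.trans (ring (f e) (f g) (F J)) (≡.trans (cong (λ y → f g + (f e + y)) (additive f F z s p)) (sym (≡.trans (s g (e ∷ K)) (cong (f g +_) (s e K)))))))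
        where
        ring : ∀ a b c → a + (b + c) ≡ b + (a + c)
        ring = solve-∀
      additive f F z s (trans p q) = ≡.trans (additive f F z s p) (additive f F z s q)

    deg-↭ : ∀ {J K} → J ↭ K → ∀ w → deg J w ≡ deg K w
    deg-↭ p w = additive (λ e → ⟦ inc e w ⟧) (λ J → deg J w) ≡.refl (λ _ _ → ≡.refl) p

    cost-↭ : ∀ d {J K} → J ↭ K → cost d J ≡ cost d K
    cost-↭ d = additive (λ (u , v) → d u v) (cost d) ≡.refl (λ _ _ → ≡.refl)

    deg0⇒par : ∀ J w → deg J w ≡ 0 → par J w ≡ false
    deg0⇒par []      w h = ≡.refl
    deg0⇒par (e ∷ J) w h with inc e w
    ... | false = deg0⇒par J w h

    -- An edge of J at s, moved to the front. Edges are ordered pairs, so `ends` admits both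
    -- orientations; `s≢` excludes loops.
    record At (s : Fin k) (J : List Edge) : Set where
      constructor at
      field
        edge  : Edge
        other : Fin k
        rest  : List Edge
        split : J ↭ edge ∷ rest
        s≢    : s ≢ other
        ends  : edge ≡ (s , other) ⊎ edge ≡ (other , s)
      incident : ∀ w → inc edge w ≡ δᵇ s w ⊕ δᵇ other w
      incident w with ends
      ... | inj₁ e = cong (λ f → inc f w) e
      ... | inj₂ e = ≡.trans (cong (λ f → inc f w) e) (xor-comm (δᵇ other w) (δᵇ s w))
      inc-s : inc edge s ≡ true
      inc-s = ≡.trans (incident s) (cong₂ _⊕_ (δᵇ-refl s) (δᵇ-≢ (λ e → s≢ (sym e))))

    private
      at-∷ : ∀ {s J} e → At s J → At s (e ∷ J)
      at-∷ e (at f z R p h ends) = at f z (e ∷ R) (↭-trans (prep e p) (swap e f refl)) h ends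

      at-head : ∀ {s} e J → inc e s ≡ true → At s (e ∷ J)
      at-head {s} (u , v) J h with u Fin.≟ s | v Fin.≟ s
      ... | yes ≡.refl | no v≢ = at (u , v) v J refl (λ e → v≢ (sym e)) (inj₁ ≡.refl)
      ... | no u≢ | yes ≡.refl = at (u , v) u J refl (λ e → u≢ (sym e)) (inj₂ ≡.refl)
      ... | yes _ | yes _ with () ← h
      ... | no _  | no _  with () ← h

    pick-par : ∀ s J → par J s ≡ true → At s J
    pick-par s (e ∷ J) h with inc e s in eq
    ... | true  = at-head e J eq
    ... | false = at-∷ e (pick-par s J h)

    pick-deg : ∀ s J → 0 < deg J s → At s J
    pick-deg s (e ∷ J) h with inc e s in eq
    ... | true  = at-head e J eq
    ... | false = at-∷ e (pick-deg s J h)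

    -- The edges of a path from s to x in A ++ R change sides.
    record Swap (V : List (Fin k)) (A R : List Edge) (s x : Fin k) : Set where
      field
        A′ R′   : List Edge
        par-A   : ∀ w → par A′ w ≡ par A w ⊕ (δᵇ s w ⊕ δᵇ x w)
        par-R   : ∀ w → par R′ w ≡ par R w ⊕ (δᵇ s w ⊕ δᵇ x w)
        costs   : ∀ d → cost d A′ + cost d R′ ≡ cost d A + cost d R
        degree  : deg A x ≡ suc (deg A′ x)
        within-A : Within V A′
        within-R : Within V R′

    private
      move : ∀ p a z x → (a ⊕ z) ⊕ p ⊕ (z ⊕ x) ≡ p ⊕ (a ⊕ x)
      move p a z x = ≡.trans (cong (_⊕ (z ⊕ x)) (xor-comm (a ⊕ z) p)) (≡.trans (xor-assoc p (a ⊕ z) (z ⊕ x)) (cong (p ⊕_) (≡.trans (xor-assoc a z (z ⊕ x)) (cong (a ⊕_) (⊕-cancel z x)))))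

      peel : ∀ {J s} (t : At s J) w → par (At.rest t) w ≡ (δᵇ s w ⊕ δᵇ (At.other t) w) ⊕ par J w
      peel {J} {s} t w = sym (≡.trans (cong ((δᵇ s w ⊕ δᵇ (At.other t) w) ⊕_) (≡.trans (par-↭ (At.split t) w) (cong (_⊕ par (At.rest t) w) (At.incident t w)))) (⊕-cancel (δᵇ s w ⊕ δᵇ (At.other t) w) _))

    -- A and R together have odd degree exactly at s and x. So a walk from s, continued at each
    -- vertex with an edge from the list of odd parity there, reaches x, and it stops at the first
    -- arrival. As R has no edge at x, the last edge comes from A, and the degree of x in A drops by
    -- exactly one.
    swapPath : ∀ V fuel A R s x → length A + length R ≤ fuel → Within V A → Within V R → s ≢ x → deg R x ≡ 0 →
      (∀ w → par A w ⊕ par R w ≡ δᵇ s w ⊕ δᵇ x w) → Swap V A R s x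
    swapPath V fuel A R s x size wA wR s≢x degR h with par A s in eq
    ... | true = fromA fuel size (pick-par s A eq)
      where
      fromA : ∀ fuel → length A + length R ≤ fuel → At s A → Swap V A R s x
      fromA fuel size t@(at e z A₀ split s≢z ends) with z Fin.≟ x
      ... | yes ≡.refl = record
        { A′ = A₀ ; R′ = e ∷ R
        ; par-A = λ w → ≡.trans (peel t w) (xor-comm _ (par A w))
        ; par-R = λ w → ≡.trans (cong (_⊕ par R w) (At.incident t w)) (xor-comm _ (par R w))
        ; costs = λ d → ≡.trans (ring (cost d A₀) (d (proj₁ e) (proj₂ e)) (cost d R)) (cong (_+ cost d R) (sym (cost-↭ d split)))
        ; degree = ≡.trans (deg-↭ split x) (cong (λ b → ⟦ b ⟧ + deg A₀ x) (≡.trans (At.incident t x) (cong₂ _⊕_ (δᵇ-≢ s≢x) (δᵇ-refl x))))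
        ; within-A = All.tail (All-resp-↭ split wA)
        ; within-R = All.head (All-resp-↭ split wA) ∷ wR }
        where
        ring : ∀ a e r → a + (e + r) ≡ (e + a) + r
        ring = solve-∀
      fromA zero size t@(at e z A₀ split s≢z ends) | no z≢x with () ← ≤-trans (≤-reflexive (cong (_+ length R) (sym (↭-length split)))) size
      fromA (suc fuel) size t@(at e z A₀ split s≢z ends) | no z≢x = record
        { A′ = A′ ; R′ = e ∷ R′
        ; par-A = λ w → ≡.trans (par-A w) (≡.trans (cong (_⊕ (δᵇ z w ⊕ δᵇ x w)) (peel t w)) (move (par A w) (δᵇ s w) (δᵇ z w) (δᵇ x w)))
        ; par-R = λ w → ≡.trans (cong₂ _⊕_ (At.incident t w) (par-R w)) (≡.trans (sym (xor-assoc (δᵇ s w ⊕ δᵇ z w) (par R w) _)) (move (par R w) (δᵇ s w) (δᵇ z w) (δᵇ x w)))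
        ; costs = λ d → ≡.trans (ring₁ (cost d A′) (d (proj₁ e) (proj₂ e)) (cost d R′)) (≡.trans (cong (d (proj₁ e) (proj₂ e) +_) (costs d)) (≡.trans (sym (+-assoc (d (proj₁ e) (proj₂ e)) (cost d A₀) (cost d R))) (cong (_+ cost d R) (sym (cost-↭ d split)))))
        ; degree = ≡.trans (deg-↭ split x) (≡.trans (cong (λ b → ⟦ b ⟧ + deg A₀ x) (≡.trans (At.incident t x) (cong₂ _⊕_ (δᵇ-≢ s≢x) (δᵇ-≢ z≢x)))) degree)
        ; within-A = within-A
        ; within-R = All.head (All-resp-↭ split wA) ∷ within-R }
        where
        ring₁ : ∀ a e r → a + (e + r) ≡ e + (a + r)
        ring₁ = solve-∀
        open Swap (swapPath V fuel A₀ R z x (≤-pred (≤-trans (≤-reflexive (cong (_+ length R) (sym (↭-length split)))) size)) (All.tail (All-resp-↭ split wA)) wR z≢x degR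
          λ w → ≡.trans (cong (_⊕ par R w) (peel t w)) (≡.trans (xor-assoc (δᵇ s w ⊕ δᵇ z w) (par A w) (par R w)) (≡.trans (cong ((δᵇ s w ⊕ δᵇ z w) ⊕_) (h w)) (rearrange (δᵇ s w) (δᵇ z w) (δᵇ x w)))))
    ... | false = fromR fuel size (pick-par s R (≡.trans (sym (cong (_⊕ par R s) eq)) (≡.trans (h s) (cong₂ _⊕_ (δᵇ-refl s) (δᵇ-≢ (λ e → s≢x (sym e)))))))
      where
      fromR : ∀ fuel → length A + length R ≤ fuel → At s R → Swap V A R s x
      fromR fuel size t@(at e z R₀ split s≢z ends) with z Fin.≟ x
      ... | yes ≡.refl = contradiction (≡.trans (sym degR) (≡.trans (deg-↭ split x) (cong (λ b → ⟦ b ⟧ + deg R₀ x) (≡.trans (At.incident t x) (cong₂ _⊕_ (δᵇ-≢ s≢x) (δᵇ-refl x)))))) λ ()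
      fromR zero size t@(at e z R₀ split s≢z ends) | no z≢x with () ← ≤-trans (≤-trans (≤-reflexive (sym (↭-length split))) (m≤n+m (length R) (length A))) size
      fromR (suc fuel) size t@(at e z R₀ split s≢z ends) | no z≢x = record
        { A′ = e ∷ A′ ; R′ = R′
        ; par-A = λ w → ≡.trans (cong₂ _⊕_ (At.incident t w) (par-A w)) (≡.trans (sym (xor-assoc (δᵇ s w ⊕ δᵇ z w) (par A w) _)) (move (par A w) (δᵇ s w) (δᵇ z w) (δᵇ x w)))
        ; par-R = λ w → ≡.trans (par-R w) (≡.trans (cong (_⊕ (δᵇ z w ⊕ δᵇ x w)) (peel t w)) (move (par R w) (δᵇ s w) (δᵇ z w) (δᵇ x w)))
        ; costs = λ d → ≡.trans (+-assoc (d (proj₁ e) (proj₂ e)) (cost d A′) (cost d R′)) (≡.trans (cong (d (proj₁ e) (proj₂ e) +_) (costs d)) (≡.trans (ring₂ (d (proj₁ e) (proj₂ e)) (cost d A) (cost d R₀)) (cong (cost d A +_) (sym (cost-↭ d split)))))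
        ; degree = ≡.trans degree (cong suc (sym (cong (λ b → ⟦ b ⟧ + deg A′ x) (≡.trans (At.incident t x) (cong₂ _⊕_ (δᵇ-≢ s≢x) (δᵇ-≢ z≢x))))))
        ; within-A = All.head (All-resp-↭ split wR) ∷ within-A
        ; within-R = within-R }
        where
        ring₂ : ∀ e a r → e + (a + r) ≡ a + (e + r)
        ring₂ = solve-∀
        degR₀ : deg R₀ x ≡ 0
        degR₀ = n≤0⇒n≡0 (≤-trans (m≤n+m (deg R₀ x) _) (≤-reflexive (≡.trans (sym (deg-↭ split x)) degR)))
        open Swap (swapPath V fuel A R₀ z x (≤-pred (≤-trans (≤-reflexive (≡.trans (sym (+-suc (length A) (length R₀))) (cong (length A +_) (sym (↭-length split))))) size)) wA (All.tail (All-resp-↭ split wR)) z≢x degR₀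
          λ w → ≡.trans (cong (par A w ⊕_) (peel t w)) (≡.trans (swap₁ (par A w) (δᵇ s w ⊕ δᵇ z w) (par R w)) (≡.trans (cong ((δᵇ s w ⊕ δᵇ z w) ⊕_) (h w)) (rearrange (δᵇ s w) (δᵇ z w) (δᵇ x w)))))

-- Trees encoded by leaf heights and branching heights

module LaminarTrees where

  open TJoins
  open import Data.Bool.Base using (Bool)
  open import Data.Fin.Base using (Fin)
  import Data.Fin.Properties as Fin
  open import Data.List.Base using (List; []; _∷_; map)
  open import Data.List.Membership.Propositional using (_∈_)
  open import Data.List.Relation.Binary.Permutation.Propositional using (_↭_; refl; prep; swap; ↭-sym; ↭-trans)
  open import Data.List.Relation.Unary.All as All using (All; []; _∷_)
  open import Data.List.Relation.Unary.AllPairs using (AllPairs; []; _∷_)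
  open import Data.List.Relation.Unary.Any as Any using (Any; here; there)
  open import Data.Nat.Base
  open import Data.Nat.ListAction using (sum)
  open import Data.Nat.Properties
  open import Data.Nat.Tactic.RingSolver using (solve-∀)
  open import Data.Product.Base using (∃-syntax; _×_; _,_; proj₁; proj₂)
  open import Data.Unit.Base using (⊤; tt)
  open import Relation.Binary.PropositionalEquality as ≡ using (_≡_; _≢_; cong; sym; subst)
  open import Relation.Nullary.Decidable.Core using (yes; no)
  open import Relation.Nullary.Negation.Core using (contradiction)

  module _ {k : ℕ} where

    -- A leaf of the tree, its height above the root, and the height of the
    -- least common ancestor with the preceding leaf.
    Entry : Set
    Entry = Fin k × ℕ × ℕ

    pt : Entry → Fin k
    pt = proj₁

    ht gp : Entry → ℕ
    ht e = proj₁ (proj₂ e)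
    gp e = proj₂ (proj₂ e)

    -- m is the minimum of the gaps passed so far, which makes `m ⊓ e` the height of the least
    -- common ancestor of x and y. `Dominated` starts with m = h, as no ancestor is higher than the
    -- leaf itself.
    Far : Weight → Fin k → ℕ → ℕ → List Entry → Set
    Far d x h m []                 = ⊤
    Far d x h m ((y , h′ , e) ∷ es) = h + h′ ≤ d x y + 2 * (m ⊓ e) × Far d x h (m ⊓ e) es

    -- The tree metric is dominated by d.
    Dominated : Weight → List Entry → Set
    Dominated d []                 = ⊤
    Dominated d ((x , h , e) ∷ es) = Far d x h h es × Dominated d es

    -- The root is a branching. A tree with a single leaf has no branching and must be a point.
    ZeroGap : List Entry → Set
    ZeroGap []           = ⊤
    ZeroGap (x ∷ [])     = ht x ≡ 0
    ZeroGap (x ∷ y ∷ es) = Any (λ z → gp z ≡ 0) (y ∷ es)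

    record Tree (V : List (Fin k)) (d : Weight) (m : ℕ) : Set where
      field
        es        : List Entry
        points    : map pt es ↭ V
        dominated : Dominated d es
        gap≤      : All (λ z → gp z ≤ ht z) es
        zero-gap  : ZeroGap es
        long      : m + sum (map gp es) ≤ sum (map ht es)

    private
      unique-pts : ∀ {es : List Entry} {x} → All (x ≢_) (map pt es) → All (λ z → x ≢ pt z) es
      unique-pts {[]}     []       = []
      unique-pts {z ∷ es} (h ∷ hs) = h ∷ unique-pts hs

    trivialTree : ∀ V d → Tree V d 0
    trivialTree V d = record { es = map flat V ; points = ids V ; dominated = dom V ; gap≤ = le V ; zero-gap = zg V ; long = ≤-reflexive (sums V) }
      where
      flat : Fin k → Entry
      flat x = x , 0 , 0
      ids : ∀ V → map pt (map flat V) ↭ V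
      ids []      = refl
      ids (x ∷ V) = prep x (ids V)
      far : ∀ x V → Far d x 0 0 (map flat V)
      far x []      = tt
      far x (y ∷ V) = z≤n , far x V
      dom : ∀ V → Dominated d (map flat V)
      dom []      = tt
      dom (x ∷ V) = far x V , dom V
      le : ∀ V → All (λ z → gp z ≤ ht z) (map flat V)
      le []      = []
      le (x ∷ V) = z≤n ∷ le V
      zg : ∀ V → ZeroGap (map flat V)
      zg []          = tt
      zg (x ∷ [])    = ≡.refl
      zg (x ∷ y ∷ V) = here ≡.refl
      sums : ∀ V → sum (map gp (map flat V)) ≡ sum (map ht (map flat V))
      sums []      = ≡.refl
      sums (x ∷ V) = sums V

    module _ (x : Fin k) where

      raise : Entry → Entry
      raise (y , h , e) = y , ⟦ δᵇ y x ⟧ + h , e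

      private
        both : ∀ {u v} → u ≢ v → ⟦ δᵇ u x ⟧ + ⟦ δᵇ v x ⟧ ≡ ⟦ inc (u , v) x ⟧
        both {u} {v} u≢v with u Fin.≟ x | v Fin.≟ x
        ... | yes ≡.refl | yes ≡.refl = contradiction ≡.refl u≢v
        ... | yes _ | no _  = ≡.refl
        ... | no _  | yes _ = ≡.refl
        ... | no _  | no _  = ≡.refl

        far-raise : ∀ {V} {d d′ : Weight} → (∀ {u v} → u ∈ V → v ∈ V → u ≢ v → d′ u v + ⟦ inc (u , v) x ⟧ ≤ d u v) →
          ∀ u → u ∈ V → ∀ h {m m′} → m ≤ m′ → ∀ es → All (_∈ V) (map pt es) → All (λ z → u ≢ pt z) es → Far d′ u h m es → Far d u (⟦ δᵇ u x ⟧ + h) m′ (map raise es)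
        far-raise le u u∈ h m≤ [] _ _ _ = tt
        far-raise {d = d} {d′} le u u∈ h {m} {m′} m≤ ((y , h′ , e) ∷ es) (y∈ ∷ es∈) (u≢y ∷ us) (c , f) = (begin
          (⟦ δᵇ u x ⟧ + h) + (⟦ δᵇ y x ⟧ + h′)        ≡⟨ ring ⟦ δᵇ u x ⟧ h ⟦ δᵇ y x ⟧ h′ ⟩
          (⟦ δᵇ u x ⟧ + ⟦ δᵇ y x ⟧) + (h + h′)        ≤⟨ +-mono-≤ (≤-reflexive (both u≢y)) c ⟩
          ⟦ inc (u , y) x ⟧ + (d′ u y + 2 * (m ⊓ e))  ≡⟨ ring′ ⟦ inc (u , y) x ⟧ (d′ u y) (2 * (m ⊓ e)) ⟩
          (d′ u y + ⟦ inc (u , y) x ⟧) + 2 * (m ⊓ e)  ≤⟨ +-mono-≤ (le u∈ y∈ u≢y) (*-monoʳ-≤ 2 (⊓-monoˡ-≤ e m≤)) ⟩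
          d u y + 2 * (m′ ⊓ e)                        ∎) , far-raise le u u∈ h (⊓-monoˡ-≤ e m≤) es es∈ us f
          where
          open ≤-Reasoning
          ring : ∀ a b c d → (a + b) + (c + d) ≡ (a + c) + (b + d)
          ring = solve-∀
          ring′ : ∀ a b c → a + (b + c) ≡ (b + a) + c
          ring′ = solve-∀

        dominated-raise : ∀ {V} {d d′ : Weight} → (∀ {u v} → u ∈ V → v ∈ V → u ≢ v → d′ u v + ⟦ inc (u , v) x ⟧ ≤ d u v) →
          ∀ es → All (_∈ V) (map pt es) → AllPairs _≢_ (map pt es) → Dominated d′ es → Dominated d (map raise es)
        dominated-raise le [] _ _ _ = tt
        dominated-raise le ((u , h , e) ∷ es) (u∈ ∷ es∈) (u≢ ∷ us) (f , dm) = far-raise le u u∈ h (m≤n+m h _) es es∈ (unique-pts u≢) f , dominated-raise le es es∈ us dm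

        zero-raise : ∀ es → 2 ≤ Data.List.Base.length es → ZeroGap es → ZeroGap (map raise es)
        zero-raise (z ∷ y ∷ es) _ zg = go (y ∷ es) zg
          where
          go : ∀ es → Any (λ z → gp z ≡ 0) es → Any (λ z → gp z ≡ 0) (map raise es)
          go (z ∷ es) (here p)  = here p
          go (z ∷ es) (there p) = there (go es p)
        zero-raise (z ∷ []) (s≤s ()) zg
        zero-raise [] () zg

        sum-raise : ∀ es → x ∈ map pt es → suc (sum (map ht es)) ≤ sum (map ht (map raise es))
        sum-raise ((y , h , e) ∷ es) (here ≡.refl) rewrite δᵇ-refl x = s≤s (+-monoʳ-≤ h (mono es))
          where
          mono : ∀ es → sum (map ht es) ≤ sum (map ht (map raise es))
          mono []                = z≤n
          mono ((y , h , _) ∷ es) = +-mono-≤ (m≤n+m h _) (mono es)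
        sum-raise ((y , h , e) ∷ es) (there x∈) = ≤-trans (≤-reflexive (sym (+-suc h _))) (+-mono-≤ (m≤n+m h _) (sum-raise es x∈))

      -- Lengthening the edge to the leaf x by one adds the cut around x to the packing, for which d
      -- has room above d′. With a second leaf present, raising a height does not affect the zero
      -- gap.
      raiseTree : ∀ {V d d′ m} → (∀ {u v} → u ∈ V → v ∈ V → u ≢ v → d′ u v + ⟦ inc (u , v) x ⟧ ≤ d u v) → AllPairs _≢_ V → x ∈ V → 2 ≤ Data.List.Base.length V → Tree V d′ m → Tree V d (suc m)
      raiseTree {V} {d} {d′} {m} le uniq x∈ 2≤ t = record
        { es = map raise es
        ; points = subst (_↭ V) (sym (same es)) points
        ; dominated = dominated-raise le es (All.tabulate (∈-resp-↭ points)) (unique-↭ (↭-sym points) uniq) dominated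
        ; gap≤ = gaps es gap≤
        ; zero-gap = zero-raise es (≤-trans 2≤ (≤-reflexive (≡.trans (sym (↭-length points)) (length-map pt es)))) zero-gap
        ; long = ≤-trans (s≤s (≤-trans (≤-reflexive (cong (m +_) (cong sum (sameGaps es)))) long)) (sum-raise es (∈-resp-↭ (↭-sym points) x∈)) }
        where
        open Tree t
        open Walks using (unique-↭)
        open import Data.List.Properties using (length-map)
        open import Data.List.Relation.Binary.Permutation.Propositional.Properties using (↭-length; ∈-resp-↭)
        same : ∀ es → map pt (map raise es) ≡ map pt es
        same []       = ≡.refl
        same (z ∷ es) = cong (pt z ∷_) (same es)
        sameGaps : ∀ es → map gp (map raise es) ≡ map gp es
        sameGaps []       = ≡.refl
        sameGaps (z ∷ es) = cong (gp z ∷_) (sameGaps es)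
        gaps : ∀ es → All (λ z → gp z ≤ ht z) es → All (λ z → gp z ≤ ht z) (map raise es)
        gaps []       []       = []
        gaps (z ∷ es) (h ∷ hs) = ≤-trans h (m≤n+m (ht z) _) ∷ gaps es hs

    module _ (x a : Fin k) where

      -- The new leaf a is placed at the leaf x.
      attach : List Entry → List Entry
      attach [] = []
      attach ((y , h , e) ∷ es) with y Fin.≟ x
      ... | yes _ = (y , h , e) ∷ (a , h , h) ∷ es
      ... | no _  = (y , h , e) ∷ attach es

      private
        ⊓-absorb : ∀ m {e h} → e ≤ h → (m ⊓ e) ⊓ h ≡ m ⊓ e
        ⊓-absorb m e≤h = m≤n⇒m⊓n≡m (≤-trans (m⊓n≤n m _) e≤h)

        far-weaken : ∀ {d d″ : Weight} {u v} h m es → All (λ z → d″ u (pt z) ≤ d v (pt z)) es → Far d″ u h m es → Far d v h m es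
        far-weaken h m []       _        _       = tt
        far-weaken h m (z ∷ es) (l ∷ ls) (c , f) = ≤-trans c (+-monoˡ-≤ _ l) , far-weaken h (m ⊓ gp z) es ls f

        module _ {d d″ : Weight} (le : ∀ u v → d″ u v ≤ d u v) (leʳ : ∀ u → u ≢ x → d″ u x ≤ d u a) (leˡ : ∀ v → v ≢ x → d″ x v ≤ d a v) where

          far-attach : ∀ u → u ≢ x → ∀ h m es → All (λ z → gp z ≤ ht z) es → Far d″ u h m es → Far d u h m (attach es)
          far-attach u u≢x h m [] _ _ = tt
          far-attach u u≢x h m ((y , h′ , e) ∷ es) (e≤ ∷ gs) (c , f) with y Fin.≟ x
          ... | yes ≡.refl = ≤-trans c (+-monoˡ-≤ _ (le u x)) ,
            subst (λ m′ → h + h′ ≤ d u a + 2 * m′) (sym (⊓-absorb m e≤)) (≤-trans c (+-monoˡ-≤ _ (leʳ u u≢x))) ,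
            subst (λ m′ → Far d u h m′ es) (sym (⊓-absorb m e≤)) (far-weaken h (m ⊓ e) es (All.tabulate λ {z} _ → le u (pt z)) f)
          ... | no _ = ≤-trans c (+-monoˡ-≤ _ (le u y)) , far-attach u u≢x h (m ⊓ e) es gs f

          dominated-attach : ∀ es → AllPairs _≢_ (map pt es) → All (λ z → gp z ≤ ht z) es → Dominated d″ es → Dominated d (attach es)
          dominated-attach [] _ _ _ = tt
          dominated-attach ((y , h , e) ∷ es) (y≢ ∷ us) (_ ∷ gs) (f , dm) with y Fin.≟ x
          ... | yes ≡.refl = (≤-trans (≤-reflexive (cong (h +_) (sym (+-identityʳ h)))) (≤-trans (≤-reflexive (cong (2 *_) (sym (⊓-idem h)))) (m≤n+m _ (d x a))) ,
                subst (λ m → Far d x h m es) (sym (⊓-idem h)) (far-weaken h h es (All.tabulate λ {z} _ → le x (pt z)) f)) ,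
              far-weaken h h es (All.map (λ {z} n → leˡ (pt z) (λ eq → n (sym eq))) (unique-pts y≢)) f ,
              dominated-weaken es dm
            where
            dominated-weaken : ∀ es → Dominated d″ es → Dominated d es
            dominated-weaken []       _        = tt
            dominated-weaken (z ∷ es) (f , dm) = far-weaken (ht z) (ht z) es (All.tabulate λ {w} _ → le (pt z) (pt w)) f , dominated-weaken es dm
          ... | no y≢x = far-attach y y≢x h h es gs f , dominated-attach es us gs dm

        points-attach : ∀ es → x ∈ map pt es → map pt (attach es) ↭ a ∷ map pt es
        points-attach ((y , h , e) ∷ es) x∈ with y Fin.≟ x
        ... | yes _ = swap y a refl
        points-attach ((y , h , e) ∷ es) (here ≡.refl) | no y≢x = contradiction ≡.refl y≢x
        points-attach ((y , h , e) ∷ es) (there x∈)    | no _   = ↭-trans (prep y (points-attach es x∈)) (swap y a refl)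

        gap-attach : ∀ es → All (λ z → gp z ≤ ht z) es → All (λ z → gp z ≤ ht z) (attach es)
        gap-attach [] [] = []
        gap-attach ((y , h , e) ∷ es) (g ∷ gs) with y Fin.≟ x
        ... | yes _ = g ∷ ≤-refl ∷ gs
        ... | no _  = g ∷ gap-attach es gs

        any-attach : ∀ es → Any (λ z → gp z ≡ 0) es → Any (λ z → gp z ≡ 0) (attach es)
        any-attach ((y , h , e) ∷ es) p with y Fin.≟ x
        any-attach ((y , h , e) ∷ es) (here p)  | yes _ = here p
        any-attach ((y , h , e) ∷ es) (there p) | yes _ = there (there p)
        any-attach ((y , h , e) ∷ es) (here p)  | no _  = here p
        any-attach ((y , h , e) ∷ es) (there p) | no _  = there (any-attach es p)

        zero-attach : ∀ es → x ∈ map pt es → ZeroGap es → ZeroGap (attach es)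
        zero-attach ((y , h , e) ∷ []) x∈ zg with y Fin.≟ x
        ... | yes _ = here zg
        zero-attach ((y , h , e) ∷ []) (here ≡.refl) zg | no y≢x = contradiction ≡.refl y≢x
        zero-attach ((y , h , e) ∷ z ∷ es) x∈ zg with y Fin.≟ x
        ... | yes _ = there zg
        ... | no _ with attach (z ∷ es) | any-attach (z ∷ es) zg
        ...   | w ∷ ws | p = p

        sum-attach : ∀ es m → x ∈ map pt es → m + sum (map gp es) ≤ sum (map ht es) → m + sum (map gp (attach es)) ≤ sum (map ht (attach es))
        sum-attach es m x∈ l = let (η , p , q) = sums es x∈ in
          ≤-trans (≤-reflexive (≡.trans (cong (m +_) p) (ring m η (sum (map gp es))))) (≤-trans (+-monoʳ-≤ η l) (≤-reflexive (sym q)))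
          where
          ring : ∀ m η s → m + (η + s) ≡ η + (m + s)
          ring = solve-∀
          sums : ∀ es → x ∈ map pt es → ∃[ η ] (sum (map gp (attach es)) ≡ η + sum (map gp es) × sum (map ht (attach es)) ≡ η + sum (map ht es))
          sums ((y , h , e) ∷ es) x∈ with y Fin.≟ x
          ... | yes _ = h , ring e h _ , ring h h _
          sums ((y , h , e) ∷ es) (here ≡.refl) | no y≢x = contradiction ≡.refl y≢x
          sums ((y , h , e) ∷ es) (there x∈)    | no _   = let (η , p , q) = sums es x∈ in
            η , ≡.trans (cong (e +_) p) (ring e η _) , ≡.trans (cong (h +_) q) (ring h η _)

      -- The twin of x gets the height of x both as its height and as its gap, so heights and gaps
      -- grow by the same amount and the length is kept. The weights d″ at x lie below the distances
      -- from x and from a, so domination holds for both leaves.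
      attachTree : ∀ {V d d″ m} → (∀ u v → d″ u v ≤ d u v) → (∀ u → u ≢ x → d″ u x ≤ d u a) → (∀ v → v ≢ x → d″ x v ≤ d a v) →
        AllPairs _≢_ V → x ∈ V → Tree V d″ m → Tree (a ∷ V) d m
      attachTree {V} {d} {d″} {m} le leʳ leˡ uniq x∈ t = record
        { es = attach es
        ; points = ↭-trans (points-attach es x∈es) (prep a points)
        ; dominated = dominated-attach le leʳ leˡ es (unique-↭ (↭-sym points) uniq) gap≤ dominated
        ; gap≤ = gap-attach es gap≤
        ; zero-gap = zero-attach es x∈es zero-gap
        ; long = sum-attach es m x∈es long }
        where
        open Tree t
        open Walks using (unique-↭)
        open import Data.List.Relation.Binary.Permutation.Propositional.Properties using (∈-resp-↭)
        x∈es : x ∈ map pt es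
        x∈es = ∈-resp-↭ (↭-sym points) x∈

    tree-↭ : ∀ {V V′ d m} → V ↭ V′ → Tree V d m → Tree V′ d m
    tree-↭ p t = record { es = es ; points = ↭-trans points p ; dominated = dominated ; gap≤ = gap≤ ; zero-gap = zero-gap ; long = long }
      where open Tree t

-- Duality between T-joins and trees

module JoinDuality where

  open TJoins
  open LaminarTrees
  open Walks using (unique-↭)
  open import Data.Bool.Base using (Bool; true; false; _∧_; not)
  open import Data.Bool.Properties using (xor-assoc; xor-comm; xor-same; xor-identityʳ)
  import Data.Bool.Properties as Bool
  open import Data.Empty using (⊥)
  open import Data.Fin.Base using (Fin; zero; suc)
  import Data.Fin.Properties as Fin
  open import Data.List.Base using (List; []; _∷_; _++_; length; map)
  open import Data.List.Membership.Propositional using (_∈_; find)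
  open import Data.List.Membership.Propositional.Properties using (∈-∃++)
  open import Data.List.Relation.Binary.Permutation.Propositional using (_↭_; refl; ↭-sym)
  open import Data.List.Relation.Binary.Permutation.Propositional.Properties using (All-resp-↭; ∈-resp-↭; ↭-length; shift)
  open import Data.List.Relation.Unary.All as All using (All; []; _∷_)
  open import Data.List.Relation.Unary.AllPairs using (AllPairs; []; _∷_)
  open import Data.List.Relation.Unary.Any as Any using (Any; here; there; any?)
  open import Data.Nat.Base
  open import Data.Nat.Properties
  open import Data.Nat.Tactic.RingSolver using (solve-∀)
  open import Data.Product.Base using (∃-syntax; _×_; _,_; proj₁; proj₂)
  open import Data.Sum.Base using (_⊎_; inj₁; inj₂)
  open import Relation.Binary.PropositionalEquality as ≡ using (_≡_; _≢_; cong; cong₂; sym; subst)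
  open import Relation.Nullary.Decidable.Core using (Dec; yes; no; _×-dec_; ¬?; does)
  open import Relation.Nullary.Negation.Core using (¬_; contradiction)

  private
    ⊕-cancel : ∀ a b → a ⊕ (a ⊕ b) ≡ b
    ⊕-cancel a b = ≡.trans (sym (xor-assoc a a b)) (cong (_⊕ b) (xor-same a))

    ⊕-cancelʳ : ∀ a b → (b ⊕ a) ⊕ a ≡ b
    ⊕-cancelʳ a b = ≡.trans (xor-assoc b a a) (≡.trans (cong (b ⊕_) (xor-same a)) (xor-identityʳ b))

    interchange : ∀ a b c d → (a ⊕ b) ⊕ (c ⊕ d) ≡ (a ⊕ c) ⊕ (b ⊕ d)
    interchange a b c d = ≡.trans (xor-assoc a b (c ⊕ d)) (≡.trans (cong (a ⊕_) (≡.trans (sym (xor-assoc b c d)) (≡.trans (cong (_⊕ d) (xor-comm b c)) (xor-assoc c b d)))) (sym (xor-assoc a c (b ⊕ d))))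

    xorSum : ∀ {n} → (Fin n → Bool) → Bool
    xorSum {zero}  g = false
    xorSum {suc n} g = g zero ⊕ xorSum (λ i → g (suc i))

    xorSum-cong : ∀ {n} {g h : Fin n → Bool} → (∀ i → g i ≡ h i) → xorSum g ≡ xorSum h
    xorSum-cong {zero}  e = ≡.refl
    xorSum-cong {suc n} e = cong₂ _⊕_ (e zero) (xorSum-cong λ i → e (suc i))

    xorSum-⊕ : ∀ {n} (g h : Fin n → Bool) → xorSum (λ i → g i ⊕ h i) ≡ xorSum g ⊕ xorSum h
    xorSum-⊕ {zero}  g h = ≡.refl
    xorSum-⊕ {suc n} g h = ≡.trans (cong ((g zero ⊕ h zero) ⊕_) (xorSum-⊕ (λ i → g (suc i)) λ i → h (suc i))) (interchange (g zero) (h zero) _ _)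

    xorSum-false : ∀ {n} (f : Fin n → Bool) → xorSum (λ i → f i ∧ false) ≡ false
    xorSum-false {zero}  f = ≡.refl
    xorSum-false {suc n} f = cong₂ _⊕_ (Bool.∧-zeroʳ (f zero)) (xorSum-false (λ i → f (suc i)))

    xorSum-δ : ∀ {n} (f : Fin n → Bool) u → xorSum (λ w → f w ∧ does (u Fin.≟ w)) ≡ f u
    xorSum-δ {suc n} f zero    = ≡.trans (cong₂ _⊕_ (Bool.∧-identityʳ (f zero)) (xorSum-false (λ i → f (suc i)))) (xor-identityʳ (f zero))
    xorSum-δ {suc n} f (suc u) = ≡.trans (cong (_⊕ xorSum (λ w → f (suc w) ∧ does (u Fin.≟ w))) (Bool.∧-zeroʳ (f zero))) (xorSum-δ (λ i → f (suc i)) u)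

  module _ {k : ℕ} where

    IsJoin : List (Fin k) → (Fin k → Bool) → List (Edge {k}) → Set
    IsJoin V T J = Within V J × (∀ w → par J w ≡ T w)

    private
      -- Modulo 2, d is the coboundary of f, so the parity of a cost is the pairing of f with the
      -- set of odd vertices.
      odd-cost : ∀ {d : Weight} {f : Fin k → Bool} → (∀ u v → isOdd (d u v) ≡ f u ⊕ f v) → ∀ J → isOdd (cost d J) ≡ xorSum (λ w → f w ∧ par J w)
      odd-cost {d} {f} h [] = sym (xorSum-false f)
      odd-cost {d} {f} h ((u , v) ∷ J) = ≡.trans (isOdd-+ (d u v) (cost d J)) (≡.trans (cong₂ _⊕_
          (≡.trans (h u v) (sym (≡.trans (xorSum-cong λ w → Bool.∧-distribˡ-xor (f w) (δᵇ u w) (δᵇ v w)) (≡.trans (xorSum-⊕ (λ w → f w ∧ δᵇ u w) (λ w → f w ∧ δᵇ v w)) (cong₂ _⊕_ (xorSum-δ f u) (xorSum-δ f v))))))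
          (odd-cost h J))
        (≡.trans (sym (xorSum-⊕ (λ w → f w ∧ inc (u , v) w) (λ w → f w ∧ par J w))) (xorSum-cong λ w → sym (Bool.∧-distribˡ-xor (f w) (inc (u , v) w) (par J w)))))

      same-odd : ∀ {d : Weight} {f : Fin k → Bool} → (∀ u v → isOdd (d u v) ≡ f u ⊕ f v) → ∀ J K → (∀ w → par J w ≡ par K w) → isOdd (cost d J) ≡ isOdd (cost d K)
      same-odd {f = f} h J K e = ≡.trans (odd-cost h J) (≡.trans (xorSum-cong λ w → cong (f w ∧_) (e w)) (sym (odd-cost h K)))

      above-by-two : ∀ {x y} → suc x ≤ y → isOdd x ≡ isOdd y → 2 + x ≤ y
      above-by-two {x} {y} x<y e with suc x ≟ y
      ... | yes ≡.refl = contradiction e (not-self (isOdd x))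
        where
        not-self : ∀ b → b ≢ not b
        not-self true ()
        not-self false ()
      ... | no ne = ≤∧≢⇒< x<y ne

      end-∈ : ∀ {V : List (Fin k)} {J : List Edge} {s : Fin k} → Within V J → (t : At s J) → At.other t ∈ V
      end-∈ w t with All.head (All-resp-↭ (At.split t) w) | At.ends t
      ... | u∈ , v∈ | inj₁ e = subst (_∈ _) (cong proj₂ e) v∈
      ... | u∈ , v∈ | inj₂ e = subst (_∈ _) (cong proj₁ e) u∈

    -- Over all vertices y of V, the cost of a cheapest join for T with the parities of r and y
    -- flipped is least at x, where R attains it. At such an x the next cut can be packed.
    module Shrink (V : List (Fin k)) (d : Weight) (f : Fin k → Bool) (parity : ∀ u v → isOdd (d u v) ≡ f u ⊕ f v)
      (positive : ∀ {u v} → u ∈ V → v ∈ V → u ≢ v → 0 < d u v)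
      (T : Fin k → Bool) (r : Fin k) (Tr : T r ≡ true) (x : Fin k) (x∈ : x ∈ V)
      (R : List Edge) (joinR : IsJoin V (λ w → T w ⊕ (δᵇ r w ⊕ δᵇ x w)) R)
      (minimal : ∀ y → y ∈ V → ∀ K → IsJoin V (λ w → T w ⊕ (δᵇ r w ⊕ δᵇ y w)) K → cost d R ≤ cost d K) where

      private
        μ : ℕ
        μ = cost d R

        edge-pos : ∀ {J : List Edge} {s : Fin k} → Within V J → (t : At s J) → let (u , v) = At.edge t in 0 < d u v
        edge-pos {s = s} w t with All.head (All-resp-↭ (At.split t) w) | At.ends t
        ... | u∈ , v∈ | inj₁ e = positive u∈ v∈ λ eq → At.s≢ t (≡.trans (sym (cong proj₁ e)) (≡.trans eq (cong proj₂ e)))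
        ... | u∈ , v∈ | inj₂ e = positive u∈ v∈ λ eq → At.s≢ t (≡.trans (sym (cong proj₂ e)) (≡.trans (sym eq) (cong proj₁ e)))

        retarget : ∀ t r x y → (x ⊕ y) ⊕ (t ⊕ (r ⊕ x)) ≡ t ⊕ (r ⊕ y)
        retarget t r x y = ≡.trans (xor-comm (x ⊕ y) _) (≡.trans (xor-assoc t (r ⊕ x) (x ⊕ y)) (cong (t ⊕_) (≡.trans (xor-assoc r x (x ⊕ y)) (cong (r ⊕_) (⊕-cancel x y)))))

        par-rest : ∀ {J : List Edge} {s : Fin k} (t : At s J) w → par (At.rest t) w ≡ (δᵇ s w ⊕ δᵇ (At.other t) w) ⊕ par J w
        par-rest {J} {s} t w = sym (≡.trans (cong ((δᵇ s w ⊕ δᵇ (At.other t) w) ⊕_) (≡.trans (par-↭ (At.split t) w) (cong (_⊕ par (At.rest t) w) (At.incident t w)))) (⊕-cancel (δᵇ s w ⊕ δᵇ (At.other t) w) _))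

        -- Deleting an edge of R at x would give a strictly cheaper join for the other end of that
        -- edge, against the choice of x.
        degR : deg R x ≡ 0
        degR with deg R x in eq
        ... | zero  = ≡.refl
        ... | suc _ = contradiction (minimal (At.other t) (end-∈ (proj₁ joinR) t) (At.rest t)
                (All.tail (All-resp-↭ (At.split t) (proj₁ joinR)) , λ w → ≡.trans (par-rest t w) (≡.trans (cong ((δᵇ x w ⊕ δᵇ (At.other t) w) ⊕_) (proj₂ joinR w)) (retarget (T w) (δᵇ r w) (δᵇ x w) (δᵇ (At.other t) w)))))
              (<⇒≱ (subst (cost d (At.rest t) <_) (sym (cost-↭ d (At.split t))) (m<n+m (cost d (At.rest t)) (edge-pos (proj₁ joinR) t))))
          where
          t : At x R
          t = pick-deg x R (subst (0 <_) (sym eq) (s≤s z≤n))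

      r≢x : r ≢ x
      r≢x ≡.refl with () ← ≡.trans (sym (deg0⇒par R r degR)) (≡.trans (proj₂ joinR r) (≡.trans (cong (T r ⊕_) (xor-same (δᵇ r r))) (≡.trans (xor-identityʳ (T r)) Tr)))

      private
        -- Induction on the degree of x. Remove an edge from x to y and exchange a path from y to x
        -- with R: this gives a join `A₁` for x with two edges fewer at x, and a join `B₁` for y.
        -- The removed edge and `B₁` together weigh more than μ, by parity at least μ + 2, which
        -- pays for the two edges.
        heavy : ∀ n A → deg A x ≤ n → IsJoin V (λ w → T w ⊕ (δᵇ r w ⊕ δᵇ x w)) A → μ + deg A x ≤ cost d A
        heavy n A le joinA with deg A x in eq
        ... | zero = ≤-trans (≤-reflexive (+-identityʳ μ)) (minimal x x∈ A joinA)
        heavy (suc n) A (s≤s le) joinA | suc degA = conclude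
          where
          t : At x A
          t = pick-deg x A (subst (0 <_) (sym eq) (s≤s z≤n))
          y : Fin k
          y = At.other t
          A₀ : List Edge
          A₀ = At.rest t
          de : ℕ
          de = d (proj₁ (At.edge t)) (proj₂ (At.edge t))
          deg-A₀ : deg A₀ x ≡ degA
          deg-A₀ = suc-injective (≡.trans (sym (cong (λ b → ⟦ b ⟧ + deg A₀ x) (At.inc-s t))) (≡.trans (sym (deg-↭ (At.split t) x)) eq))
          par-A₀ : ∀ w → par A₀ w ≡ T w ⊕ (δᵇ r w ⊕ δᵇ y w)
          par-A₀ w = ≡.trans (par-rest t w) (≡.trans (cong ((δᵇ x w ⊕ δᵇ y w) ⊕_) (proj₂ joinA w)) (retarget (T w) (δᵇ r w) (δᵇ x w) (δᵇ y w)))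
          swapped : Swap V A₀ R y x
          swapped = swapPath V _ A₀ R y x ≤-refl (All.tail (All-resp-↭ (At.split t) (proj₁ joinA))) (proj₁ joinR) (λ e → At.s≢ t (sym e)) degR
            λ w → ≡.trans (cong₂ _⊕_ (par-A₀ w) (proj₂ joinR w)) (≡.trans (interchange (T w) _ (T w) _) (≡.trans (cong (_⊕ ((δᵇ r w ⊕ δᵇ y w) ⊕ (δᵇ r w ⊕ δᵇ x w))) (xor-same (T w)))
                (≡.trans (interchange (δᵇ r w) (δᵇ y w) (δᵇ r w) (δᵇ x w)) (cong (_⊕ (δᵇ y w ⊕ δᵇ x w)) (xor-same (δᵇ r w))))))
          open Swap swapped renaming (A′ to A₁; R′ to B₁)
          joinA₁ : IsJoin V (λ w → T w ⊕ (δᵇ r w ⊕ δᵇ x w)) A₁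
          joinA₁ = within-A , λ w → ≡.trans (par-A w) (≡.trans (cong (_⊕ (δᵇ y w ⊕ δᵇ x w)) (par-A₀ w)) (≡.trans (xor-comm _ (δᵇ y w ⊕ δᵇ x w)) (retarget (T w) (δᵇ r w) (δᵇ y w) (δᵇ x w))))
          joinB₁ : IsJoin V (λ w → T w ⊕ (δᵇ r w ⊕ δᵇ y w)) B₁
          joinB₁ = within-R , λ w → ≡.trans (par-R w) (≡.trans (cong₂ _⊕_ (proj₂ joinR w) (xor-comm (δᵇ y w) (δᵇ x w))) (≡.trans (xor-comm _ (δᵇ x w ⊕ δᵇ y w)) (retarget (T w) (δᵇ r w) (δᵇ x w) (δᵇ y w))))
          two-more : 2 + μ ≤ de + cost d B₁
          two-more = above-by-two (+-mono-≤ (edge-pos (proj₁ joinA) t) (minimal y (end-∈ (proj₁ joinA) t) B₁ joinB₁))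
            (same-odd {d} {f} parity R (At.edge t ∷ B₁) λ w → ≡.trans (proj₂ joinR w) (sym (≡.trans (cong₂ _⊕_ (At.incident t w) (proj₂ joinB₁ w))
              (≡.trans (cong (_⊕ (T w ⊕ (δᵇ r w ⊕ δᵇ y w))) (xor-comm (δᵇ x w) (δᵇ y w))) (retarget (T w) (δᵇ r w) (δᵇ y w) (δᵇ x w))))))
          degA≡ : degA ≡ suc (deg A₁ x)
          degA≡ = ≡.trans (sym deg-A₀) degree
          conclude : μ + suc degA ≤ cost d A
          conclude = +-cancelʳ-≤ μ (μ + suc degA) (cost d A) (begin
            (μ + suc degA) + μ                                ≡⟨ cong (λ z → (μ + suc z) + μ) degA≡ ⟩
            (μ + suc (suc (deg A₁ x))) + μ                    ≡⟨ ring₁ μ (deg A₁ x) ⟩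
            (μ + deg A₁ x) + (2 + μ)                          ≤⟨ +-mono-≤ (heavy n A₁ (≤-trans (n≤1+n _) (≤-trans (≤-reflexive (sym degA≡)) le)) joinA₁) two-more ⟩
            cost d A₁ + (de + cost d B₁)                      ≡⟨ ring₂ (cost d A₁) de (cost d B₁) ⟩
            de + (cost d A₁ + cost d B₁)                      ≡⟨ cong (de +_) (costs d) ⟩
            de + (cost d A₀ + μ)                              ≡⟨ +-assoc de (cost d A₀) μ ⟨
            (de + cost d A₀) + μ                              ≡⟨ cong (_+ μ) (cost-↭ d (At.split t)) ⟨
            cost d A + μ                                      ∎)
            where
            open ≤-Reasoning
            ring₁ : ∀ m a → (m + suc (suc a)) + m ≡ (m + a) + (2 + m)
            ring₁ = solve-∀
            ring₂ : ∀ a e b → a + (e + b) ≡ e + (a + b)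
            ring₂ = solve-∀

      -- Exchanging a path from r to x between J and R gives a join for x with one edge fewer at x,
      -- bounded by `heavy`, and a T-join, bounded by the hypothesis.
      shrunk-cost : ∀ {m′} → (∀ J → IsJoin V T J → suc m′ ≤ cost d J) → ∀ J → IsJoin V T J → m′ + deg J x ≤ cost d J
      shrunk-cost {m′} least J joinJ = +-cancelʳ-≤ μ (m′ + deg J x) (cost d J) (begin
        (m′ + deg J x) + μ              ≡⟨ cong (λ z → (m′ + z) + μ) degree ⟩
        (m′ + suc (deg A x)) + μ        ≡⟨ ring m′ (deg A x) μ ⟩
        (μ + deg A x) + suc m′          ≤⟨ +-mono-≤ (heavy _ A ≤-refl joinA) (least B joinB) ⟩
        cost d A + cost d B             ≡⟨ costs d ⟩
        cost d J + μ                    ∎)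
        where
        open ≤-Reasoning
        ring : ∀ m a u → (m + suc a) + u ≡ (u + a) + suc m
        ring = solve-∀
        open Swap (swapPath V _ J R r x ≤-refl (proj₁ joinJ) (proj₁ joinR) r≢x degR
          λ w → ≡.trans (cong₂ _⊕_ (proj₂ joinJ w) (proj₂ joinR w)) (⊕-cancel (T w) _)) renaming (A′ to A; R′ to B)
        joinA : IsJoin V (λ w → T w ⊕ (δᵇ r w ⊕ δᵇ x w)) A
        joinA = within-A , λ w → ≡.trans (par-A w) (cong (_⊕ (δᵇ r w ⊕ δᵇ x w)) (proj₂ joinJ w))
        joinB : IsJoin V T B
        joinB = within-R , λ w → ≡.trans (par-R w) (≡.trans (cong (_⊕ (δᵇ r w ⊕ δᵇ x w)) (proj₂ joinR w)) (⊕-cancelʳ (δᵇ r w ⊕ δᵇ x w) (T w)))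

    private
      Boundary : Set
      Boundary = Fin k → Bool

      module Merge (x a : Fin k) (a≢x : a ≢ x) where

        rename : Fin k → Fin k
        rename u with u Fin.≟ a
        ... | yes _ = x
        ... | no _  = u

        rename-a : rename a ≡ x
        rename-a with a Fin.≟ a
        ... | yes _ = ≡.refl
        ... | no h  = contradiction ≡.refl h

        rename-≢ : ∀ {u} → u ≢ a → rename u ≡ u
        rename-≢ {u} u≢a with u Fin.≟ a
        ... | yes e = contradiction e u≢a
        ... | no _  = ≡.refl

        renameEdge : Edge → Edge
        renameEdge (u , v) = rename u , rename v

        -- The boundary after contracting a into x: the parity at a moves to x.
        push : Boundary → Boundary
        push g w = not (δᵇ a w) ∧ (g w ⊕ (δᵇ x w ∧ g a))

        private
          push-⊕ : ∀ g h w → push (λ v → g v ⊕ h v) w ≡ push g w ⊕ push h w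
          push-⊕ g h w = ≡.trans (cong (not (δᵇ a w) ∧_) (≡.trans (cong ((g w ⊕ h w) ⊕_) (Bool.∧-distribˡ-xor (δᵇ x w) (g a) (h a))) (interchange (g w) (h w) _ _)))
            (Bool.∧-distribˡ-xor (not (δᵇ a w)) _ _)

          push-δ : ∀ u w → δᵇ (rename u) w ≡ push (δᵇ u) w
          push-δ u w = byCases (u Fin.≟ a) (a Fin.≟ w)
            where
            fromA : Dec (a ≡ w) → δᵇ x w ≡ push (δᵇ a) w
            fromA (yes ≡.refl) = ≡.trans (δᵇ-≢ (λ e → a≢x (sym e))) (sym (cong (λ b → not b ∧ (b ⊕ (δᵇ x a ∧ b))) (δᵇ-refl a)))
            fromA (no a≢w) = sym (≡.trans (cong (λ b → not b ∧ (b ⊕ (δᵇ x w ∧ δᵇ a a))) (δᵇ-≢ a≢w)) (≡.trans (cong (δᵇ x w ∧_) (δᵇ-refl a)) (Bool.∧-identityʳ (δᵇ x w))))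
            fromU : u ≢ a → Dec (a ≡ w) → δᵇ u w ≡ push (δᵇ u) w
            fromU u≢a (yes ≡.refl) = ≡.trans (δᵇ-≢ u≢a) (sym (cong (λ b → not b ∧ (δᵇ u a ⊕ (δᵇ x a ∧ δᵇ u a))) (δᵇ-refl a)))
            fromU u≢a (no a≢w) = sym (≡.trans (cong (λ b → not b ∧ (δᵇ u w ⊕ (δᵇ x w ∧ δᵇ u a))) (δᵇ-≢ a≢w))
              (≡.trans (cong (δᵇ u w ⊕_) (≡.trans (cong (δᵇ x w ∧_) (δᵇ-≢ u≢a)) (Bool.∧-zeroʳ (δᵇ x w)))) (xor-identityʳ (δᵇ u w))))
            byCases : Dec (u ≡ a) → Dec (a ≡ w) → δᵇ (rename u) w ≡ push (δᵇ u) w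
            byCases (yes u≡a) d = ≡.trans (cong (λ z → δᵇ z w) (≡.trans (cong rename u≡a) rename-a)) (≡.trans (fromA d) (cong (λ z → push (δᵇ z) w) (sym u≡a)))
            byCases (no u≢a)  d = ≡.trans (cong (λ z → δᵇ z w) (rename-≢ u≢a)) (fromU u≢a d)

        push-par : ∀ J w → par (map renameEdge J) w ≡ push (par J) w
        push-par [] w = sym (≡.trans (cong (not (δᵇ a w) ∧_) (Bool.∧-zeroʳ (δᵇ x w))) (Bool.∧-zeroʳ (not (δᵇ a w))))
        push-par ((u , v) ∷ J) w = ≡.trans (cong₂ _⊕_ (≡.trans (cong₂ _⊕_ (push-δ u w) (push-δ v w)) (sym (push-⊕ (δᵇ u) (δᵇ v) w))) (push-par J w)) (sym (push-⊕ (inc (u , v)) (par J) w))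

        push-injective : ∀ g h → (∀ w → push g w ≡ push h w) → g a ≡ h a → ∀ w → g w ≡ h w
        push-injective g h e ea w with a Fin.≟ w
        ... | yes ≡.refl = ea
        ... | no a≢w = ≡.trans (sym (⊕-cancelʳ (δᵇ x w ∧ g a) (g w))) (≡.trans (cong₂ _⊕_ (≡.trans (sym (simple g)) (≡.trans (e w) (simple h))) (cong (δᵇ x w ∧_) ea)) (⊕-cancelʳ (δᵇ x w ∧ h a) (h w)))
          where
          simple : ∀ g → push g w ≡ g w ⊕ (δᵇ x w ∧ g a)
          simple g = cong (λ b → not b ∧ (g w ⊕ (δᵇ x w ∧ g a))) (δᵇ-≢ a≢w)

        push-cong : ∀ {g h} → (∀ w → g w ≡ h w) → ∀ w → push g w ≡ push h w
        push-cong e w = cong₂ (λ b c → not (δᵇ a w) ∧ (b ⊕ (δᵇ x w ∧ c))) (e w) (e a)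

        module _ (d : Weight {k}) where

          -- Once a and x are identified, an edge at x may start from either of them.
          merged : Weight
          merged u v with u Fin.≟ x | v Fin.≟ x
          ... | yes _ | yes _ = d u v
          ... | yes _ | no _  = d u v ⊓ d a v
          ... | no _  | yes _ = d u v ⊓ d u a
          ... | no _  | no _  = d u v

          merged-≤ : ∀ u v → merged u v ≤ d u v
          merged-≤ u v with u Fin.≟ x | v Fin.≟ x
          ... | yes _ | yes _ = ≤-refl
          ... | yes _ | no _  = m⊓n≤m _ _
          ... | no _  | yes _ = m⊓n≤m _ _
          ... | no _  | no _  = ≤-refl

          merged-≤ʳ : ∀ u → u ≢ x → merged u x ≤ d u a
          merged-≤ʳ u u≢x with u Fin.≟ x | x Fin.≟ x
          ... | yes e | _     = contradiction e u≢x
          ... | no _  | yes _ = m⊓n≤n _ _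
          ... | no _  | no h  = contradiction ≡.refl h

          merged-≤ˡ : ∀ v → v ≢ x → merged x v ≤ d a v
          merged-≤ˡ v v≢x with x Fin.≟ x | v Fin.≟ x
          ... | _     | yes e = contradiction e v≢x
          ... | yes _ | no _  = m⊓n≤n _ _
          ... | no h  | no _  = contradiction ≡.refl h

          merged-sym : (∀ u v → d u v ≡ d v u) → ∀ u v → merged u v ≡ merged v u
          merged-sym s u v with u Fin.≟ x | v Fin.≟ x
          ... | yes _ | yes _ = s u v
          ... | yes _ | no _  = cong₂ _⊓_ (s u v) (s a v)
          ... | no _  | yes _ = cong₂ _⊓_ (s u v) (s u a)
          ... | no _  | no _  = s u v

          merged-parity : ∀ {f : Boundary} → (∀ u v → isOdd (d u v) ≡ f u ⊕ f v) → f a ≡ f x → ∀ u v → isOdd (merged u v) ≡ f u ⊕ f v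
          merged-parity {f} par fa u v with u Fin.≟ x | v Fin.≟ x
          ... | yes _ | yes _ = par u v
          ... | no _  | no _  = par u v
          ... | yes ≡.refl | no _ with ⊓-sel (d u v) (d a v)
          ...   | inj₁ e = ≡.trans (cong isOdd e) (par u v)
          ...   | inj₂ e = ≡.trans (cong isOdd e) (≡.trans (par a v) (cong (_⊕ f v) fa))
          merged-parity {f} par fa u v | no _ | yes ≡.refl with ⊓-sel (d u v) (d u a)
          ...   | inj₁ e = ≡.trans (cong isOdd e) (par u v)
          ...   | inj₂ e = ≡.trans (cong isOdd e) (≡.trans (par u a) (cong (f u ⊕_) fa))

          liftEdge : ∀ {u v} → u ≢ a → v ≢ a → ∃[ e ] (renameEdge e ≡ (u , v) × d (proj₁ e) (proj₂ e) ≡ merged u v × (proj₁ e ≡ u ⊎ proj₁ e ≡ a) × (proj₂ e ≡ v ⊎ proj₂ e ≡ a))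
          liftEdge {u} {v} u≢a v≢a with u Fin.≟ x | v Fin.≟ x
          ... | yes _ | yes _ = (u , v) , cong₂ _,_ (rename-≢ u≢a) (rename-≢ v≢a) , ≡.refl , inj₁ ≡.refl , inj₁ ≡.refl
          ... | no _  | no _  = (u , v) , cong₂ _,_ (rename-≢ u≢a) (rename-≢ v≢a) , ≡.refl , inj₁ ≡.refl , inj₁ ≡.refl
          ... | yes u≡x | no _ with ⊓-sel (d u v) (d a v)
          ...   | inj₁ e = (u , v) , cong₂ _,_ (rename-≢ u≢a) (rename-≢ v≢a) , sym e , inj₁ ≡.refl , inj₁ ≡.refl
          ...   | inj₂ e = (a , v) , cong₂ _,_ (≡.trans rename-a (sym u≡x)) (rename-≢ v≢a) , sym e , inj₂ ≡.refl , inj₁ ≡.refl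
          liftEdge {u} {v} u≢a v≢a | no _ | yes v≡x with ⊓-sel (d u v) (d u a)
          ...   | inj₁ e = (u , v) , cong₂ _,_ (rename-≢ u≢a) (rename-≢ v≢a) , sym e , inj₁ ≡.refl , inj₁ ≡.refl
          ...   | inj₂ e = (u , a) , cong₂ _,_ (rename-≢ u≢a) (≡.trans rename-a (sym v≡x)) , sym e , inj₁ ≡.refl , inj₂ ≡.refl

          lift : ∀ {V′} → All (_≢ a) V′ → ∀ J′ → Within V′ J′ → ∃[ J ] (map renameEdge J ≡ J′ × cost d J ≡ cost merged J′ × Within (a ∷ V′) J)
          lift ne [] [] = [] , ≡.refl , ≡.refl , []
          lift {V′} ne ((u , v) ∷ J′) ((u∈ , v∈) ∷ w) =
            let (e , r≡ , c≡ , eu , ev) = liftEdge (All.lookup ne u∈) (All.lookup ne v∈) ; (J , rs , cs , ws) = lift ne J′ w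
            in e ∷ J , cong₂ _∷_ r≡ rs , cong₂ _+_ c≡ cs , (member u∈ eu , member v∈ ev) ∷ ws
            where
            member : ∀ {z y} → z ∈ V′ → y ≡ z ⊎ y ≡ a → y ∈ a ∷ V′
            member z∈ (inj₁ ≡.refl) = there z∈
            member z∈ (inj₂ ≡.refl) = here ≡.refl

      -- The predecessor, except at 0: lowering must change the parity everywhere for d to stay a
      -- coboundary modulo 2, also on pairs outside V, where a weight may be 0.
      flip : ℕ → ℕ
      flip zero    = 1
      flip (suc y) = y

      isOdd-flip : ∀ y → isOdd (flip y) ≡ not (isOdd y)
      isOdd-flip zero    = ≡.refl
      isOdd-flip (suc y) = not-not (isOdd y)
        where
        not-not : ∀ b → b ≡ not (not b)
        not-not true  = ≡.refl
        not-not false = ≡.refl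

      lower : Bool → ℕ → ℕ
      lower true  y = flip y
      lower false y = y

      isOdd-lower : ∀ b y → isOdd (lower b y) ≡ isOdd y ⊕ b
      isOdd-lower true  y = ≡.trans (isOdd-flip y) (xor-comm true (isOdd y))
      isOdd-lower false y = sym (xor-identityʳ (isOdd y))

      lower-+ : ∀ b {y} → 0 < y → lower b y + ⟦ b ⟧ ≡ y
      lower-+ true  {suc y} _ = +-comm y 1
      lower-+ false {y}     _ = +-identityʳ y

      within-↭ : ∀ {V V′ : List (Fin k)} {J} → V ↭ V′ → Within V J → Within V′ J
      within-↭ p = All.map λ (u∈ , v∈) → ∈-resp-↭ p u∈ , ∈-resp-↭ p v∈

      two-members : ∀ {V : List (Fin k)} {r x} → r ∈ V → x ∈ V → r ≢ x → 2 ≤ length V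
      two-members (here ≡.refl) (here ≡.refl) ne = contradiction ≡.refl ne
      two-members {_ ∷ _ ∷ _} (here _)  (there _) ne = s≤s (s≤s z≤n)
      two-members {_ ∷ _ ∷ _} (there _) _         ne = s≤s (s≤s z≤n)

    -- Seymour's theorem that a minimum T-join is as long as a maximum packing
    -- of T-cuts, by Sebő's argument: move the leaf x towards its neighbours, and
    -- identify leaves that have met.
    duality : ∀ m l (V : List (Fin k)) (d : Weight) (f T : Fin k → Bool) → length V ≤ l → AllPairs _≢_ V → (∀ u v → d u v ≡ d v u) → (∀ u v → isOdd (d u v) ≡ f u ⊕ f v) →
      ∀ J₀ → IsJoin V T J₀ → (∀ J → IsJoin V T J → m ≤ cost d J) → ¬ ¬ Tree V d m
    duality zero    l V d f T _ _ _ _ _ _ _ none = none (trivialTree V d)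
    duality (suc m) l V d f T size uniq d-sym parity J₀ joinJ₀ lower-bound none
      -- Two leaves at distance 0 have met and are identified; otherwise all distances within V are
      -- positive, as shrinking requires. The recursion is on m, then on the number of leaves.
      with any? (λ a → any? (λ x → ¬? (a Fin.≟ x) ×-dec (d a x ≟ 0)) V) V
    ... | yes pair = merge l size (find pair)
      where
      merge : ∀ l → length V ≤ l → ∃[ a ] (a ∈ V × Any (λ x → a ≢ x × d a x ≡ 0) V) → ⊥
      merge l size (a , a∈ , rest) with find rest | ∈-∃++ a∈
      ... | x , x∈ , a≢x , dax | xs , ys , eq = go l size
        where
        open Merge x a a≢x
        V′ : List (Fin k)
        V′ = xs ++ ys
        V↭ : V ↭ a ∷ V′
        V↭ = subst (_↭ a ∷ V′) (sym eq) (shift a xs ys)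
        uniq′ : AllPairs _≢_ (a ∷ V′)
        uniq′ = unique-↭ V↭ uniq
        a∉ : All (_≢ a) V′
        a∉ with uniq′
        ... | h ∷ _ = All.map (λ p q → p (sym q)) h
        uniqV′ : AllPairs _≢_ V′
        uniqV′ with uniq′
        ... | _ ∷ h = h
        drop-a : ∀ {u} → u ∈ V → u ≢ a → u ∈ V′
        drop-a u∈ u≢a with ∈-resp-↭ V↭ u∈
        ... | here e  = contradiction e u≢a
        ... | there h = h
        x∈′ : x ∈ V′
        x∈′ = drop-a x∈ λ e → a≢x (sym e)
        fa : f a ≡ f x
        fa = ≡.trans (sym (⊕-cancelʳ (f x) (f a))) (cong (_⊕ f x) (≡.trans (sym (parity a x)) (cong isOdd dax)))
        renamed∈ : ∀ {u} → u ∈ V → rename u ∈ V′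
        renamed∈ {u} u∈ with u Fin.≟ a
        ... | yes _  = x∈′
        ... | no u≢a = drop-a u∈ u≢a
        within-rename : ∀ {J} → Within V J → Within V′ (map renameEdge J)
        within-rename []              = []
        within-rename ((u∈ , v∈) ∷ w) = (renamed∈ u∈ , renamed∈ v∈) ∷ within-rename w
        join′ : IsJoin V′ (push T) (map renameEdge J₀)
        join′ = within-rename (proj₁ joinJ₀) , λ w → ≡.trans (push-par J₀ w) (push-cong (proj₂ joinJ₀) w)
        bound′ : ∀ J′ → IsJoin V′ (push T) J′ → suc m ≤ cost (merged d) J′
        bound′ J′ (w′ , p′) = let (J , r≡ , c≡ , w) = lift d a∉ J′ w′ in
          ≤-trans (complete J (within-↭ (↭-sym V↭) w) (λ v → ≡.trans (sym (push-par J v)) (≡.trans (cong (λ K → par K v) r≡) (p′ v))) (par J a Bool.≟ T a)) (≤-reflexive c≡)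
          where
          complete : ∀ J → Within V J → (∀ v → push (par J) v ≡ push T v) → Dec (par J a ≡ T a) → suc m ≤ cost d J
          complete J w p (yes e) = lower-bound J (w , push-injective (par J) T p e)
          -- If the parity at a is wrong, so is that at x; the edge from a to x costs 0 and repairs
          -- both.
          complete J w p (no ne) = subst (suc m ≤_) (cong (_+ cost d J) dax) (lower-bound ((a , x) ∷ J) ((a∈ , x∈) ∷ w , push-injective (par ((a , x) ∷ J)) T
            (λ v → ≡.trans (sym (push-par ((a , x) ∷ J) v)) (≡.trans (cong (_⊕ par (map renameEdge J) v) (≡.trans (cong₂ (λ b c → δᵇ b v ⊕ δᵇ c v) rename-a (rename-≢ (λ e → a≢x (sym e)))) (xor-same (δᵇ x v)))) (≡.trans (push-par J v) (p v))))
            (≡.trans (cong₂ (λ b c → (b ⊕ c) ⊕ par J a) (δᵇ-refl a) (δᵇ-≢ (λ e → a≢x (sym e)))) (differ (par J a) (T a) ne))))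
            where
            differ : ∀ b c → b ≢ c → true ⊕ b ≡ c
            differ true  true  h = contradiction ≡.refl h
            differ true  false h = ≡.refl
            differ false true  h = ≡.refl
            differ false false h = contradiction ≡.refl h
        go : ∀ l → length V ≤ l → ⊥
        go zero size with () ← ≤-trans (≤-reflexive (sym (↭-length V↭))) size
        go (suc l) size = duality (suc m) l V′ (merged d) f (push T) (≤-pred (≤-trans (≤-reflexive (sym (↭-length V↭))) size)) uniqV′ (merged-sym d d-sym) (merged-parity d {f} parity fa) (map renameEdge J₀) join′ bound′
          λ t → none (tree-↭ (↭-sym V↭) (attachTree x a (merged-≤ d) (merged-≤ʳ d) (merged-≤ˡ d) uniqV′ x∈′ t))
    ... | no noPair with Fin.any? (λ w → T w Bool.≟ true)
    ...   | no empty = contradiction (lower-bound [] ([] , λ w → sym (Bool.¬-not λ e → empty (w , e)))) λ ()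
    ...   | yes (r , Tr) = least {λ n → ∃[ x ] ∃[ R ] (x ∈ V × IsJoin V (λ w → T w ⊕ (δᵇ r w ⊕ δᵇ x w)) R × cost d R ≡ n)} some chosen
      where
      positive : ∀ {u v} → u ∈ V → v ∈ V → u ≢ v → 0 < d u v
      positive {u} {v} u∈ v∈ u≢v = n≢0⇒n>0 λ e → noPair (Any.map (λ { ≡.refl → Any.map (λ { ≡.refl → u≢v , e }) v∈ }) u∈)
      t₀ : At r J₀
      t₀ = pick-par r J₀ (≡.trans (proj₂ joinJ₀ r) Tr)
      r∈ : r ∈ V
      r∈ with All.head (All-resp-↭ (At.split t₀) (proj₁ joinJ₀)) | At.ends t₀
      ... | u∈ , v∈ | inj₁ e = subst (_∈ V) (cong proj₁ e) u∈
      ... | u∈ , v∈ | inj₂ e = subst (_∈ V) (cong proj₂ e) v∈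
      some : ∃[ n ] ∃[ x ] ∃[ R ] (x ∈ V × IsJoin V (λ w → T w ⊕ (δᵇ r w ⊕ δᵇ x w)) R × cost d R ≡ n)
      some = _ , At.other t₀ , At.rest t₀ , end-∈ (proj₁ joinJ₀) t₀ , (All.tail (All-resp-↭ (At.split t₀) (proj₁ joinJ₀)) ,
        λ w → ≡.trans (sym (⊕-cancel (δᵇ r w ⊕ δᵇ (At.other t₀) w) (par (At.rest t₀) w)))
          (≡.trans (cong ((δᵇ r w ⊕ δᵇ (At.other t₀) w) ⊕_) (≡.trans (cong (_⊕ par (At.rest t₀) w) (sym (At.incident t₀ w))) (≡.trans (sym (par-↭ (At.split t₀) w)) (proj₂ joinJ₀ w)))) (xor-comm _ (T w)))) , ≡.refl
      chosen : ∃[ n ] ((∃[ x ] ∃[ R ] (x ∈ V × IsJoin V (λ w → T w ⊕ (δᵇ r w ⊕ δᵇ x w)) R × cost d R ≡ n)) × (∀ j → (∃[ x ] ∃[ R ] (x ∈ V × IsJoin V (λ w → T w ⊕ (δᵇ r w ⊕ δᵇ x w)) R × cost d R ≡ j)) → n ≤ j)) → ⊥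
      chosen (n , (x , R , x∈ , joinR , ≡.refl) , minimal) =
        duality m l V d′ (λ w → f w ⊕ δᵇ w x) T size uniq (λ u v → cong₂ lower (xor-comm (δᵇ u x) (δᵇ v x)) (d-sym u v))
          (λ u v → ≡.trans (isOdd-lower (inc (u , v) x) (d u v)) (≡.trans (cong (_⊕ inc (u , v) x) (parity u v)) (interchange (f u) (f v) (δᵇ u x) (δᵇ v x))))
          J₀ joinJ₀ (λ J joinJ → +-cancelʳ-≤ (deg J x) m (cost d′ J) (≤-trans (shrunk-cost lower-bound J joinJ) (≤-reflexive (sym (reduced J (proj₁ joinJ))))))
          λ t → none (raiseTree x (λ {u} {v} u∈ v∈ u≢v → ≤-reflexive (lower-+ (inc (u , v) x) (positive u∈ v∈ u≢v))) uniq x∈ (two-members r∈ x∈ r≢x) t)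
        where
        open Shrink V d f parity positive T r Tr x x∈ R joinR (λ y y∈ K joinK → minimal (cost d K) (y , K , y∈ , joinK , ≡.refl))
        d′ : Weight
        d′ u v = lower (inc (u , v) x) (d u v)
        reduced : ∀ J → Within V J → cost d′ J + deg J x ≡ cost d J
        reduced [] [] = ≡.refl
        reduced ((u , v) ∷ J) ((u∈ , v∈) ∷ w) = ≡.trans (ring (d′ u v) (cost d′ J) ⟦ inc (u , v) x ⟧ (deg J x)) (cong₂ _+_ (single (u Fin.≟ v)) (reduced J w))
          where
          ring : ∀ a b c d → (a + b) + (c + d) ≡ (a + c) + (b + d)
          ring = solve-∀
          single : Dec (u ≡ v) → d′ u v + ⟦ inc (u , v) x ⟧ ≡ d u v
          single (yes ≡.refl) = ≡.trans (cong (λ b → lower b (d u u) + ⟦ b ⟧) (xor-same (δᵇ u x))) (+-identityʳ (d u u))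
          single (no u≢v)     = lower-+ (inc (u , v) x) (positive u∈ v∈ u≢v)

-- Christofides' walk, with trees for its two parts

module ChristofidesBounds where

  open TJoins
  open LaminarTrees
  open JoinDuality
  open Walks
  open Tours using (nub)
  open import Data.Bool.Base using (Bool; false)
  open import Data.Bool.Properties using (xor-assoc; xor-comm; xor-same; xor-identityʳ)
  open import Data.Empty using (⊥)
  open import Data.Fin.Base using (Fin; zero; suc)
  import Data.Fin.Properties as Fin
  open import Data.List.Base using (List; []; _∷_; _++_; length; map; allFin; cartesianProduct)
  open import Data.List.Properties using (length-tabulate)
  open import Data.List.Membership.Propositional using (_∈_; find)
  open import Data.List.Membership.Propositional.Properties using (∈-∃++; ∈-++⁺ˡ; ∈-++⁺ʳ; ∈-++⁻; ∈-allFin; ∈-cartesianProduct⁺; ∈-cartesianProduct⁻)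
  open import Data.List.Membership.DecPropositional using () renaming (_∈?_ to member?)
  open import Data.List.Membership.Propositional.Properties.WithK using (unique∧set⇒bag)
  open import Data.List.Relation.Binary.BagAndSetEquality using (∼bag⇒↭)
  open import Data.List.Relation.Binary.Permutation.Propositional using (_↭_; refl; prep; ↭-sym; ↭-trans)
  open import Data.List.Relation.Binary.Permutation.Propositional.Properties using (∈-resp-↭; ↭-length; shift)
  open import Data.List.Relation.Unary.All as All using (All; []; _∷_)
  open import Data.List.Relation.Unary.AllPairs using (AllPairs; []; _∷_)
  open import Data.List.Relation.Unary.Any as Any using (Any; here; there; any?)
  open import Data.List.Relation.Unary.Unique.Propositional.Properties using (allFin⁺)
  open import Data.Nat.Base
  open import Data.Nat.ListAction using (sum)
  open import Data.Nat.Properties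
  open import Data.Nat.Tactic.RingSolver using (solve-∀)
  open import Data.Product.Base using (∃-syntax; _×_; _,_; proj₁; proj₂)
  open import Data.Sum.Base using (_⊎_; inj₁; inj₂)
  open import Data.Unit.Base using (tt)
  open import Function.Bundles using (mk⇔)
  open import Relation.Binary.PropositionalEquality as ≡ using (_≡_; _≢_; cong; cong₂; sym; subst)
  open import Relation.Nullary.Decidable.Core using (Dec; yes; no)
  open import Relation.Nullary.Negation.Core using (¬_; contradiction)

  opaque
    argmin : ∀ {A : Set} (f : A → ℕ) x xs → ∃[ m ] (m ∈ x ∷ xs × (∀ {y} → y ∈ x ∷ xs → f m ≤ f y))
    argmin f x []       = x , here ≡.refl , λ { (here ≡.refl) → ≤-refl }
    argmin f x (y ∷ ys) with argmin f y ys
    ... | m , m∈ , h with ≤-total (f x) (f m)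
    ...   | inj₁ le = x , here ≡.refl , λ { (here ≡.refl) → ≤-refl ; (there z∈) → ≤-trans le (h z∈) }
    ...   | inj₂ ge = m , there m∈ , λ { (here ≡.refl) → ge ; (there z∈) → h z∈ }

    argmax : ∀ {A : Set} (f : A → ℕ) x xs → ∃[ m ] (m ∈ x ∷ xs × (∀ {y} → y ∈ x ∷ xs → f y ≤ f m))
    argmax f x []       = x , here ≡.refl , λ { (here ≡.refl) → ≤-refl }
    argmax f x (y ∷ ys) with argmax f y ys
    ... | m , m∈ , h with ≤-total (f x) (f m)
    ...   | inj₁ le = m , there m∈ , λ { (here ≡.refl) → le ; (there z∈) → h z∈ }
    ...   | inj₂ ge = x , here ≡.refl , λ { (here ≡.refl) → ≤-refl ; (there z∈) → ≤-trans (h z∈) ge }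

  module _ {k : ℕ} (M : Pseudometric (Fin k)) where
    open Pseudometric M

    private
      X : Set
      X = Fin k

      Edges : Set
      Edges = List (Edge {k})

      2d : Weight
      2d u v = 2 * d u v

    -- Prim's algorithm, started with the points D reached and U not yet reached:
    -- the points in the order in which they are reached, from where and at
    -- which distance.
    data Prim : List X → List X → List (X × ℕ × X) → Set where
      done : ∀ {D} → Prim D [] []
      step : ∀ {D U U′ L} v p → p ∈ D → U ↭ v ∷ U′ → (∀ {u w} → u ∈ D → w ∈ U → d p v ≤ d u w) → Prim (v ∷ D) U′ L → Prim D U ((v , d p v , p) ∷ L)

    private
      nearest : ∀ x D y U → ∃[ p ] ∃[ v ] (p ∈ x ∷ D × v ∈ y ∷ U × (∀ {u w} → u ∈ x ∷ D → w ∈ y ∷ U → d p v ≤ d u w))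
      nearest x D y U = let ((p , v) , pv∈ , h) = argmin (λ (u , w) → d u w) (x , y) (map (x ,_) U ++ cartesianProduct D (y ∷ U))
                            (p∈ , v∈) = ∈-cartesianProduct⁻ (x ∷ D) (y ∷ U) pv∈
                        in p , v , p∈ , v∈ , λ u∈ w∈ → h (∈-cartesianProduct⁺ u∈ w∈)

    opaque
      prim : ∀ x D U → ∃[ L ] Prim (x ∷ D) U L
      prim x D U = go (length U) x D U ≤-refl
        where
        go : ∀ fuel x D U → length U ≤ fuel → ∃[ L ] Prim (x ∷ D) U L
        go fuel x D [] _ = [] , done
        go (suc fuel) x D (y ∷ U) (s≤s size) with nearest x D y U
        ... | p , v , p∈ , v∈ , h with ∈-∃++ v∈
        ... | xs , ys , eq = let (L , P) = go fuel v (x ∷ D) (xs ++ ys) (≤-pred (≤-trans (≤-reflexive (sym (↭-length perm))) (s≤s size))) in _ , step v p p∈ perm h P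
          where
          perm : y ∷ U ↭ v ∷ (xs ++ ys)
          perm = subst (_↭ v ∷ (xs ++ ys)) (sym eq) (shift v xs ys)

    treeEdges : List (X × ℕ × X) → Edges
    treeEdges = map (λ (v , a , p) → p , v)

    module _ (H : ℕ) where
      private
        entry : X × ℕ × X → Entry
        entry (v , a , p) = v , H , H ∸ a

        H≤ : ∀ {a c} → a ≤ c → H ≤ c + (H ∸ a)
        H≤ {a} {c} a≤c = ≤-trans (m≤n+m∸n H a) (+-monoˡ-≤ (H ∸ a) a≤c)

        -- All leaves have height H, and the gap before a point reached at distance a is H - a. The
        -- least common ancestor of x and v is then at height H minus the longest step after x up to
        -- v. No such step is longer than d x v, because x was reached by then and v was not.
        prim-far : ∀ {D U L} → Prim D U L → ∀ {x} → x ∈ D → ∀ m → (∀ {w} → w ∈ U → H ≤ d x w + m) → Far 2d x H m (map entry L)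
        prim-far done x∈ m h = tt
        prim-far {D} {U} (step {U′ = U′} v p p∈ perm least P) {x} x∈ m h = twice , prim-far P (there x∈) (m ⊓ e) (λ w∈ → both (∈-resp-↭ (↭-sym perm) (there w∈)))
          where
          e : ℕ
          e = H ∸ d p v
          both : ∀ {w} → w ∈ U → H ≤ d x w + (m ⊓ e)
          both {w} w∈ = ≤-trans (⊓-glb (h w∈) (H≤ (least x∈ w∈))) (≤-reflexive (sym (+-distribˡ-⊓ (d x w) m e)))
          twice : H + H ≤ 2 * d x v + 2 * (m ⊓ e)
          twice = ≤-trans (+-mono-≤ v≤ v≤) (≤-reflexive (ring (d x v) (m ⊓ e)))
            where
            v≤ : H ≤ d x v + (m ⊓ e)
            v≤ = both (∈-resp-↭ (↭-sym perm) (here ≡.refl))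
            ring : ∀ a b → (a + b) + (a + b) ≡ 2 * a + 2 * b
            ring = solve-∀

        prim-dominated : ∀ {D U L} → Prim D U L → Dominated 2d (map entry L)
        prim-dominated done = tt
        prim-dominated (step v p p∈ perm least P) = prim-far P (here ≡.refl) H (λ {w} _ → m≤n+m H (d v w)) , prim-dominated P

        prim-points : ∀ {D U L} → Prim D U L → map pt (map entry L) ↭ U
        prim-points done = refl
        prim-points (step v p p∈ perm least P) = ↭-trans (prep v (prim-points P)) (↭-sym perm)

        entry-gap : ∀ L → All (λ z → gp z ≤ ht z) (map entry L)
        entry-gap []                = []
        entry-gap ((v , a , p) ∷ L) = m∸n≤m H a ∷ entry-gap L

        entry-sum : ∀ L → All (λ (_ , a , _) → a ≤ H) L → cost d (treeEdges L) ≡ sum (map (λ (_ , a , _) → a) L) →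
          cost d (treeEdges L) + sum (map gp (map entry L)) ≡ sum (map ht (map entry L))
        entry-sum L bs e = ≡.trans (cong (_+ sum (map gp (map entry L))) e) (go L bs)
          where
          go : ∀ L → All (λ (_ , a , _) → a ≤ H) L → sum (map (λ (_ , a , _) → a) L) + sum (map gp (map entry L)) ≡ sum (map ht (map entry L))
          go [] [] = ≡.refl
          go ((v , a , p) ∷ L) (b ∷ bs) = ≡.trans (ring a _ (H ∸ a) _) (cong₂ _+_ (m+[n∸m]≡n b) (go L bs))
            where
            ring : ∀ a b c d → (a + b) + (c + d) ≡ (a + c) + (b + d)
            ring = solve-∀

        entry-zero : ∀ L → Any (λ (_ , a , _) → a ≡ H) L → Any (λ z → gp z ≡ 0) (map entry L)
        entry-zero (_ ∷ L) (here ≡.refl) = here (n∸n≡0 H)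
        entry-zero (_ ∷ L) (there p)     = there (entry-zero L p)

      cost-tree : ∀ {D U L} → Prim D U L → cost d (treeEdges L) ≡ sum (map (λ (_ , a , _) → a) L)
      cost-tree done = ≡.refl
      cost-tree (step v p _ _ _ P) = cong (d p v +_) (cost-tree P)

      primTree : ∀ x {U L} → Prim (x ∷ []) U L → All (λ (_ , a , _) → a ≤ H) L → Any (λ (_ , a , _) → a ≡ H) L → Tree (x ∷ U) 2d (cost d (treeEdges L))
      primTree x {U} {L@(_ ∷ _)} P bs top = record
        { es        = (x , H , 0) ∷ map entry L
        ; points    = prep x (prim-points P)
        ; dominated = prim-far P (here ≡.refl) H (λ {w} _ → m≤n+m H (d x w)) , prim-dominated P
        ; gap≤      = z≤n ∷ entry-gap L
        ; zero-gap  = entry-zero L top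
        -- Each later leaf contributes H - (H - a) = a, and the first leaf adds its height H.
        ; long      = ≤-trans (≤-reflexive (entry-sum L bs (cost-tree P))) (m≤n+m _ H) }

    -- Taking the longest step for H makes the gap before its point 0, so that the root is a
    -- branching.
    primTree′ : ∀ x {y U L} → Prim (x ∷ []) (y ∷ U) L → Tree (x ∷ y ∷ U) 2d (cost d (treeEdges L))
    primTree′ x P@(step {L = L} v p _ _ _ _) =
      let ((_ , H , _) , top∈ , h) = argmax (λ (_ , a , _) → a) (v , d p v , p) L
      in primTree H x P (All.tabulate h) (Any.map (λ e → cong (λ (_ , a , _) → a) (sym e)) top∈)

    -- Well-separated points have a long spanning tree, which pays for the detours to all other
    -- vertices.
    prim-lower : ∀ {ρ D U L} → (∀ {u w} → u ∈ D → w ∈ U → ρ ≤ d u w) → (∀ {u w} → u ∈ U → w ∈ U → u ≢ w → ρ ≤ d u w) → AllPairs _≢_ U → Prim D U L → length U * ρ ≤ cost d (treeEdges L)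
    prim-lower {ρ} across inside uniq done = z≤n
    prim-lower {ρ} {D} {U} across inside uniq (step {U′ = U′} v p p∈ perm _ P) = ≤-trans (≤-reflexive (cong (_* ρ) (↭-length perm)))
      (+-mono-≤ (across p∈ (back (here ≡.refl))) (prim-lower across′ (λ u∈ w∈ → inside (back (there u∈)) (back (there w∈))) rest P))
      where
      back : ∀ {z} → z ∈ v ∷ U′ → z ∈ U
      back = ∈-resp-↭ (↭-sym perm)
      fresh : All (v ≢_) U′
      fresh with unique-↭ perm uniq
      ... | h ∷ _ = h
      rest : AllPairs _≢_ U′
      rest with unique-↭ perm uniq
      ... | _ ∷ h = h
      across′ : ∀ {u w} → u ∈ v ∷ D → w ∈ U′ → ρ ≤ d u w
      across′ (here ≡.refl) w∈ = inside (back (here ≡.refl)) (back (there w∈)) (All.lookup fresh w∈)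
      across′ (there u∈)    w∈ = across u∈ (back (there w∈))

    private
      deg-pos : ∀ {u v : X} (E : Edges) → (u , v) ∈ E ⊎ (v , u) ∈ E → u ≢ v → 0 < deg E u
      deg-pos {u} {v} (e ∷ E) (inj₁ (here ≡.refl)) u≢v = subst (λ b → 0 < ⟦ b ⟧ + deg E u) (sym (cong₂ _⊕_ (δᵇ-refl u) (δᵇ-≢ (λ e → u≢v (sym e))))) (s≤s z≤n)
      deg-pos {u} {v} (e ∷ E) (inj₂ (here ≡.refl)) u≢v = subst (λ b → 0 < ⟦ b ⟧ + deg E u) (sym (cong₂ _⊕_ (δᵇ-≢ (λ e → u≢v (sym e))) (δᵇ-refl u))) (s≤s z≤n)
      deg-pos (e ∷ E) (inj₁ (there h)) u≢v = ≤-trans (deg-pos E (inj₁ h) u≢v) (m≤n+m _ _)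
      deg-pos (e ∷ E) (inj₂ (there h)) u≢v = ≤-trans (deg-pos E (inj₂ h) u≢v) (m≤n+m _ _)

      edge-cost : ∀ {s : X} {E : Edges} (t : At s E) → d s (At.other t) + cost d (At.rest t) ≡ cost d E
      edge-cost {s} {E} t = sym (≡.trans (cost-↭ d (At.split t)) (cong (_+ cost d (At.rest t)) (ends≡ (At.ends t))))
        where
        ends≡ : At.edge t ≡ (s , At.other t) ⊎ At.edge t ≡ (At.other t , s) → d (proj₁ (At.edge t)) (proj₂ (At.edge t)) ≡ d s (At.other t)
        ends≡ (inj₁ e) = cong (λ (u , v) → d u v) e
        ends≡ (inj₂ e) = ≡.trans (cong (λ (u , v) → d u v) e) (d-sym (At.other t) s)

      On : List X → Edge {k} → Set
      On C (u , v) = u ∈ C × v ∈ C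

      at-on : ∀ {s : X} {E : Edges} {C} (t : At s E) → s ∈ C → At.other t ∈ C → ∀ {e} → e ∈ E → e ∈ At.rest t ⊎ On C e
      at-on {s} {E} {C} t s∈ o∈ e∈ with ∈-resp-↭ (At.split t) e∈
      ... | there h = inj₁ h
      ... | here ≡.refl with At.ends t
      ...   | inj₁ e = inj₂ (subst (On C) (sym e) (s∈ , o∈))
      ...   | inj₂ e = inj₂ (subst (On C) (sym e) (o∈ , s∈))

      peel : ∀ {s : X} {E : Edges} (t : At s E) w → par (At.rest t) w ≡ (δᵇ s w ⊕ δᵇ (At.other t) w) ⊕ par E w
      peel {s} {E} t w = sym (≡.trans (cong (i ⊕_) (≡.trans (par-↭ (At.split t) w) (cong (_⊕ par (At.rest t) w) (At.incident t w))))
        (≡.trans (sym (xor-assoc i i (par (At.rest t) w))) (cong (_⊕ par (At.rest t) w) (xor-same i))))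
        where
        i : Bool
        i = δᵇ s w ⊕ δᵇ (At.other t) w

      -- By `used`, an edge is left over or has both ends on the trail. This bookkeeping later shows
      -- that the final walk is closed under adjacency.
      record Trail (z y : X) (E : Edges) : Set where
        field
          zs    : List X
          E′    : Edges
          fewer : length E′ ≤ length E
          cheap : path d z zs y + cost d E′ ≡ cost d E
          even  : ∀ w → par E′ w ≡ false
          used  : ∀ {e} → e ∈ E → e ∈ E′ ⊎ On (y ∷ z ∷ zs) e

      trail : ∀ fuel (z y : X) (E : Edges) → length E ≤ fuel → z ≢ y → (∀ w → par E w ≡ δᵇ z w ⊕ δᵇ y w) → Trail z y E
      trail fuel z y E size z≢y h = go fuel size (pick-par z E (≡.trans (h z) (cong₂ _⊕_ (δᵇ-refl z) (δᵇ-≢ (λ e → z≢y (sym e))))))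
        where
        go : ∀ fuel → length E ≤ fuel → At z E → Trail z y E
        go fuel size t with At.other t Fin.≟ y
        ... | yes o≡y = record
          { zs = [] ; E′ = At.rest t ; fewer = ≤-trans (n≤1+n _) (≤-reflexive (sym (↭-length (At.split t))))
          ; cheap = ≡.trans (cong (λ o → d z o + cost d (At.rest t)) (sym o≡y)) (edge-cost t)
          ; even = λ w → ≡.trans (peel t w) (≡.trans (cong₂ _⊕_ (cong (λ o → δᵇ z w ⊕ δᵇ o w) o≡y) (h w)) (xor-same (δᵇ z w ⊕ δᵇ y w)))
          ; used = at-on t (there (here ≡.refl)) (here o≡y) }
        go zero size t | no _ with () ← ≤-trans (≤-reflexive (sym (↭-length (At.split t)))) size
        go (suc fuel) size t | no o≢y = record
          { zs = At.other t ∷ zs ; E′ = E′ ; fewer = ≤-trans fewer (≤-trans (n≤1+n _) (≤-reflexive (sym (↭-length (At.split t)))))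
          ; cheap = ≡.trans (+-assoc (d z (At.other t)) (path d (At.other t) zs y) (cost d E′)) (≡.trans (cong (d z (At.other t) +_) cheap) (edge-cost t))
          ; even = even
          ; used = λ e∈ → later (at-on {C = y ∷ z ∷ At.other t ∷ zs} t (there (here ≡.refl)) (there (there (here ≡.refl))) e∈) }
          where
          rest : Trail (At.other t) y (At.rest t)
          rest = trail fuel (At.other t) y (At.rest t) (≤-pred (≤-trans (≤-reflexive (sym (↭-length (At.split t)))) size)) o≢y
            λ w → ≡.trans (peel t w) (≡.trans (cong ((δᵇ z w ⊕ δᵇ (At.other t) w) ⊕_) (h w)) (cancel (δᵇ z w) (δᵇ (At.other t) w) (δᵇ y w)))
            where
            cancel : ∀ a b c → (a ⊕ b) ⊕ (a ⊕ c) ≡ b ⊕ c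
            cancel a b c = ≡.trans (cong (_⊕ (a ⊕ c)) (xor-comm a b)) (≡.trans (xor-assoc b a (a ⊕ c)) (cong (b ⊕_) (≡.trans (sym (xor-assoc a a c)) (cong (_⊕ c) (xor-same a)))))
          open Trail rest
          wider : ∀ {u} → u ∈ y ∷ At.other t ∷ zs → u ∈ y ∷ z ∷ At.other t ∷ zs
          wider (here e)  = here e
          wider (there h) = there (there h)
          later : ∀ {e} → e ∈ At.rest t ⊎ On (y ∷ z ∷ At.other t ∷ zs) e → e ∈ E′ ⊎ On (y ∷ z ∷ At.other t ∷ zs) e
          later (inj₂ on) = inj₂ on
          later (inj₁ e∈) with used e∈
          ... | inj₁ h         = inj₁ h
          ... | inj₂ (u∈ , v∈) = inj₂ (wider u∈ , wider v∈)

      record Splice (C : List X) (E : Edges) : Set where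
        constructor splice
        field
          C₁      : List X
          E₁      : Edges
          shorter : length E₁ < length E
          costs   : cyc d C₁ + cost d E₁ ≡ cyc d C + cost d E
          even₁   : ∀ w → par E₁ w ≡ false
          keeps   : ∀ {u} → u ∈ C → u ∈ C₁
          covers  : ∀ {e} → e ∈ E → e ∈ E₁ ⊎ On C₁ e

      spliceTrail : ∀ xs y ys (E : Edges) (t : At y E) → Trail (At.other t) y (At.rest t) → Splice (xs ++ y ∷ ys) E
      spliceTrail xs y ys E t record { zs = zs ; E′ = E′ ; fewer = fewer ; cheap = cheap ; even = even ; used = used } =
        splice (y ∷ z ∷ zs ++ y ∷ (ys ++ xs)) E′ (≤-trans (s≤s fewer) (≤-reflexive (sym (↭-length (At.split t))))) costs even
          (λ u∈ → moved (∈-++⁻ xs u∈)) (λ e∈ → where-is (at-on {C = y ∷ z ∷ zs} t (here ≡.refl) (there (here ≡.refl)) e∈))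
        where
        z : X
        z = At.other t
        costs : cyc d (y ∷ z ∷ zs ++ y ∷ (ys ++ xs)) + cost d E′ ≡ cyc d (xs ++ y ∷ ys) + cost d E
        costs = ≡.trans (cong (_+ cost d E′) (path-++ d y (z ∷ zs) y (ys ++ xs) y))
          (≡.trans (ring (d y z) (path d z zs y) (path d y (ys ++ xs) y) (cost d E′))
            (cong₂ _+_ (cyc-rotate d (y ∷ ys) xs) (≡.trans (cong (d y z +_) cheap) (edge-cost t))))
          where
          ring : ∀ a b c e → (a + b + c) + e ≡ c + (a + (b + e))
          ring = solve-∀
        moved : ∀ {u} → u ∈ xs ⊎ u ∈ y ∷ ys → u ∈ y ∷ z ∷ zs ++ y ∷ (ys ++ xs)
        moved (inj₁ u∈)            = there (∈-++⁺ʳ (z ∷ zs) (there (∈-++⁺ʳ ys u∈)))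
        moved (inj₂ (here ≡.refl)) = here ≡.refl
        moved (inj₂ (there u∈))    = there (∈-++⁺ʳ (z ∷ zs) (there (∈-++⁺ˡ u∈)))
        onTrail : ∀ {u} → u ∈ y ∷ z ∷ zs → u ∈ y ∷ z ∷ zs ++ y ∷ (ys ++ xs)
        onTrail (here e)  = here e
        onTrail (there h) = there (∈-++⁺ˡ h)
        on : ∀ {e} → On (y ∷ z ∷ zs) e → On (y ∷ z ∷ zs ++ y ∷ (ys ++ xs)) e
        on (u∈ , v∈) = onTrail u∈ , onTrail v∈
        used′ : ∀ {e} → e ∈ E′ ⊎ On (y ∷ z ∷ zs) e → e ∈ E′ ⊎ On (y ∷ z ∷ zs ++ y ∷ (ys ++ xs)) e
        used′ (inj₁ h) = inj₁ h
        used′ (inj₂ o) = inj₂ (on o)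
        where-is : ∀ {e} → e ∈ At.rest t ⊎ On (y ∷ z ∷ zs) e → e ∈ E′ ⊎ On (y ∷ z ∷ zs ++ y ∷ (ys ++ xs)) e
        where-is (inj₁ e∈) = used′ (used e∈)
        where-is (inj₂ o)  = inj₂ (on o)

    -- Euler: closed trails are spliced into a closed walk that cannot be
    -- extended.
    opaque
      euler : ∀ fuel C (E : Edges) → length E ≤ fuel → (∀ w → par E w ≡ false) →
        ∃[ C′ ] (cyc d C′ ≤ cyc d C + cost d E × (∀ {u} → u ∈ C → u ∈ C′) × (∀ {u v} → (u , v) ∈ E ⊎ (v , u) ∈ E → u ∈ C′ → v ∈ C′))
      euler fuel C E size even = go fuel size (any? (λ y → 0 <? deg E y) C)
        where
        Result : Set
        Result = ∃[ C′ ] (cyc d C′ ≤ cyc d C + cost d E × (∀ {u} → u ∈ C → u ∈ C′) × (∀ {u v} → (u , v) ∈ E ⊎ (v , u) ∈ E → u ∈ C′ → v ∈ C′))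
        extend : ∀ fuel → length E ≤ fuel → Splice C E → Result
        extend zero size (splice C₁ E₁ shorter costs even₁ keeps covers) with () ← ≤-trans shorter size
        extend (suc fuel) size (splice C₁ E₁ shorter costs even₁ keeps covers) =
          let (C′ , le , sub , closed) = euler fuel C₁ E₁ (≤-pred (≤-trans shorter size)) even₁ in
          C′ , ≤-trans le (≤-reflexive costs) , (λ u∈ → sub (keeps u∈)) , closed′ sub closed
          where
          closed′ : ∀ {C′} → (∀ {u} → u ∈ C₁ → u ∈ C′) → (∀ {u v} → (u , v) ∈ E₁ ⊎ (v , u) ∈ E₁ → u ∈ C′ → v ∈ C′) → ∀ {u v} → (u , v) ∈ E ⊎ (v , u) ∈ E → u ∈ C′ → v ∈ C′
          closed′ sub closed (inj₁ e∈) u∈ with covers e∈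
          ... | inj₁ h        = closed (inj₁ h) u∈
          ... | inj₂ (_ , v∈) = sub v∈
          closed′ sub closed (inj₂ e∈) u∈ with covers e∈
          ... | inj₁ h        = closed (inj₂ h) u∈
          ... | inj₂ (v∈ , _) = sub v∈
        go : ∀ fuel → length E ≤ fuel → Dec (Any (λ y → 0 < deg E y) C) → Result
        go fuel size (no none) = C , m≤m+n _ _ , (λ u∈ → u∈) , closed
          where
          closed : ∀ {u v} → (u , v) ∈ E ⊎ (v , u) ∈ E → u ∈ C → v ∈ C
          closed {u} {v} e u∈ with u Fin.≟ v
          ... | yes ≡.refl = u∈
          ... | no u≢v     = contradiction (Any.map (λ { ≡.refl → deg-pos E e u≢v }) u∈) none
        go fuel size (yes some) with find some
        ... | y , y∈ , deg>0 with ∈-∃++ y∈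
        ...   | xs , ys , eq = extend fuel size (subst (λ C → Splice C E) (sym eq) (spliceTrail xs y ys E t
                (trail _ (At.other t) y (At.rest t) ≤-refl (λ e → At.s≢ t (sym e)) λ w → ≡.trans (peel t w) (≡.trans (cong ((δᵇ y w ⊕ δᵇ (At.other t) w) ⊕_) (even w)) (≡.trans (xor-identityʳ _) (xor-comm (δᵇ y w) (δᵇ (At.other t) w)))))))
          where
          t : At y E
          t = pick-deg y E deg>0

    prim-reached : ∀ {D U L C} → Prim D U L → (∀ {u v} → (u , v) ∈ treeEdges L → u ∈ C → v ∈ C) → (∀ {u} → u ∈ D → u ∈ C) → ∀ {u} → u ∈ U → u ∈ C
    prim-reached (step v p p∈ perm _ P) closed start u∈ with ∈-resp-↭ perm u∈ | closed (here ≡.refl) (start p∈)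
    ... | here ≡.refl | v∈ = v∈
    ... | there u∈′   | v∈ = prim-reached P (λ e → closed (there e)) (λ { (here ≡.refl) → v∈ ; (there h) → start h }) u∈′

    prim-within : ∀ {D U L} {V : List X} → Prim D U L → (∀ {u} → u ∈ D → u ∈ V) → (∀ {u} → u ∈ U → u ∈ V) → Within V (treeEdges L)
    prim-within done _ _ = []
    prim-within (step v p p∈ perm _ P) inD inU = (inD p∈ , inU (∈-resp-↭ (↭-sym perm) (here ≡.refl))) ∷
      prim-within P (λ { (here ≡.refl) → inU (∈-resp-↭ (↭-sym perm) (here ≡.refl)) ; (there h) → inD h }) (λ h → inU (∈-resp-↭ (↭-sym perm) (there h)))

  private
    double-cost : ∀ {k} (d : Weight {k}) J → cost (λ u v → 2 * d u v) J ≡ 2 * cost d J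
    double-cost d []            = ≡.refl
    double-cost d ((u , v) ∷ J) = ≡.trans (cong (2 * d u v +_) (double-cost d J)) (sym (*-distribˡ-+ 2 (d u v) (cost d J)))

    cost-++ : ∀ {k} (d : Weight {k}) J K → cost d (J ++ K) ≡ cost d J + cost d K
    cost-++ d []            K = ≡.refl
    cost-++ d ((u , v) ∷ J) K = ≡.trans (cong (d u v +_) (cost-++ d J K)) (sym (+-assoc (d u v) (cost d J) (cost d K)))

  -- Christofides' tour, together with trees that bound the two parts of its cost.
  record Bounds {k} (M : Pseudometric (Fin k)) (ρ : ℕ) : Set where
    open Pseudometric M
    field
      ts      : List (Fin k)
      tour    : ts ↭ allFin k
      m₁ m₂   : ℕ
      tree₁   : Tree (allFin k) (λ u v → 2 * d u v) m₁
      tree₂   : Tree (allFin k) (λ u v → 2 * d u v) m₂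
      cheap   : 2 * cyc d ts ≤ 2 * m₁ + m₂
      far     : pred k * ρ ≤ m₁

  -- Doubled distances are even, so `duality` applies with f constantly `false`. The double negation
  -- stems from the choice of a cheapest join and from `duality`.
  christofides : ∀ {k} (M : Pseudometric (Fin (suc (suc k)))) ρ → (∀ u v → u ≢ v → ρ ≤ Pseudometric.d M u v) → ¬ ¬ Bounds M ρ
  -- The Prim tree T is itself a join for its odd vertices, so there are joins to minimise over.
  christofides {k} M ρ sep none = least {λ c → ∃[ J ] (IsJoin V (par T) J × cost 2d J ≡ c)} (_ , T , (withinT , λ _ → ≡.refl) , ≡.refl) chosen
    where
    open Pseudometric M
    K : ℕ
    K = suc (suc k)
    V U : List (Fin K)
    V = allFin K
    U = Data.List.Base.tabulate suc
    2d : Weight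
    2d u v = 2 * d u v
    L : List (Fin K × ℕ × Fin K)
    L = proj₁ (prim M zero [] U)
    P : Prim M (zero ∷ []) U L
    P = proj₂ (prim M zero [] U)
    T : List (Edge {K})
    T = treeEdges M L
    withinT : Within V T
    withinT = prim-within M P (λ _ → ∈-allFin _) (λ _ → ∈-allFin _)
    uniqU : AllPairs _≢_ U
    uniqU with allFin⁺ K
    ... | _ ∷ h = h
    first≢ : All (zero ≢_) U
    first≢ with allFin⁺ K
    ... | h ∷ _ = h
    tree₁ : Tree V 2d (cost d T)
    tree₁ = primTree′ M zero P
    far : suc k * ρ ≤ cost d T
    far = ≤-trans (≤-reflexive (cong (_* ρ) (sym (length-tabulate {n = suc k} suc)))) (prim-lower M (λ { (here ≡.refl) w∈ → sep _ _ (All.lookup first≢ w∈) }) (λ _ _ u≢w → sep _ _ u≢w) uniqU P)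
    chosen : ∃[ c ] ((∃[ J ] (IsJoin V (par T) J × cost 2d J ≡ c)) × (∀ c′ → (∃[ J ] (IsJoin V (par T) J × cost 2d J ≡ c′)) → c ≤ c′)) → ⊥
    chosen (c , (J , joinJ , ≡.refl) , minimal) = duality (cost 2d J) (length V) V 2d (λ _ → false) (par T) ≤-refl (allFin⁺ K)
      (λ u v → cong (2 *_) (d-sym u v)) (λ u v → isOdd-double (d u v)) J joinJ (λ J′ joinJ′ → minimal (cost 2d J′) (J′ , joinJ′ , ≡.refl))
      λ t → none (record { ts = vs ; tour = perm ; m₁ = cost d T ; m₂ = cost 2d J ; tree₁ = tree₁ ; tree₂ = t ; cheap = cheap ; far = far })
      where
      -- Tree and join together have even degrees, and the tree connects all points.
      walk = euler M _ (zero ∷ []) (T ++ J) ≤-refl (λ w → ≡.trans (par-++ T J w) (≡.trans (cong (par T w ⊕_) (proj₂ joinJ w)) (xor-same (par T w))))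
      C : List (Fin K)
      C = proj₁ walk
      start : zero ∈ C
      start = proj₁ (proj₂ (proj₂ walk)) (here ≡.refl)
      everywhere : ∀ u → u ∈ C
      everywhere zero    = start
      everywhere (suc i) = prim-reached M P (λ e → proj₂ (proj₂ (proj₂ walk)) (inj₁ (∈-++⁺ˡ e))) (λ { (here ≡.refl) → start }) (suc∈ i)
        where
        suc∈ : ∀ i → suc i ∈ U
        suc∈ i with ∈-allFin {n = K} (suc i)
        ... | there h = h
      nubbed = nub (member? Fin._≟_) C
      vs : List (Fin K)
      vs = proj₁ nubbed
      perm : vs ↭ V
      perm = ∼bag⇒↭ (unique∧set⇒bag (proj₁ (proj₂ (proj₂ nubbed))) (allFin⁺ K) (λ {x} → mk⇔ (λ _ → ∈-allFin x) (λ _ → proj₂ (proj₂ (proj₂ nubbed)) (everywhere x))))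
      cheap : 2 * cyc d vs ≤ 2 * cost d T + cost 2d J
      cheap = begin
        2 * cyc d vs                    ≤⟨ *-monoʳ-≤ 2 (cyc-⊆ (proj₁ (proj₂ nubbed))) ⟩
        2 * cyc d C                     ≤⟨ *-monoʳ-≤ 2 (proj₁ (proj₂ walk)) ⟩
        2 * (d zero zero + cost d (T ++ J)) ≡⟨ cong (λ y → 2 * (y + cost d (T ++ J))) (d-refl zero) ⟩
        2 * cost d (T ++ J)             ≡⟨ cong (2 *_) (cost-++ d T J) ⟩
        2 * (cost d T + cost d J)       ≡⟨ *-distribˡ-+ 2 (cost d T) (cost d J) ⟩
        2 * cost d T + 2 * cost d J     ≡⟨ cong (2 * cost d T +_) (double-cost d J) ⟨
        2 * cost d T + cost 2d J        ∎
        where open ≤-Reasoning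

-- Nets of separated points, and access to lists by position

module Nets where

  open TJoins using (Weight)
  open LaminarTrees
  open TreeLowerBound using (iota)
  open ChristofidesBounds using (argmin; argmax)
  open Walks
  open import Data.Fin.Base using (Fin; zero; suc)
  open import Data.List.Base using (List; []; _∷_; map; length; tabulate)
  open import Data.List.Membership.Propositional.Properties using (∈-allFin)
  open import Data.List.Relation.Unary.All as All using (All; []; _∷_)
  open import Data.List.Relation.Unary.Any using (Any; here; there)
  open import Data.Nat.Base
  open import Data.Nat.Properties
  open import Data.Product.Base using (∃-syntax; _×_; _,_; proj₁; proj₂)
  open import Relation.Binary.PropositionalEquality
  open import Relation.Nullary.Negation.Core using (contradiction)

  record Net {n} (M : Pseudometric (Fin (suc n))) (B k : ℕ) : Set where
    open Pseudometric M
    field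
      pts   : Fin (suc k) → Fin (suc n)
      ρ     : ℕ
      sep   : ∀ i j → i ≢ j → ρ ≤ d (pts i) (pts j)
      cov   : ∀ v → ∃[ i ] d (pts i) v ≤ ρ
      ρ≤B   : ρ ≤ B

  private
    -- Gonzalez: add a point that is farthest from the chosen ones.
    addFarthest : ∀ {n} (M : Pseudometric (Fin (suc n))) B k → Net M B k → Net M B (suc k)
    addFarthest {n} M B k N = record { pts = pts′ ; ρ = ρ′ ; sep = sep′ ; cov = λ v → suc (near v) , u-max v ; ρ≤B = ≤-trans ρ′≤ρ ρ≤B }
      where
      open Pseudometric M
      open Net N
      closest : ∀ v → ∃[ i ] (∀ j → d (pts i) v ≤ d (pts j) v)
      closest v = let (i , _ , h) = argmin (λ i → d (pts i) v) zero (tabulate suc) in i , λ j → h (∈-allFin j)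
      near : Fin (suc n) → Fin (suc k)
      near v = proj₁ (closest v)
      farthest : ∃[ u ] (∀ v → d (pts (near v)) v ≤ d (pts (near u)) u)
      farthest = let (u , _ , h) = argmax (λ v → d (pts (near v)) v) zero (tabulate suc) in u , λ v → h (∈-allFin v)
      u : Fin (suc n)
      u = proj₁ farthest
      u-max : ∀ v → d (pts (near v)) v ≤ d (pts (near u)) u
      u-max = proj₂ farthest
      ρ′ : ℕ
      ρ′ = d (pts (near u)) u
      ρ′≤ : ∀ i → ρ′ ≤ d (pts i) u
      ρ′≤ = proj₂ (closest u)
      ρ′≤ρ : ρ′ ≤ ρ
      ρ′≤ρ = let (i , h) = cov u in ≤-trans (ρ′≤ i) h
      pts′ : Fin (suc (suc k)) → Fin (suc n)
      pts′ zero    = u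
      pts′ (suc i) = pts i
      sep′ : ∀ i j → i ≢ j → ρ′ ≤ d (pts′ i) (pts′ j)
      sep′ zero    zero    ne = contradiction refl ne
      sep′ zero    (suc j) ne = ≤-trans (ρ′≤ j) (≤-reflexive (d-sym (pts j) u))
      sep′ (suc i) zero    ne = ρ′≤ i
      sep′ (suc i) (suc j) ne = ≤-trans ρ′≤ρ (sep i j λ e → ne (cong suc e))

  net : ∀ {n} (M : Pseudometric (Fin (suc n))) B → (∀ u v → Pseudometric.d M u v ≤ B) → ∀ k → Net M B k
  net M B bound zero    = record { pts = λ _ → zero ; ρ = B ; sep = λ { zero zero ne → contradiction refl ne } ; cov = λ v → zero , bound zero v ; ρ≤B = ≤-refl }
  net M B bound (suc k) = addFarthest M B k (net M B bound k)

  nth : ∀ {A : Set} → A → List A → ℕ → A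
  nth z []       i       = z
  nth z (x ∷ xs) zero    = x
  nth z (x ∷ xs) (suc i) = nth z xs i

  nth-all : ∀ {A : Set} {P : A → Set} (z : A) {xs} → All P xs → ∀ i → i < length xs → P (nth z xs i)
  nth-all z (p ∷ ps) zero    _       = p
  nth-all z (p ∷ ps) (suc i) (s≤s h) = nth-all z ps i h

  map-nth : ∀ {A B : Set} (f : A → B) z xs → map f xs ≡ map (λ i → f (nth z xs i)) (iota 0 (length xs))
  map-nth {A} {B} f z xs = go xs 0 (λ i → f (nth z xs i)) (λ i → refl)
    where
    go : ∀ xs p (g : ℕ → B) → (∀ i → g (p + i) ≡ f (nth z xs i)) → map f xs ≡ map g (iota p (length xs))
    go []       p g h = refl
    go (x ∷ xs) p g h = cong₂ _∷_ (trans (sym (h 0)) (cong g (+-identityʳ p))) (go xs (suc p) g λ i → trans (cong g (sym (+-suc p i))) (h (suc i)))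

  module _ {k : ℕ} (z : Entry {k}) where

    private
      far-index : ∀ {d : Weight} {x h} m es → Far d x h m es → ∀ j → j < length es →
        h + ht (nth z es j) ≤ d x (pt (nth z es j)) + 2 * m × (∀ g → g ≤ j → h + ht (nth z es j) ≤ d x (pt (nth z es j)) + 2 * gp (nth z es g))
      far-index {d} {x} {h} m ((y , h′ , e) ∷ es) (c , f) zero _ =
        ≤-trans c (+-monoʳ-≤ (d x y) (*-monoʳ-≤ 2 (m⊓n≤m m e))) , λ { zero _ → ≤-trans c (+-monoʳ-≤ (d x y) (*-monoʳ-≤ 2 (m⊓n≤n m e))) }
      far-index {d} {x} {h} m ((y , h′ , e) ∷ es) (c , f) (suc j) (s≤s j<) = let (b , bs) = far-index (m ⊓ e) es f j j< in
        ≤-trans b (+-monoʳ-≤ (d x (pt (nth z es j))) (*-monoʳ-≤ 2 (m⊓n≤m m e))) , λ { zero _ → ≤-trans b (+-monoʳ-≤ (d x (pt (nth z es j))) (*-monoʳ-≤ 2 (m⊓n≤n m e))) ; (suc g) (s≤s g≤) → bs g g≤ }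

    -- The least common ancestor is no higher than any gap in between. This yields one inequality
    -- per triple, the form in which three tokens can be checked.
    dominated-index : ∀ {d : Weight} es → Dominated d es → ∀ i g j → i < g → g ≤ j → j < length es →
      ht (nth z es i) + ht (nth z es j) ≤ d (pt (nth z es i)) (pt (nth z es j)) + 2 * gp (nth z es g)
    dominated-index ((x , h , e) ∷ es) (f , dm) zero    (suc g) (suc j) _         (s≤s g≤j) (s≤s j<) = proj₂ (far-index h es f j j<) g g≤j
    dominated-index ((x , h , e) ∷ es) (f , dm) (suc i) (suc g) (suc j) (s≤s i<g) (s≤s g≤j) (s≤s j<) = dominated-index es dm i g j i<g g≤j j<

    zero-index : ∀ es → 2 ≤ length es → ZeroGap es → ∃[ g ] (1 ≤ g × g < length es × gp (nth z es g) ≡ 0)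
    zero-index (x ∷ [])     (s≤s ()) _
    zero-index (x ∷ y ∷ es) _ zg = let (g , g< , e) = go (y ∷ es) zg in suc g , s≤s z≤n , s≤s g< , e
      where
      go : ∀ es → Any (λ w → gp w ≡ 0) es → ∃[ g ] (g < length es × gp (nth z es g) ≡ 0)
      go (w ∷ es) (here p)  = 0 , s≤s z≤n , p
      go (w ∷ es) (there p) = let (g , g< , e) = go es p in suc g , s≤s g< , e

-- Layout and rules of the tokens, and soundness of the rules

module TokenRules where

  open BitStrings
  open import Defs
  open TreeLowerBound
  open Programs using (fromℕ-mono-≤)
  open EdgeStreams using (dist; dist-sym; dist-≤)
  open Tours
  open Walks
  open import Data.Bool.Base using (Bool; false)
  open import Data.Empty using (⊥)
  open import Data.Fin.Base using (Fin; zero; suc; toℕ; fromℕ<)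
  import Data.Fin.Properties as Fin
  open import Data.List.Base using (List; []; _∷_; map)
  open import Data.List.Membership.Propositional using (_∈_)
  open import Data.List.Membership.Propositional.Properties using (∈-map⁺)
  open import Data.Maybe.Base using (Maybe; just)
  open import Data.Nat.Base
  open import Data.Nat.DivMod using (_/_; _%_; m≡m%n+[m/n]*n; m%n<n; m<n⇒m%n≡m; [m+kn]%n≡m%n; +-distrib-/-∣ˡ; m*n/n≡m; m<n⇒m/n≡0)
  open import Data.Nat.Divisibility using (n∣m*n)
  open import Data.Nat.ListAction using (sum)
  open import Data.Nat.Properties
  open import Data.Nat.Tactic.RingSolver using (solve-∀)
  open import Data.Product.Base using (∃-syntax; _×_; _,_; proj₁; proj₂)
  open import Data.Rational.Base as ℚ using (ℚ)
  import Data.Rational.Properties as ℚ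
  open import Data.Unit.Base using (⊤; tt)
  open import Data.Vec.Base as Vec using (Vec; []; _∷_; replicate)
  open import Data.Vec.Properties using (≡-dec)
  import Data.Bool.Properties as Bool
  open import Relation.Binary.PropositionalEquality
  open import Relation.Nullary.Decidable using (Dec; yes; no; _×-dec_; _→-dec_)

  data Role : Set where
    hdr : Role
    tok : ℕ → ℕ → Role

  module Check (n′ k ℓ′ bi′ q pad : ℕ) (α₀ : ℚ) where

    -- A token is a vertex and three numbers of q bits; `pad` makes room for a residue modulo p.
    n K ℓ bi b : ℕ
    n  = suc n′
    K  = suc (suc k)
    ℓ  = suc ℓ′
    bi = suc bi′
    b  = ℓ + (q + (q + (q + pad)))

    Word Index : Set
    Word  = Vec Bool b
    Index = Vec Bool bi

    -- Reduced modulo n, so that every bit string names a vertex and no message is malformed.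
    vdec : Vec Bool ℓ → Fin n
    vdec v = fromℕ< (m%n<n (val v) n)

    vert : Word → Fin n
    vert w = vdec (pre ℓ w)

    α β γ : Word → ℕ
    α w = val (pre q (suf ℓ w))
    β w = val (pre q (suf q (suf ℓ w)))
    γ w = val (pre q (suf q (suf q (suf ℓ w))))

    -- Token 0 is the header: α is the length of the closed walk, β its covering
    -- radius.  Then come the tokens tok 0 a of the walk (α: length so far) and
    -- tok 1 a, tok 2 a of two trees (α: height, β: height of the branching
    -- before, γ: length of the tree so far); β of their first token points to a
    -- branching at the root.
    role : ℕ → Role
    role zero    = hdr
    role (suc y) = tok (y / K) (y % K)

    roleOf : Index → Role
    roleOf i = role (val i)

    IsHeader : Role → Set
    IsHeader hdr       = ⊤
    IsHeader (tok _ _) = ⊥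

    isHeader? : ∀ r → Dec (IsHeader r)
    isHeader? hdr       = yes tt
    isHeader? (tok _ _) = no λ ()

    Between : Role → ℕ → ℕ → ℕ → Set
    Between hdr       κ i j = ⊥
    Between (tok κ′ g) κ i j = κ′ ≡ κ × i < g × g ≤ j

    between? : ∀ r κ i j → Dec (Between r κ i j)
    between? hdr        κ i j = no λ ()
    between? (tok κ′ g) κ i j = (κ′ ≟ κ) ×-dec ((i <? g) ×-dec (g ≤? j))

    total : Word → ℕ
    total t = n * (2 * β t) + α t

    Final : Word → Word → Word → Set
    Final t₁ t₂ t₃ = fromℕ (total t₃) ℚ.≤ α₀ ℚ.* fromℕ (γ t₁ ⊔ γ t₂)

    -- w is the distance of the vertices of t₁ and t₂.
    Rule : Role → Word → Role → Word → Role → Word → ℕ → Set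
    Rule (tok 0 a) t₁ (tok 0 a′) t₂ r₃ t₃ w =
      (a′ ≡ suc a → α t₁ + w ≤ α t₂) × (suc a ≡ K → a′ ≡ 0 → IsHeader r₃ → α t₁ + w ≤ α t₃)
    Rule (tok 0 a) t₁ hdr t₂ r₃ t₃ w = β t₁ ≤ β t₂
    Rule (tok (suc κ) i) t₁ (tok (suc κ′) j) t₂ r₃ t₃ w =
      (κ ≡ κ′ → (Between r₃ (suc κ) i j → α t₁ + α t₂ ≤ 2 * w + 2 * β t₃)
              × (j ≡ suc i → γ t₂ + β t₂ ≤ γ t₁ + α t₂)
              × (i ≡ 0 → γ t₁ ≤ α t₁ × 1 ≤ β t₁ × β t₁ < K × (β t₁ ≡ j → β t₂ ≡ 0)))
      × (κ ≡ 0 → κ′ ≡ 1 → suc i ≡ K → suc j ≡ K → IsHeader r₃ → Final t₁ t₂ t₃)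
    Rule _ _ _ _ _ _ _ = ⊤

    rule? : ∀ r₁ t₁ r₂ t₂ r₃ t₃ w → Dec (Rule r₁ t₁ r₂ t₂ r₃ t₃ w)
    rule? hdr               t₁ r₂                 t₂ r₃ t₃ w = yes tt
    rule? (tok 0 a)         t₁ hdr                t₂ r₃ t₃ w = β t₁ ≤? β t₂
    rule? (tok 0 a)         t₁ (tok 0 a′)         t₂ r₃ t₃ w =
      ((a′ ≟ suc a) →-dec (α t₁ + w ≤? α t₂)) ×-dec ((suc a ≟ K) →-dec ((a′ ≟ 0) →-dec (isHeader? r₃ →-dec (α t₁ + w ≤? α t₃))))
    rule? (tok 0 a)         t₁ (tok (suc κ′) j)   t₂ r₃ t₃ w = yes tt
    rule? (tok (suc κ) i)   t₁ hdr                t₂ r₃ t₃ w = yes tt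
    rule? (tok (suc κ) i)   t₁ (tok 0 a′)         t₂ r₃ t₃ w = yes tt
    rule? (tok (suc κ) i)   t₁ (tok (suc κ′) j)   t₂ r₃ t₃ w =
      ((κ ≟ κ′) →-dec ((between? r₃ (suc κ) i j →-dec (α t₁ + α t₂ ≤? 2 * w + 2 * β t₃))
        ×-dec (((j ≟ suc i) →-dec (γ t₂ + β t₂ ≤? γ t₁ + α t₂))
        ×-dec ((i ≟ 0) →-dec ((γ t₁ ≤? α t₁) ×-dec ((1 ≤? β t₁) ×-dec ((β t₁ <? K) ×-dec ((β t₁ ≟ j) →-dec (β t₂ ≟ 0)))))))))
      ×-dec ((κ ≟ 0) →-dec ((κ′ ≟ 1) →-dec ((suc i ≟ K) →-dec ((suc j ≟ K) →-dec (isHeader? r₃ →-dec (fromℕ (total t₃) ℚ.≤? α₀ ℚ.* fromℕ (γ t₁ ⊔ γ t₂)))))))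

    Near : Role → Word → ℕ → Set
    Near hdr             t w = ⊥
    Near (tok 0 a)       t w = w ≤ β t
    Near (tok (suc _) a) t w = ⊥

    near? : ∀ r t w → Dec (Near r t w)
    near? hdr             t w = no λ ()
    near? (tok 0 a)       t w = w ≤? β t
    near? (tok (suc _) a) t w = no λ ()

    -- For the header, i is a genuine choice: some walk token is near v. For every other j the
    -- condition forces i = j and speaks only of those v that are the vertex of token i₂. In this
    -- way the only available distance, from v to the vertex of token i, becomes the distance
    -- between two tokens.
    CondOf : Role → Vec Bool ℓ → Index → Index → Index → Index → Word → Word → Word → Vec Bool q → Set
    CondOf hdr         v j i₂ i₃ i s₁ s₂ s₃ w = Near (roleOf i) s₁ (val w)
    CondOf r@(tok _ _) v j i₂ i₃ i s₁ s₂ s₃ w = i ≡ j × (vdec v ≡ vert s₂ → Rule r s₁ (roleOf i₂) s₂ (roleOf i₃) s₃ (val w))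

    Cond : Vec Bool ℓ → Index → Index → Index → Index → Word → Word → Word → Vec Bool q → Set
    Cond v j = CondOf (roleOf j) v j

    cond? : ∀ v j i₂ i₃ i s₁ s₂ s₃ w → Dec (Cond v j i₂ i₃ i s₁ s₂ s₃ w)
    cond? v j i₂ i₃ i s₁ s₂ s₃ w = condOf? (roleOf j)
      where
      condOf? : ∀ r → Dec (CondOf r v j i₂ i₃ i s₁ s₂ s₃ w)
      condOf? hdr         = near? (roleOf i) s₁ (val w)
      condOf? r@(tok _ _) = ≡-dec Bool._≟_ i j ×-dec ((vdec v Fin.≟ vert s₂) →-dec rule? r s₁ (roleOf i₂) s₂ (roleOf i₃) s₃ (val w))

    out : Word → Maybe ℚ
    out t = just (fromℕ (total t))

    header : Index
    header = replicate bi false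

    val-header : val header ≡ 0
    val-header = go bi
      where
      go : ∀ m → val (replicate m false) ≡ 0
      go zero    = refl
      go (suc m) = cong (_* 2) (go m)

    index : ℕ → ℕ → Index
    index κ a = bits bi (suc (κ * K + a))

    module Valid (n≤2^ℓ : n ≤ 2 ^ ℓ) (tokens≤ : suc (3 * K) ≤ 2 ^ bi) where

      vdec-bits : ∀ u → vdec (bits ℓ (toℕ u)) ≡ u
      vdec-bits u = Fin.toℕ-injective (trans (Fin.toℕ-fromℕ< _) (trans (cong (_% n) (val-bits ℓ (toℕ u) (<-≤-trans (Fin.toℕ<n u) n≤2^ℓ))) (m<n⇒m%n≡m (Fin.toℕ<n u))))

      index< : ∀ {κ a} → κ < 3 → a < K → suc (κ * K + a) < 2 ^ bi
      index< {κ} {a} κ<3 a<K = <-≤-trans (s≤s (≤-trans (≤-reflexive (sym (+-suc (κ * K) a))) (≤-trans (+-monoʳ-≤ (κ * K) a<K) (≤-trans (≤-reflexive (+-comm (κ * K) K)) (*-monoˡ-≤ K κ<3))))) tokens≤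

      role-index : ∀ {κ a} → κ < 3 → a < K → roleOf (index κ a) ≡ tok κ a
      role-index {κ} {a} κ<3 a<K = trans (cong role (val-bits bi _ (index< κ<3 a<K))) (cong₂ tok quotient remainder)
        where
        quotient : (κ * K + a) / K ≡ κ
        quotient = trans (+-distrib-/-∣ˡ {κ * K} a {K} (n∣m*n κ)) (trans (cong₂ _+_ (m*n/n≡m κ K) (m<n⇒m/n≡0 a<K)) (+-identityʳ κ))
        remainder : (κ * K + a) % K ≡ a
        remainder = trans (cong (_% K) (+-comm (κ * K) a)) (trans ([m+kn]%n≡m%n a κ K) (m<n⇒m%n≡m a<K))

      index-role : ∀ i {a} → roleOf i ≡ tok 0 a → a < K × i ≡ index 0 a
      index-role i {a} e with val i in eq
      index-role i {a} () | zero
      index-role i {a} e | suc y with e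
      ... | refl′ = small , val-injective i _ (trans eq (trans (cong suc y≡) (sym (val-bits bi (suc a) (index< {0} (s≤s z≤n) small)))))
        where
        tok₁ tok₂ : Role → ℕ
        tok₁ hdr       = 0
        tok₁ (tok κ _) = κ
        tok₂ hdr       = 0
        tok₂ (tok _ a) = a
        small : a < K
        small = subst (_< K) (cong tok₂ refl′) (m%n<n y K)
        y≡ : y ≡ a
        y≡ = trans (m≡m%n+[m/n]*n y K) (trans (cong₂ (λ r d → r + d * K) (cong tok₂ refl′) (cong tok₁ refl′)) (+-identityʳ a))

      module Sound (2≤n : 2 ≤ n) (G : MetricGraph n) (u : ℕ) (weights : WeightsAtMost G u) (u<2^q : u < 2 ^ q)
        (token : Index → Word)
        (satisfied : ∀ v j i₂ i₃ → ∃[ i ] Cond v j i₂ i₃ i (token i) (token i₂) (token i₃) (bits q (dist G (vdec v) (vert (token i))))) where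

        private
          D : Fin n → Fin n → ℕ
          D = dist G

          val-dist : ∀ x y → val (bits q (D x y)) ≡ D x y
          val-dist x y = val-bits q _ (≤-<-trans (dist-≤ G weights x y) u<2^q)

          at : ℕ → ℕ → Word
          at κ a = token (index κ a)

          rule : ∀ {κ a} → κ < 3 → a < K → ∀ i₂ i₃ {r₂ r₃} → roleOf i₂ ≡ r₂ → roleOf i₃ ≡ r₃ →
            Rule (tok κ a) (at κ a) r₂ (token i₂) r₃ (token i₃) (D (vert (token i₂)) (vert (at κ a)))
          rule {κ} {a} κ<3 a<K i₂ i₃ refl refl = extract (roleOf (index κ a)) (role-index κ<3 a<K) (satisfied v (index κ a) i₂ i₃)
            where
            v : Vec Bool ℓ
            v = bits ℓ (toℕ (vert (token i₂)))
            extract : ∀ r → r ≡ tok κ a → ∃[ i ] CondOf r v (index κ a) i₂ i₃ i (token i) (token i₂) (token i₃) (bits q (D (vdec v) (vert (token i)))) →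
              Rule (tok κ a) (at κ a) (roleOf i₂) (token i₂) (roleOf i₃) (token i₃) (D (vert (token i₂)) (vert (at κ a)))
            extract _ refl (i , refl , h) = subst (Rule (tok κ a) (at κ a) (roleOf i₂) (token i₂) (roleOf i₃) (token i₃))
              (trans (val-dist (vdec v) (vert (at κ a))) (cong (λ x → D x (vert (at κ a))) (vdec-bits (vert (token i₂))))) (h (vdec-bits (vert (token i₂))))

          head-role : roleOf header ≡ hdr
          head-role = cong role val-header

          H : Word
          H = token header

          vertexAt : ℕ → Fin n
          vertexAt a = vert (at 0 a)

          walk : List (Fin n)
          walk = map vertexAt (iota 0 K)

          walk-cost : cyc D walk ≤ α H
          walk-cost = from 0 (suc k) (λ a a< → tour-step a a<) refl
            where
            tour-step : ∀ a → a < suc k → α (at 0 a) + D (vertexAt a) (vertexAt (suc a)) ≤ α (at 0 (suc a))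
            tour-step a a<k = subst (λ y → α (at 0 a) + y ≤ α (at 0 (suc a))) (dist-sym G (vertexAt (suc a)) (vertexAt a))
              (proj₁ (rule {0} {a} (s≤s z≤n) (<-trans a<k (n<1+n (suc k))) (index 0 (suc a)) header (role-index (s≤s z≤n) (s≤s a<k)) head-role) refl)
            last-step : α (at 0 (suc k)) + D (vertexAt (suc k)) (vertexAt 0) ≤ α H
            last-step = subst (λ y → α (at 0 (suc k)) + y ≤ α H) (dist-sym G (vertexAt 0) (vertexAt (suc k)))
              (proj₂ (rule {0} {suc k} (s≤s z≤n) (n<1+n (suc k)) (index 0 0) header (role-index (s≤s z≤n) (s≤s z≤n)) head-role) refl refl tt)
            from : ∀ p c → (∀ a → a < suc k → α (at 0 a) + D (vertexAt a) (vertexAt (suc a)) ≤ α (at 0 (suc a))) → p + c ≡ suc k →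
              path D (vertexAt p) (map vertexAt (iota (suc p) c)) (vertexAt 0) ≤ α H
            from p c steps e = ≤-trans (m≤n+m _ (α (at 0 p))) (prefix p c e)
              where
              prefix : ∀ p c → p + c ≡ suc k → α (at 0 p) + path D (vertexAt p) (map vertexAt (iota (suc p) c)) (vertexAt 0) ≤ α H
              prefix p zero    e = subst (λ y → α (at 0 y) + D (vertexAt y) (vertexAt 0) ≤ α H) (trans (sym e) (+-identityʳ p)) last-step
              prefix p (suc c) e = ≤-trans (≤-reflexive (sym (+-assoc (α (at 0 p)) _ _)))
                (≤-trans (+-monoˡ-≤ _ (steps p (≤-trans (s≤s (m≤m+n p c)) (≤-reflexive (trans (sym (+-suc p c)) e))))) (prefix (suc p) c (trans (sym (+-suc p c)) e)))

          -- The nearby token is compared with its own β, which a rule bounds by that of the header.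
          covered : ∀ v → ∃[ w ] (w ∈ walk × D w v ≤ β H)
          covered v = found (satisfied (bits ℓ (toℕ v)) header header header)
            where
            found : ∃[ i ] Cond (bits ℓ (toℕ v)) header header header i (token i) H H (bits q (D (vdec (bits ℓ (toℕ v))) (vert (token i)))) → ∃[ w ] (w ∈ walk × D w v ≤ β H)
            found (i , c) = go (roleOf i) refl (subst (λ r → CondOf r (bits ℓ (toℕ v)) header header header i (token i) H H (bits q (D (vdec (bits ℓ (toℕ v))) (vert (token i))))) head-role c)
              where
              go : ∀ r → roleOf i ≡ r → Near (roleOf i) (token i) (val (bits q (D (vdec (bits ℓ (toℕ v))) (vert (token i))))) → ∃[ w ] (w ∈ walk × D w v ≤ β H)
              go hdr             e h with () ← subst (λ r → Near r (token i) (val (bits q (D (vdec (bits ℓ (toℕ v))) (vert (token i)))))) e h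
              go (tok (suc _) _) e h with () ← subst (λ r → Near r (token i) (val (bits q (D (vdec (bits ℓ (toℕ v))) (vert (token i)))))) e h
              go (tok 0 a)       e h = let (a<K , i≡) = index-role i e in
                vertexAt a , ∈-map⁺ vertexAt (iota-∈ 0 K z≤n a<K) ,
                subst (λ j → D (vert (token j)) v ≤ β H) i≡
                  (≤-trans (≤-reflexive (trans (dist-sym G (vert (token i)) v) (sym (trans (val-dist (vdec (bits ℓ (toℕ v))) (vert (token i))) (cong (λ x → D x (vert (token i))) (vdec-bits v))))))
                    (≤-trans (subst (λ r → Near r (token i) (val (bits q (D (vdec (bits ℓ (toℕ v))) (vert (token i)))))) e h)
                      (subst (λ j → β (token j) ≤ β H) (sym i≡) (rule {0} {a} (s≤s z≤n) a<K header header head-role head-role))))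

        upper : ∀ opt → (∀ vs → IsTour G vs → opt ≤ tourCost G vs) → opt ≤ total H
        upper opt min = let (vs , tour , le) = covering-tour G 2≤n (β H) walk covered in
          ≤-trans (min vs tour) (≤-trans le (+-monoʳ-≤ (n * (2 * β H)) walk-cost))

        private
          module Tree (κ : ℕ) (κ<2 : suc κ < 3) where
            h e s : ℕ → ℕ
            h a = α (at (suc κ) a)
            e a = β (at (suc κ) a)
            s a = γ (at (suc κ) a)
            vx : ℕ → Fin n
            vx a = vert (at (suc κ) a)

            open Dual h e

            pairs : ∀ i j g → i < K → j < K → g < K →
              (Between (tok (suc κ) g) (suc κ) i j → h i + h j ≤ 2 * D (vx j) (vx i) + 2 * e g)
              × (j ≡ suc i → s j + e j ≤ s i + h j)
              × (i ≡ 0 → s i ≤ h i × 1 ≤ e i × e i < K × (e i ≡ j → e j ≡ 0))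
            pairs i j g i<K j<K g<K = proj₁ (rule {suc κ} {i} κ<2 i<K (index (suc κ) j) (index (suc κ) g) (role-index κ<2 j<K) (role-index κ<2 g<K)) refl

            below : ∀ i g j → i < g → g ≤ j → j ≤ suc k → h i + h j ≤ 2 * D (vx i) (vx j) + 2 * e g
            below i g j i<g g≤j j≤ = subst (λ y → h i + h j ≤ 2 * y + 2 * e g) (dist-sym G (vx j) (vx i))
              (proj₁ (pairs i j g (<-trans (<-≤-trans i<g g≤j) (s≤s j≤)) (s≤s j≤) (≤-<-trans g≤j (s≤s j≤))) (refl , i<g , g≤j))

            first : ∀ j → j < K → s 0 ≤ h 0 × 1 ≤ e 0 × e 0 < K × (e 0 ≡ j → e j ≡ 0)
            first j j<K = proj₂ (proj₂ (pairs 0 j 0 (s≤s z≤n) j<K (s≤s z≤n))) refl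

            -- The first leaf has no branching before it, so its β is free to point to a zero gap.
            g₀ : ℕ
            g₀ = e 0
            g₀<K : g₀ < K
            g₀<K = proj₁ (proj₂ (proj₂ (first 0 (s≤s z≤n))))

            -- γ is checked from above only: a prover that understates it weakens its own lower
            -- bound.
            cumulative : ∀ a → a < K → s a + gaps 0 a ≤ sum (map h (iota 0 (suc a)))
            cumulative zero    a< = ≤-trans (≤-reflexive (+-identityʳ (s 0))) (≤-trans (proj₁ (first 0 (s≤s z≤n))) (≤-reflexive (sym (+-identityʳ (h 0)))))
            cumulative (suc a) a< = begin
              s (suc a) + gaps 0 (suc a)                    ≡⟨ cong (s (suc a) +_) (sum-snoc e 1 a) ⟩
              s (suc a) + (gaps 0 a + e (suc a))            ≡⟨ ring₁ (s (suc a)) (gaps 0 a) (e (suc a)) ⟩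
              (s (suc a) + e (suc a)) + gaps 0 a            ≤⟨ +-monoˡ-≤ (gaps 0 a) (proj₁ (proj₂ (pairs a (suc a) 0 (<-trans (n<1+n a) a<) a< (s≤s z≤n))) refl) ⟩
              (s a + h (suc a)) + gaps 0 a                  ≡⟨ ring₂ (s a) (h (suc a)) (gaps 0 a) ⟩
              (s a + gaps 0 a) + h (suc a)                  ≤⟨ +-monoˡ-≤ (h (suc a)) (cumulative a (<-trans (n<1+n a) a<)) ⟩
              sum (map h (iota 0 (suc a))) + h (suc a)      ≡⟨ sum-snoc h 0 (suc a) ⟨
              sum (map h (iota 0 (suc (suc a))))            ∎
              where
              open ≤-Reasoning
              ring₁ : ∀ a b c → a + (b + c) ≡ (a + c) + b
              ring₁ = solve-∀
              ring₂ : ∀ a b c → (a + b) + c ≡ (a + c) + b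
              ring₂ = solve-∀

            lower : ∀ vs → IsTour G vs → s (suc k) ≤ tourCost G vs
            lower vs tour = let (t , perm , le) = tour-points G 2≤n vs tour vx (iota 0 K) in
              ≤-trans (+-cancelʳ-≤ (gaps 0 (suc k)) (s (suc k)) (cyc (λ i j → D (vx i) (vx j)) t)
                (≤-trans (cumulative (suc k) ≤-refl) (heights≤tour (suc k) g₀ (proj₁ (proj₂ (first 0 (s≤s z≤n)))) (≤-pred g₀<K) (proj₂ (proj₂ (proj₂ (first g₀ g₀<K))) refl)
                  (λ i j → D (vx i) (vx j)) below (λ i j → dist-sym G (vx i) (vx j)) t perm))) le

        answer-correct : ℚ.NonNegative α₀ → ∀ opt → IsMinTourCost G opt → fromℕ opt ℚ.≤ fromℕ (total H) × fromℕ (total H) ℚ.≤ α₀ ℚ.* fromℕ opt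
        answer-correct nn opt ((vs , tour , cost≡) , min) = fromℕ-mono-≤ (upper opt min) ,
          ℚ.≤-trans (proj₂ (rule {1} {suc k} (s≤s (s≤s z≤n)) (n<1+n (suc k)) (index 2 (suc k)) header (role-index (s≤s (s≤s (s≤s z≤n))) (n<1+n (suc k))) head-role) refl refl refl refl tt)
            (ℚ.*-monoˡ-≤-nonNeg α₀ {{nn}} (fromℕ-mono-≤ (⊔-lub (≤-trans (Tree.lower 0 (s≤s (s≤s z≤n)) vs tour) (≤-reflexive cost≡)) (≤-trans (Tree.lower 1 (s≤s (s≤s (s≤s z≤n))) vs tour) (≤-reflexive cost≡)))))

-- The honest message

module HonestTokens where

  open BitStrings
  open TokenRules
  open import Defs
  open LaminarTrees
  open TreeLowerBound
  open Nets
  open EdgeStreams using (dist; dist-sym; dist-≤)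
  open Walks
  open import Data.Bool.Base using (Bool; false)
  open import Data.Fin.Base using (Fin; zero; suc; toℕ)
  open import Data.List.Base using (List; _∷_; map; length; allFin)
  open import Data.List.Membership.Propositional using (_∈_)
  open import Data.List.Properties using (length-map; length-tabulate)
  open import Data.List.Relation.Binary.Permutation.Propositional.Properties using (↭-length)
  open import Data.List.Relation.Unary.Any using (here; there)
  open import Data.Nat.Base
  open import Data.Nat.DivMod using (m%n<n)
  open import Data.Nat.ListAction using (sum)
  open import Data.Nat.Properties
  open import Data.Nat.Tactic.RingSolver using (solve-∀)
  open import Data.Product.Base using (∃-syntax; _×_; _,_; proj₁; proj₂)
  open import Data.Rational.Base as ℚ using (ℚ)
  open import Data.Unit.Base using (⊤; tt)
  open import Data.Vec.Base as Vec using (Vec; replicate)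
  open import Relation.Binary.PropositionalEquality
  open import Relation.Nullary.Decidable.Core using (yes; no)

  nth-∈ : ∀ {A : Set} (z : A) {x xs} → x ∈ xs → ∃[ i ] (i < length xs × nth z xs i ≡ x)
  nth-∈ z (here refl) = 0 , s≤s z≤n , refl
  nth-∈ z (there x∈)  = let (i , i< , e) = nth-∈ z x∈ in suc i , s≤s i< , e

  -- The numbers of a tree as they appear in its tokens: e 0 points to a gap 0,
  -- and s accumulates the length.
  record Leaves {n} (d : Fin n → Fin n → ℕ) (B k m : ℕ) : Set where
    field
      vx      : ℕ → Fin n
      h e s   : ℕ → ℕ
      below   : ∀ i g j → i < g → g ≤ j → j < suc (suc k) → h i + h j ≤ 2 * d (vx i) (vx j) + 2 * e g
      step    : ∀ a → suc a < suc (suc k) → s (suc a) + e (suc a) ≤ s a + h (suc a)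
      first   : s 0 ≤ h 0
      1≤e₀    : 1 ≤ e 0
      e₀<     : e 0 < suc (suc k)
      zeroGap : e (e 0) ≡ 0
      long    : m ≤ s (suc k)
      h≤      : ∀ a → a < suc (suc k) → h a ≤ 2 * B
      e≤      : ∀ a → a < suc (suc k) → e a ≤ suc k ⊔ 2 * B
      s≤      : ∀ a → a < suc (suc k) → s a ≤ suc a * (2 * B)

  leaves : ∀ {n k m B} (d : Fin n → Fin n → ℕ) → (∀ u v → d u v ≤ B) → (pts : Fin (suc (suc k)) → Fin n) →
    Tree (allFin (suc (suc k))) (λ u v → 2 * d (pts u) (pts v)) m → Leaves d B k m
  leaves {n} {k} {m} {B} d d≤B pts t = record
    { vx = vx ; h = h ; e = e ; s = s ; below = below ; step = λ a a< → ≤-reflexive (step a a<) ; first = ≤-refl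
    ; 1≤e₀ = 1≤g₀ ; e₀< = g₀<K ; zeroGap = zeroGap g₀ 1≤g₀ gap₀
    ; long = long′ ; h≤ = h≤ ; e≤ = e≤ ; s≤ = s≤ }
    where
    open Tree t
    K : ℕ
    K = suc (suc k)
    len : length es ≡ K
    len = trans (sym (length-map pt es)) (trans (↭-length points) (length-tabulate {n = K} (λ i → i)))
    z : Entry {K}
    z = zero , 0 , 0
    at : ℕ → Entry {K}
    at = nth z es
    root : ∃[ g ] (1 ≤ g × g < length es × gp (at g) ≡ 0)
    root = zero-index z es (≤-trans (s≤s (s≤s z≤n)) (≤-reflexive (sym len))) zero-gap
    g₀ : ℕ
    g₀ = proj₁ root
    1≤g₀ : 1 ≤ g₀
    1≤g₀ = proj₁ (proj₂ root)
    g₀<K : g₀ < K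
    g₀<K = <-≤-trans (proj₁ (proj₂ (proj₂ root))) (≤-reflexive len)
    gap₀ : gp (at g₀) ≡ 0
    gap₀ = proj₂ (proj₂ (proj₂ root))
    vx : ℕ → Fin n
    vx a = pts (pt (at a))
    h e s : ℕ → ℕ
    h a = ht (at a)
    e zero    = g₀
    e (suc a) = gp (at (suc a))
    s zero    = h 0
    s (suc a) = s a + (h (suc a) ∸ e (suc a))
    zeroGap : ∀ g → 1 ≤ g → gp (at g) ≡ 0 → e g ≡ 0
    zeroGap (suc g) _ eq = eq
    dominated′ : ∀ i g j → i < g → g ≤ j → j < K → h i + h j ≤ 2 * d (vx i) (vx j) + 2 * gp (at g)
    dominated′ i g j i<g g≤j j< = dominated-index z es dominated i g j i<g g≤j (<-≤-trans j< (≤-reflexive (sym len)))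
    below : ∀ i g j → i < g → g ≤ j → j < K → h i + h j ≤ 2 * d (vx i) (vx j) + 2 * e g
    below i (suc g) j = dominated′ i (suc g) j
    gap≤h : ∀ a → suc a < K → e (suc a) ≤ h (suc a)
    gap≤h a a< = nth-all z gap≤ (suc a) (<-≤-trans a< (≤-reflexive (sym len)))
    step : ∀ a → suc a < K → s (suc a) + e (suc a) ≡ s a + h (suc a)
    step a a< = trans (+-assoc (s a) (h (suc a) ∸ e (suc a)) (e (suc a))) (cong (s a +_) (m∸n+n≡m (gap≤h a a<)))
    cumulative : ∀ a → a < K → s a + sum (map e (iota 1 a)) ≡ sum (map h (iota 0 (suc a)))
    cumulative zero    a< = refl
    cumulative (suc a) a< = begin-equality
      s (suc a) + sum (map e (iota 1 (suc a)))          ≡⟨ cong (s (suc a) +_) (sum-snoc e 1 a) ⟩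
      s (suc a) + (sum (map e (iota 1 a)) + e (suc a))  ≡⟨ ring₁ (s (suc a)) (sum (map e (iota 1 a))) (e (suc a)) ⟩
      (s (suc a) + e (suc a)) + sum (map e (iota 1 a))  ≡⟨ cong (_+ sum (map e (iota 1 a))) (step a a<) ⟩
      (s a + h (suc a)) + sum (map e (iota 1 a))        ≡⟨ ring₂ (s a) (h (suc a)) (sum (map e (iota 1 a))) ⟩
      (s a + sum (map e (iota 1 a))) + h (suc a)        ≡⟨ cong (_+ h (suc a)) (cumulative a (<-trans (n<1+n a) a<)) ⟩
      sum (map h (iota 0 (suc a))) + h (suc a)          ≡⟨ sum-snoc h 0 (suc a) ⟨
      sum (map h (iota 0 (suc (suc a))))                ∎
      where
      open ≤-Reasoning
      ring₁ : ∀ a b c → a + (b + c) ≡ (a + c) + b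
      ring₁ = solve-∀
      ring₂ : ∀ a b c → (a + b) + c ≡ (a + c) + b
      ring₂ = solve-∀
    e-gp : ∀ p c → 1 ≤ p → map e (iota p c) ≡ map (λ i → gp (at i)) (iota p c)
    e-gp p       zero    _ = refl
    e-gp (suc p) (suc c) _ = cong (gp (at (suc p)) ∷_) (e-gp (suc (suc p)) c (s≤s z≤n))
    sums : ∀ (f : Entry {K} → ℕ) → sum (map f es) ≡ sum (map (λ i → f (at i)) (iota 0 K))
    sums f = cong sum (trans (map-nth f z es) (cong (λ l → map (λ i → f (at i)) (iota 0 l)) len))
    long′ : m ≤ s (suc k)
    long′ = +-cancelʳ-≤ (sum (map e (iota 1 (suc k)))) m (s (suc k)) (begin
      m + sum (map e (iota 1 (suc k)))                      ≡⟨ cong (λ l → m + sum l) (e-gp 1 (suc k) (s≤s z≤n)) ⟩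
      m + sum (map (λ i → gp (at i)) (iota 1 (suc k)))      ≤⟨ +-monoʳ-≤ m (m≤n+m _ (gp (at 0))) ⟩
      m + sum (map (λ i → gp (at i)) (iota 0 K))            ≡⟨ cong (m +_) (sums gp) ⟨
      m + sum (map gp es)                                   ≤⟨ long ⟩
      sum (map ht es)                                       ≡⟨ sums ht ⟩
      sum (map h (iota 0 K))                                ≡⟨ cumulative (suc k) ≤-refl ⟨
      s (suc k) + sum (map e (iota 1 (suc k)))              ∎)
      where open ≤-Reasoning
    twice : ∀ i j → 2 * d (vx i) (vx j) + 2 * gp (at g₀) ≤ 2 * B
    twice i j = ≤-trans (≤-reflexive (trans (cong (λ y → 2 * d (vx i) (vx j) + 2 * y) gap₀) (+-identityʳ _))) (*-monoʳ-≤ 2 (d≤B (vx i) (vx j)))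
    -- Heights on opposite sides of the zero gap sum to at most twice a distance, and every leaf has
    -- a partner on the other side. This keeps heights within the q bits of a token.
    h≤ : ∀ a → a < K → h a ≤ 2 * B
    h≤ a a< with a <? g₀
    ... | yes a<g = ≤-trans (m≤m+n (h a) (h g₀)) (≤-trans (dominated′ a g₀ g₀ a<g ≤-refl g₀<K) (twice a g₀))
    ... | no a≮g  = ≤-trans (m≤n+m (h a) (h 0)) (≤-trans (dominated′ 0 g₀ a 1≤g₀ (≮⇒≥ a≮g) a<) (twice 0 a))
    e≤ : ∀ a → a < K → e a ≤ suc k ⊔ 2 * B
    e≤ zero    a< = ≤-trans (≤-pred g₀<K) (m≤m⊔n (suc k) (2 * B))
    e≤ (suc a) a< = ≤-trans (gap≤h a a<) (≤-trans (h≤ (suc a) a<) (m≤n⊔m (suc k) (2 * B)))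
    s≤ : ∀ a → a < K → s a ≤ suc a * (2 * B)
    s≤ zero    a< = ≤-trans (h≤ 0 a<) (≤-reflexive (sym (+-identityʳ (2 * B))))
    s≤ (suc a) a< = ≤-trans (+-mono-≤ (s≤ a (<-trans (n<1+n a) a<)) (≤-trans (m∸n≤m (h (suc a)) (e (suc a))) (h≤ (suc a) a<))) (≤-reflexive (+-comm (suc a * (2 * B)) (2 * B)))

  module Honest (n′ k ℓ′ bi′ q pad : ℕ) (α₀ : ℚ) where

    open Check n′ k ℓ′ bi′ q pad α₀

    -- `small` makes every number fit into its q bits: running lengths are at most K times 2 B, and
    -- the pointer to a zero gap is less than K.
    module Tokens (n≤2^ℓ : n ≤ 2 ^ ℓ) (tokens≤ : suc (3 * K) ≤ 2 ^ bi)
      (G : MetricGraph n) (B : ℕ) (weights : WeightsAtMost G B) (small : K * suc (2 * B) < 2 ^ q)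
      (f : ℕ → Fin n) (ρ : ℕ) (ρ≤B : ρ ≤ B) (covers : ∀ v → ∃[ a ] (a < K × dist G (f a) v ≤ ρ))
      {m₁ m₂ : ℕ} (t₁ : Leaves (dist G) B k m₁) (t₂ : Leaves (dist G) B k m₂)
      (final : fromℕ (n * (2 * ρ) + cyc (dist G) (map f (iota 0 K))) ℚ.≤ α₀ ℚ.* fromℕ (Leaves.s t₁ (suc k) ⊔ Leaves.s t₂ (suc k))) where

      open Valid n≤2^ℓ tokens≤

      private
        D : Fin n → Fin n → ℕ
        D = dist G

        D≤B : ∀ u v → D u v ≤ B
        D≤B = dist-≤ G weights

        fits : ∀ {x} → x ≤ K * suc (2 * B) → x < 2 ^ q
        fits h = ≤-<-trans h small

        2B≤ : 2 * B ≤ K * suc (2 * B)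
        2B≤ = ≤-trans (n≤1+n (2 * B)) (m≤n*m (suc (2 * B)) K)

        B<2^q : ∀ {x} → x ≤ B → x < 2 ^ q
        B<2^q h = fits (≤-trans h (≤-trans (m≤m+n B (B + 0)) 2B≤))

        val-dist : ∀ x y → val (bits q (D x y)) ≡ D x y
        val-dist x y = val-bits q _ (B<2^q (D≤B x y))

        mk : Fin n → ℕ → ℕ → ℕ → Word
        mk u x y z = bits ℓ (toℕ u) Vec.++ (bits q x Vec.++ (bits q y Vec.++ (bits q z Vec.++ replicate pad false)))

        module _ (u : Fin n) (x y z : ℕ) where
          tail₁ : Vec Bool (q + (q + (q + pad)))
          tail₁ = bits q x Vec.++ (bits q y Vec.++ (bits q z Vec.++ replicate pad false))
          tail₂ : Vec Bool (q + (q + pad))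
          tail₂ = bits q y Vec.++ (bits q z Vec.++ replicate pad false)
          tail₃ : Vec Bool (q + pad)
          tail₃ = bits q z Vec.++ replicate pad false
          vert-mk : vert (mk u x y z) ≡ u
          vert-mk = trans (cong vdec (pre-++ (bits ℓ (toℕ u)) tail₁)) (vdec-bits u)
          rest₁ : suf ℓ (mk u x y z) ≡ tail₁
          rest₁ = suf-++ (bits ℓ (toℕ u)) tail₁
          rest₂ : suf q (suf ℓ (mk u x y z)) ≡ tail₂
          rest₂ = trans (cong (suf q) rest₁) (suf-++ (bits q x) tail₂)
          rest₃ : suf q (suf q (suf ℓ (mk u x y z))) ≡ tail₃
          rest₃ = trans (cong (suf q) rest₂) (suf-++ (bits q y) tail₃)
          α-mk : x < 2 ^ q → α (mk u x y z) ≡ x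
          α-mk x< = trans (cong (λ t → val (pre q t)) rest₁) (trans (cong val (pre-++ (bits q x) tail₂)) (val-bits q x x<))
          β-mk : y < 2 ^ q → β (mk u x y z) ≡ y
          β-mk y< = trans (cong (λ t → val (pre q t)) rest₂) (trans (cong val (pre-++ (bits q y) tail₃)) (val-bits q y y<))
          γ-mk : z < 2 ^ q → γ (mk u x y z) ≡ z
          γ-mk z< = trans (cong (λ t → val (pre q t)) rest₃) (trans (cong val (pre-++ (bits q z) (replicate pad false))) (val-bits q z z<))

        walked : ℕ → ℕ
        walked zero    = 0
        walked (suc a) = walked a + D (f a) (f (suc a))

        walked≤ : ∀ a → walked a ≤ a * B
        walked≤ zero    = z≤n
        walked≤ (suc a) = ≤-trans (+-mono-≤ (walked≤ a) (D≤B (f a) (f (suc a)))) (≤-reflexive (+-comm (a * B) B))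

        T : ℕ
        T = walked (suc k) + D (f (suc k)) (f 0)

        walk-length : T ≡ cyc D (map f (iota 0 K))
        walk-length = sym (go 0 (suc k) refl)
          where
          go : ∀ p c → p + c ≡ suc k → walked p + path D (f p) (map f (iota (suc p) c)) (f 0) ≡ T
          go p zero    eq = cong (λ y → walked y + D (f y) (f 0)) (trans (sym (+-identityʳ p)) eq)
          go p (suc c) eq = trans (sym (+-assoc (walked p) _ _)) (go (suc p) c (trans (sym (+-suc p c)) eq))

        KB : ∀ {a} → a ≤ K → a * B ≤ K * suc (2 * B)
        KB a≤K = *-mono-≤ a≤K (≤-trans (m≤m+n B (B + 0)) (n≤1+n (2 * B)))

        T< : T < 2 ^ q
        T< = fits (≤-trans (+-mono-≤ (walked≤ (suc k)) (D≤B (f (suc k)) (f 0))) (≤-trans (≤-reflexive (+-comm (suc k * B) B)) (KB ≤-refl)))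

        walked< : ∀ a → a < K → walked a < 2 ^ q
        walked< a a<K = fits (≤-trans (walked≤ a) (KB (<⇒≤ a<K)))

        module Numbers {m} (t : Leaves D B k m) where
          open Leaves t public
          word : ℕ → Word
          word a = mk (vx a) (h a) (e a) (s a)
          α≡ : ∀ {a} → a < K → α (word a) ≡ h a
          α≡ {a} a<K = α-mk (vx a) (h a) (e a) (s a) (fits (≤-trans (h≤ a a<K) 2B≤))
          β≡ : ∀ {a} → a < K → β (word a) ≡ e a
          β≡ {a} a<K = β-mk (vx a) (h a) (e a) (s a) (fits (≤-trans (e≤ a a<K) (⊔-lub (≤-trans (n≤1+n (suc k)) (m≤m*n K (suc (2 * B)))) 2B≤)))
          γ≡ : ∀ {a} → a < K → γ (word a) ≡ s a
          γ≡ {a} a<K = γ-mk (vx a) (h a) (e a) (s a) (fits (≤-trans (s≤ a a<K) (*-mono-≤ a<K (n≤1+n (2 * B)))))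
          vert≡ : ∀ a → vert (word a) ≡ vx a
          vert≡ a = vert-mk (vx a) (h a) (e a) (s a)

          rule₁ : ∀ {i j g} → i < g → g ≤ j → j < K → α (word i) + α (word j) ≤ 2 * D (vert (word j)) (vert (word i)) + 2 * β (word g)
          rule₁ {i} {j} {g} i<g g≤j j<K = subst₂ _≤_ (sym (cong₂ _+_ (α≡ (<-trans (<-≤-trans i<g g≤j) j<K)) (α≡ j<K)))
            (cong₂ (λ y z → 2 * y + 2 * z) (trans (dist-sym G (vx i) (vx j)) (sym (cong₂ D (vert≡ j) (vert≡ i)))) (sym (β≡ (≤-<-trans g≤j j<K)))) (below i g j i<g g≤j j<K)

          rule₂ : ∀ {i} → suc i < K → γ (word (suc i)) + β (word (suc i)) ≤ γ (word i) + α (word (suc i))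
          rule₂ {i} i< = subst₂ _≤_ (sym (cong₂ _+_ (γ≡ i<) (β≡ i<))) (sym (cong₂ _+_ (γ≡ (<-trans (n<1+n i) i<)) (α≡ i<))) (step i i<)

          0<K : 0 < K
          0<K = s≤s z≤n

          rule₃ : ∀ j → j < K → γ (word 0) ≤ α (word 0) × 1 ≤ β (word 0) × β (word 0) < K × (β (word 0) ≡ j → β (word j) ≡ 0)
          rule₃ j j<K = subst₂ _≤_ (sym (γ≡ 0<K)) (sym (α≡ 0<K)) first , subst (1 ≤_) (sym (β≡ 0<K)) 1≤e₀ , subst (_< K) (sym (β≡ 0<K)) e₀< ,
            λ eq → trans (β≡ j<K) (trans (cong e (trans (sym eq) (β≡ 0<K))) zeroGap)

        module N₁ = Numbers t₁
        module N₂ = Numbers t₂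

        tokenOf : Role → Word
        tokenOf hdr                   = mk zero T ρ 0
        tokenOf (tok 0 a)             = mk (f a) (walked a) ρ 0
        tokenOf (tok 1 a)             = N₁.word a
        -- Indices beyond the 3 K proper tokens have roles with larger κ; copies of the second tree
        -- satisfy the rules there as well.
        tokenOf (tok (suc (suc _)) a) = N₂.word a

        Good : Role → Set
        Good hdr       = ⊤
        Good (tok κ a) = a < K

        good : ∀ i → Good (roleOf i)
        good i = go (val i)
          where
          go : ∀ y → Good (role y)
          go zero    = tt
          go (suc y) = m%n<n y K

        ρ< : ρ < 2 ^ q
        ρ< = B<2^q ρ≤B

        rules : ∀ r₁ r₂ r₃ → Good r₁ → Good r₂ → Good r₃ → Rule r₁ (tokenOf r₁) r₂ (tokenOf r₂) r₃ (tokenOf r₃) (D (vert (tokenOf r₂)) (vert (tokenOf r₁)))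
        rules hdr       r₂                _   _ _ _ = tt
        rules (tok 0 a) (tok (suc _) _)   _   _ _ _ = tt
        rules (tok 0 a) hdr               _   _ _ _ = ≤-reflexive (trans (β-mk (f a) (walked a) ρ 0 ρ<) (sym (β-mk zero T ρ 0 ρ<)))
        rules (tok 0 a) (tok 0 a′)        r₃  a<K a′<K g₃ = next , last r₃
          where
          here≡ : α (tokenOf (tok 0 a)) ≡ walked a
          here≡ = α-mk (f a) (walked a) ρ 0 (walked< a a<K)
          dist≡ : D (vert (tokenOf (tok 0 a′))) (vert (tokenOf (tok 0 a))) ≡ D (f a) (f a′)
          dist≡ = trans (cong₂ D (vert-mk (f a′) (walked a′) ρ 0) (vert-mk (f a) (walked a) ρ 0)) (dist-sym G (f a′) (f a))
          next : a′ ≡ suc a → α (tokenOf (tok 0 a)) + D (vert (tokenOf (tok 0 a′))) (vert (tokenOf (tok 0 a))) ≤ α (tokenOf (tok 0 a′))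
          next eq = ≤-reflexive (trans (cong₂ _+_ here≡ (trans dist≡ (cong (λ y → D (f a) (f y)) eq))) (trans (cong walked (sym eq)) (sym (α-mk (f a′) (walked a′) ρ 0 (walked< a′ a′<K)))))
          last : ∀ r₃ → suc a ≡ K → a′ ≡ 0 → IsHeader r₃ → α (tokenOf (tok 0 a)) + D (vert (tokenOf (tok 0 a′))) (vert (tokenOf (tok 0 a))) ≤ α (tokenOf r₃)
          last hdr eq eq′ _ = ≤-reflexive (trans (cong₂ _+_ here≡ dist≡) (trans (cong₂ (λ x y → walked x + D (f x) (f y)) (suc-injective eq) eq′) (sym (α-mk zero T ρ 0 T<))))
        rules (tok (suc κ) i) hdr         _   _ _ _ = tt
        rules (tok (suc κ) i) (tok 0 _)   _   _ _ _ = tt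
        rules (tok (suc κ) i) (tok (suc κ′) j) r₃ i<K j<K g₃ = same , last
          where
          same : κ ≡ κ′ → (Between r₃ (suc κ) i j → α (tokenOf (tok (suc κ) i)) + α (tokenOf (tok (suc κ′) j)) ≤ 2 * D (vert (tokenOf (tok (suc κ′) j))) (vert (tokenOf (tok (suc κ) i))) + 2 * β (tokenOf r₃))
               × (j ≡ suc i → γ (tokenOf (tok (suc κ′) j)) + β (tokenOf (tok (suc κ′) j)) ≤ γ (tokenOf (tok (suc κ) i)) + α (tokenOf (tok (suc κ′) j)))
               × (i ≡ 0 → γ (tokenOf (tok (suc κ) i)) ≤ α (tokenOf (tok (suc κ) i)) × 1 ≤ β (tokenOf (tok (suc κ) i)) × β (tokenOf (tok (suc κ) i)) < K × (β (tokenOf (tok (suc κ) i)) ≡ j → β (tokenOf (tok (suc κ′) j)) ≡ 0))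
          same refl = pair κ r₃ , chain κ , start κ
            where
            pair : ∀ κ r₃ → Between r₃ (suc κ) i j → α (tokenOf (tok (suc κ) i)) + α (tokenOf (tok (suc κ) j)) ≤ 2 * D (vert (tokenOf (tok (suc κ) j))) (vert (tokenOf (tok (suc κ) i))) + 2 * β (tokenOf r₃)
            pair zero    (tok _ g) (refl , i<g , g≤j) = N₁.rule₁ i<g g≤j j<K
            pair (suc κ) (tok _ g) (refl , i<g , g≤j) = N₂.rule₁ i<g g≤j j<K
            chain : ∀ κ → j ≡ suc i → γ (tokenOf (tok (suc κ) j)) + β (tokenOf (tok (suc κ) j)) ≤ γ (tokenOf (tok (suc κ) i)) + α (tokenOf (tok (suc κ) j))
            chain zero    refl = N₁.rule₂ j<K
            chain (suc κ) refl = N₂.rule₂ j<K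
            start : ∀ κ → i ≡ 0 → γ (tokenOf (tok (suc κ) i)) ≤ α (tokenOf (tok (suc κ) i)) × 1 ≤ β (tokenOf (tok (suc κ) i)) × β (tokenOf (tok (suc κ) i)) < K × (β (tokenOf (tok (suc κ) i)) ≡ j → β (tokenOf (tok (suc κ) j)) ≡ 0)
            start zero    refl = N₁.rule₃ j j<K
            start (suc κ) refl = N₂.rule₃ j j<K
          last : κ ≡ 0 → κ′ ≡ 1 → suc i ≡ K → suc j ≡ K → IsHeader r₃ → Final (tokenOf (tok (suc κ) i)) (tokenOf (tok (suc κ′) j)) (tokenOf r₃)
          last refl refl refl refl hd = onHeader r₃ hd
            where
            onHeader : ∀ r₃ → IsHeader r₃ → Final (N₁.word (suc k)) (N₂.word (suc k)) (tokenOf r₃)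
            onHeader hdr _ = subst₂ (λ x y → fromℕ x ℚ.≤ α₀ ℚ.* fromℕ y)
              (cong₂ (λ y z → n * (2 * y) + z) (sym (β-mk zero T ρ 0 ρ<)) (trans (sym walk-length) (sym (α-mk zero T ρ 0 T<))))
              (sym (cong₂ _⊔_ (N₁.γ≡ i<K) (N₂.γ≡ j<K))) final

      token : Index → Word
      token i = tokenOf (roleOf i)

      satisfied : ∀ v j i₂ i₃ → ∃[ i ] Cond v j i₂ i₃ i (token i) (token i₂) (token i₃) (bits q (dist G (vdec v) (vert (token i))))
      satisfied v j i₂ i₃ = byRole (roleOf j) refl
        where
        byRole : ∀ r → roleOf j ≡ r → ∃[ i ] CondOf r v j i₂ i₃ i (token i) (token i₂) (token i₃) (bits q (dist G (vdec v) (vert (token i))))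
        byRole hdr _ = let (a , a<K , near) = covers (vdec v) in index 0 a ,
          subst (λ r → Near r (tokenOf r) (val (bits q (D (vdec v) (vert (tokenOf r)))))) (sym (role-index {0} (s≤s z≤n) a<K))
            (subst₂ _≤_ (sym (trans (val-dist (vdec v) (vert (tokenOf (tok 0 a)))) (trans (cong (D (vdec v)) (vert-mk (f a) (walked a) ρ 0)) (dist-sym G (vdec v) (f a))))) (sym (β-mk (f a) (walked a) ρ 0 ρ<)) near)
        byRole r@(tok κ a) eq = j , refl , λ v≡ →
          subst₂ (λ r t → Rule r t (roleOf i₂) (token i₂) (roleOf i₃) (token i₃) (val (bits q (D (vdec v) (vert (token j)))))) eq refl
            (subst (Rule (roleOf j) (token j) (roleOf i₂) (token i₂) (roleOf i₃) (token i₃))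
              (trans (cong (λ x → D x (vert (token j))) (sym v≡)) (sym (val-dist (vdec v) (vert (token j)))))
              (rules (roleOf j) (roleOf i₂) (roleOf i₃) (good j) (good i₂) (good i₃)))

-- Existence of a valid message, and the size of the net

module Completeness where

  open BitStrings
  open TokenRules
  open ChristofidesBounds
  open import Defs
  open HonestTokens
  open LaminarTrees
  open TreeLowerBound
  open Programs using (fromℕ-+; fromℕ-*; fromℕ-mono-≤; fromℕ-nonNeg)
  open Nets
  open EdgeStreams using (dist; dist-≤; dist-refl)
  open Tours using (metric)
  open Walks
  open import Data.Fin.Base using (Fin; zero; suc)
  import Data.Integer.Base as ℤ
  open import Data.List.Base using (List; map; length)
  open import Data.List.Membership.Propositional.Properties using (∈-allFin)
  open import Data.List.Properties using (length-tabulate)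
  open import Data.List.Relation.Binary.Permutation.Propositional using (↭-sym)
  open import Data.List.Relation.Binary.Permutation.Propositional.Properties using (↭-length; ∈-resp-↭)
  open import Data.Nat.Base
  open import Data.Nat.Properties
  open import Data.Product.Base using (∃; ∃-syntax; _×_; _,_)
  open import Data.Rational.Base as ℚ using (ℚ; 0ℚ; 1ℚ; ½)
  import Data.Rational.Properties as ℚ
  open import Relation.Binary.PropositionalEquality
  open import Relation.Nullary.Decidable.Core using (Dec; yes; no)
  open import Relation.Nullary.Negation.Core using (¬_; contradiction)

  pull : ∀ {A B : Set} → (A → B) → Pseudometric B → Pseudometric A
  pull f M = record { d = λ x y → d (f x) (f y) ; d-refl = λ x → d-refl (f x) ; d-sym = λ x y → d-sym (f x) (f y) ; triangle = λ x y z → triangle (f x) (f y) (f z) }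
    where open Pseudometric M

  factor : ℚ → ℚ
  factor ε = (ℤ.+ 3) ℚ./ 2 ℚ.+ ε

  halves : ∀ {x y} → 2 * x ≤ 3 * y → fromℕ x ℚ.≤ (ℤ.+ 3) ℚ./ 2 ℚ.* fromℕ y
  halves {x} {y} h = begin
    fromℕ x                            ≡⟨ ℚ.*-identityˡ (fromℕ x) ⟨
    ½ ℚ.* fromℕ 2 ℚ.* fromℕ x          ≡⟨ ℚ.*-assoc ½ (fromℕ 2) (fromℕ x) ⟩
    ½ ℚ.* (fromℕ 2 ℚ.* fromℕ x)        ≡⟨ cong (½ ℚ.*_) (fromℕ-* 2 x) ⟨
    ½ ℚ.* fromℕ (2 * x)                ≤⟨ ℚ.*-monoˡ-≤-nonNeg ½ (fromℕ-mono-≤ {2 * x} {3 * y} h) ⟩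
    ½ ℚ.* fromℕ (3 * y)                ≡⟨ cong (½ ℚ.*_) (fromℕ-* 3 y) ⟩
    ½ ℚ.* (fromℕ 3 ℚ.* fromℕ y)        ≡⟨ ℚ.*-assoc ½ (fromℕ 3) (fromℕ y) ⟨
    ½ ℚ.* fromℕ 3 ℚ.* fromℕ y          ∎
    where open ℚ.≤-Reasoning

  -- The net is fine enough for replacing all vertices by its points.
  Fine : ℚ → ℕ → ℕ → ℕ → Set
  Fine ε n k ρ = fromℕ (n * (2 * ρ)) ℚ.≤ ε ℚ.* fromℕ (suc k * ρ)

  module Exists (n′ k ℓ′ bi′ q pad : ℕ) (ε : ℚ) (0≤ε : 0ℚ ℚ.≤ ε) where

    open Check n′ k ℓ′ bi′ q pad (factor ε)

    module _ (n≤2^ℓ : n ≤ 2 ^ ℓ) (tokens≤ : suc (3 * K) ≤ 2 ^ bi)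
      (G : MetricGraph n) (B : ℕ) (weights : WeightsAtMost G B) (small : K * suc (2 * B) < 2 ^ q) (N : Net (metric G) B (suc k))
      (fine : Fine ε n k (Net.ρ N)) where

      open Net N

      proof : ¬ ¬ (∃[ token ] (∀ v j i₂ i₃ → ∃[ i ] Cond v j i₂ i₃ i (token i) (token i₂) (token i₃) (bits q (dist G (vdec v) (vert (token i))))))
      proof none = christofides (pull pts (metric G)) ρ sep λ bounds → none (convincing bounds)
        where
        convincing : Bounds (pull pts (metric G)) ρ → ∃[ token ] (∀ v j i₂ i₃ → ∃[ i ] Cond v j i₂ i₃ i (token i) (token i₂) (token i₃) (bits q (dist G (vdec v) (vert (token i)))))
        convincing bounds = T.token , T.satisfied
          where
          open Bounds bounds
          t₁ : Leaves (dist G) B k m₁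
          t₁ = leaves (dist G) (dist-≤ G weights) pts tree₁
          t₂ : Leaves (dist G) B k m₂
          t₂ = leaves (dist G) (dist-≤ G weights) pts tree₂
          len : length ts ≡ K
          len = trans (↭-length tour) (length-tabulate {n = K} (λ i → i))
          f : ℕ → Fin n
          f a = pts (nth zero ts a)
          covers : ∀ v → ∃[ a ] (a < K × dist G (f a) v ≤ ρ)
          covers v = let (i , near) = cov v ; (a , a< , eq) = nth-∈ zero (∈-resp-↭ (↭-sym tour) (∈-allFin i)) in
            a , <-≤-trans a< (≤-reflexive len) , subst (λ x → dist G (pts x) v ≤ ρ) (sym eq) near
          L : ℕ
          L = Leaves.s t₁ (suc k) ⊔ Leaves.s t₂ (suc k)
          m₁≤L : m₁ ≤ L
          m₁≤L = ≤-trans (Leaves.long t₁) (m≤m⊔n _ _)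
          m₂≤L : m₂ ≤ L
          m₂≤L = ≤-trans (Leaves.long t₂) (m≤n⊔m (Leaves.s t₁ (suc k)) _)
          walk : ℕ
          walk = cyc (dist G) (map f (iota 0 K))
          walk≡ : walk ≡ cyc (λ i j → dist G (pts i) (pts j)) ts
          walk≡ = trans (cong (λ l → cyc (dist G) (map f (iota 0 l))) (sym len)) (trans (cong (cyc (dist G)) (sym (map-nth pts zero ts))) (sym (cyc-map (dist G) pts ts)))
          -- The origin of 3/2: twice the walk is at most 2 m₁ + m₂, and L bounds both `m₁` and
          -- `m₂`.
          2walk≤3L : 2 * walk ≤ 3 * L
          2walk≤3L = ≤-trans (≤-reflexive (cong (2 *_) walk≡)) (≤-trans cheap (≤-trans (+-mono-≤ (*-monoʳ-≤ 2 m₁≤L) m₂≤L) (≤-reflexive (+-comm (2 * L) L))))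
          final : fromℕ (n * (2 * ρ) + walk) ℚ.≤ factor ε ℚ.* fromℕ L
          final = begin
            fromℕ (n * (2 * ρ) + walk)                            ≡⟨ fromℕ-+ (n * (2 * ρ)) walk ⟩
            fromℕ (n * (2 * ρ)) ℚ.+ fromℕ walk                    ≤⟨ ℚ.+-mono-≤ (ℚ.≤-trans fine (ℚ.*-monoˡ-≤-nonNeg ε {{ℚ.nonNegative 0≤ε}} (fromℕ-mono-≤ {suc k * ρ} {L} (≤-trans far m₁≤L)))) (halves {walk} {L} 2walk≤3L) ⟩
            ε ℚ.* fromℕ L ℚ.+ (ℤ.+ 3) ℚ./ 2 ℚ.* fromℕ L           ≡⟨ ℚ.+-comm (ε ℚ.* fromℕ L) ((ℤ.+ 3) ℚ./ 2 ℚ.* fromℕ L) ⟩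
            (ℤ.+ 3) ℚ./ 2 ℚ.* fromℕ L ℚ.+ ε ℚ.* fromℕ L           ≡⟨ ℚ.*-distribʳ-+ (fromℕ L) ((ℤ.+ 3) ℚ./ 2) ε ⟨
            factor ε ℚ.* fromℕ L                                  ∎
            where open ℚ.≤-Reasoning
          module T = Honest.Tokens n′ k ℓ′ bi′ q pad (factor ε) n≤2^ℓ tokens≤ G B weights small f ρ ρ≤B covers t₁ t₂ final


  module _ (ε : ℚ) where

    private
      searchDown : ∀ t j → t ℚ.≤ ε ℚ.* fromℕ j → ¬ (t ℚ.≤ ε ℚ.* fromℕ 0) → ∃[ i ] (suc i ≤ j × t ℚ.≤ ε ℚ.* fromℕ (suc i) × ε ℚ.* fromℕ i ℚ.≤ t)
      searchDown t zero    h ¬0 = contradiction h ¬0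
      searchDown t (suc j) h ¬0 with t ℚ.≤? ε ℚ.* fromℕ j
      ... | yes h′ = let (i , i≤ , rest) = searchDown t j h′ ¬0 in i , ≤-trans i≤ (n≤1+n j) , rest
      ... | no ¬h  = j , ≤-refl , h , ℚ.<⇒≤ (ℚ.≰⇒> ¬h)

      everything : ∀ {n} (G : MetricGraph (suc n)) B → Net (metric G) B n
      everything G B = record { pts = λ i → i ; ρ = 0 ; sep = λ _ _ _ → z≤n ; cov = λ v → v , ≤-reflexive (dist-refl G v) ; ρ≤B = z≤n }

      -- The net has two points more than i; they contribute 2 ε, which ε ≤ n absorbs.
      few : ∀ n i → ε ℚ.≤ fromℕ n → ε ℚ.* fromℕ i ℚ.≤ fromℕ (2 * n) → fromℕ (2 + i) ℚ.* ε ℚ.≤ fromℕ (4 * n)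
      few n i ε≤n least = begin
        fromℕ (2 + i) ℚ.* ε                        ≡⟨ cong (ℚ._* ε) (fromℕ-+ 2 i) ⟩
        (fromℕ 2 ℚ.+ fromℕ i) ℚ.* ε                ≡⟨ ℚ.*-distribʳ-+ ε (fromℕ 2) (fromℕ i) ⟩
        fromℕ 2 ℚ.* ε ℚ.+ fromℕ i ℚ.* ε            ≤⟨ ℚ.+-mono-≤ (ℚ.*-monoˡ-≤-nonNeg (fromℕ 2) ε≤n) (ℚ.≤-trans (ℚ.≤-reflexive (ℚ.*-comm (fromℕ i) ε)) least) ⟩
        fromℕ 2 ℚ.* fromℕ n ℚ.+ fromℕ (2 * n)      ≡⟨ cong (ℚ._+ fromℕ (2 * n)) (fromℕ-* 2 n) ⟨
        fromℕ (2 * n) ℚ.+ fromℕ (2 * n)            ≡⟨ fromℕ-+ (2 * n) (2 * n) ⟨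
        fromℕ (2 * n + 2 * n)                      ≡⟨ cong fromℕ (sym (*-distribʳ-+ n 2 2)) ⟩
        fromℕ (4 * n)                              ∎
        where open ℚ.≤-Reasoning

      fine : ∀ n i → fromℕ (2 * n) ℚ.≤ ε ℚ.* fromℕ (suc i) → ∀ ρ → Fine ε n i ρ
      fine n i enough ρ = begin
        fromℕ (n * (2 * ρ))                    ≡⟨ cong fromℕ (trans (sym (*-assoc n 2 ρ)) (cong (_* ρ) (*-comm n 2))) ⟩
        fromℕ (2 * n * ρ)                      ≡⟨ fromℕ-* (2 * n) ρ ⟩
        fromℕ (2 * n) ℚ.* fromℕ ρ              ≤⟨ ℚ.*-monoʳ-≤-nonNeg (fromℕ ρ) {{ℚ.nonNegative (fromℕ-nonNeg ρ)}} enough ⟩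
        ε ℚ.* fromℕ (suc i) ℚ.* fromℕ ρ        ≡⟨ ℚ.*-assoc ε (fromℕ (suc i)) (fromℕ ρ) ⟩
        ε ℚ.* (fromℕ (suc i) ℚ.* fromℕ ρ)      ≡⟨ cong (ε ℚ.*_) (fromℕ-* (suc i) ρ) ⟨
        ε ℚ.* fromℕ (suc i * ρ)                ∎
        where open ℚ.≤-Reasoning

      fine-0 : ∀ n k → Fine ε n k 0
      fine-0 n k = ℚ.≤-reflexive (trans (cong fromℕ (*-zeroʳ n)) (sym (trans (cong (λ y → ε ℚ.* fromℕ y) (*-zeroʳ (suc k))) (ℚ.*-zeroʳ ε))))

      few-1 : ∀ n → ε ℚ.≤ 1ℚ → fromℕ n ℚ.* ε ℚ.≤ fromℕ (4 * n)
      few-1 n ε≤1 = ℚ.≤-trans (ℚ.*-monoˡ-≤-nonNeg (fromℕ n) {{ℚ.nonNegative (fromℕ-nonNeg n)}} ε≤1)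
        (ℚ.≤-trans (ℚ.≤-reflexive (ℚ.*-identityʳ (fromℕ n))) (fromℕ-mono-≤ {n} {4 * n} (m≤m+n n _)))

      smallest : ∀ j → 1 ≤ j → 1ℚ ℚ.≤ ε → ∃[ i ] (suc i ≤ j × fromℕ j ℚ.≤ ε ℚ.* fromℕ (suc i) × ε ℚ.* fromℕ i ℚ.≤ fromℕ j)
      smallest j 1≤j 1≤ε = searchDown (fromℕ j) j
        (ℚ.≤-trans (ℚ.≤-reflexive (sym (ℚ.*-identityˡ (fromℕ j)))) (ℚ.*-monoʳ-≤-nonNeg (fromℕ j) {{ℚ.nonNegative (fromℕ-nonNeg j)}} 1≤ε))
        λ h → contradiction (ℚ.≤-trans (fromℕ-mono-≤ {1} {j} 1≤j) (ℚ.≤-trans h (ℚ.≤-reflexive (ℚ.*-zeroʳ ε)))) (λ { (ℚ.*≤* (ℤ.+≤+ ())) })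

    -- The first bound cancels the factor ε in the communication bound; the second keeps the length
    -- of an index logarithmic in n whatever ε is; the third provides the net for every graph.
    NetSize : ℕ → ℕ → Set
    NetSize n′ k = fromℕ (2 + k) ℚ.* ε ℚ.≤ fromℕ (4 * suc n′) × 2 + k ≤ suc (2 * suc n′)
      × (∀ (G : MetricGraph (suc n′)) B → WeightsAtMost G B → ∃[ N ] Fine ε (suc n′) k (Net.ρ {n′} {metric G} {B} {suc k} N))

    private
      allVertices : ∀ m → ε ℚ.≤ 1ℚ → NetSize (suc m) m
      allVertices m ε≤1 = few-1 (suc (suc m)) ε≤1 , ≤-trans (m≤m+n (suc (suc m)) _) (n≤1+n _) , λ G B _ → everything G B , fine-0 (suc (suc m)) m

      someVertices : ∀ n′ → 1ℚ ℚ.≤ ε → ε ℚ.≤ fromℕ (suc n′) → ∃ (NetSize n′)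
      someVertices n′ 1≤ε ε≤n = let (i , i≤ , enough , least) = smallest (2 * suc n′) (s≤s z≤n) 1≤ε in
        i , few (suc n′) i ε≤n least , s≤s i≤ , λ G B weights → net (metric G) B (dist-≤ G weights) (suc i) , fine (suc n′) i enough (Net.ρ (net (metric G) B (dist-≤ G weights) (suc i)))

    -- All vertices if ε ≤ 1, and about 2 n / ε otherwise.
    netSize : ∀ m → ε ℚ.≤ fromℕ (suc (suc m)) → ∃ (NetSize (suc m))
    netSize m ε≤n = size (ε ℚ.≤? 1ℚ)
      where
      size : Dec (ε ℚ.≤ 1ℚ) → ∃ (NetSize (suc m))
      size (yes ε≤1) = m , allVertices m ε≤1
      size (no ε≰1)  = someVertices (suc m) (ℚ.<⇒≤ (ℚ.≰⇒> ε≰1)) ε≤n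

-- The protocol with the token rules, for given parameters

module Assembly where

  open BitStrings
  open TokenRules using (module Check)
  open import Defs
  open Completeness
  open Verification using (module Protocol)
  open EdgeStreams using (dist)
  open import Data.Fin.Base using (Fin)
  import Data.Integer.Base as ℤ
  open import Data.Maybe.Base using (Maybe; just)
  open import Data.Maybe.Properties using (just-injective)
  open import Data.Nat.Base
  open import Data.Nat.Primality using (Prime)
  open import Data.Nat.Properties
  open import Data.Product.Base using (∃-syntax; _×_; _,_; proj₂)
  open import Data.Rational.Base as ℚ using (ℚ; 0ℚ)
  import Data.Rational.Properties as ℚ
  open import Relation.Binary.PropositionalEquality
  open import Relation.Nullary.Negation.Core using (¬_)

  module Assemble (n′ k ℓ′ bi′ q pad a′ p B : ℕ) (ε : ℚ) (0≤ε : 0ℚ ℚ.≤ ε) where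

    open Check n′ k ℓ′ bi′ q pad (factor ε)

    samples stateBits : ℕ
    samples   = ℓ + (bi + (bi + (bi + (bi + (b + (b + (b + q)))))))
    stateBits = b + ((samples * suc a′ + (b + b)) + ((b + (b + (b + b))) + ((b + 1) + (b + (b + b)))))

    communication : ℕ
    communication = 2 ^ bi * b + samples * (suc (2 ^ bi * 5) * b + suc a′)

    module _ (isPrime : Prime p) (2^a≤p : 2 ^ suc a′ ≤ p) (p≤2^b : p ≤ 2 ^ b)
      (2≤n : 2 ≤ n) (n≤2^ℓ : n ≤ 2 ^ ℓ) (tokens≤ : suc (3 * K) ≤ 2 ^ bi) (small : K * suc (2 * B) < 2 ^ q)
      (N<p : 2 ^ bi < p) (M<p : 2 ^ (ℓ + (bi + (bi + bi))) < p) (error : 3 * (samples * (2 ^ bi * 5)) ≤ 2 ^ suc a′)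
      (pb : ℕ) (fits : communication < 2 ^ pb) (size : NetSize ε n′ k) where

      private
        B<2^q : B < 2 ^ q
        B<2^q = ≤-<-trans (≤-trans (m≤m+n B (B + 0)) (≤-trans (n≤1+n (2 * B)) (m≤n*m (suc (2 * B)) K))) small

        nonNeg : ℚ.NonNegative (factor ε)
        nonNeg = ℚ.nonNegative (ℚ.+-mono-≤ {0ℚ} {(ℤ.+ 3) ℚ./ 2} {0ℚ} {ε} (ℚ.nonNegative⁻¹ ((ℤ.+ 3) ℚ./ 2)) 0≤ε)

        Π : Problem (WeightedEdge n)
        Π = TSP n B (factor ε)

        open TSPInstance

        Satisfied : MetricGraph n → (Index → Word) → Set
        Satisfied G token = ∀ v j i₂ i₃ → ∃[ i ] Cond v j i₂ i₃ i (token i) (token i₂) (token i₃) (bits q (dist G (vdec v) (vert (token i))))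

        sound : ∀ x token → Satisfied (graph x) token → ∀ v → out (token header) ≡ just v → Problem.Correct Π x v
        sound x token satisfied v eq = subst (Problem.Correct Π x) (just-injective eq)
          (Valid.Sound.answer-correct n≤2^ℓ tokens≤ 2≤n (graph x) B (weightsAtMost x) B<2^q token satisfied nonNeg (opt x) (isMinTourCost x))

        exists : ∀ x → ¬ ¬ (∃[ token ] (Satisfied (graph x) token × ∃[ v ] out (token header) ≡ just v))
        exists x none = let (N , fine) = proj₂ (proj₂ size) (graph x) B (weightsAtMost x) in
          Exists.proof n′ k ℓ′ bi′ q pad ε 0≤ε n≤2^ℓ tokens≤ (graph x) B (weightsAtMost x) small N fine
            λ (token , satisfied) → none (token , satisfied , _ , refl)

      verifies : ∃[ V ] IsSIP Π {pb + stateBits} V communication (samples * 2 + 1)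
      verifies = Protocol.Verify.verifier-SIP n ℓ bi′ (ℓ′ + (q + (q + (q + pad)))) q a′ p isPrime 2^a≤p p≤2^b vdec vert Cond cond? out
        Π graph (λ x σ pr → pr) N<p M<p error pb fits sound exists

-- Choice of parameters and numeric estimates

module Parameters where

  open import Data.Nat.Base
  open import Data.Nat.Logarithm using (⌈log₂_⌉; ⌈log₂⌉-mono-≤; ⌈log₂2*n⌉≡1+⌈log₂n⌉; ⌈log₂2^n⌉≡n)
  open import Data.Nat.Properties
  open import Data.Nat.Tactic.RingSolver using (solve-∀)
  open import Data.Product.Base using (∃-syntax; _×_; _,_)
  open import Relation.Binary.PropositionalEquality
  open import Relation.Nullary.Decidable.Core using (yes; no)

  private
    by : ∀ {x y} d → x + d ≡ y → x ≤ y
    by {x} d e = ≤-trans (m≤m+n x d) (≤-reflexive e)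

  powerOf2 : ∀ m → ∃[ e ] (suc m ≤ 2 ^ e × 2 ^ e ≤ 2 * suc m)
  powerOf2 zero = 0 , ≤-refl , s≤s z≤n
  powerOf2 (suc m) with powerOf2 m
  ... | e , lo , hi with suc (suc m) ≤? 2 ^ e
  ... | yes fits = e , fits , ≤-trans hi (*-monoʳ-≤ 2 (n≤1+n (suc m)))
  ... | no ¬fits = suc e , ≤-trans (by m (ring m)) (*-monoʳ-≤ 2 lo) , *-monoʳ-≤ 2 (<⇒≤ (≰⇒> ¬fits))
    where
    ring : ∀ m → suc (suc m) + m ≡ 2 * suc m
    ring = solve-∀

  2^-cancel-≤ : ∀ {x y} → 2 ^ x ≤ 2 ^ y → x ≤ y
  2^-cancel-≤ {x} {y} h = ≮⇒≥ λ y<x → <⇒≱ (^-monoʳ-< 2 (s≤s (s≤s z≤n)) y<x) h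

  suc≤2^ : ∀ c → suc c ≤ 2 ^ c
  suc≤2^ zero    = ≤-refl
  suc≤2^ (suc c) = ≤-trans (by c (ring c)) (*-monoʳ-≤ 2 (suc≤2^ c))
    where
    ring : ∀ c → suc (suc c) + c ≡ 2 * suc c
    ring = solve-∀

  logarithm : ∀ m → let n = suc (suc m) in ∃[ ℓ′ ] (n ≤ 2 ^ suc ℓ′ × suc ℓ′ ≤ 2 * ⌈log₂ n ⌉)
  logarithm m = positive (powerOf2 (suc m))
    where
    n : ℕ
    n = suc (suc m)
    1≤log : 1 ≤ ⌈log₂ n ⌉
    1≤log = ⌈log₂⌉-mono-≤ {2} {n} (s≤s (s≤s z≤n))
    positive : ∃[ e ] (n ≤ 2 ^ e × 2 ^ e ≤ 2 * n) → ∃[ ℓ′ ] (n ≤ 2 ^ suc ℓ′ × suc ℓ′ ≤ 2 * ⌈log₂ n ⌉)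
    positive (zero  , s≤s () , _)
    positive (suc e , lo , hi) = e , lo , (begin
      suc e                              ≡⟨ ⌈log₂2^n⌉≡n (suc e) ⟨
      ⌈log₂ 2 ^ suc e ⌉                  ≤⟨ ⌈log₂⌉-mono-≤ hi ⟩
      ⌈log₂ 2 * n ⌉                      ≡⟨ ⌈log₂2*n⌉≡1+⌈log₂n⌉ n ⟩
      1 + ⌈log₂ n ⌉                      ≤⟨ +-mono-≤ 1≤log (≤-reflexive (sym (+-identityʳ ⌈log₂ n ⌉))) ⟩
      2 * ⌈log₂ n ⌉                      ∎)
      where open ≤-Reasoning

  -- N tokens of at most X bits, then at most X rounds of 5 N + 1 coefficients and one sample point:
  -- N X + 5 N X² + 2 X², where N ≥ 1 and X ≥ 1 absorb the smaller terms.
  prog-length≤ : ∀ N b m a X → 1 ≤ N → 1 ≤ X → b ≤ X → m ≤ X → a ≤ X → N * b + m * (suc (N * 5) * b + a) ≤ 8 * (N * (X * X))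
  prog-length≤ (suc N) b m a (suc X) _ _ b≤ m≤ a≤ = ≤-trans
    (+-mono-≤ (*-monoʳ-≤ (suc N) b≤) (*-mono-≤ m≤ (+-mono-≤ (*-monoʳ-≤ (suc (suc N * 5)) b≤) a≤)))
    (by (suc N * (suc X * X) + 2 * (N * (suc X * suc X))) (ring N X))
    where
    ring : ∀ N X → (suc N * suc X + suc X * (suc (suc N * 5) * suc X + suc X)) + (suc N * (suc X * X) + 2 * (N * (suc X * suc X))) ≡ 8 * (suc N * (suc X * suc X))
    ring = solve-∀

  state≤ : ∀ b m a X → 1 ≤ X → b ≤ X → m ≤ X → a ≤ X → b + ((m * a + (b + b)) + ((b + (b + (b + b))) + ((b + 1) + (b + (b + b))))) ≤ 13 * (X * X)
  state≤ b m a (suc X) _ b≤ m≤ a≤ = ≤-trans (≤-reflexive (ring₁ b (m * a)))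
    (≤-trans (+-mono-≤ (*-mono-≤ m≤ a≤) (+-monoˡ-≤ 1 (*-monoʳ-≤ 11 b≤))) (by (12 * (X * X) + 13 * X) (ring₂ X)))
    where
    ring₁ : ∀ b y → b + ((y + (b + b)) + ((b + (b + (b + b))) + ((b + 1) + (b + (b + b))))) ≡ y + (11 * b + 1)
    ring₁ = solve-∀
    ring₂ : ∀ X → (suc X * suc X + (11 * suc X + 1)) + (12 * (X * X) + 13 * X) ≡ 13 * (suc X * suc X)
    ring₂ = solve-∀

  -- The program counter has only Λ ℓ bits; the square comes from storing the m secret points of a
  -- bits each.
  space≤ : ∀ Λ C ℓ L → 1 ≤ ℓ → ℓ ≤ 2 * L → ∀ R → Λ * ℓ + 13 * ((C * ℓ) * (C * ℓ)) ≤ (4 * (Λ + 13 * (C * C)) + R) * L ^ 2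
  space≤ Λ C (suc ℓ) L _ ℓ≤ R = ≤-trans (by (Λ * (suc ℓ * ℓ)) (ring₁ Λ C ℓ)) (≤-trans (*-monoʳ-≤ (Λ + 13 * (C * C)) (*-mono-≤ ℓ≤ ℓ≤)) (by (R * L ^ 2) (ring₂ (Λ + 13 * (C * C)) L R)))
    where
    ring₁ : ∀ Λ C ℓ → (Λ * suc ℓ + 13 * ((C * suc ℓ) * (C * suc ℓ))) + Λ * (suc ℓ * ℓ) ≡ (Λ + 13 * (C * C)) * (suc ℓ * suc ℓ)
    ring₁ = solve-∀
    ring₂ : ∀ A L R → A * ((2 * L) * (2 * L)) + R * (L * (L * 1)) ≡ (4 * A + R) * (L * (L * 1))
    ring₂ = solve-∀

  bits≤ : ∀ C ℓ L n → ℓ ≤ 2 * L → ∀ Q R → (56 * ((C * ℓ) * (C * ℓ))) * (4 * n) ≤ (Q + (896 * (C * C) + R)) * (n * L ^ 2)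
  bits≤ C ℓ L n ℓ≤ Q R = ≤-trans (≤-reflexive (ring₁ C ℓ n)) (≤-trans (*-monoʳ-≤ (224 * (C * C) * n) (*-mono-≤ ℓ≤ ℓ≤)) (by ((Q + R) * (n * L ^ 2)) (ring₂ C L n Q R)))
    where
    ring₁ : ∀ C ℓ n → (56 * ((C * ℓ) * (C * ℓ))) * (4 * n) ≡ 224 * (C * C) * n * (ℓ * ℓ)
    ring₁ = solve-∀
    ring₂ : ∀ C L n Q R → 224 * (C * C) * n * ((2 * L) * (2 * L)) + (Q + R) * (n * (L * (L * 1))) ≡ (Q + (896 * (C * C) + R)) * (n * (L * (L * 1)))
    ring₂ = solve-∀

  rounds≤ : ∀ m C ℓ L → m ≤ C * ℓ → 1 ≤ C * ℓ → ℓ ≤ 2 * L → ∀ Q R → m * 2 + 1 ≤ (Q + (R + 6 * C)) * L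
  rounds≤ m C ℓ L m≤ 1≤ ℓ≤ Q R = ≤-trans (+-mono-≤ (*-monoˡ-≤ 2 m≤) 1≤) (≤-trans (≤-reflexive (ring₁ C ℓ)) (≤-trans (*-monoʳ-≤ (3 * C) ℓ≤) (by ((Q + R) * L) (ring₂ C L Q R))))
    where
    ring₁ : ∀ C ℓ → C * ℓ * 2 + C * ℓ ≡ 3 * C * ℓ
    ring₁ = solve-∀
    ring₂ : ∀ C L Q R → 3 * C * (2 * L) + (Q + R) * L ≡ (Q + (R + 6 * C)) * L
    ring₂ = solve-∀

  points≤ : ∀ {K n ℓ} → 2 ≤ n → n ≤ 2 ^ ℓ → K ≤ suc (2 * n) → K ≤ 2 ^ (2 + ℓ)
  points≤ {K} {suc n} {ℓ} 2≤n n≤ K≤ = ≤-trans K≤ (≤-trans (by (suc (2 * n)) (ring n)) (≤-trans (*-monoʳ-≤ 4 n≤) (≤-reflexive (sym (^-distribˡ-+-* 2 2 ℓ)))))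
    where
    ring : ∀ n → suc (2 * suc n) + suc (2 * n) ≡ 4 * suc n
    ring = solve-∀

  -- K ≤ 2 n + 1 gives 2 ^ bi ≤ 2 ^ (5 + ℓ), and 5 + ℓ ≤ 6 ℓ for ℓ ≥ 1.
  indexBits≤ : ∀ {K n ℓ′ bi} → 2 ≤ n → n ≤ 2 ^ suc ℓ′ → K ≤ suc (2 * n) → 2 ^ bi ≤ 2 * suc (3 * K) → bi ≤ 6 * suc ℓ′
  indexBits≤ {K} {n} {ℓ′} {bi} 2≤n n≤ K≤ hi = ≤-trans (2^-cancel-≤ {bi} {5 + suc ℓ′} (≤-trans hi (≤-trans (doubled (points≤ {K} {n} {suc ℓ′} 2≤n n≤ K≤) (m^n>0 2 (2 + suc ℓ′))) (≤-reflexive (sym (power 3 2 (suc ℓ′))))))) (by (5 * ℓ′) (ring ℓ′))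
    where
    ring : ∀ ℓ → (5 + suc ℓ) + 5 * ℓ ≡ 6 * suc ℓ
    ring = solve-∀
    power : ∀ x y z → 2 ^ (x + (y + z)) ≡ 2 ^ x * 2 ^ (y + z)
    power x y z = ^-distribˡ-+-* 2 x (y + z)
    ring′ : ∀ y → 2 * suc (3 * suc y) + 2 * y ≡ 8 * suc y
    ring′ = solve-∀
    doubled : ∀ {y} → K ≤ y → 1 ≤ y → 2 * suc (3 * K) ≤ 2 ^ 3 * y
    doubled {suc y} K≤y _ = ≤-trans (*-monoʳ-≤ 2 (s≤s (*-monoʳ-≤ 3 K≤y))) (by (2 * y) (ring′ y))

  -- The factors are at most 2 ^ (2 + ℓ) and 2 ^ (2 + ℓ c). The 6 in the exponent leaves 5 ℓ for the
  -- constant 4 and the strictness.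
  numbers< : ∀ {K B n ℓ′} c → 2 ≤ n → n ≤ 2 ^ suc ℓ′ → K ≤ suc (2 * n) → B ≡ n ^ c → K * suc (2 * B) < 2 ^ ((c + 6) * suc ℓ′)
  numbers< {K} {B} {n} {ℓ′} c 2≤n n≤ K≤ refl = begin-strict
    K * suc (2 * B)                              ≤⟨ *-mono-≤ (points≤ {K} {n} {ℓ} 2≤n n≤ K≤) weight ⟩
    2 ^ (2 + ℓ) * 2 ^ (2 + ℓ * c)                ≡⟨ ^-distribˡ-+-* 2 (2 + ℓ) (2 + ℓ * c) ⟨
    2 ^ ((2 + ℓ) + (2 + ℓ * c))                  <⟨ ^-monoʳ-< 2 (s≤s (s≤s z≤n)) {(2 + ℓ) + (2 + ℓ * c)} {(c + 6) * ℓ} (by (5 * ℓ′) (ring c ℓ′)) ⟩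
    2 ^ ((c + 6) * ℓ)                            ∎
    where
    open ≤-Reasoning
    ℓ : ℕ
    ℓ = suc ℓ′
    ring : ∀ c ℓ → suc ((2 + suc ℓ) + (2 + suc ℓ * c)) + 5 * ℓ ≡ (c + 6) * suc ℓ
    ring = solve-∀
    ring′ : ∀ y → suc (2 * suc y) + suc (2 * y) ≡ 4 * suc y
    ring′ = solve-∀
    quadruple : ∀ {y} → B ≤ y → 1 ≤ y → suc (2 * B) ≤ 4 * y
    quadruple {suc y} h _ = ≤-trans (s≤s (*-monoʳ-≤ 2 h)) (by (suc (2 * y)) (ring′ y))
    weight : suc (2 * B) ≤ 2 ^ (2 + ℓ * c)
    weight = ≤-trans (quadruple {2 ^ (ℓ * c)} (≤-trans (^-monoˡ-≤ c n≤) (≤-reflexive (^-*-assoc 2 ℓ c))) (m^n>0 2 (ℓ * c))) (≤-reflexive (sym (^-distribˡ-+-* 2 2 (ℓ * c))))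

  -- 214 + 16 c is the coefficient of ℓ in the bound on the number of sum-check variables. Rounded
  -- up to a power of two, it can be compared with 2 ^ a in the exponents.
  exponent : ∀ c → ∃[ μ ] (214 + 16 * c ≤ 2 ^ μ × μ ≤ 10 + c)
  exponent zero    = 8 , by 42 refl , by 2 refl
  exponent (suc c) = let (μ , large , few) = exponent c in
    suc μ , ≤-trans (by (198 + 16 * c) (ring c)) (*-monoʳ-≤ 2 large) , ≤-trans (s≤s few) (≤-reflexive (sym (+-suc 10 c)))
    where
    ring : ∀ c → (214 + 16 * suc c) + (198 + 16 * c) ≡ 2 * (214 + 16 * c)
    ring = solve-∀

  -- X bounds the lengths of words and sample points and the number of sum-check
  -- rounds.
  module Lengths (c ℓ′ bi μ : ℕ) (bi≤ : bi ≤ 6 * suc ℓ′) (large : 214 + 16 * c ≤ 2 ^ μ) (μ≤ : μ ≤ 10 + c) where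

    ℓ q a b m C X N : ℕ
    ℓ = suc ℓ′
    q = (c + 6) * ℓ
    -- `error≤` asks for 4 + μ + 7 ℓ with μ ≤ 10 + c, and `constraints≤` for ℓ + 3 bi ≤ 19 ℓ.
    a = (21 + c) * ℓ
    -- The last 2 a bits make room for a prime up to 2 ^ 2a.
    b = ℓ + (q + (q + (q + a * 2)))
    m = ℓ + (bi + (bi + (bi + (bi + (b + (b + (b + q)))))))
    C = 2 ^ μ
    X = C * ℓ
    N = 2 ^ bi

    b≤X : b ≤ X
    b≤X = ≤-trans (≤-reflexive (ring c ℓ)) (*-monoˡ-≤ ℓ {61 + 5 * c} {C} (≤-trans (by (153 + 11 * c) (ring′ c)) large))
      where
      ring : ∀ c ℓ → ℓ + ((c + 6) * ℓ + ((c + 6) * ℓ + ((c + 6) * ℓ + (21 + c) * ℓ * 2))) ≡ (61 + 5 * c) * ℓ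
      ring = solve-∀
      ring′ : ∀ c → (61 + 5 * c) + (153 + 11 * c) ≡ 214 + 16 * c
      ring′ = solve-∀

    a≤X : a ≤ X
    a≤X = *-monoˡ-≤ ℓ {21 + c} {C} (≤-trans (by (193 + 15 * c) (ring c)) large)
      where
      ring : ∀ c → (21 + c) + (193 + 15 * c) ≡ 214 + 16 * c
      ring = solve-∀

    m≤X : m ≤ X
    m≤X = ≤-trans (+-monoʳ-≤ ℓ (+-mono-≤ bi≤ (+-mono-≤ bi≤ (+-mono-≤ bi≤ (+-monoˡ-≤ (b + (b + (b + q))) bi≤))))) (≤-trans (≤-reflexive (ring c ℓ)) (*-monoˡ-≤ ℓ {214 + 16 * c} {C} large))
      where
      ring : ∀ c ℓ → let q = (c + 6) * ℓ ; b = ℓ + (q + (q + (q + (21 + c) * ℓ * 2))) in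
        ℓ + (6 * ℓ + (6 * ℓ + (6 * ℓ + (6 * ℓ + (b + (b + (b + q))))))) ≡ (214 + 16 * c) * ℓ
      ring = solve-∀

    1≤X : 1 ≤ X
    1≤X = *-mono-≤ (m^n>0 2 μ) (s≤s {0} {ℓ′} z≤n)

    X≤ : X ≤ 2 ^ (μ + ℓ)
    X≤ = ≤-trans (*-monoʳ-≤ C (<⇒≤ (suc≤2^ ℓ))) (≤-reflexive (sym (^-distribˡ-+-* 2 μ ℓ)))

    N≤ : N ≤ 2 ^ (6 * ℓ)
    N≤ = ^-monoʳ-≤ 2 {bi} {6 * ℓ} bi≤

    error≤ : 3 * (m * (N * 5)) ≤ 2 ^ a
    error≤ = begin
      3 * (m * (N * 5))                                     ≡⟨ ring m N ⟩
      15 * (m * N)                                          ≤⟨ *-mono-≤ (n≤1+n 15) (*-mono-≤ {m} {2 ^ (μ + ℓ)} {N} {2 ^ (6 * ℓ)} (≤-trans m≤X X≤) N≤) ⟩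
      2 ^ 4 * (2 ^ (μ + ℓ) * 2 ^ (6 * ℓ))            ≡⟨ cong (2 ^ 4 *_) (^-distribˡ-+-* 2 (μ + ℓ) (6 * ℓ)) ⟨
      2 ^ 4 * 2 ^ (μ + ℓ + 6 * ℓ)                    ≡⟨ ^-distribˡ-+-* 2 4 (μ + ℓ + 6 * ℓ) ⟨
      2 ^ (4 + (μ + ℓ + 6 * ℓ))                      ≤⟨ ^-monoʳ-≤ 2 {4 + (μ + ℓ + 6 * ℓ)} {a} (≤-trans (+-monoʳ-≤ 4 (+-monoˡ-≤ (6 * ℓ) (+-monoˡ-≤ ℓ μ≤))) (by ((14 + c) * ℓ′) (ring′ c ℓ′))) ⟩
      2 ^ a                                                 ∎
      where
      open ≤-Reasoning
      ring : ∀ m N → 3 * (m * (N * 5)) ≡ 15 * (m * N)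
      ring = solve-∀
      ring′ : ∀ c ℓ → (4 + ((10 + c) + suc ℓ + 6 * suc ℓ)) + (14 + c) * ℓ ≡ (21 + c) * suc ℓ
      ring′ = solve-∀

    constraints≤ : 2 ^ (ℓ + (bi + (bi + bi))) ≤ 2 ^ a
    constraints≤ = ^-monoʳ-≤ 2 {ℓ + (bi + (bi + bi))} {a} (≤-trans (+-monoʳ-≤ ℓ (+-mono-≤ bi≤ (+-mono-≤ bi≤ bi≤))) (by ((2 + c) * ℓ) (ring c ℓ)))
      where
      ring : ∀ c ℓ → (ℓ + (6 * ℓ + (6 * ℓ + 6 * ℓ))) + (2 + c) * ℓ ≡ (21 + c) * ℓ
      ring = solve-∀

    N≤2^a : N ≤ 2 ^ a
    N≤2^a = ≤-trans (^-monoʳ-≤ 2 {bi} {ℓ + (bi + (bi + bi))} (≤-trans (m≤m+n bi (bi + bi)) (m≤n+m (bi + (bi + bi)) ℓ))) constraints≤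

    3≤a : 3 ≤ a
    3≤a = ≤-trans (by 18 refl) (≤-trans (m≤m+n 21 c) (m≤m*n (21 + c) ℓ))

    2a≤b : a * 2 ≤ b
    2a≤b = ≤-trans (m≤n+m (a * 2) q) (≤-trans (m≤n+m _ q) (≤-trans (m≤n+m _ q) (m≤n+m _ ℓ)))

    program : N * b + m * (suc (N * 5) * b + a) ≤ 8 * (N * (X * X))
    program = prog-length≤ N b m a X (m^n>0 2 bi) 1≤X b≤X m≤X a≤X

    Λ : ℕ
    -- 8 N X² with N ≤ 2 ^ 6ℓ and X ≤ 2 ^ (10 + c + ℓ) is less than 2 ^ (24 + 2 c + 8 ℓ).
    Λ = 32 + 2 * c

    program< : N * b + m * (suc (N * 5) * b + a) < 2 ^ (Λ * ℓ)
    program< = ≤-<-trans program (begin-strict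
      8 * (N * (X * X))                                                  ≤⟨ *-monoʳ-≤ 8 (*-mono-≤ {N} {2 ^ (6 * ℓ)} {X * X} {2 ^ y * 2 ^ y} N≤ (*-mono-≤ X≤ X≤)) ⟩
      2 ^ 3 * (2 ^ (6 * ℓ) * (2 ^ y * 2 ^ y))                            ≡⟨ cong (λ z → 2 ^ 3 * (2 ^ (6 * ℓ) * z)) (^-distribˡ-+-* 2 y y) ⟨
      2 ^ 3 * (2 ^ (6 * ℓ) * 2 ^ (y + y))                                ≡⟨ cong (2 ^ 3 *_) (^-distribˡ-+-* 2 (6 * ℓ) (y + y)) ⟨
      2 ^ 3 * 2 ^ (6 * ℓ + (y + y))                                      ≡⟨ ^-distribˡ-+-* 2 3 (6 * ℓ + (y + y)) ⟨
      2 ^ (3 + (6 * ℓ + (y + y)))                                        <⟨ ^-monoʳ-< 2 (s≤s (s≤s z≤n)) {3 + (6 * ℓ + (y + y))} {Λ * ℓ} (≤-trans (+-monoʳ-≤ 4 (+-monoʳ-≤ (6 * ℓ) (+-mono-≤ (+-monoˡ-≤ ℓ μ≤) (+-monoˡ-≤ ℓ μ≤)))) (by ((24 + 2 * c) * ℓ′) (ring c ℓ′))) ⟩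
      2 ^ (Λ * ℓ)                                                        ∎)
      where
      open ≤-Reasoning
      y : ℕ
      y = μ + ℓ
      ring : ∀ c ℓ → suc (3 + (6 * suc ℓ + (((10 + c) + suc ℓ) + ((10 + c) + suc ℓ)))) + (24 + 2 * c) * ℓ ≡ (32 + 2 * c) * suc ℓ
      ring = solve-∀

-- Large ε: an answer without communication

module NoCommunication where

  open BitStrings
  open import Defs
  open Completeness using (factor)
  open Programs
  open EdgeStreams
  open Tours
  open import Data.Bool.Base using (Bool; false)
  open import Data.Fin.Base using (Fin)
  import Data.Fin.Properties as Fin
  import Data.Integer.Base as ℤ
  open import Data.List.Base using (List; []; _∷_; foldl)
  open import Data.List.Membership.Propositional using (_∈_)
  open import Data.List.Relation.Binary.Permutation.Propositional using (↭-sym)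
  open import Data.List.Relation.Binary.Permutation.Propositional.Properties using (∈-resp-↭)
  open import Data.List.Relation.Unary.Any using (here; there)
  open import Data.Maybe.Base using (Maybe; just)
  open import Data.Nat.Base
  open import Data.Nat.Properties
  open import Data.Product.Base using (∃-syntax; _×_; _,_; proj₁; proj₂)
  open import Data.Rational.Base as ℚ using (ℚ)
  import Data.Rational.Properties as ℚ
  open import Data.Sum.Base using (_⊎_; inj₁; inj₂)
  open import Data.Vec.Base using (Vec; [])
  open import Relation.Binary.Definitions using (tri<; tri≈; tri>)
  open import Relation.Binary.PropositionalEquality

  -- A tour costs at most n times and at least once the largest weight.
  module LargestWeight (n B q : ℕ) (2≤n : 2 ≤ n) (B<2^q : B < 2 ^ q) (ε : ℚ) (n≤ε : fromℕ n ℚ.≤ ε) where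

    private
      step : WeightedEdge n → Vec Bool q → Vec Bool q
      step (_ , _ , w) s = bits q (val s ⊔ w)

      initial : Vec Bool 0 → Vec Bool q
      initial _ = bits q 0

      answer : Vec Bool q → Maybe ℚ
      answer s = just (fromℕ (n * val s))

      weightOf : WeightedEdge n → ℕ
      weightOf (_ , _ , w) = w

      consume : List (WeightedEdge n) → Vec Bool q → Vec Bool q
      consume σ s = foldl (λ y e → step e y) s σ

      largest : ∀ σ s → (∀ {e} → e ∈ σ → weightOf e ≤ B) → let r = val (consume σ s) in
        val s ≤ r × (∀ {e} → e ∈ σ → weightOf e ≤ r) × (r ≤ val s ⊎ (∃[ e ] (e ∈ σ × r ≤ weightOf e)))
      largest []      s h = ≤-refl , (λ ()) , inj₁ ≤-refl
      largest (e ∷ σ) s h = let (lo , all , from) = largest σ (step e s) (λ e∈ → h (there e∈)) in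
        ≤-trans (≤-trans (m≤m⊔n (val s) (weightOf e)) (≤-reflexive (sym new))) lo ,
        (λ { (here refl) → ≤-trans (≤-trans (m≤n⊔m (val s) (weightOf e)) (≤-reflexive (sym new))) lo ; (there e∈) → all e∈ }) ,
        source from
        where
        new : val (step e s) ≡ val s ⊔ weightOf e
        new = val-bits q _ (⊔-lub (val<2^ s) (≤-<-trans (h (here refl)) B<2^q))
        source : ∀ {r} → r ≤ val (step e s) ⊎ (∃[ e ] (e ∈ σ × r ≤ weightOf e)) → r ≤ val s ⊎ (∃[ e′ ] (e′ ∈ e ∷ σ × r ≤ weightOf e′))
        source (inj₂ (e′ , e′∈ , le)) = inj₂ (e′ , there e′∈ , le)
        source (inj₁ le) with ⊔-sel (val s) (weightOf e)
        ... | inj₁ eq = inj₁ (≤-trans le (≤-reflexive (trans new eq)))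
        ... | inj₂ eq = inj₂ (e , here refl , ≤-trans le (≤-reflexive (trans new eq)))

      Π : Problem (WeightedEdge n)
      Π = TSP n B (factor ε)

      open TSPInstance

      correct : ∀ x σ → Problem.Presents Π x σ → Problem.Correct Π x (fromℕ (n * val (consume σ (bits q 0))))
      correct x σ perm = within (isMinTourCost x)
        where
        G : MetricGraph n
        G = graph x
        open MetricGraph G
        M : ℕ
        M = val (consume σ (bits q 0))
        listed : ∀ {e} → e ∈ σ → weightOf e ≡ weight (proj₁ e) (proj₁ (proj₂ e)) × proj₁ e ≢ proj₁ (proj₂ e)
        listed e∈ = edge-weight G (∈-resp-↭ perm e∈)
        props = largest σ (bits q 0) λ e∈ → ≤-trans (≤-reflexive (proj₁ (listed e∈))) (weightsAtMost x _ _ (proj₂ (listed e∈)))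
        reached : ∀ {i j} → (i , j , weight i j) ∈ edges G → weight i j ≤ M
        reached e∈ = proj₁ (proj₂ props) (∈-resp-↭ (↭-sym perm) e∈)
        bounded : ∀ i j → dist G i j ≤ M
        bounded i j with Fin.<-cmp i j
        ... | tri< i<j i≢j _  = ≤-trans (≤-reflexive (dist-≢ G i≢j)) (reached (edge-∈ G i<j))
        ... | tri≈ _ refl _   = ≤-trans (≤-reflexive (dist-refl G i)) z≤n
        ... | tri> _ i≢j j<i  = ≤-trans (≤-reflexive (trans (dist-≢ G i≢j) (symmetric i j))) (reached (edge-∈ G j<i))
        attained : ∀ vs → IsTour G vs → M ≤ tourCost G vs
        attained vs tour = from (proj₂ (proj₂ props))
          where
          from : M ≤ val (bits q 0) ⊎ (∃[ e ] (e ∈ σ × M ≤ weightOf e)) → M ≤ tourCost G vs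
          from (inj₁ le) = ≤-trans le (≤-trans (≤-reflexive (val-bits q 0 (m^n>0 2 q))) z≤n)
          from (inj₂ ((i , j , w) , e∈ , le)) = ≤-trans le (≤-trans (≤-reflexive (trans (proj₁ (listed e∈)) (sym (dist-≢ G (proj₂ (listed e∈)))))) (≤-trans (m≤m+n (dist G i j) _) (weight-tour G 2≤n vs tour i j)))
        within : IsMinTourCost G (opt x) → fromℕ (opt x) ℚ.≤ fromℕ (n * M) × fromℕ (n * M) ℚ.≤ factor ε ℚ.* fromℕ (opt x)
        within ((vs , tour , cost) , _) = fromℕ-mono-≤ {opt x} {n * M} (≤-trans (≤-reflexive (sym cost)) (tour-upper G 2≤n vs tour M bounded)) , (begin
          fromℕ (n * M)                                             ≤⟨ fromℕ-mono-≤ {n * M} {n * opt x} (*-monoʳ-≤ n (≤-trans (attained vs tour) (≤-reflexive cost))) ⟩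
          fromℕ (n * opt x)                                         ≡⟨ fromℕ-* n (opt x) ⟩
          fromℕ n ℚ.* fromℕ (opt x)                                 ≤⟨ ℚ.*-monoʳ-≤-nonNeg (fromℕ (opt x)) {{ℚ.nonNegative (fromℕ-nonNeg (opt x))}} (ℚ.≤-trans n≤ε 0+ε≤) ⟩
          factor ε ℚ.* fromℕ (opt x)                                ∎)
          where
          open ℚ.≤-Reasoning
          0+ε≤ : ε ℚ.≤ factor ε
          0+ε≤ = ℚ.≤-trans (ℚ.≤-reflexive (sym (ℚ.+-identityˡ ε))) (ℚ.+-monoˡ-≤ ε (ℚ.nonNegative⁻¹ ((ℤ.+ 3) ℚ./ 2)))

    verifies : ∃[ V ] IsSIP Π {0 + q} V 0 0
    verifies = _ , Compile.isSIP encBits 0 [] (s≤s z≤n) 0 initial step answer Π (λ x σ pr P v → [] , consume σ (bits q 0))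
      (λ x σ pr P v → refl) (λ x σ pr P v → z≤n) (λ _ _ → false)
      (λ x σ pr → count-all 0 _ λ v → ind-yes (answered? Π x ([] , output (answer (consume σ (bits q 0))))) (correct x σ pr))
      (λ x σ pr P → count-all 0 _ λ v → ind-yes (answeredOrRejected? Π x ([] , output (answer (consume σ (bits q 0))))) (correct x σ pr))

-- One constant for space, communication and rounds

open import Defs
open Assembly
open Completeness using (NetSize; netSize)
open Programs using (fromℕ-*; fromℕ-mono-≤; fromℕ-nonNeg)
open Parameters
open PrimeBounds
open NoCommunication
open import Data.Integer.Base using (+_)
open import Data.Nat.Base as ℕ using (ℕ; zero; suc; _^_; s≤s; z≤n)
open import Data.Nat.Logarithm using (⌈log₂_⌉)
open import Data.Nat.Primality using (Prime)
import Data.Nat.Properties as ℕ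
open import Data.Nat.Tactic.RingSolver using (solve-∀)
open import Data.Product.Base using (_×_; _,_; proj₁; proj₂; ∃-syntax)
open import Data.Rational.Base using (ℚ; 0ℚ; _<_; _≤_; _+_; _*_; _/_; nonNegative)
import Data.Rational.Properties as ℚ
open import Relation.Binary.PropositionalEquality
open import Relation.Nullary.Decidable.Core using (Dec; yes; no)

Verified : ℕ → ℕ → ℕ → ℚ → Set
Verified K c n ε = ∃[ space ] ∃[ bits ] ∃[ r ]
  ( space ℕ.≤ K ℕ.* ⌈log₂ n ⌉ ^ 2
  × fromℕ bits * ε ≤ fromℕ (K ℕ.* (n ℕ.* ⌈log₂ n ⌉ ^ 2))
  × r ℕ.≤ K ℕ.* ⌈log₂ n ⌉
  × ∃[ V ] IsSIP (TSP n (n ^ c) (+ 3 / 2 + ε)) {space} V bits r )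

module Costs (c μ : ℕ) (large : 214 ℕ.+ 16 ℕ.* c ℕ.≤ 2 ^ μ) (μ≤ : μ ℕ.≤ 10 ℕ.+ c) where

  private
    C Λ Q R S : ℕ
    C = 2 ^ μ
    Λ = 32 ℕ.+ 2 ℕ.* c
    Q = 4 ℕ.* (Λ ℕ.+ 13 ℕ.* (C ℕ.* C))
    R = 896 ℕ.* (C ℕ.* C)
    S = 6 ℕ.* C

  -- The sum of the constants for space, communication and rounds, as a single one has to serve all
  -- three bounds.
  constant : ℕ
  constant = Q ℕ.+ (R ℕ.+ S)

  module _ (n″ ℓ′ : ℕ) (n≤2^ℓ : suc (suc n″) ℕ.≤ 2 ^ suc ℓ′) (ℓ≤ : suc ℓ′ ℕ.≤ 2 ℕ.* ⌈log₂ suc (suc n″) ⌉) (ε : ℚ) (0≤ε : 0ℚ ≤ ε) where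

    private
      n : ℕ
      n = suc (suc n″)

      2≤n : 2 ℕ.≤ n
      2≤n = s≤s (s≤s z≤n)

    -- Once ε exceeds `constant` times n log² n, the bound on bits times ε allows not a single bit,
    -- so large ε calls for a verifier that does not communicate.
    silent : fromℕ n ≤ ε → Verified constant c n ε
    silent n≤ε = 0 ℕ.+ q , 0 , 0 ,
      ℕ.≤-trans (ℕ.≤-trans (ℕ.*-monoˡ-≤ (suc ℓ′) {c ℕ.+ 6} {Λ} c+6≤Λ) (ℕ.m≤m+n _ _)) (space≤ Λ C (suc ℓ′) ⌈log₂ n ⌉ (s≤s z≤n) ℓ≤ (R ℕ.+ S)) ,
      ℚ.≤-trans (ℚ.≤-reflexive (ℚ.*-zeroˡ ε)) (fromℕ-nonNeg (constant ℕ.* (n ℕ.* ⌈log₂ n ⌉ ^ 2))) , z≤n ,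
      LargestWeight.verifies n (n ^ c) q 2≤n B<2^q ε n≤ε
      where
      q : ℕ
      q = (c ℕ.+ 6) ℕ.* suc ℓ′
      c+6≤Λ : c ℕ.+ 6 ℕ.≤ Λ
      c+6≤Λ = ℕ.≤-trans (ℕ.m≤m+n (c ℕ.+ 6) (c ℕ.+ 26)) (ℕ.≤-reflexive (ring c))
        where
        ring : ∀ c → (c ℕ.+ 6) ℕ.+ (c ℕ.+ 26) ≡ 32 ℕ.+ 2 ℕ.* c
        ring = solve-∀
      B<2^q : n ^ c ℕ.< 2 ^ q
      B<2^q = ℕ.≤-<-trans (ℕ.≤-trans (ℕ.m≤m+n (n ^ c) _) (ℕ.≤-trans (ℕ.n≤1+n (2 ℕ.* n ^ c)) (ℕ.m≤m+n _ 0))) (numbers< {1} c 2≤n n≤2^ℓ (s≤s z≤n) refl)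

    module _ (k : ℕ) (size : NetSize ε (suc n″) k) where

      private
        K : ℕ
        K = suc (suc k)

        few : fromℕ K * ε ≤ fromℕ (4 ℕ.* n)
        few = proj₁ size

        K≤ : K ℕ.≤ suc (2 ℕ.* n)
        K≤ = proj₁ (proj₂ size)

      module _ (bi′ : ℕ) (tokens≤ : suc (3 ℕ.* K) ℕ.≤ 2 ^ suc bi′) (hi : 2 ^ suc bi′ ℕ.≤ 2 ℕ.* suc (3 ℕ.* K)) where

        private
          open Lengths c ℓ′ (suc bi′) μ (indexBits≤ {K} {n} {ℓ′} {suc bi′} 2≤n n≤2^ℓ K≤ hi) large μ≤ hiding (C; Λ)

          a′ : ℕ
          -- Chosen so that `suc a′` is a by computation.
          a′ = ℓ′ ℕ.+ (20 ℕ.+ c) ℕ.* ℓ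

          stateBits communication : ℕ
          stateBits     = b ℕ.+ ((m ℕ.* a ℕ.+ (b ℕ.+ b)) ℕ.+ ((b ℕ.+ (b ℕ.+ (b ℕ.+ b))) ℕ.+ ((b ℕ.+ 1) ℕ.+ (b ℕ.+ (b ℕ.+ b)))))
          communication = N ℕ.* b ℕ.+ m ℕ.* (suc (N ℕ.* 5) ℕ.* b ℕ.+ a)

          -- Rounding 3 K + 1 up to a power of two gives N ≤ 6 K + 2 ≤ 7 K, and K ε ≤ 4 n turns the
          -- number of points into n / ε.
          affordable : ∀ {l} → l ℕ.≤ 8 ℕ.* (N ℕ.* (X ℕ.* X)) → fromℕ l * ε ≤ fromℕ (constant ℕ.* (n ℕ.* ⌈log₂ n ⌉ ^ 2))
          affordable {l} l≤ = begin
            fromℕ l * ε                                          ≤⟨ ℚ.*-monoʳ-≤-nonNeg ε {{nonNegative 0≤ε}} (fromℕ-mono-≤ {l} {56 ℕ.* (X ℕ.* X) ℕ.* K} (ℕ.≤-trans l≤ (ℕ.≤-trans (ℕ.*-monoʳ-≤ 8 (ℕ.*-monoˡ-≤ (X ℕ.* X) N≤7K)) (ℕ.≤-reflexive (ring K (X ℕ.* X)))))) ⟩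
            fromℕ (56 ℕ.* (X ℕ.* X) ℕ.* K) * ε                   ≡⟨ cong (_* ε) (fromℕ-* (56 ℕ.* (X ℕ.* X)) K) ⟩
            fromℕ (56 ℕ.* (X ℕ.* X)) * fromℕ K * ε               ≡⟨ ℚ.*-assoc (fromℕ (56 ℕ.* (X ℕ.* X))) (fromℕ K) ε ⟩
            fromℕ (56 ℕ.* (X ℕ.* X)) * (fromℕ K * ε)             ≤⟨ ℚ.*-monoˡ-≤-nonNeg (fromℕ (56 ℕ.* (X ℕ.* X))) {{nonNegative (fromℕ-nonNeg (56 ℕ.* (X ℕ.* X)))}} few ⟩
            fromℕ (56 ℕ.* (X ℕ.* X)) * fromℕ (4 ℕ.* n)           ≡⟨ fromℕ-* (56 ℕ.* (X ℕ.* X)) (4 ℕ.* n) ⟨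
            fromℕ (56 ℕ.* (X ℕ.* X) ℕ.* (4 ℕ.* n))               ≤⟨ fromℕ-mono-≤ {56 ℕ.* (X ℕ.* X) ℕ.* (4 ℕ.* n)} (bits≤ C ℓ ⌈log₂ n ⌉ n ℓ≤ Q S) ⟩
            fromℕ (constant ℕ.* (n ℕ.* ⌈log₂ n ⌉ ^ 2))           ∎
            where
            open ℚ.≤-Reasoning
            ring : ∀ K Y → 8 ℕ.* (7 ℕ.* K ℕ.* Y) ≡ 56 ℕ.* Y ℕ.* K
            ring = solve-∀
            ring′ : ∀ k → 2 ℕ.* suc (3 ℕ.* suc (suc k)) ℕ.+ k ≡ 7 ℕ.* suc (suc k)
            ring′ = solve-∀
            N≤7K : N ℕ.≤ 7 ℕ.* K
            N≤7K = ℕ.≤-trans hi (ℕ.≤-trans (ℕ.m≤m+n _ k) (ℕ.≤-reflexive (ring′ k)))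

        interactive : ∀ p → Prime p → 2 ^ a ℕ.< p → p ℕ.≤ 2 ^ (a ℕ.* 2) → Verified constant c n ε
        interactive p isPrime 2^a<p p≤ = Λ ℕ.* ℓ ℕ.+ stateBits , communication , m ℕ.* 2 ℕ.+ 1 ,
          ℕ.≤-trans (ℕ.+-monoʳ-≤ (Λ ℕ.* ℓ) (state≤ b m a X 1≤X b≤X m≤X a≤X)) (space≤ Λ C ℓ ⌈log₂ n ⌉ (s≤s z≤n) ℓ≤ (R ℕ.+ S)) ,
          affordable program ,
          rounds≤ m C ℓ ⌈log₂ n ⌉ m≤X 1≤X ℓ≤ Q R ,
          Assemble.verifies (suc n″) k ℓ′ bi′ q (a ℕ.* 2) a′ p (n ^ c) ε 0≤ε isPrime (ℕ.<⇒≤ 2^a<p) (ℕ.≤-trans p≤ (ℕ.^-monoʳ-≤ 2 2a≤b))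
            2≤n n≤2^ℓ tokens≤ (numbers< {K} {n ^ c} {n} {ℓ′} c 2≤n n≤2^ℓ K≤ refl)
            (ℕ.≤-<-trans N≤2^a 2^a<p) (ℕ.≤-<-trans constraints≤ 2^a<p) error≤ (Λ ℕ.* ℓ) program< size

        withPrime : Verified constant c n ε
        withPrime = let (p , isPrime , lo , hi) = prime-between a 3≤a in interactive p isPrime lo hi

    verified : Verified constant c n ε
    verified = decide (fromℕ n ℚ.≤? ε)
      where
      enough : ∀ k → NetSize ε (suc n″) k → ∃[ e ] (suc (3 ℕ.* suc (suc k)) ℕ.≤ 2 ^ e × 2 ^ e ℕ.≤ 2 ℕ.* suc (3 ℕ.* suc (suc k))) → Verified constant c n ε
      enough k size (zero , s≤s () , _)
      enough k size (suc bi′ , lo , hi) = withPrime k size bi′ lo hi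
      decide : Dec (fromℕ n ≤ ε) → Verified constant c n ε
      decide (yes n≤ε) = silent n≤ε
      decide (no n≰ε)  = let (k , size) = netSize ε n″ (ℚ.<⇒≤ (ℚ.≰⇒> n≰ε)) in enough k size (powerOf2 (3 ℕ.* suc (suc k)))

-- Weights are integers in [0, n ^ c] for a fixed c; K is the constant hidden
-- in the O-notation, uniform in n and ε.
theorem11 : (c : ℕ) →
    ∃[ K ] ((n : ℕ) → 2 ℕ.≤ n → (ε : ℚ) → 0ℚ < ε →
      ∃[ space ] ∃[ bits ] ∃[ r ]
        ( space ℕ.≤ K ℕ.* ⌈log₂ n ⌉ ^ 2
        × fromℕ bits * ε ≤ fromℕ (K ℕ.* (n ℕ.* ⌈log₂ n ⌉ ^ 2))
        × r ℕ.≤ K ℕ.* ⌈log₂ n ⌉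
        × ∃[ V ] IsSIP (TSP n (n ^ c) (+ 3 / 2 + ε)) {space} V bits r ))
theorem11 c = let (μ , large , μ≤) = exponent c in Costs.constant c μ large μ≤ , bounds μ large μ≤
  where
  bounds : ∀ μ large μ≤ n → 2 ℕ.≤ n → ∀ ε → 0ℚ < ε → Verified (Costs.constant c μ large μ≤) c n ε
  bounds μ large μ≤ (suc (suc m)) _ ε 0<ε = let (ℓ′ , n≤ , ℓ≤) = logarithm m in Costs.verified c μ large μ≤ m ℓ′ n≤ ℓ≤ ε (ℚ.<⇒≤ 0<ε)
  bounds μ large μ≤ (suc zero) (s≤s ()) ε 0<ε
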